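{- Let $\ell$ be a rational prime. Let $X$ be a connected (finite) graph with $\chi(X)\neq 0$, and let $$X=X_0\leftarrow X_1\leftarrow\cdots\leftarrow X_n\leftarrow\cdots \qquad (\ast)$$ be an (unbranched) $\mathbb{Z}_\ell$-tower above $X$. Let $p:Y\to X$ be a Galois cover of graphs whose Galois group is a finite $\ell$-group, and pull back the tower $(\ast)$ along $p$ to obtain $$Y\leftarrow Y\times_X X_1\leftarrow Y\times_X X_2\leftarrow\cdots\leftarrow Y\times_X X_n\leftarrow\cdots. \qquad (\ast\ast)$$ Assume that all the graphs in both towers are connected, so that $(\ast\ast)$ is a $\mathbb{Z}_\ell$-tower above $Y$. Let $\mu_X,\lambda_X$ be the Iwasawa invariants of $(\ast)$ and let $\mu_Y,\lambda_Y$ be the Iwasawa invariants of $(\ast\ast)$. Then $\mu_X=0$ if and only if $\mu_Y=0$, in which case $$\lambda_Y+1=[Y:X]\,(\lambda_X+1),$$ where $[Y:X]$ is the degree of the cover $Y/X$.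
   Context: Graphs (in the sense of Serre). A graph $X$ consists of a finite set of vertices $V_X$, a finite set of directed edges $\mathbf{E}_X$, an incidence map $e\mapsto (o(e),t(e))\in V_X\times V_X$ and an inversion $e\mapsto\bar e$ on $\mathbf{E}_X$ with $\bar e\ne e$, $\bar{\bar e}=e$, $o(\bar e)=t(e)$, $t(\bar e)=o(e)$. Loops and parallel edges are allowed. The set $E_X$ of undirected edges is $\mathbf{E}_X$ modulo $e\sim\bar e$. For $v\in V_X$, $\mathbf{E}_{X,v}=\{e\in\mathbf{E}_X: o(e)=v\}$. The Euler characteristic of a connected graph is $\chi(X)=|V_X|-|E_X|$. All graphs are finite. Morphisms and covers. A morphism $f:Y\to X$ is a pair of maps $V_Y\to V_X$, $\mathbf{E}_Y\to\mathbf{E}_X$ (both denoted $f$) commuting with $o$, $t$ and inversion. It is a cover if it is surjective on vertices and, for every $w\in V_Y$, restricts to a bijection $\mathbf{E}_{Y,w}\to\mathbf{E}_{X,f(w)}$. If $Y$ is connected, all fibers $f^{ -1}(v)$, $v\in V_X$, have the same cardinality, the degree $[Y:X]$. Let $\mathrm{Aut}_f(Y/X)=\{\sigma\in\mathrm{Aut}(Y): f\circ\sigma=f\}$. The cover $f$ is Galois if $Y$ is connected and $\mathrm{Aut}_f(Y/X)$ acts transitively on $f^{ -1}(v)$ for every $v\in V_X$; then one writes $\mathrm{Gal}(Y/X)=\mathrm{Aut}_f(Y/X)$. $\mathbb{Z}_\ell$-towers. A $\mathbb{Z}_\ell$-tower above a connected graph $X$ is a sequence of covers of connected graphs $X=X_0\leftarrow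 X_1\leftarrow\cdots\leftarrow X_n\leftarrow\cdots$ such that for every $n\ge 1$ the composite cover $X_n\to X$ is Galois with Galois group isomorphic to $\mathbb{Z}/\ell^n\mathbb{Z}$. Pullbacks. For morphisms $p_1:Y_1\to X$, $p_2:Y_2\to X$, the pullback $Y_1\times_X Y_2$ has vertices $\{(w_1,w_2)\in V_{Y_1}\times V_{Y_2}: p_1(w_1)=p_2(w_2)\}$ and directed edges $\{(e_1,e_2)\in\mathbf{E}_{Y_1}\times\mathbf{E}_{Y_2}: p_1(e_1)=p_2(e_2)\}$, with $o$, $t$ and inversion defined componentwise. The maps $Y\times_X X_{n+1}\to Y\times_X X_n$ in the pulled back tower are the identity on the first component and the tower map $X_{n+1}\to X_n$ on the second. Iwasawa invariants. It is a known theorem that for a $\mathbb{Z}_\ell$-tower $X=X_0\leftarrow X_1\leftarrow\cdots$ above a connected graph $X$ with $\chi(X)\neq 0$, if $\kappa_n$ denotes the number of spanning trees of $X_n$, there exist (unique) integers $\mu\ge 0$, $\lambda\ge 0$, $\nu$ such that $\mathrm{ord}_\ell(\kappa_n)=\mu\ell^n+\lambda n+\nu$ for all sufficiently large $n$. The integers $\mu,\lambda$ are called the Iwasawa invariants of the tower. (Here $\chi(Y)=[Y:X]\chi(X)\neq 0$, so this applies to the tower above $Y$ as well.) -}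

module Defs where

open import Level using (0ℓ)
open import Data.Nat as ℕ using (ℕ; zero; suc; _^_; _≤_; _<_)
import Data.Nat.Divisibility as ℕ
open import Data.Nat.DivMod using (_mod_)
open import Data.Integer as ℤ using (ℤ; +_; -_)
import Data.Integer.Properties as ℤ
open import Data.Integer.Divisibility.Signed as ℤ using (divides)
open import Data.Integer.Tactic.RingSolver using (solve-∀)
open import Data.Fin as Fin using (Fin; toℕ; fromℕ<; finToFun; funToFin)
open import Data.Fin.Properties as Fin
  using (0↔⊥; 1↔⊤; +↔⊎; *↔×; any?; all?; finToFun-funToFin; injective⇒≤; toℕ-fromℕ<)
open import Data.Fin.Subset using (Subset; _∈_; inside; outside)
open import Data.Fin.Subset.Properties using (_∈?_)
open import Data.Vec using ([]; _∷_)
open import Data.List as List using (List; []; _∷_; _++_; allFin; filter; length)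
open import Data.List.Membership.Propositional using () renaming (_∈_ to _∈ˡ_)
open import Data.List.Membership.Propositional.Properties using (∈-map⁺; ∈-allFin)
open import Data.List.Relation.Unary.Any using (here; there)
open import Data.Product using (Σ; ∃; _×_; _,_; proj₁; proj₂; Σ-syntax)
open import Data.Product.Properties using (Σ-≡,≡→≡)
open import Data.Product.Function.NonDependent.Propositional using (_×-↔_)
open import Data.Sum using (_⊎_; inj₁; inj₂)
open import Data.Sum.Function.Propositional using (_⊎-↔_)
open import Data.Unit using (tt)
open import Function using (_∘_; id; _↔_; Inverse; mk↔ₛ′; Bijective; Injective; StrictlySurjective)
open import Function.Construct.Composition using (_↔-∘_)
open import Function.Construct.Symmetry using (↔-sym)
open import Function.Properties.Inverse using (↔⇒↣)
open import Algebra using (Group)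
open import Algebra.Morphism.Structures using (module GroupMorphisms)
open import Axiom.UniquenessOfIdentityProofs using (module Decidable⇒UIP)
open import Relation.Nullary using (¬_; Dec; yes; no; contradiction; Irrelevant)
open import Relation.Nullary.Decidable using (map′; ¬?; _×-dec_; _⊎-dec_; _→-dec_; via-injection)
open import Relation.Unary as U using (Pred)
open import Relation.Binary using (DecidableEquality)
open import Relation.Binary.Construct.Closure.ReflexiveTransitive using (Star; ε; _◅_; _◅◅_)
open import Relation.Binary.PropositionalEquality as ≡ using (_≡_; _≢_; refl; sym; trans; cong; cong₂; subst)

record Finite (A : Set) : Set where
  field
    size  : ℕ
    index : A ↔ Fin size

  open Inverse index public using () renaming (to to toFin; from to fromFin)

  fromFin-toFin : ∀ a → fromFin (toFin a) ≡ a
  fromFin-toFin = Inverse.strictlyInverseʳ index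

  toFin-injective : Injective _≡_ _≡_ toFin
  toFin-injective {a} {b} eq =
    trans (sym (fromFin-toFin a)) (trans (cong fromFin eq) (fromFin-toFin b))

  _≟_ : DecidableEquality A
  _≟_ = via-injection (↔⇒↣ index) Fin._≟_

  ≡-irrelevant : {a b : A} → Irrelevant (a ≡ b)
  ≡-irrelevant = Decidable⇒UIP.≡-irrelevant _≟_

  elements : List A
  elements = List.map fromFin (allFin size)

  ∈-elements : ∀ a → a ∈ˡ elements
  ∈-elements a = subst (_∈ˡ elements) (fromFin-toFin a) (∈-map⁺ fromFin (∈-allFin (toFin a)))

  ∃? : {P : Pred A 0ℓ} → U.Decidable P → Dec (∃ P)
  ∃? {P} P? = map′ (λ (i , p) → fromFin i , p)
                   (λ (a , p) → toFin a , subst P (sym (fromFin-toFin a)) p)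
                   (any? (P? ∘ fromFin))

  ∀? : {P : Pred A 0ℓ} → U.Decidable P → Dec (∀ a → P a)
  ∀? {P} P? = map′ (λ h a → subst P (fromFin-toFin a) (h (toFin a)))
                   (λ h i → h (fromFin i))
                   (all? (P? ∘ fromFin))

×-finite : {A B : Set} → Finite A → Finite B → Finite (A × B)
×-finite A B = record
  { size  = Finite.size A ℕ.* Finite.size B
  ; index = ↔-sym *↔× ↔-∘ (Finite.index A ×-↔ Finite.index B)
  }

private
  dec-finite : {A : Set} → Dec A → Irrelevant A → Finite A
  dec-finite (yes a) irr = record
    { size  = 1
    ; index = ↔-sym 1↔⊤ ↔-∘ mk↔ₛ′ (λ _ → tt) (λ _ → a) (λ _ → refl) (irr a)
    }
  dec-finite (no ¬a) _ = record
    { size  = 0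
    ; index = ↔-sym 0↔⊥ ↔-∘ mk↔ₛ′ ¬a (λ ()) (λ ()) (λ a → contradiction a ¬a)
    }

  Σ-Fin-suc : ∀ {n} (P : Pred (Fin (suc n)) 0ℓ) →
              Σ (Fin (suc n)) P ↔ (P Fin.zero ⊎ Σ (Fin n) (P ∘ Fin.suc))
  Σ-Fin-suc P = mk↔ₛ′
    (λ { (Fin.zero , p) → inj₁ p ; (Fin.suc i , p) → inj₂ (i , p) })
    (λ { (inj₁ p) → Fin.zero , p ; (inj₂ (i , p)) → Fin.suc i , p })
    (λ { (inj₁ p) → refl ; (inj₂ (i , p)) → refl })
    (λ { (Fin.zero , p) → refl ; (Fin.suc i , p) → refl })

  Σ-Fin-finite : ∀ n {P : Pred (Fin n) 0ℓ} → U.Decidable P → U.Irrelevant P →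
                 Finite (Σ (Fin n) P)
  Σ-Fin-finite zero P? irr = record
    { size = 0 ; index = mk↔ₛ′ proj₁ (λ ()) (λ ()) (λ { (() , _) }) }
  Σ-Fin-finite (suc n) {P} P? irr = record
    { size  = Finite.size head ℕ.+ Finite.size tail
    ; index = ↔-sym +↔⊎ ↔-∘ ((Finite.index head ⊎-↔ Finite.index tail) ↔-∘ Σ-Fin-suc P)
    }
    where
    head = dec-finite (P? Fin.zero) irr
    tail = Σ-Fin-finite n (P? ∘ Fin.suc) irr

Σ-finite : {A : Set} {P : Pred A 0ℓ} → Finite A → U.Decidable P → U.Irrelevant P →
           Finite (Σ A P)
Σ-finite {A} {P} A-finite P? irr = record
  { size  = Finite.size ΣP
  ; index = Finite.index ΣP ↔-∘ mk↔ₛ′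
      (λ (a , p) → toFin a , subst P (sym (fromFin-toFin a)) p)
      (λ (i , p) → fromFin i , p)
      (λ (i , p) → Σ-≡,≡→≡ (Inverse.strictlyInverseˡ index i , irr _ _))
      (λ (a , p) → Σ-≡,≡→≡ (fromFin-toFin a , irr _ _))
  }
  where
  open Finite A-finite
  ΣP = Σ-Fin-finite size {P ∘ fromFin} (P? ∘ fromFin) irr

-- Finite graphs in the sense of Serre: E is the set of directed edges.
record Graph : Set₁ where
  no-eta-equality
  field
    V E      : Set
    V-finite : Finite V
    E-finite : Finite E
    o t      : E → V
    inv      : E → E
    inv-≢    : ∀ e → inv e ≢ e
    inv-inv  : ∀ e → inv (inv e) ≡ e
    o-inv    : ∀ e → o (inv e) ≡ t e
    t-inv    : ∀ e → t (inv e) ≡ o e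

  module Vᶠ = Finite V-finite
  module Eᶠ = Finite E-finite

open Graph using (V; E)

-- Each class {e , inv e} is counted once, at its member of least index.
∣undirectedEdges∣ : Graph → ℕ
∣undirectedEdges∣ X = length (filter (λ e → Eᶠ.toFin e Fin.<? Eᶠ.toFin (inv e)) Eᶠ.elements)
  where open Graph X hiding (V; E)

χ : Graph → ℤ
χ X = + Finite.size (Graph.V-finite X) ℤ.- + ∣undirectedEdges∣ X

next : ∀ {n} → Fin (suc n) → Fin (suc n)
next {n} i = suc (toℕ i) mod suc n

-- P selects the edges of a subgraph of X containing all the vertices.
module _ (X : Graph) (P : Pred (E X) 0ℓ) where
  open Graph X hiding (V; E)

  Step : V X → V X → Set
  Step v w = ∃ λ e → P e × o e ≡ v × t e ≡ w

  Walk : V X → V X → Set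
  Walk = Star Step

  ConnectedVia : Set
  ConnectedVia = V X × (∀ v w → Walk v w)

  -- A circuit (Serre's Circ) of length n + 1: a loop when n = 0; the condition no-return is
  -- what excludes the pair e , inv e when n = 1.
  record IsCircuit {n} (c : Fin (suc n) → E X) : Set where
    constructor mkCircuit
    field
      inside-P  : ∀ i → P (c i)
      chained   : ∀ i → t (c i) ≡ o (c (next i))
      no-return : ∀ i → c (next i) ≢ inv (c i)
      distinct  : ∀ i j → o (c i) ≡ o (c j) → i ≡ j

  Acyclic : Set
  Acyclic = ∀ n (c : Fin (suc n) → E X) → ¬ IsCircuit c

  module _ (P? : U.Decidable P) where

    -- Walks whose intermediate vertices lie in the list (Warshall's algorithm).
    private
      Via : List (V X) → V X → V X → Set
      Via []       v w = v ≡ w ⊎ Step v w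
      Via (u ∷ us) v w = Via us v w ⊎ (Via us v u × Via us u w)

      via? : ∀ us v w → Dec (Via us v w)
      via? []       v w = (v Vᶠ.≟ w) ⊎-dec Eᶠ.∃? (λ e → P? e ×-dec (o e Vᶠ.≟ v) ×-dec (t e Vᶠ.≟ w))
      via? (u ∷ us) v w = via? us v w ⊎-dec (via? us v u ×-dec via? us u w)

      via⇒walk : ∀ us {v w} → Via us v w → Walk v w
      via⇒walk []       (inj₁ refl)    = ε
      via⇒walk []       (inj₂ s)       = s ◅ ε
      via⇒walk (u ∷ us) (inj₁ p)       = via⇒walk us p
      via⇒walk (u ∷ us) (inj₂ (p , q)) = via⇒walk us p ◅◅ via⇒walk us q

      to-head : ∀ {u us v} → Via (u ∷ us) v u → Via us v u
      to-head (inj₁ p)       = p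
      to-head (inj₂ (p , _)) = p

      from-head : ∀ {u us w} → Via (u ∷ us) u w → Via us u w
      from-head (inj₁ p)       = p
      from-head (inj₂ (_ , q)) = q

      via-trans : ∀ {us u v w} → u ∈ˡ us → Via us v u → Via us u w → Via us v w
      via-trans (here refl) p q = inj₂ (to-head p , from-head q)
      via-trans (there u∈us) (inj₁ p)        (inj₁ q)        = inj₁ (via-trans u∈us p q)
      via-trans (there u∈us) (inj₁ p)        (inj₂ (q , q′)) = inj₂ (via-trans u∈us p q , q′)
      via-trans (there u∈us) (inj₂ (p , p′)) (inj₁ q)        = inj₂ (p , via-trans u∈us p′ q)
      via-trans (there u∈us) (inj₂ (p , _))  (inj₂ (_ , q′)) = inj₂ (p , q′)

      via-base : ∀ us {v w} → Via [] v w → Via us v w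
      via-base []       p = p
      via-base (u ∷ us) p = inj₁ (via-base us p)

      walk⇒via : ∀ {v w} → Walk v w → Via Vᶠ.elements v w
      walk⇒via ε       = via-base Vᶠ.elements (inj₁ refl)
      walk⇒via (s ◅ p) =
        via-trans (Vᶠ.∈-elements _) (via-base Vᶠ.elements (inj₂ s)) (walk⇒via p)

    walk? : ∀ v w → Dec (Walk v w)
    walk? v w = map′ (via⇒walk Vᶠ.elements) walk⇒via (via? Vᶠ.elements v w)

    connectedVia? : Dec ConnectedVia
    connectedVia? =
      map′ (λ ((v , _) , h) → v , h) (λ (v , h) → (v , tt) , h)
        (Vᶠ.∃? (λ _ → yes tt) ×-dec Vᶠ.∀? (λ v → Vᶠ.∀? (walk? v)))

    isCircuit? : ∀ {n} (c : Fin (suc n) → E X) → Dec (IsCircuit c)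
    isCircuit? c =
      map′ (λ (a , b , d , f) → mkCircuit a b d f)
           (λ (mkCircuit a b d f) → a , b , d , f)
        (all? (λ i → P? (c i))
         ×-dec all? (λ i → t (c i) Vᶠ.≟ o (c (next i)))
         ×-dec all? (λ i → ¬? (c (next i) Eᶠ.≟ inv (c i)))
         ×-dec all? (λ i → all? (λ j → (o (c i) Vᶠ.≟ o (c j)) →-dec (i Fin.≟ j))))

    private
      isCircuit-cong : ∀ {n} {c d : Fin (suc n) → E X} → (∀ i → c i ≡ d i) →
                       IsCircuit c → IsCircuit d
      isCircuit-cong eq (mkCircuit a b d f) = mkCircuit
        (λ i → subst P (eq i) (a i))
        (λ i → trans (cong t (sym (eq i))) (trans (b i) (cong o (eq (next i)))))
        (λ i h → d i (trans (eq (next i)) (trans h (cong inv (sym (eq i))))))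
        (λ i j h → f i j (trans (cong o (eq i)) (trans h (cong o (sym (eq j))))))

      decode : ∀ n → Fin (Eᶠ.size ^ n) → Fin n → E X
      decode n k = Eᶠ.fromFin ∘ finToFun k

      decode-surjective : ∀ {n} (c : Fin n → E X) → ∃ λ k → ∀ i → c i ≡ decode n k i
      decode-surjective c = funToFin (Eᶠ.toFin ∘ c) , λ i → sym
        (trans (cong Eᶠ.fromFin (finToFun-funToFin (Eᶠ.toFin ∘ c) i)) (Eᶠ.fromFin-toFin (c i)))

      circuit-short : ∀ {n} {c : Fin (suc n) → E X} → IsCircuit c → n < Vᶠ.size
      circuit-short {c = c} circuit = injective⇒≤ {f = Vᶠ.toFin ∘ o ∘ c}
        (λ eq → IsCircuit.distinct circuit _ _ (Vᶠ.toFin-injective eq))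

      ShortCircuit : Set
      ShortCircuit = ∃ λ (n : Fin Vᶠ.size) → ∃ λ (k : Fin (Eᶠ.size ^ suc (toℕ n))) →
        IsCircuit (decode (suc (toℕ n)) k)

      shorten : ∀ n (c : Fin (suc n) → E X) → IsCircuit c → ShortCircuit
      shorten n c circuit = i , search n (sym (toℕ-fromℕ< _)) c circuit
        where
        i = fromℕ< (circuit-short circuit)
        search : ∀ m {k} → m ≡ k → (c : Fin (suc m) → E X) → IsCircuit c →
                 ∃ λ (j : Fin (Eᶠ.size ^ suc k)) → IsCircuit (decode (suc k) j)
        search m refl c circuit with j , eq ← decode-surjective c =
          j , isCircuit-cong eq circuit

    acyclic? : Dec Acyclic
    acyclic? = map′
      (λ ¬s n c circuit → ¬s (shorten n c circuit))
      (λ acyclic (n , k , circuit) → acyclic (toℕ n) (decode (suc (toℕ n)) k) circuit)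
      (¬? (any? (λ n → any? (λ k → isCircuit? (decode (suc (toℕ n)) k)))))

Connected : Graph → Set
Connected X = ConnectedVia X U.U

-- A set of undirected edges is encoded as an inversion-stable set of
-- directed edges.
module _ (X : Graph) where
  open Graph X hiding (V; E)

  Edges : Subset Eᶠ.size → Pred (E X) 0ℓ
  Edges S e = Eᶠ.toFin e ∈ S

  IsSpanningTree : Pred (Subset Eᶠ.size) 0ℓ
  IsSpanningTree S =
    (∀ e → Edges S e → Edges S (inv e)) × ConnectedVia X (Edges S) × Acyclic X (Edges S)

  isSpanningTree? : U.Decidable IsSpanningTree
  isSpanningTree? S =
    Eᶠ.∀? (λ e → edges? e →-dec edges? (inv e))
      ×-dec connectedVia? X (Edges S) edges?
      ×-dec acyclic? X (Edges S) edges?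
    where
    edges? : U.Decidable (Edges S)
    edges? e = Eᶠ.toFin e ∈? S

subsets : ∀ n → List (Subset n)
subsets zero    = [] ∷ []
subsets (suc n) = List.map (inside ∷_) (subsets n) ++ List.map (outside ∷_) (subsets n)

κ : Graph → ℕ
κ X = length (filter (isSpanningTree? X) (subsets (Finite.size (Graph.E-finite X))))

record Hom (Y X : Graph) : Set where
  no-eta-equality
  private
    module Y = Graph Y
    module X = Graph X
  field
    onV   : V Y → V X
    onE   : E Y → E X
    o-hom : ∀ e → onV (Y.o e) ≡ X.o (onE e)
    t-hom : ∀ e → onV (Y.t e) ≡ X.t (onE e)
    inv-hom : ∀ e → onE (Y.inv e) ≡ X.inv (onE e)

open Hom

idₕ : ∀ {X} → Hom X X
idₕ = record
  { onV = id ; onE = id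
  ; o-hom = λ _ → refl ; t-hom = λ _ → refl ; inv-hom = λ _ → refl }

infixr 9 _∘ₕ_
_∘ₕ_ : ∀ {X Y Z} → Hom Y X → Hom Z Y → Hom Z X
f ∘ₕ g = record
  { onV     = onV f ∘ onV g
  ; onE     = onE f ∘ onE g
  ; o-hom   = λ e → trans (cong (onV f) (o-hom g e)) (o-hom f (onE g e))
  ; t-hom   = λ e → trans (cong (onV f) (t-hom g e)) (t-hom f (onE g e))
  ; inv-hom = λ e → trans (cong (onE f) (inv-hom g e)) (inv-hom f (onE g e))
  }

infix 4 _≈ₕ_
record _≈ₕ_ {Y X} (f g : Hom Y X) : Set where
  constructor mk≈
  field
    onV≡ : ∀ w → onV f w ≡ onV g w
    onE≡ : ∀ e → onE f e ≡ onE g e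

open _≈ₕ_

OutEdges : (X : Graph) → V X → Set
OutEdges X v = Σ[ e ∈ E X ] Graph.o X e ≡ v

onOutEdges : ∀ {Y X} (f : Hom Y X) (w : V Y) → OutEdges Y w → OutEdges X (onV f w)
onOutEdges f w (e , oe≡w) = onE f e , trans (sym (o-hom f e)) (cong (onV f) oe≡w)

record IsCover {Y X} (f : Hom Y X) : Set where
  field
    surjective      : StrictlySurjective _≡_ (onV f)
    local-bijection : ∀ w → Bijective _≡_ _≡_ (onOutEdges f w)

Fibre : ∀ {Y X} → Hom Y X → V X → Set
Fibre {Y} f v = Σ[ w ∈ V Y ] onV f w ≡ v

HasDegree : ∀ {Y X} → Hom Y X → ℕ → Set
HasDegree f d = ∀ v → Fibre f v ↔ Fin d

record Aut {Y X} (f : Hom Y X) : Set where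
  field
    σ σ⁻¹ : Hom Y Y
    σ∘σ⁻¹ : σ ∘ₕ σ⁻¹ ≈ₕ idₕ
    σ⁻¹∘σ : σ⁻¹ ∘ₕ σ ≈ₕ idₕ
    over  : f ∘ₕ σ ≈ₕ f

open Aut using (σ)

module _ {Y X} (f : Hom Y X) where
  open Aut hiding (σ)

  private
    _∙_ : Aut f → Aut f → Aut f
    a ∙ b = record
      { σ     = σ a ∘ₕ σ b
      ; σ⁻¹   = σ⁻¹ b ∘ₕ σ⁻¹ a
      ; σ∘σ⁻¹ = mk≈
          (λ w → trans (cong (onV (σ a)) (onV≡ (σ∘σ⁻¹ b) _)) (onV≡ (σ∘σ⁻¹ a) w))
          (λ e → trans (cong (onE (σ a)) (onE≡ (σ∘σ⁻¹ b) _)) (onE≡ (σ∘σ⁻¹ a) e))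
      ; σ⁻¹∘σ = mk≈
          (λ w → trans (cong (onV (σ⁻¹ b)) (onV≡ (σ⁻¹∘σ a) _)) (onV≡ (σ⁻¹∘σ b) w))
          (λ e → trans (cong (onE (σ⁻¹ b)) (onE≡ (σ⁻¹∘σ a) _)) (onE≡ (σ⁻¹∘σ b) e))
      ; over  = mk≈
          (λ w → trans (onV≡ (over a) _) (onV≡ (over b) w))
          (λ e → trans (onE≡ (over a) _) (onE≡ (over b) e))
      }

    unit : Aut f
    unit = record
      { σ = idₕ ; σ⁻¹ = idₕ
      ; σ∘σ⁻¹ = mk≈ (λ _ → refl) (λ _ → refl)
      ; σ⁻¹∘σ = mk≈ (λ _ → refl) (λ _ → refl)
      ; over  = mk≈ (λ _ → refl) (λ _ → refl)
      }

    inverse : Aut f → Aut f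
    inverse a = record
      { σ = σ⁻¹ a ; σ⁻¹ = σ a ; σ∘σ⁻¹ = σ⁻¹∘σ a ; σ⁻¹∘σ = σ∘σ⁻¹ a
      ; over = mk≈
          (λ w → trans (sym (onV≡ (over a) _)) (cong (onV f) (onV≡ (σ∘σ⁻¹ a) w)))
          (λ e → trans (sym (onE≡ (over a) _)) (cong (onE f) (onE≡ (σ∘σ⁻¹ a) e)))
      }

  AutGroup : Group 0ℓ 0ℓ
  AutGroup = record
    { Carrier = Aut f
    ; _≈_     = λ a b → σ a ≈ₕ σ b
    ; _∙_     = _∙_
    ; ε       = unit
    ; _⁻¹     = inverse
    ; isGroup = record
      { isMonoid = record
        { isSemigroup = record
          { isMagma = record
            { isEquivalence = record
              { refl  = mk≈ (λ _ → refl) (λ _ → refl)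
              ; sym   = λ p → mk≈ (λ w → sym (onV≡ p w)) (λ e → sym (onE≡ p e))
              ; trans = λ p q → mk≈ (λ w → trans (onV≡ p w) (onV≡ q w))
                                    (λ e → trans (onE≡ p e) (onE≡ q e))
              }
            ; ∙-cong = λ {a} {b} {c} {d} p q → mk≈
                (λ w → trans (cong (onV (σ a)) (onV≡ q w)) (onV≡ p _))
                (λ e → trans (cong (onE (σ a)) (onE≡ q e)) (onE≡ p _))
            }
          ; assoc = λ _ _ _ → mk≈ (λ _ → refl) (λ _ → refl)
          }
        ; identity = (λ _ → mk≈ (λ _ → refl) (λ _ → refl)) , (λ _ → mk≈ (λ _ → refl) (λ _ → refl))
        }
      ; inverse = σ⁻¹∘σ , σ∘σ⁻¹
      ; ⁻¹-cong = λ {a} {b} p → mk≈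
          (λ w → trans (cong (onV (σ⁻¹ a)) (sym (onV≡ (σ∘σ⁻¹ b) w)))
                   (trans (cong (onV (σ⁻¹ a)) (sym (onV≡ p _))) (onV≡ (σ⁻¹∘σ a) _)))
          (λ e → trans (cong (onE (σ⁻¹ a)) (sym (onE≡ (σ∘σ⁻¹ b) e)))
                   (trans (cong (onE (σ⁻¹ a)) (sym (onE≡ p _))) (onE≡ (σ⁻¹∘σ a) _)))
      }
    }

record IsGalois {Y X} (f : Hom Y X) : Set where
  field
    isCover    : IsCover f
    connected  : Connected Y
    transitive : ∀ w w′ → onV f w ≡ onV f w′ → ∃ λ (a : Aut f) → onV (σ a) w ≡ w′

HasOrder : Group 0ℓ 0ℓ → ℕ → Set
HasOrder G n = Inverse (Group.setoid G) (≡.setoid (Fin n))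

IsFiniteℓGroup : ℕ → Group 0ℓ 0ℓ → Set
IsFiniteℓGroup ℓ G = ∃ λ k → HasOrder G (ℓ ^ k)

infix 4 _≅_
_≅_ : Group 0ℓ 0ℓ → Group 0ℓ 0ℓ → Set
G ≅ H = ∃ λ f → GroupMorphisms.IsGroupIsomorphism (Group.rawGroup G) (Group.rawGroup H) f

-- The quotient ℤ/nℤ: the integers, with congruence modulo n as equality.
ℤ/_ : ℕ → Group 0ℓ 0ℓ
ℤ/ n = record
  { Carrier = ℤ
  ; _≈_     = _≈_
  ; _∙_     = ℤ._+_
  ; ε       = + 0
  ; _⁻¹     = -_
  ; isGroup = record
    { isMonoid = record
      { isSemigroup = record
        { isMagma = record
          { isEquivalence = record
            { refl  = λ {a} → reflexive {a} refl
            ; sym   = λ {a} {b} p → subst (+ n ℤ.∣_) (neg a b) (ℤ.∣m⇒∣-m p)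
            ; trans = λ {a} {b} {c} p q →
                subst (+ n ℤ.∣_) (telescope a b c) (ℤ.∣m∣n⇒∣m+n p q)
            }
          ; ∙-cong = λ {a} {b} {c} {d} p q →
              subst (+ n ℤ.∣_) (interchange a b c d) (ℤ.∣m∣n⇒∣m+n p q)
          }
        ; assoc = λ a b c → reflexive (ℤ.+-assoc a b c)
        }
      ; identity = (λ a → reflexive (ℤ.+-identityˡ a)) , (λ a → reflexive (ℤ.+-identityʳ a))
      }
    ; inverse = (λ a → reflexive (ℤ.+-inverseˡ a)) , (λ a → reflexive (ℤ.+-inverseʳ a))
    ; ⁻¹-cong = λ {a} {b} p → subst (+ n ℤ.∣_) (neg-cong a b) (ℤ.∣m⇒∣-m p)
    }
  }
  where
  _≈_ : ℤ → ℤ → Set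
  a ≈ b = + n ℤ.∣ a ℤ.- b

  reflexive : ∀ {a b} → a ≡ b → a ≈ b
  reflexive {a} refl = divides (+ 0) (trans (ℤ.+-inverseʳ a) (sym (ℤ.*-zeroˡ (+ n))))

  neg : ∀ a b → - (a ℤ.- b) ≡ b ℤ.- a
  neg = solve-∀

  telescope : ∀ a b c → (a ℤ.- b) ℤ.+ (b ℤ.- c) ≡ a ℤ.- c
  telescope = solve-∀

  interchange : ∀ a b c d → (a ℤ.- b) ℤ.+ (c ℤ.- d) ≡ (a ℤ.+ c) ℤ.- (b ℤ.+ d)
  interchange = solve-∀

  neg-cong : ∀ a b → - (a ℤ.- b) ≡ (- a) ℤ.- (- b)
  neg-cong = solve-∀

module _ {Y₁ Y₂ X} (p₁ : Hom Y₁ X) (p₂ : Hom Y₂ X) where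
  private
    module Y₁ = Graph Y₁
    module Y₂ = Graph Y₂
    module X  = Graph X

    V× : Set
    V× = Σ[ (w₁ , w₂) ∈ V Y₁ × V Y₂ ] onV p₁ w₁ ≡ onV p₂ w₂

    E× : Set
    E× = Σ[ (e₁ , e₂) ∈ E Y₁ × E Y₂ ] onE p₁ e₁ ≡ onE p₂ e₂

    V×-≡ : {a b : V×} → proj₁ a ≡ proj₁ b → a ≡ b
    V×-≡ eq = Σ-≡,≡→≡ (eq , X.Vᶠ.≡-irrelevant _ _)

    E×-≡ : {a b : E×} → proj₁ a ≡ proj₁ b → a ≡ b
    E×-≡ eq = Σ-≡,≡→≡ (eq , X.Eᶠ.≡-irrelevant _ _)

  pullback : Graph
  pullback .Graph.V = V×
  pullback .Graph.E = E×
  pullback .Graph.V-finite =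
    Σ-finite (×-finite Y₁.V-finite Y₂.V-finite) (λ _ → _ X.Vᶠ.≟ _) X.Vᶠ.≡-irrelevant
  pullback .Graph.E-finite =
    Σ-finite (×-finite Y₁.E-finite Y₂.E-finite) (λ _ → _ X.Eᶠ.≟ _) X.Eᶠ.≡-irrelevant
  pullback .Graph.o ((e₁ , e₂) , eq) =
    (Y₁.o e₁ , Y₂.o e₂) , trans (o-hom p₁ e₁) (trans (cong X.o eq) (sym (o-hom p₂ e₂)))
  pullback .Graph.t ((e₁ , e₂) , eq) =
    (Y₁.t e₁ , Y₂.t e₂) , trans (t-hom p₁ e₁) (trans (cong X.t eq) (sym (t-hom p₂ e₂)))
  pullback .Graph.inv ((e₁ , e₂) , eq) =
    (Y₁.inv e₁ , Y₂.inv e₂) , trans (inv-hom p₁ e₁) (trans (cong X.inv eq) (sym (inv-hom p₂ e₂)))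
  pullback .Graph.inv-≢ ((e₁ , _) , _) eq = Y₁.inv-≢ e₁ (cong (proj₁ ∘ proj₁) eq)
  pullback .Graph.inv-inv ((e₁ , e₂) , _) = E×-≡ (cong₂ _,_ (Y₁.inv-inv e₁) (Y₂.inv-inv e₂))
  pullback .Graph.o-inv ((e₁ , e₂) , _) = V×-≡ (cong₂ _,_ (Y₁.o-inv e₁) (Y₂.o-inv e₂))
  pullback .Graph.t-inv ((e₁ , e₂) , _) = V×-≡ (cong₂ _,_ (Y₁.t-inv e₁) (Y₂.t-inv e₂))

  pullback-proj₁ : Hom pullback Y₁
  pullback-proj₁ = record
    { onV = proj₁ ∘ proj₁ ; onE = proj₁ ∘ proj₁
    ; o-hom = λ _ → refl ; t-hom = λ _ → refl ; inv-hom = λ _ → refl }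

module _ {Y X Z W} (p : Hom Y X) (q : Hom Z X) (g : Hom W Z) where
  private
    module X = Graph X

  -- id ×_X g
  pullback-map : Hom (pullback p (q ∘ₕ g)) (pullback p q)
  pullback-map = record
    { onV     = λ ((w , z) , eq) → (w , onV g z) , eq
    ; onE     = λ ((d , e) , eq) → (d , onE g e) , eq
    ; o-hom   = λ ((d , e) , _) →
        Σ-≡,≡→≡ (cong (_ ,_) (o-hom g e) , X.Vᶠ.≡-irrelevant _ _)
    ; t-hom   = λ ((d , e) , _) →
        Σ-≡,≡→≡ (cong (_ ,_) (t-hom g e) , X.Vᶠ.≡-irrelevant _ _)
    ; inv-hom = λ ((d , e) , _) →
        Σ-≡,≡→≡ (cong (_ ,_) (inv-hom g e) , X.Eᶠ.≡-irrelevant _ _)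
    }

record Tower : Set₁ where
  field
    level : ℕ → Graph
    map   : ∀ n → Hom (level (suc n)) (level n)

  base : Graph
  base = level 0

  toBase : ∀ n → Hom (level n) base
  toBase zero    = idₕ
  toBase (suc n) = toBase n ∘ₕ map n

record IsℤℓTower (ℓ : ℕ) (T : Tower) : Set where
  open Tower T
  field
    connected : ∀ n → Connected (level n)
    covers    : ∀ n → IsCover (map n)
    galois    : ∀ n → 1 ≤ n → IsGalois (toBase n)
    cyclic    : ∀ n → 1 ≤ n → AutGroup (toBase n) ≅ (ℤ/ (ℓ ^ n))

module _ (T : Tower) {Y} (p : Hom Y (Tower.base T)) where
  open Tower T

  pulledLevel : ℕ → Graph
  pulledLevel zero    = Y
  pulledLevel (suc n) = pullback p (toBase (suc n))

  pulledMap : ∀ n → Hom (pulledLevel (suc n)) (pulledLevel n)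
  pulledMap zero    = pullback-proj₁ p (toBase 1)
  pulledMap (suc n) = pullback-map p (toBase (suc n)) (map (suc n))

  pullbackTower : Tower
  pullbackTower = record { level = pulledLevel ; map = pulledMap }

-- k = ord_ℓ(m); no such k exists when m = 0.
IsOrd : ℕ → ℕ → ℕ → Set
IsOrd ℓ m k = (ℓ ^ k ℕ.∣ m) × ¬ (ℓ ^ suc k ℕ.∣ m)

record IwasawaInvariants (ℓ : ℕ) (T : Tower) (μ lam : ℕ) : Set where
  field
    ν       : ℤ
    bound   : ℕ
    formula : ∀ n → bound ≤ n → ∃ λ k →
      IsOrd ℓ (κ (Tower.level T n)) k ×
      + k ≡ + μ ℤ.* + (ℓ ^ n) ℤ.+ + lam ℤ.* + n ℤ.+ ν

-- Put N = ℓᵐ⁺¹ and M = ℓᵐ, let ζ be an N-th root of unity of order N, and let α be a voltage assignment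
-- describing the cyclic cover Xₘ₊₁ → X.  By the matrix-tree theorem and Fourier transform over ℤ/N,
-- N κ(Xₘ₊₁) = κ(X) ∏ Q(ζⁱ) over 0 < i < N, where Q(z) is the determinant of the Laplacian of X whose
-- edges are weighted by z^α.  Dividing by the same formula for Xₘ leaves
-- ℓ κ(Xₘ₊₁) = κ(Xₘ) ∏ Q(ζⁱ) over the i prime to ℓ, a norm from ℤ[ζ].  The prime ℓ is totally ramified in
-- ℤ[ζ], with uniformizer 1 - ζ and index φ = M (ℓ - 1).  So if a is the order of vanishing of Q modulo ℓ
-- at z = 1, then ord κ(Xₘ₊₁) + 1 = ord κ(Xₘ) + a when a < φ, and ≥ ord κ(Xₘ) + φ otherwise.  Comparing
-- with μ ℓⁿ + λ n + ν for one large m shows that μ = 0 exactly when a < φ, and then a = λ + 1.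
-- The pulled back tower has voltages α ∘ p, and its Laplacian is a group matrix over Gal(Y/X).
-- Modulo ℓ its determinant is Q^[Y:X]: expanding the determinant over the rows, the ℓ-group Gal(Y/X)
-- permutes the terms, and only the fixed ones survive.  Hence a is multiplied by [Y:X].

module Submission where

open import Defs
open import Level using (0ℓ)
open import Algebra using (CommutativeMonoid; CommutativeRing; Group; IsGroup)
open import Algebra.Morphism.Structures using (module GroupMorphisms)
open import Data.Product.Properties using (Σ-≡,≡→≡)
open import Data.Bool as Bool using (Bool; true; false)
open import Data.Fin.Subset using (Subset; _∈_)
open import Data.Fin.Subset.Properties using (_∈?_)
import Data.List.Properties as List
import Relation.Binary.Construct.Closure.ReflexiveTransitive as Star
open import Data.Maybe using (Maybe; just; nothing)
open import Data.Nat as ℕ using (ℕ; zero; suc; z≤n; s≤s; _!)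
open import Data.Nat.Combinatorics renaming (_C_ to _choose_) using (nCk+nC[k+1]≡[n+1]C[k+1]; k![n∸k]!∣n!)
open import Data.Nat.Combinatorics.Specification using (nCk≡n!/k![n-k]!)
import Data.Nat.GCD as ℕ
import Data.Nat.Properties as ℕ
import Data.Nat.DivMod as ℕ
import Data.Nat.Divisibility as ℕ
open import Data.Nat.Primality using (Prime; euclidsLemma; prime⇒nonZero; ¬prime[0]; ¬prime[1])
open import Data.Unit using (⊤; tt)
open import Data.Nat.Induction using (<-rec)
open import Data.Integer as ℤ using (ℤ; +_; -[1+_])
import Data.Integer.Properties as ℤ
import Data.Integer.DivMod as ℤ
import Data.Integer.Divisibility.Signed as ℤ
open import Data.Integer.Tactic.RingSolver using (solve-∀)
open import Data.Fin as Fin using (Fin; zero; suc; toℕ)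
import Data.Fin.Properties as Fin
import Data.Fin.Permutation as Perm
open import Data.List as List using (List; []; _∷_)
open import Data.Vec as Vec using (Vec; []; _∷_; lookup; tabulate)
import Data.Vec.Properties as Vec
open import Data.Product using (∃; _×_; _,_; proj₁; proj₂; uncurry)
open import Data.Sum as Sum using (_⊎_; inj₁; inj₂; [_,_]′)
import Data.Sum.Properties as Sum
open import Data.Sum.Function.Propositional using (_⊎-↔_)
open import Function using (_∘_; id; it; _↔_; Inverse; mk↔ₛ′; _⇔_; mk⇔)
open import Function.Construct.Composition using (_↔-∘_)
open import Function.Construct.Symmetry using (↔-sym)
open import Relation.Nullary using (¬_; Dec; yes; no; contradiction)
open import Relation.Nullary.Decidable using (dec-true; map′; ¬?; _×-dec_; _⊎-dec_)
open import Relation.Unary as U using (Pred)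
open import Relation.Binary using (tri<; tri≈; tri>)
open import Relation.Binary.Construct.Closure.ReflexiveTransitive using (Star; ε; _◅_; _◅◅_)
open import Relation.Binary.PropositionalEquality as ≡ using (_≡_; _≢_; _≗_; refl; sym; trans; cong; cong₂; subst; subst₂)

-- Finite sums

-- The obstacle is to compare valuations in ℤ[ζ] by elementary means. Its elements are represented
-- by integer polynomials acting through the shift on the sequences killed by the cyclotomic
-- polynomial, equal when they act alike. Torsion-freeness is then immediate, and the residue map at
-- the prime above ℓ is evaluation at X = 1 modulo ℓ. A norm stays a product of conjugates inside
-- the ring; orders are read off from equations between products (integer) × (element prime to ℓ),
-- and raising to the power φ brings the 1 - ζⁱ into this form. The order a is computed once, modulo
-- ℓ in ℤ[X], and specialised to all conjugates. As N is not invertible in ℤ[ζ], the Fourier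
-- transform is undone by cancelling a power of N. It is applied to the Laplacian plus a multiple of
-- the all-ones matrix, because deleting a vertex would destroy the deck symmetry. In the group
-- determinant, the fixed terms still carry signs of translations. These are trivial in
-- characteristic ℓ, because Frobenius fixes 0-1 determinants.

module FiniteSum (M : CommutativeMonoid 0ℓ 0ℓ) where
  open CommutativeMonoid M
    renaming (_∙_ to _+_; ε to 0#; ∙-cong to +-cong; ∙-congˡ to +-congˡ; ∙-congʳ to +-congʳ;
              identityˡ to +-identityˡ; identityʳ to +-identityʳ; assoc to +-assoc;
              refl to ≈-refl; sym to ≈-sym; trans to ≈-trans)
  open import Algebra.Properties.CommutativeMonoid.Sum M public
  open import Relation.Binary.Reasoning.Setoid setoid

  when : {P : Set} → Dec P → Carrier → Carrier
  when (yes _) x = x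
  when (no  _) x = 0#

  when-yes : {P : Set} (d : Dec P) {x : Carrier} → P → when d x ≈ x
  when-yes (yes _) p = ≈-refl
  when-yes (no ¬p) p = contradiction p ¬p

  when-no : {P : Set} (d : Dec P) {x : Carrier} → ¬ P → when d x ≈ 0#
  when-no (yes p) ¬p = contradiction p ¬p
  when-no (no _)  ¬p = ≈-refl

  when-cong : {P : Set} (d : Dec P) {x y : Carrier} → (P → x ≈ y) → when d x ≈ when d y
  when-cong (yes p) eq = eq p
  when-cong (no _)  eq = ≈-refl

  when-⇔ : {P Q : Set} (d : Dec P) (e : Dec Q) {x y : Carrier} →
           (P → Q) → (Q → P) → (P → x ≈ y) → when d x ≈ when e y
  when-⇔ (yes p) e f g eq = ≈-trans (eq p) (≈-sym (when-yes e (f p)))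
  when-⇔ (no ¬p) e f g eq = ≈-sym (when-no e (λ q → ¬p (g q)))

  when-× : {P Q : Set} (d : Dec P) (e : Dec Q) {x : Carrier} →
           when (d ×-dec e) x ≈ when d (when e x)
  when-× (yes _) (yes _) = ≈-refl
  when-× (yes _) (no _)  = ≈-refl
  when-× (no _)  _       = ≈-refl

  sum-0 : ∀ {n} {f : Fin n → Carrier} → (∀ i → f i ≈ 0#) → sum f ≈ 0#
  sum-0 {n} eq = ≈-trans (sum-cong-≋ eq) (sum-replicate-zero n)

  sum-when : ∀ {n} {P : Set} (d : Dec P) {f : Fin n → Carrier} →
             sum (λ i → when d (f i)) ≈ when d (sum f)
  sum-when     (yes _) = ≈-refl
  sum-when {n} (no _)  = sum-0 {n} (λ _ → ≈-refl)

  sum-at : ∀ {n} {f : Fin n → Carrier} (i : Fin n) → (∀ j → j ≢ i → f j ≈ 0#) → sum f ≈ f i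
  sum-at {suc n} {f} zero    h =
    ≈-trans (+-congˡ (sum-0 (λ i → h (suc i) (λ ())))) (+-identityʳ _)
  sum-at {suc n} {f} (suc i) h =
    ≈-trans (+-cong (h zero (λ ())) (sum-at i (λ j j≢i → h (suc j) (j≢i ∘ Fin.suc-injective))))
            (+-identityˡ _)

  sum-δ : ∀ {n} (i : Fin n) {f : Fin n → Carrier} → sum (λ j → when (i Fin.≟ j) (f j)) ≈ f i
  sum-δ i {f} = ≈-trans (sum-at i (λ j j≢i → when-no (i Fin.≟ j) (j≢i ∘ sym)))
                        (when-yes (i Fin.≟ i) refl)

  sum-+ : ∀ m {n} (f : Fin (m ℕ.+ n) → Carrier) →
          sum f ≈ sum (λ i → f (i Fin.↑ˡ n)) + sum (λ j → f (m Fin.↑ʳ j))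
  sum-+ zero    f = ≈-sym (+-identityˡ _)
  sum-+ (suc m) f = ≈-trans (+-congˡ (sum-+ m (f ∘ suc))) (≈-sym (+-assoc _ _ _))

  sum-combine : ∀ m n (f : Fin (m ℕ.* n) → Carrier) →
                sum f ≈ sum {m} (λ i → sum {n} (λ j → f (Fin.combine i j)))
  sum-combine zero    n f = ≈-refl
  sum-combine (suc m) n f = ≈-trans (sum-+ n f) (+-congˡ (sum-combine m n (λ k → f (n Fin.↑ʳ k))))

  opaque
    ∑ : {A : Set} → Finite A → (A → Carrier) → Carrier
    ∑ FA f = sum (f ∘ Finite.fromFin FA)

    ∑-def : {A : Set} (FA : Finite A) (f : A → Carrier) → ∑ FA f ≈ sum (f ∘ Finite.fromFin FA)
    ∑-def FA f = ≈-refl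

    ∑-cong : {A : Set} (FA : Finite A) {f g : A → Carrier} → (∀ a → f a ≈ g a) → ∑ FA f ≈ ∑ FA g
    ∑-cong FA eq = sum-cong-≋ (λ i → eq (Finite.fromFin FA i))

    ∑-+ : {A : Set} (FA : Finite A) {f g : A → Carrier} →
          ∑ FA (λ a → f a + g a) ≈ ∑ FA f + ∑ FA g
    ∑-+ FA = ∑-distrib-+ {Finite.size FA} _ _

    ∑-0 : {A : Set} (FA : Finite A) {f : A → Carrier} → (∀ a → f a ≈ 0#) → ∑ FA f ≈ 0#
    ∑-0 FA eq = sum-0 (λ i → eq (Finite.fromFin FA i))

    ∑-at : {A : Set} (FA : Finite A) {f : A → Carrier} (a : A) →
           (∀ b → b ≢ a → f b ≈ 0#) → ∑ FA f ≈ f a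
    ∑-at FA {f} a h = ≈-trans
      (sum-at (FA.toFin a) (λ j j≢ → h _ (λ eq →
        j≢ (trans (sym (Inverse.strictlyInverseˡ FA.index j)) (cong FA.toFin eq)))))
      (reflexive (cong f (FA.fromFin-toFin a)))
      where module FA = Finite FA

    ∑-when : {A : Set} (FA : Finite A) {P : Set} (d : Dec P) {f : A → Carrier} →
             ∑ FA (λ a → when d (f a)) ≈ when d (∑ FA f)
    ∑-when FA d = sum-when {Finite.size FA} d

    ∑-swap : {A B : Set} (FA : Finite A) (FB : Finite B) {f : A → B → Carrier} →
             ∑ FA (λ a → ∑ FB (λ b → f a b)) ≈ ∑ FB (λ b → ∑ FA (λ a → f a b))
    ∑-swap FA FB = ∑-comm {Finite.size FA} {Finite.size FB} _

    ∑-↔ : {A B : Set} (FA : Finite A) (FB : Finite B) (φ : A ↔ B) (f : B → Carrier) →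
          ∑ FB f ≈ ∑ FA (f ∘ Inverse.to φ)
    ∑-↔ FA FB φ f = ≈-trans
      (sum-permute {Finite.size FA} (f ∘ FB.fromFin) (FB.index ↔-∘ (φ ↔-∘ ↔-sym (Finite.index FA))))
      (sum-cong-≋ {Finite.size FA} (λ i → reflexive (cong f (FB.fromFin-toFin _))))
      where module FB = Finite FB

    ∑-× : {A B : Set} (FA : Finite A) (FB : Finite B) (f : A × B → Carrier) →
          ∑ (×-finite FA FB) f ≈ ∑ FA (λ a → ∑ FB (λ b → f (a , b)))
    ∑-× FA FB f = ≈-trans (sum-combine FA.size FB.size _)
      (sum-cong-≋ {FA.size} (λ i → sum-cong-≋ {FB.size} (λ j → reflexive (cong f (cong₂ _,_
        (cong (FA.fromFin ∘ proj₁) (Fin.remQuot-combine i j))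
        (cong (FB.fromFin ∘ proj₂) (Fin.remQuot-combine i j)))))))
      where
      module FA = Finite FA
      module FB = Finite FB

  ∑-unique : {A : Set} (FA : Finite A) {P : A → Set} (P? : ∀ a → Dec (P a)) {f : A → Carrier} (a : A) → P a →
             (∀ b → P b → b ≡ a) → ∑ FA (λ b → when (P? b) (f b)) ≈ f a
  ∑-unique FA P? a pa uniq =
    ≈-trans (∑-at FA a (λ b b≢a → when-no (P? b) (b≢a ∘ uniq b))) (when-yes (P? a) pa)

  -- Both sides equal the sum over all pairs in `R`, by uniqueness of the partner in each direction.
  -- A relation is used instead of a map because the partner may depend on the proof of `P` or `Q`,
  -- and exists only under it.
  ∑-bij : {A B : Set} (FA : Finite A) (FB : Finite B)
          {P : A → Set} {Q : B → Set} {R : A → B → Set}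
          (P? : ∀ a → Dec (P a)) (Q? : ∀ b → Dec (Q b)) (R? : ∀ a b → Dec (R a b))
          {f : A → Carrier} {g : B → Carrier} →
          (∀ {a b} → R a b → P a × Q b × f a ≈ g b) →
          (∀ a → P a → ∃ λ b → R a b × (∀ b′ → R a b′ → b′ ≡ b)) →
          (∀ b → Q b → ∃ λ a → R a b × (∀ a′ → R a′ b → a′ ≡ a)) →
          ∑ FA (λ a → when (P? a) (f a)) ≈ ∑ FB (λ b → when (Q? b) (g b))
  ∑-bij FA FB P? Q? R? {f} {g} R⇒ ∃b ∃a = begin
    ∑ FA (λ a → when (P? a) (f a))                       ≈⟨ ∑-cong FA left ⟩
    ∑ FA (λ a → ∑ FB (λ b → when (R? a b) (f a)))        ≈⟨ ∑-swap FA FB ⟩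
    ∑ FB (λ b → ∑ FA (λ a → when (R? a b) (f a)))
      ≈⟨ ∑-cong FB (λ b → ∑-cong FA (λ a → when-cong (R? a b) (proj₂ ∘ proj₂ ∘ R⇒))) ⟩
    ∑ FB (λ b → ∑ FA (λ a → when (R? a b) (g b)))        ≈⟨ ∑-cong FB right ⟩
    ∑ FB (λ b → when (Q? b) (g b))                       ∎
    where
    left : ∀ a → when (P? a) (f a) ≈ ∑ FB (λ b → when (R? a b) (f a))
    left a with P? a
    ... | yes p = let b , r , uniq = ∃b a p in ≈-sym (∑-unique FB (R? a) b r uniq)
    ... | no ¬p = ≈-sym (∑-0 FB (λ b → when-no (R? a b) (¬p ∘ proj₁ ∘ R⇒)))
    right : ∀ b → ∑ FA (λ a → when (R? a b) (g b)) ≈ when (Q? b) (g b)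
    right b with Q? b
    ... | yes q = let a , r , uniq = ∃a b q in ∑-unique FA (λ a → R? a b) a r uniq
    ... | no ¬q = ∑-0 FA (λ a → when-no (R? a b) (¬q ∘ proj₁ ∘ proj₂ ∘ R⇒))

Fin-finite : ∀ n → Finite (Fin n)
Fin-finite n = record { size = n ; index = mk↔ₛ′ id id (λ _ → refl) (λ _ → refl) }

Vec-finite : {A : Set} → Finite A → ∀ n → Finite (Vec A n)
Vec-finite FA zero = record
  { size = 1 ; index = mk↔ₛ′ (λ _ → zero) (λ _ → []) (λ { zero → refl }) (λ { [] → refl }) }
Vec-finite FA (suc n) = record
  { size  = Finite.size F
  ; index = Finite.index F ↔-∘ mk↔ₛ′ Vec.uncons (uncurry _∷_) (λ _ → refl) (λ { (a ∷ v) → refl })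
  }
  where F = ×-finite FA (Vec-finite FA n)

module _ (M : CommutativeMonoid 0ℓ 0ℓ) where
  open CommutativeMonoid M
  open FiniteSum M

  opaque
    unfolding ∑

    ∑-[] : ∀ {A : Set} (FA : Finite A) (f : Vec A 0 → Carrier) → ∑ (Vec-finite FA 0) f ≈ f []
    ∑-[] FA f = identityʳ _

    ∑-∷ : ∀ {A : Set} (FA : Finite A) n (f : Vec A (suc n) → Carrier) →
          ∑ (Vec-finite FA (suc n)) f ≈ ∑ FA (λ a → ∑ (Vec-finite FA n) (λ v → f (a ∷ v)))
    ∑-∷ FA n f = ∑-× FA (Vec-finite FA n) (f ∘ uncurry _∷_)

-- The homomorphism from ℤ gives the ring solver decidable coefficients over a ring whose own
-- equality need not be decidable.
module IntegerCoefficients (R : CommutativeRing 0ℓ 0ℓ) where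
  open CommutativeRing R hiding (zero) renaming (refl to ≈-refl; sym to ≈-sym; trans to ≈-trans)
  open import Algebra.Properties.Semiring.Mult semiring public renaming (_×_ to _·_)
  open import Algebra.Properties.Ring ring using (-‿distribˡ-*; -‿distribʳ-*; -0#≈0#)
  open import Algebra.Properties.AbelianGroup +-abelianGroup using (⁻¹-involutive; ⁻¹-∙-comm)
  open import Relation.Binary.Reasoning.Setoid setoid
  open import Algebra.Solver.Ring.AlmostCommutativeRing
    using (fromCommutativeRing; _-Raw-AlmostCommutative⟶_)

  private
    ι : ℤ → Carrier
    ι (+ n)    = n · 1#
    ι -[1+ n ] = - (suc n · 1#)

    ι-⊖ : ∀ m n → ι (m ℤ.⊖ n) ≈ m · 1# - n · 1#
    ι-⊖ zero    zero    = ≈-sym (-‿inverseʳ 0#)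
    ι-⊖ zero    (suc n) = ≈-sym (+-identityˡ _)
    ι-⊖ (suc m) zero    = ≈-sym (≈-trans (+-congˡ -0#≈0#) (+-identityʳ _))
    ι-⊖ (suc m) (suc n) = begin
      ι (suc m ℤ.⊖ suc n)                     ≡⟨ cong ι (ℤ.[1+m]⊖[1+n]≡m⊖n m n) ⟩
      ι (m ℤ.⊖ n)                             ≈⟨ ι-⊖ m n ⟩
      m · 1# - n · 1#                         ≈⟨ +-congʳ (≈-trans (+-congʳ (-‿inverseʳ 1#)) (+-identityˡ _)) ⟨
      ((1# - 1#) + m · 1#) - n · 1#           ≈⟨ +-congʳ (≈-trans (+-assoc _ _ _) (≈-trans (+-congˡ (+-comm _ _)) (≈-sym (+-assoc _ _ _)))) ⟩
      ((1# + m · 1#) - 1#) - n · 1#           ≈⟨ +-assoc _ _ _ ⟩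
      (1# + m · 1#) + (- 1# - n · 1#)         ≈⟨ +-congˡ (⁻¹-∙-comm _ _) ⟩
      suc m · 1# - suc n · 1#                 ∎

    ι-+ : ∀ i j → ι (i ℤ.+ j) ≈ ι i + ι j
    ι-+ (+ m)    (+ n)    = ×-homo-+ 1# m n
    ι-+ (+ m)    -[1+ n ] = ι-⊖ m (suc n)
    ι-+ -[1+ m ] (+ n)    = ≈-trans (ι-⊖ n (suc m)) (+-comm _ _)
    ι-+ -[1+ m ] -[1+ n ] = begin
      - (suc (suc (m ℕ.+ n)) · 1#)        ≡⟨ cong (λ k → - (suc k · 1#)) (sym (ℕ.+-suc m n)) ⟩
      - ((suc m ℕ.+ suc n) · 1#)          ≈⟨ -‿cong (×-homo-+ 1# (suc m) (suc n)) ⟩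
      - (suc m · 1# + suc n · 1#)         ≈⟨ ⁻¹-∙-comm _ _ ⟨
      - (suc m · 1#) - suc n · 1#         ∎

    ι-neg : ∀ i → ι (ℤ.- i) ≈ - ι i
    ι-neg (+ zero)  = ≈-sym -0#≈0#
    ι-neg (+ suc n) = ≈-refl
    ι-neg -[1+ n ]  = ≈-sym (⁻¹-involutive _)

    ι-* : ∀ i j → ι (i ℤ.* j) ≈ ι i * ι j
    ι-* (+ m)    (+ n)    = ≈-trans (reflexive (cong ι (sym (ℤ.pos-* m n)))) (×1-homo-* m n)
    ι-* (+ m)    -[1+ n ] = begin
      ι (+ m ℤ.* -[1+ n ])         ≡⟨ cong ι (sym (ℤ.neg-distribʳ-* (+ m) (+ suc n))) ⟩
      ι (ℤ.- (+ m ℤ.* + suc n))    ≈⟨ ι-neg (+ m ℤ.* + suc n) ⟩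
      - ι (+ m ℤ.* + suc n)        ≈⟨ -‿cong (ι-* (+ m) (+ suc n)) ⟩
      - (m · 1# * (suc n · 1#))    ≈⟨ -‿distribʳ-* _ _ ⟩
      m · 1# * - (suc n · 1#)      ∎
    ι-* -[1+ m ] j        = begin
      ι (-[1+ m ] ℤ.* j)           ≡⟨ cong ι (sym (ℤ.neg-distribˡ-* (+ suc m) j)) ⟩
      ι (ℤ.- (+ suc m ℤ.* j))      ≈⟨ ι-neg (+ suc m ℤ.* j) ⟩
      - ι (+ suc m ℤ.* j)          ≈⟨ -‿cong (pos j) ⟩
      - (suc m · 1# * ι j)         ≈⟨ -‿distribˡ-* _ _ ⟩
      - (suc m · 1#) * ι j         ∎
      where
      pos : ∀ j → ι (+ suc m ℤ.* j) ≈ suc m · 1# * ι j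
      pos (+ n)    = ≈-trans (reflexive (cong ι (sym (ℤ.pos-* (suc m) n)))) (×1-homo-* (suc m) n)
      pos -[1+ n ] = begin
        - (suc (n ℕ.+ m ℕ.* suc n) · 1#)    ≈⟨ -‿cong (×1-homo-* (suc m) (suc n)) ⟩
        - (suc m · 1# * (suc n · 1#))       ≈⟨ -‿distribʳ-* _ _ ⟩
        suc m · 1# * - (suc n · 1#)         ∎

    morphism : ℤ.+-*-rawRing -Raw-AlmostCommutative⟶ fromCommutativeRing R
    morphism = record
      { ⟦_⟧ = ι ; +-homo = ι-+ ; *-homo = ι-* ; -‿homo = ι-neg
      ; 0-homo = ≈-refl ; 1-homo = +-identityʳ 1# }

    ι≟ : ∀ i j → Maybe (ι i ≈ ι j)
    ι≟ i j with i ℤ.≟ j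
    ... | yes refl = just ≈-refl
    ... | no _     = nothing

  open import Algebra.Solver.Ring ℤ.+-*-rawRing (fromCommutativeRing R) morphism ι≟ public
    using (solve; _:=_; _:+_; _:*_; :-_; _:-_; con)

-- Determinants

⊎-finite : {A B : Set} → Finite A → Finite B → Finite (A ⊎ B)
⊎-finite FA FB = record
  { size  = Finite.size FA ℕ.+ Finite.size FB
  ; index = ↔-sym Fin.+↔⊎ ↔-∘ (Finite.index FA ⊎-↔ Finite.index FB)
  }

module Summation (R : CommutativeRing 0ℓ 0ℓ) where
  open CommutativeRing R hiding (zero) renaming (refl to ≈-refl; sym to ≈-sym; trans to ≈-trans)
  open IntegerCoefficients R public
  open FiniteSum +-commutativeMonoid public hiding (sum-permute; ∑-permute)
  open import Algebra.Properties.Semiring.Sum semiring public using (*-distribˡ-sum; *-distribʳ-sum)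
  open import Algebra.Properties.Ring ring public using (-0#≈0#)
  open import Algebra.Properties.AbelianGroup +-abelianGroup public using () renaming (⁻¹-∙-comm to -‿+-comm)
  module Π = FiniteSum *-commutativeMonoid

  δ : {P : Set} → Dec P → Carrier
  δ d = when d 1#

  when-* : {P : Set} (d : Dec P) {x y : Carrier} → when d x * y ≈ when d (x * y)
  when-* (yes _) = ≈-refl
  when-* (no _)  = zeroˡ _

  *-when : {P : Set} (d : Dec P) {x y : Carrier} → x * when d y ≈ when d (x * y)
  *-when (yes _) = ≈-refl
  *-when (no _)  = zeroʳ _

  δ-* : {P : Set} (d : Dec P) {x : Carrier} → δ d * x ≈ when d x
  δ-* d = ≈-trans (when-* d) (when-cong d (λ _ → *-identityˡ _))

  *-δ : {P : Set} (d : Dec P) {x : Carrier} → x * δ d ≈ when d x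
  *-δ d = ≈-trans (*-comm _ _) (δ-* d)

  opaque
    unfolding ∑

    *-∑ : {A : Set} (FA : Finite A) {x : Carrier} {f : A → Carrier} →
          x * ∑ FA f ≈ ∑ FA (λ a → x * f a)
    *-∑ FA = *-distribˡ-sum {Finite.size FA} _ _

    ∑-* : {A : Set} (FA : Finite A) {x : Carrier} {f : A → Carrier} →
          ∑ FA f * x ≈ ∑ FA (λ a → f a * x)
    ∑-* FA = *-distribʳ-sum {Finite.size FA} _ _

    ∑-⊎ : {A B : Set} (FA : Finite A) (FB : Finite B) (f : A ⊎ B → Carrier) →
          ∑ (⊎-finite FA FB) f ≈ ∑ FA (f ∘ inj₁) + ∑ FB (f ∘ inj₂)
    ∑-⊎ FA FB f = ≈-trans (sum-+ FA.size _) (+-cong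
      (sum-cong-≋ {FA.size} (λ i → reflexive (cong (f ∘ Sum.map FA.fromFin FB.fromFin) (Fin.splitAt-↑ˡ FA.size i FB.size))))
      (sum-cong-≋ {FB.size} (λ j → reflexive (cong (f ∘ Sum.map FA.fromFin FB.fromFin) (Fin.splitAt-↑ʳ FA.size FB.size j)))))
      where
      module FA = Finite FA
      module FB = Finite FB

    ∑-neg : {A : Set} (FA : Finite A) {f : A → Carrier} → ∑ FA (λ a → - f a) ≈ - ∑ FA f
    ∑-neg FA {f} = go (Finite.size FA) (f ∘ Finite.fromFin FA)
      where
      go : ∀ n (g : Fin n → Carrier) → sum (λ i → - g i) ≈ - sum g
      go zero    g = ≈-sym -0#≈0#
      go (suc n) g = ≈-trans (+-congˡ (go n (g ∘ suc))) (-‿+-comm _ _)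

    ∑-δ : {A : Set} (FA : Finite A) (a : A) (a≟ : ∀ b → Dec (a ≡ b)) {f : A → Carrier} →
          ∑ FA (λ b → when (a≟ b) (f b)) ≈ f a
    ∑-δ FA a a≟ = ∑-unique FA a≟ a refl (λ b eq → sym eq)

-- The exterior algebra of Rⁿ, with ω S the coefficient of the basis element indexed by S;
-- A ↦ W n A is the exterior product of the rows of A, so the determinant is its top coefficient.
module Exterior (R : CommutativeRing 0ℓ 0ℓ) where
  open CommutativeRing R hiding (zero) renaming (refl to ≈-refl; sym to ≈-sym; trans to ≈-trans)
  open Summation R
  open import Relation.Binary.Reasoning.Setoid setoid

  Vector : ℕ → Set
  Vector n = Fin n → Carrier

  Matrix : ℕ → ℕ → Set
  Matrix m n = Fin m → Vector n

  Λ : ℕ → Set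
  Λ n = Vec Bool n → Carrier

  infixr 7 _∧_
  -- With e₀ the first basis vector, split ω = ω₀ + e₀ ∧ ω₁ and v = v₀ e₀ + v′. Then v ∧ ω = v′ ∧ ω₀
  -- + e₀ ∧ (v₀ ω₀ - v′ ∧ ω₁), the minus sign coming from moving v′ past e₀.
  _∧_ : ∀ {n} → Vector n → Λ n → Λ n
  (v ∧ ω) []          = 0#
  (v ∧ ω) (false ∷ S) = (v ∘ suc ∧ ω ∘ (false ∷_)) S
  (v ∧ ω) (true ∷ S)  = v zero * ω (false ∷ S) - (v ∘ suc ∧ ω ∘ (true ∷_)) S

  one top : ∀ {n} → Λ n
  one []          = 1#
  one (false ∷ S) = one S
  one (true ∷ S)  = 0#
  top []          = 1#
  top (false ∷ S) = 0#
  top (true ∷ S)  = top S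

  W : ∀ k {n} → Matrix k n → Λ n
  W zero    A = one
  W (suc k) A = A zero ∧ W k (A ∘ suc)

  full : ∀ n → Vec Bool n
  full n = Vec.replicate n true

  ∧-cong : ∀ {n} {u v : Vector n} {ω ω′ : Λ n} → (∀ i → u i ≈ v i) → (∀ S → ω S ≈ ω′ S) →
           ∀ S → (u ∧ ω) S ≈ (v ∧ ω′) S
  ∧-cong p q []          = ≈-refl
  ∧-cong p q (false ∷ S) = ∧-cong (p ∘ suc) (q ∘ (false ∷_)) S
  ∧-cong p q (true ∷ S)  = +-cong (*-cong (p zero) (q _)) (-‿cong (∧-cong (p ∘ suc) (q ∘ (true ∷_)) S))

  ∧-congʳ : ∀ {n} (v : Vector n) {ω ω′ : Λ n} → (∀ S → ω S ≈ ω′ S) → ∀ S → (v ∧ ω) S ≈ (v ∧ ω′) S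
  ∧-congʳ v = ∧-cong {u = v} (λ _ → ≈-refl)

  ∧-∑ˡ : ∀ {A : Set} (FA : Finite A) {n} (c : A → Carrier) (ρ : A → Vector n) (ω : Λ n) S →
         ((λ j → ∑ FA (λ a → c a * ρ a j)) ∧ ω) S ≈ ∑ FA (λ a → c a * (ρ a ∧ ω) S)
  ∧-∑ˡ FA c ρ ω []          = ≈-sym (∑-0 FA (λ _ → zeroʳ _))
  ∧-∑ˡ FA c ρ ω (false ∷ S) = ∧-∑ˡ FA c (λ a → ρ a ∘ suc) _ S
  ∧-∑ˡ FA c ρ ω (true ∷ S)  = begin
    ∑ FA (λ a → c a * ρ a zero) * ω₀ - ((λ j → ∑ FA (λ a → c a * ρ a (suc j))) ∧ ω₁) S
      ≈⟨ +-cong (∑-* FA) (≈-trans (-‿cong (∧-∑ˡ FA c (λ a → ρ a ∘ suc) ω₁ S)) (≈-sym (∑-neg FA))) ⟩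
    ∑ FA (λ a → c a * ρ a zero * ω₀) + ∑ FA (λ a → - (c a * (ρ a ∘ suc ∧ ω₁) S))  ≈⟨ ∑-+ FA ⟨
    ∑ FA (λ a → c a * ρ a zero * ω₀ - c a * (ρ a ∘ suc ∧ ω₁) S)
      ≈⟨ ∑-cong FA (λ a → solve 4 (λ c r o w → c :* r :* o :- c :* w := c :* (r :* o :- w)) ≈-refl
                            (c a) (ρ a zero) ω₀ ((ρ a ∘ suc ∧ ω₁) S)) ⟩
    ∑ FA (λ a → c a * (ρ a zero * ω₀ - (ρ a ∘ suc ∧ ω₁) S))                       ∎
    where
    ω₀ = ω (false ∷ S)
    ω₁ = ω ∘ (true ∷_)

  ∧-∑ʳ : ∀ {A : Set} (FA : Finite A) {n} (c : A → Carrier) (v : Vector n) (ω : A → Λ n) S →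
         (v ∧ (λ T → ∑ FA (λ a → c a * ω a T))) S ≈ ∑ FA (λ a → c a * (v ∧ ω a) S)
  ∧-∑ʳ FA c v ω []          = ≈-sym (∑-0 FA (λ _ → zeroʳ _))
  ∧-∑ʳ FA c v ω (false ∷ S) = ∧-∑ʳ FA c (v ∘ suc) (λ a → ω a ∘ (false ∷_)) S
  ∧-∑ʳ FA c v ω (true ∷ S)  = begin
    v zero * ∑ FA (λ a → c a * ω₀ a) - (v ∘ suc ∧ (λ T → ∑ FA (λ a → c a * ω₁ a T))) S
      ≈⟨ +-cong (*-∑ FA) (≈-trans (-‿cong (∧-∑ʳ FA c (v ∘ suc) ω₁ S)) (≈-sym (∑-neg FA))) ⟩
    ∑ FA (λ a → v zero * (c a * ω₀ a)) + ∑ FA (λ a → - (c a * (v ∘ suc ∧ ω₁ a) S))  ≈⟨ ∑-+ FA ⟨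
    ∑ FA (λ a → v zero * (c a * ω₀ a) - c a * (v ∘ suc ∧ ω₁ a) S)
      ≈⟨ ∑-cong FA (λ a → solve 4 (λ c r o w → r :* (c :* o) :- c :* w := c :* (r :* o :- w)) ≈-refl
                            (c a) (v zero) (ω₀ a) ((v ∘ suc ∧ ω₁ a) S)) ⟩
    ∑ FA (λ a → c a * (v zero * ω₀ a - (v ∘ suc ∧ ω₁ a) S))                         ∎
    where
    ω₀ = λ a → ω a (false ∷ S)
    ω₁ = λ a → ω a ∘ (true ∷_)

  ∧-zeroʳ : ∀ {n} (v : Vector n) {ω : Λ n} → (∀ S → ω S ≈ 0#) → ∀ S → (v ∧ ω) S ≈ 0#
  ∧-zeroʳ v z []          = ≈-refl
  ∧-zeroʳ v z (false ∷ S) = ∧-zeroʳ (v ∘ suc) (z ∘ (false ∷_)) S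
  ∧-zeroʳ v z (true ∷ S)  = ≈-trans
    (+-cong (≈-trans (*-congˡ (z _)) (zeroʳ _)) (-‿cong (∧-zeroʳ (v ∘ suc) (z ∘ (true ∷_)) S)))
    (-‿inverseʳ 0#)

  ∧-zeroˡ : ∀ {n} {v : Vector n} (ω : Λ n) → (∀ i → v i ≈ 0#) → ∀ S → (v ∧ ω) S ≈ 0#
  ∧-zeroˡ ω z []          = ≈-refl
  ∧-zeroˡ ω z (false ∷ S) = ∧-zeroˡ _ (z ∘ suc) S
  ∧-zeroˡ ω z (true ∷ S)  = ≈-trans
    (+-cong (≈-trans (*-congʳ (z zero)) (zeroˡ _)) (-‿cong (∧-zeroˡ _ (z ∘ suc) S)))
    (-‿inverseʳ 0#)

  ∧-lincombˡ : ∀ {n} (a : Carrier) (u v : Vector n) (ω : Λ n) S →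
               ((λ i → a * u i + v i) ∧ ω) S ≈ a * (u ∧ ω) S + (v ∧ ω) S
  ∧-lincombˡ a u v ω []          = solve 1 (λ a → con (+ 0) := a :* con (+ 0) :+ con (+ 0)) ≈-refl a
  ∧-lincombˡ a u v ω (false ∷ S) = ∧-lincombˡ a (u ∘ suc) (v ∘ suc) _ S
  ∧-lincombˡ a u v ω (true ∷ S)  = ≈-trans
    (+-congˡ (-‿cong (∧-lincombˡ a (u ∘ suc) (v ∘ suc) _ S)))
    (solve 6 (λ a u v o x y → (a :* u :+ v) :* o :- (a :* x :+ y)
                              := a :* (u :* o :- x) :+ (v :* o :- y)) ≈-refl
      a (u zero) (v zero) (ω (false ∷ S)) _ _)

  ∧-lincombʳ : ∀ {n} (a b : Carrier) (v : Vector n) (ω ω′ : Λ n) S →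
               (v ∧ (λ T → a * ω T + b * ω′ T)) S ≈ a * (v ∧ ω) S + b * (v ∧ ω′) S
  ∧-lincombʳ a b v ω ω′ []          =
    solve 2 (λ a b → con (+ 0) := a :* con (+ 0) :+ b :* con (+ 0)) ≈-refl a b
  ∧-lincombʳ a b v ω ω′ (false ∷ S) = ∧-lincombʳ a b (v ∘ suc) _ _ S
  ∧-lincombʳ a b v ω ω′ (true ∷ S)  = ≈-trans
    (+-congˡ (-‿cong (∧-lincombʳ a b (v ∘ suc) _ _ S)))
    (solve 7 (λ a b v o p x y → v :* (a :* o :+ b :* p) :- (a :* x :+ b :* y)
                                := a :* (v :* o :- x) :+ b :* (v :* p :- y)) ≈-refl
      a b (v zero) (ω (false ∷ S)) (ω′ (false ∷ S)) _ _)

  ∧-sub : ∀ {n} (a : Carrier) (v : Vector n) (ω ω′ : Λ n) S →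
          (v ∧ (λ T → a * ω T - ω′ T)) S ≈ a * (v ∧ ω) S - (v ∧ ω′) S
  ∧-sub a v ω ω′ S = ≈-trans
    (∧-congʳ v (λ T → solve 3 (λ a x y → a :* x :- y := a :* x :+ (:- con (+ 1)) :* y) ≈-refl a (ω T) (ω′ T)) S)
    (≈-trans (∧-lincombʳ a _ v ω ω′ S)
      (solve 3 (λ a x y → a :* x :+ (:- con (+ 1)) :* y := a :* x :- y) ≈-refl a _ _))

  -- Anticommutativity gives only twice this identity, hence nothing in characteristic 2, which
  -- occurs for ℓ = 2.
  ∧-square : ∀ {n} (v : Vector n) (ω : Λ n) S → (v ∧ v ∧ ω) S ≈ 0#
  ∧-square v ω []          = ≈-refl
  ∧-square v ω (false ∷ S) = ∧-square (v ∘ suc) _ S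
  ∧-square v ω (true ∷ S)  = begin
    v zero * x - (v′ ∧ (λ T → v zero * ω (false ∷ T) - (v′ ∧ ω₁) T)) S
      ≈⟨ +-congˡ (-‿cong (≈-trans (∧-sub (v zero) v′ _ _ S) (+-congˡ (-‿cong (∧-square v′ ω₁ S))))) ⟩
    v zero * x - (v zero * x - 0#)
      ≈⟨ solve 1 (λ x → x :- (x :- con (+ 0)) := con (+ 0)) ≈-refl (v zero * x) ⟩
    0#  ∎
    where
    v′ = v ∘ suc
    ω₁ = ω ∘ (true ∷_)
    x = (v′ ∧ ω ∘ (false ∷_)) S

  ∧-anticomm : ∀ {n} (u v : Vector n) (ω : Λ n) S → (u ∧ v ∧ ω) S ≈ - (v ∧ u ∧ ω) S
  ∧-anticomm u v ω []          = ≈-sym -0#≈0#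
  ∧-anticomm u v ω (false ∷ S) = ∧-anticomm (u ∘ suc) (v ∘ suc) _ S
  ∧-anticomm u v ω (true ∷ S)  = begin
    u zero * x - (u′ ∧ (λ T → v zero * ω (false ∷ T) - (v′ ∧ ω₁) T)) S
      ≈⟨ +-congˡ (-‿cong (≈-trans (∧-sub (v zero) u′ _ _ S) (+-congˡ (-‿cong (∧-anticomm u′ v′ ω₁ S))))) ⟩
    u zero * x - (v zero * y - - z)
      ≈⟨ solve 5 (λ u v x y z → u :* x :- (v :* y :- (:- z)) := :- (v :* y :- (u :* x :- z))) ≈-refl
           (u zero) (v zero) x y z ⟩
    - (v zero * y - (u zero * x - z))
      ≈⟨ -‿cong (+-congˡ (-‿cong (∧-sub (u zero) v′ _ _ S))) ⟨
    - (v zero * y - (v′ ∧ (λ T → u zero * ω (false ∷ T) - (u′ ∧ ω₁) T)) S)  ∎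
    where
    u′ = u ∘ suc
    v′ = v ∘ suc
    ω₁ = ω ∘ (true ∷_)
    x = (v′ ∧ ω ∘ (false ∷_)) S
    y = (u′ ∧ ω ∘ (false ∷_)) S
    z = (v′ ∧ u′ ∧ ω₁) S

  W-cong : ∀ k {n} {A B : Matrix k n} → (∀ i j → A i j ≈ B i j) → ∀ S → W k A S ≈ W k B S
  W-cong zero    eq S = ≈-refl
  W-cong (suc k) eq   = ∧-cong (eq zero) (W-cong k (eq ∘ suc))

  -- The homomorphism of exterior algebras induced by a linear map.
  ext : ∀ m {n} → Matrix m n → Λ m → Λ n
  ext zero    B ω S = ω [] * one S
  ext (suc m) B ω S = ext m (B ∘ suc) (ω ∘ (false ∷_)) S + (B zero ∧ ext m (B ∘ suc) (ω ∘ (true ∷_))) S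

  ext-cong : ∀ m {n} (B : Matrix m n) {ω ω′ : Λ m} → (∀ S → ω S ≈ ω′ S) → ∀ S → ext m B ω S ≈ ext m B ω′ S
  ext-cong zero    B eq S = *-congʳ (eq [])
  ext-cong (suc m) B eq S = +-cong (ext-cong m _ (eq ∘ (false ∷_)) S)
                                   (∧-congʳ (B zero) (ext-cong m _ (eq ∘ (true ∷_))) S)

  ext-zero : ∀ m {n} (B : Matrix m n) {ω : Λ m} → (∀ S → ω S ≈ 0#) → ∀ S → ext m B ω S ≈ 0#
  ext-zero zero    B z S = ≈-trans (*-congʳ (z [])) (zeroˡ _)
  ext-zero (suc m) B z S = ≈-trans
    (+-cong (ext-zero m _ (z ∘ (false ∷_)) S) (∧-zeroʳ (B zero) (ext-zero m _ (z ∘ (true ∷_))) S))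
    (+-identityˡ 0#)

  ext-lincomb : ∀ m {n} (B : Matrix m n) (a b : Carrier) (ω ω′ : Λ m) S →
                ext m B (λ T → a * ω T + b * ω′ T) S ≈ a * ext m B ω S + b * ext m B ω′ S
  ext-lincomb zero    B a b ω ω′ S =
    solve 5 (λ a b x y o → (a :* x :+ b :* y) :* o := a :* (x :* o) :+ b :* (y :* o)) ≈-refl
      a b (ω []) (ω′ []) (one S)
  ext-lincomb (suc m) B a b ω ω′ S = ≈-trans
    (+-cong (ext-lincomb m _ a b _ _ S)
            (≈-trans (∧-congʳ (B zero) (ext-lincomb m _ a b _ _) S) (∧-lincombʳ a b (B zero) _ _ S)))
    (solve 6 (λ a b x y z w → a :* x :+ b :* y :+ (a :* z :+ b :* w)
                              := a :* (x :+ z) :+ b :* (y :+ w)) ≈-refl a b _ _ _ _)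

  ext-scale : ∀ m {n} (B : Matrix m n) (a : Carrier) (ω : Λ m) S →
              ext m B (λ T → a * ω T) S ≈ a * ext m B ω S
  ext-scale m B a ω S = begin
    ext m B (λ T → a * ω T) S
      ≈⟨ ext-cong m B (λ T → solve 2 (λ a x → a :* x := a :* x :+ con (+ 0) :* x) ≈-refl a (ω T)) S ⟩
    ext m B (λ T → a * ω T + 0# * ω T) S    ≈⟨ ext-lincomb m B a 0# ω ω S ⟩
    a * ext m B ω S + 0# * ext m B ω S      ≈⟨ solve 2 (λ a x → a :* x :+ con (+ 0) :* x := a :* x) ≈-refl a _ ⟩
    a * ext m B ω S                         ∎

  infixl 8 _⊙_
  _⊙_ : ∀ {m n} → Vector m → Matrix m n → Vector n
  (v ⊙ B) j = sum (λ i → v i * B i j)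

  ext-∧ : ∀ m {n} (B : Matrix m n) (v : Vector m) (ω : Λ m) S →
          ext m B (v ∧ ω) S ≈ (v ⊙ B ∧ ext m B ω) S
  ext-∧ zero    B v ω S = ≈-trans (zeroˡ _) (≈-sym (∧-zeroˡ (ext zero B ω) (λ _ → ≈-refl) S))
  ext-∧ (suc m) B v ω S = begin
    ext m B′ (v′ ∧ ω₀) S + (b ∧ ext m B′ (λ T → v zero * ω₀ T - (v′ ∧ ω₁) T)) S
      ≈⟨ +-cong (ext-∧ m B′ v′ ω₀ S) (∧-congʳ b second S) ⟩
    (vB ∧ X₀) S + (b ∧ (λ T → v zero * X₀ T - (vB ∧ X₁) T)) S
      ≈⟨ +-congˡ (≈-trans (∧-sub (v zero) b X₀ _ S) (+-congˡ (-‿cong (∧-anticomm b vB X₁ S)))) ⟩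
    (vB ∧ X₀) S + (v zero * (b ∧ X₀) S - - (vB ∧ b ∧ X₁) S)
      -- The zero inserted here stands for `(b ∧ b ∧ X₁) S`. It supplies the missing multiple of
      -- `b`, so that both terms acquire the common left factor `w`.
      ≈⟨ solve 4 (λ p a q r → p :+ (a :* q :- (:- r)) := con (+ 1) :* (a :* q :+ p) :+ con (+ 1) :* (a :* con (+ 0) :+ r)) ≈-refl _ (v zero) _ _ ⟩
    k * (v zero * (b ∧ X₀) S + (vB ∧ X₀) S) + k * (v zero * 0# + (vB ∧ b ∧ X₁) S)
      ≈⟨ +-cong (*-congˡ (≈-sym (∧-lincombˡ (v zero) b vB X₀ S)))
                (*-congˡ (≈-trans (+-congʳ (*-congˡ (≈-sym (∧-square b X₁ S)))) (≈-sym (∧-lincombˡ (v zero) b vB _ S)))) ⟩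
    k * (w ∧ X₀) S + k * (w ∧ b ∧ X₁) S
      ≈⟨ ∧-lincombʳ k k w X₀ (b ∧ X₁) S ⟨
    (w ∧ (λ T → k * X₀ T + k * (b ∧ X₁) T)) S
      ≈⟨ ∧-congʳ w (λ T → solve 2 (λ x y → con (+ 1) :* x :+ con (+ 1) :* y := x :+ y) ≈-refl _ _) S ⟩
    (w ∧ (λ T → X₀ T + (b ∧ X₁) T)) S  ∎
    where
    k = 1 · 1#
    B′ = B ∘ suc
    b = B zero
    v′ = v ∘ suc
    ω₀ = ω ∘ (false ∷_)
    ω₁ = ω ∘ (true ∷_)
    X₀ = ext m B′ ω₀
    X₁ = ext m B′ ω₁
    vB = v′ ⊙ B′
    w = λ j → v zero * b j + vB j
    second : ∀ T → ext m B′ (λ U → v zero * ω₀ U - (v′ ∧ ω₁) U) T ≈ v zero * X₀ T - (vB ∧ X₁) T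
    second T = begin
      ext m B′ (λ U → v zero * ω₀ U - (v′ ∧ ω₁) U) T
        ≈⟨ ext-cong m B′ (λ U → solve 3 (λ a x y → a :* x :- y := a :* x :+ (:- con (+ 1)) :* y) ≈-refl (v zero) (ω₀ U) _) T ⟩
      ext m B′ (λ U → v zero * ω₀ U + (- k) * (v′ ∧ ω₁) U) T
        ≈⟨ ext-lincomb m B′ (v zero) (- k) ω₀ _ T ⟩
      v zero * X₀ T + (- k) * ext m B′ (v′ ∧ ω₁) T
        ≈⟨ +-congˡ (*-congˡ (ext-∧ m B′ v′ ω₁ T)) ⟩
      v zero * X₀ T + (- k) * (vB ∧ X₁) T
        ≈⟨ solve 3 (λ a x y → a :* x :+ (:- con (+ 1)) :* y := a :* x :- y) ≈-refl (v zero) (X₀ T) _ ⟩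
      v zero * X₀ T - (vB ∧ X₁) T  ∎

  ext-one : ∀ m {n} (B : Matrix m n) S → ext m B one S ≈ one S
  ext-one zero    B S = *-identityˡ _
  ext-one (suc m) B S = ≈-trans
    (+-cong (ext-one m (B ∘ suc) S) (∧-zeroʳ (B zero) (ext-zero m (B ∘ suc) (λ _ → ≈-refl)) S))
    (+-identityʳ _)

  ext-W : ∀ k m {n} (A : Matrix k m) (B : Matrix m n) S → ext m B (W k A) S ≈ W k (λ i → A i ⊙ B) S
  ext-W zero    m A B S = ext-one m B S
  ext-W (suc k) m A B S = ≈-trans (ext-∧ m B (A zero) _ S)
    (∧-congʳ (A zero ⊙ B) (ext-W k m (A ∘ suc) B) S)

  ext-top : ∀ m {n} (B : Matrix m n) S → ext m B top S ≈ W m B S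
  ext-top zero    B S = *-identityˡ _
  ext-top (suc m) B S = ≈-trans
    (+-cong (ext-zero m (B ∘ suc) (λ _ → ≈-refl) S) (∧-congʳ (B zero) (ext-top m (B ∘ suc)) S))
    (+-identityˡ _)

  ∣_∣ : ∀ {n} → Vec Bool n → ℕ
  ∣ [] ∣        = 0
  ∣ false ∷ S ∣ = ∣ S ∣
  ∣ true ∷ S ∣  = suc ∣ S ∣

  Homogeneous : ∀ {n} → ℕ → Λ n → Set
  Homogeneous k ω = ∀ S → ∣ S ∣ ≢ k → ω S ≈ 0#

  ∧-homogeneous : ∀ {n} k (v : Vector n) {ω : Λ n} → Homogeneous k ω → Homogeneous (suc k) (v ∧ ω)
  ∧-homogeneous k       v h []          ne = ≈-refl
  ∧-homogeneous k       v h (false ∷ S) ne = ∧-homogeneous k (v ∘ suc) (h ∘ (false ∷_)) S ne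
  ∧-homogeneous zero    v h (true ∷ S)  ne = ≈-trans
    (+-cong (≈-trans (*-congˡ (h (false ∷ S) (ne ∘ cong suc))) (zeroʳ _))
            (-‿cong (∧-zeroʳ (v ∘ suc) (λ T → h (true ∷ T) (λ ())) S)))
    (-‿inverseʳ 0#)
  ∧-homogeneous (suc k) v h (true ∷ S)  ne = ≈-trans
    (+-cong (≈-trans (*-congˡ (h (false ∷ S) (ne ∘ cong suc))) (zeroʳ _))
            (-‿cong (∧-homogeneous k (v ∘ suc) (λ T ne′ → h (true ∷ T) (ne′ ∘ ℕ.suc-injective)) S
                      (ne ∘ cong suc))))
    (-‿inverseʳ 0#)

  W-homogeneous : ∀ k {n} (A : Matrix k n) → Homogeneous k (W k A)
  W-homogeneous zero    A = one-homogeneous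
    where
    one-homogeneous : ∀ {n} → Homogeneous {n} 0 one
    one-homogeneous []          ne = contradiction refl ne
    one-homogeneous (false ∷ S) ne = one-homogeneous S ne
    one-homogeneous (true ∷ S)  ne = ≈-refl
  W-homogeneous (suc k) A = ∧-homogeneous k (A zero) (W-homogeneous k (A ∘ suc))

  private
    ∣S∣≤n : ∀ {n} (S : Vec Bool n) → ∣ S ∣ ℕ.≤ n
    ∣S∣≤n []          = z≤n
    ∣S∣≤n (false ∷ S) = ℕ.m≤n⇒m≤1+n (∣S∣≤n S)
    ∣S∣≤n (true ∷ S)  = s≤s (∣S∣≤n S)

  -- The top exterior power is one-dimensional: every index set but the full one has fewer than n
  -- elements. This is what turns functoriality of `ext` into multiplicativity of the determinant.
  homogeneous-top : ∀ {n} {ω : Λ n} → Homogeneous n ω → ∀ S → ω S ≈ ω (full n) * top S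
  homogeneous-top         h []          = ≈-sym (*-identityʳ _)
  homogeneous-top {suc n} h (false ∷ S) = ≈-trans
    (h (false ∷ S) (λ eq → ℕ.<-irrefl eq (s≤s (∣S∣≤n S)))) (≈-sym (zeroʳ _))
  homogeneous-top         h (true ∷ S)  =
    homogeneous-top (λ T ne → h (true ∷ T) (ne ∘ ℕ.suc-injective)) S

  W-false : ∀ k {n} (A : Matrix k (suc n)) S → W k A (false ∷ S) ≈ W k (λ i → A i ∘ suc) S
  W-false zero    A S = ≈-refl
  W-false (suc k) A S = ∧-congʳ (A zero ∘ suc) (W-false k (A ∘ suc)) S

  W-true : ∀ k {n} (A : Matrix k (suc n)) → (∀ i → A i zero ≈ 0#) → ∀ S → W k A (true ∷ S) ≈ 0#
  W-true zero    A z S = ≈-refl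
  W-true (suc k) A z S = ≈-trans
    (+-cong (≈-trans (*-congʳ (z zero)) (zeroˡ _))
            (-‿cong (∧-zeroʳ (A zero ∘ suc) (W-true k (A ∘ suc) (z ∘ suc)) S)))
    (-‿inverseʳ 0#)

  W-∑ : ∀ {A : Set} (FA : Finite A) k {n} (c : Fin k → A → Carrier) (ρ : Fin k → A → Vector n) S →
        W k (λ i j → ∑ FA (λ a → c i a * ρ i a j)) S ≈
        ∑ (Vec-finite FA k) (λ d → Π.sum (λ i → c i (lookup d i)) * W k (λ i → ρ i (lookup d i)) S)
  W-∑ FA zero    c ρ S = ≈-sym (≈-trans (∑-[] +-commutativeMonoid FA _) (*-identityˡ _))
  W-∑ FA (suc k) c ρ S = begin
    ((λ j → ∑ FA (λ a → c zero a * ρ zero a j)) ∧ W k (λ i j → ∑ FA (λ a → c (suc i) a * ρ (suc i) a j))) S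
      ≈⟨ ∧-congʳ _ (W-∑ FA k (c ∘ suc) (ρ ∘ suc)) S ⟩
    ((λ j → ∑ FA (λ a → c zero a * ρ zero a j)) ∧ (λ T → ∑ FV (λ d → P d * X d T))) S
      ≈⟨ ∧-∑ˡ FA (c zero) (ρ zero) _ S ⟩
    ∑ FA (λ a → c zero a * (ρ zero a ∧ (λ T → ∑ FV (λ d → P d * X d T))) S)
      ≈⟨ ∑-cong FA (λ a → ≈-trans (*-congˡ (∧-∑ʳ FV P (ρ zero a) X S)) (*-∑ FV)) ⟩
    ∑ FA (λ a → ∑ FV (λ d → c zero a * (P d * (ρ zero a ∧ X d) S)))
      ≈⟨ ∑-cong FA (λ a → ∑-cong FV (λ d → ≈-sym (*-assoc _ _ _))) ⟩
    ∑ FA (λ a → ∑ FV (λ d → c zero a * P d * (ρ zero a ∧ X d) S))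
      ≈⟨ ∑-∷ +-commutativeMonoid FA k _ ⟨
    ∑ (Vec-finite FA (suc k)) (λ d → Π.sum (λ i → c i (lookup d i)) * W (suc k) (λ i → ρ i (lookup d i)) S)  ∎
    where
    FV = Vec-finite FA k
    P = λ d → Π.sum (λ i → c (suc i) (lookup d i))
    X = λ d → W k (λ i → ρ (suc i) (lookup d i))

module Determinant (R : CommutativeRing 0ℓ 0ℓ) where
  open CommutativeRing R hiding (zero) renaming (refl to ≈-refl; sym to ≈-sym; trans to ≈-trans)
  open Summation R
  open Exterior R
  open import Relation.Binary.Reasoning.Setoid setoid

  private
    detF : ∀ n → Matrix n n → Carrier
    detF n A = W n A (full n)

    -- The map induced by `B` carries the product of the rows of `A` to the product of the rows of
    -- AB, and in top degree the former is a scalar times `top`.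
    detF-* : ∀ n (A B : Matrix n n) → detF n (λ i → A i ⊙ B) ≈ detF n A * detF n B
    detF-* n A B = begin
      W n (λ i → A i ⊙ B) (full n)                ≈⟨ ext-W n n A B (full n) ⟨
      ext n B (W n A) (full n)                    ≈⟨ ext-cong n B (homogeneous-top (W-homogeneous n A)) (full n) ⟩
      ext n B (λ S → detF n A * top S) (full n)   ≈⟨ ext-scale n B (detF n A) top (full n) ⟩
      detF n A * ext n B top (full n)             ≈⟨ *-congˡ (ext-top n B (full n)) ⟩
      detF n A * detF n B                         ∎

    detF-column : ∀ n (A : Matrix (suc n) (suc n)) → (∀ i → A (suc i) zero ≈ 0#) →
                  detF (suc n) A ≈ A zero zero * detF n (λ i j → A (suc i) (suc j))
    detF-column n A z = begin
      A zero zero * W n (A ∘ suc) (false ∷ full n) - (A zero ∘ suc ∧ (λ S → W n (A ∘ suc) (true ∷ S))) (full n)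
        ≈⟨ +-cong (*-congˡ (W-false n (A ∘ suc) (full n))) (-‿cong (∧-zeroʳ (A zero ∘ suc) (W-true n (A ∘ suc) z) (full n))) ⟩
      A zero zero * detF n (λ i j → A (suc i) (suc j)) - 0#
        ≈⟨ solve 1 (λ x → x :- con (+ 0) := x) ≈-refl _ ⟩
      A zero zero * detF n (λ i j → A (suc i) (suc j))  ∎

    detF-row : ∀ n (A : Matrix (suc n) (suc n)) → (∀ j → A zero (suc j) ≈ 0#) →
               detF (suc n) A ≈ A zero zero * detF n (λ i j → A (suc i) (suc j))
    detF-row n A z = begin
      A zero zero * W n (A ∘ suc) (false ∷ full n) - (A zero ∘ suc ∧ (λ S → W n (A ∘ suc) (true ∷ S))) (full n)
        ≈⟨ +-cong (*-congˡ (W-false n (A ∘ suc) (full n))) (-‿cong (∧-zeroˡ _ z (full n))) ⟩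
      A zero zero * detF n (λ i j → A (suc i) (suc j)) - 0#
        ≈⟨ solve 1 (λ x → x :- con (+ 0) := x) ≈-refl _ ⟩
      A zero zero * detF n (λ i j → A (suc i) (suc j))  ∎

    detF-1 : ∀ n → detF n (λ i j → δ (i Fin.≟ j)) ≈ 1#
    detF-1 zero    = ≈-refl
    detF-1 (suc n) = begin
      detF (suc n) (λ i j → δ (i Fin.≟ j))                   ≈⟨ detF-column n (λ i j → δ (i Fin.≟ j)) (λ _ → ≈-refl) ⟩
      1# * detF n (λ i j → δ (suc i Fin.≟ suc j))            ≈⟨ *-identityˡ _ ⟩
      detF n (λ i j → δ (suc i Fin.≟ suc j))                 ≈⟨ W-cong n (λ i j → δ-suc i j) (full n) ⟩
      detF n (λ i j → δ (i Fin.≟ j))                         ≈⟨ detF-1 n ⟩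
      1#                                                     ∎
      where
      δ-suc : ∀ (i j : Fin n) → δ (suc i Fin.≟ suc j) ≈ δ (i Fin.≟ j)
      δ-suc i j = when-⇔ (suc i Fin.≟ suc j) (i Fin.≟ j) Fin.suc-injective (cong suc) (λ _ → ≈-refl)

    detF-rows : ∀ n (f : Fin n → Fin n) (A : Matrix n n) →
                detF n (λ i → A (f i)) ≈ detF n (λ i j → δ (f i Fin.≟ j)) * detF n A
    detF-rows n f A = ≈-trans
      (W-cong n (λ i j → ≈-sym (≈-trans (sum-cong-≋ {n} (λ k → δ-* (f i Fin.≟ k))) (sum-δ (f i) {λ k → A k j}))) (full n))
      (detF-* n _ A)

    -- The signs cancel: the rows contribute det P and the columns det Q, and PQ is the identity
    -- matrix.
    detF-perm′ : ∀ n (π : Fin n ↔ Fin n) (A : Matrix n n) →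
                 detF n (λ i j → A (Inverse.to π i) (Inverse.to π j)) ≈ detF n A
    detF-perm′ n π A = begin
      detF n (λ i j → A (f i) (f j))                     ≈⟨ W-cong n columns (full n) ⟩
      detF n (λ i → A (f i) ⊙ Q)                         ≈⟨ detF-* n (λ i → A (f i)) Q ⟩
      detF n (λ i → A (f i)) * detF n Q                  ≈⟨ *-congʳ (detF-rows n f A) ⟩
      detF n P * detF n A * detF n Q
        ≈⟨ solve 3 (λ p a q → p :* a :* q := (p :* q) :* a) ≈-refl _ _ _ ⟩
      (detF n P * detF n Q) * detF n A                   ≈⟨ *-congʳ (detF-rows n f Q) ⟨
      detF n (λ i → Q (f i)) * detF n A                  ≈⟨ *-congʳ (W-cong n cancel (full n)) ⟩
      detF n (λ i j → δ (i Fin.≟ j)) * detF n A          ≈⟨ *-congʳ (detF-1 n) ⟩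
      1# * detF n A                                      ≈⟨ *-identityˡ _ ⟩
      detF n A                                           ∎
      where
      f = Inverse.to π
      g = Inverse.from π
      P Q : Matrix n n
      P i j = δ (f i Fin.≟ j)
      Q i j = δ (g i Fin.≟ j)
      cancel : ∀ i j → δ (g (f i) Fin.≟ j) ≈ δ (i Fin.≟ j)
      cancel i j = reflexive (cong (λ k → δ (k Fin.≟ j)) (Inverse.strictlyInverseʳ π i))
      columns : ∀ i j → A (f i) (f j) ≈ (A (f i) ⊙ Q) j
      columns i j = ≈-sym (begin
        sum (λ k → A (f i) k * δ (g k Fin.≟ j))
          ≈⟨ sum-at {n} (f j) (λ k k≢ → ≈-trans (*-congˡ (when-no (g k Fin.≟ j)
               (λ eq → k≢ (trans (sym (Inverse.strictlyInverseˡ π k)) (cong f eq))))) (zeroʳ _)) ⟩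
        A (f i) (f j) * δ (g (f j) Fin.≟ j)
          ≈⟨ *-congˡ (when-yes (g (f j) Fin.≟ j) (Inverse.strictlyInverseʳ π j)) ⟩
        A (f i) (f j) * 1#  ≈⟨ *-identityʳ _ ⟩
        A (f i) (f j)       ∎)

    detF-perm : ∀ m n (π : Fin m ↔ Fin n) (A : Matrix n n) →
                detF m (λ i j → A (Inverse.to π i) (Inverse.to π j)) ≈ detF n A
    detF-perm m n π A with Perm.↔⇒≡ π
    ... | refl = detF-perm′ n π A

  opaque
    det : {I : Set} → Finite I → (I → I → Carrier) → Carrier
    det FI A = W (Finite.size FI) (λ i j → A (Finite.fromFin FI i) (Finite.fromFin FI j)) (full (Finite.size FI))

    det-def : {I : Set} (FI : Finite I) (A : I → I → Carrier) →
              det FI A ≈ W (Finite.size FI) (λ i j → A (Finite.fromFin FI i) (Finite.fromFin FI j)) (full (Finite.size FI))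
    det-def FI A = ≈-refl

    det-cong : {I : Set} (FI : Finite I) {A B : I → I → Carrier} → (∀ i j → A i j ≈ B i j) →
               det FI A ≈ det FI B
    det-cong FI eq = W-cong (Finite.size FI) (λ i j → eq _ _) (full (Finite.size FI))

    det-↔ : {I J : Set} (FI : Finite I) (FJ : Finite J) (φ : I ↔ J) (A : J → J → Carrier) →
            det FI (λ i j → A (Inverse.to φ i) (Inverse.to φ j)) ≈ det FJ A
    det-↔ FI FJ φ A = ≈-trans
      (W-cong FI.size (λ i j → reflexive (cong₂ A (sym (FJ.fromFin-toFin _)) (sym (FJ.fromFin-toFin _)))) (full FI.size))
      (detF-perm FI.size FJ.size (FJ.index ↔-∘ (φ ↔-∘ ↔-sym FI.index)) (λ i j → A (FJ.fromFin i) (FJ.fromFin j)))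
      where
      module FI = Finite FI
      module FJ = Finite FJ

    det-Fin-0 : (A : Fin 0 → Fin 0 → Carrier) → det (Fin-finite 0) A ≈ 1#
    det-Fin-0 A = ≈-refl

    det-column : ∀ n (A : Matrix (suc n) (suc n)) → (∀ i → A (suc i) zero ≈ 0#) →
                 det (Fin-finite (suc n)) A ≈ A zero zero * det (Fin-finite n) (λ i j → A (suc i) (suc j))
    det-column = detF-column

    det-row : ∀ n (A : Matrix (suc n) (suc n)) → (∀ j → A zero (suc j) ≈ 0#) →
              det (Fin-finite (suc n)) A ≈ A zero zero * det (Fin-finite n) (λ i j → A (suc i) (suc j))
    det-row = detF-row

  opaque
    unfolding det ∑

    det-* : {I : Set} (FI : Finite I) (A B : I → I → Carrier) →
            det FI (λ i j → ∑ FI (λ k → A i k * B k j)) ≈ det FI A * det FI B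
    det-* FI A B = detF-* (Finite.size FI) _ _

    -- Multilinearity in the rows, one summand chosen in each. It is applied to outgoing edges for
    -- the matrix-tree theorem, and to the pairs of a vertex and a group element for group
    -- determinants.
    det-∑ : {I A : Set} (FI : Finite I) (FA : Finite A) (c : I → A → Carrier) (ρ : I → A → I → Carrier) →
            det FI (λ i j → ∑ FA (λ a → c i a * ρ i a j)) ≈
            ∑ (Vec-finite FA (Finite.size FI)) (λ d →
              Π.∑ FI (λ i → c i (lookup d (Finite.toFin FI i))) * det FI (λ i → ρ i (lookup d (Finite.toFin FI i))))
    det-∑ FI FA c ρ = ≈-trans
      (W-∑ FA FI.size (λ i → c (FI.fromFin i)) (λ i a j → ρ (FI.fromFin i) a (FI.fromFin j)) (full FI.size))
      (∑-cong (Vec-finite FA FI.size) (λ d → *-cong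
        (Π.sum-cong-≋ {FI.size} (λ i → reflexive (cong (λ k → c (FI.fromFin i) (lookup d k)) (sym (to-from i)))))
        (W-cong FI.size (λ i j → reflexive (cong (λ k → ρ (FI.fromFin i) (lookup d k) (FI.fromFin j)) (sym (to-from i))))
                (full FI.size))))
      where
      module FI = Finite FI
      to-from : ∀ i → FI.toFin (FI.fromFin i) ≡ i
      to-from = Inverse.strictlyInverseˡ FI.index

  det-1 : {I : Set} (FI : Finite I) (_≟_ : ∀ i j → Dec (i ≡ j)) → det FI (λ i j → δ (i ≟ j)) ≈ 1#
  det-1 FI _≟_ = begin
    det FI (λ i j → δ (i ≟ j))
      ≈⟨ det-↔ (Fin-finite FI.size) FI (↔-sym FI.index) _ ⟨
    det (Fin-finite FI.size) (λ i j → δ (FI.fromFin i ≟ FI.fromFin j))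
      ≈⟨ det-cong (Fin-finite FI.size) (λ i j → when-⇔ (FI.fromFin i ≟ FI.fromFin j) (i Fin.≟ j)
           (λ eq → trans (sym (to-from i)) (trans (cong FI.toFin eq) (to-from j))) (cong FI.fromFin) (λ _ → ≈-refl)) ⟩
    det (Fin-finite FI.size) (λ i j → δ (i Fin.≟ j))  ≈⟨ det-def (Fin-finite FI.size) _ ⟩
    detF FI.size (λ i j → δ (i Fin.≟ j))              ≈⟨ detF-1 FI.size ⟩
    1#                                                ∎
    where
    module FI = Finite FI
    to-from = Inverse.strictlyInverseˡ FI.index

  det-rows : {I : Set} (FI : Finite I) (_≟_ : ∀ i j → Dec (i ≡ j)) (f : I → I) (A : I → I → Carrier) →
             det FI (λ i → A (f i)) ≈ det FI (λ i j → δ (f i ≟ j)) * det FI A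
  det-rows FI _≟_ f A = ≈-trans
    (det-cong FI (λ i j → ≈-sym (≈-trans (∑-cong FI (λ k → δ-* (f i ≟ k))) (∑-δ FI (f i) (f i ≟_)))))
    (det-* FI _ A)

  block : {I J : Set} → (I → I → Carrier) → (J → J → Carrier) → I ⊎ J → I ⊎ J → Carrier
  block A B (inj₁ i) (inj₁ j) = A i j
  block A B (inj₁ i) (inj₂ j) = 0#
  block A B (inj₂ i) (inj₁ j) = 0#
  block A B (inj₂ i) (inj₂ j) = B i j

  private
    I+1↔1+ : ∀ {J : Set} n → (Fin (suc n) ⊎ J) ↔ (Fin 1 ⊎ (Fin n ⊎ J))
    I+1↔1+ {J} n = mk↔ₛ′ to from to-from from-to
      where
      to : Fin (suc n) ⊎ J → Fin 1 ⊎ (Fin n ⊎ J)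
      to (inj₁ zero)    = inj₁ zero
      to (inj₁ (suc i)) = inj₂ (inj₁ i)
      to (inj₂ j)       = inj₂ (inj₂ j)
      from : Fin 1 ⊎ (Fin n ⊎ J) → Fin (suc n) ⊎ J
      from (inj₁ zero)     = inj₁ zero
      from (inj₂ (inj₁ i)) = inj₁ (suc i)
      from (inj₂ (inj₂ j)) = inj₂ j
      to-from : ∀ x → to (from x) ≡ x
      to-from (inj₁ zero)     = refl
      to-from (inj₂ (inj₁ i)) = refl
      to-from (inj₂ (inj₂ j)) = refl
      from-to : ∀ x → from (to x) ≡ x
      from-to (inj₁ zero)    = refl
      from-to (inj₁ (suc i)) = refl
      from-to (inj₂ j)       = refl

    1+↔suc : ∀ {J : Set} (FJ : Finite J) → Fin (suc (Finite.size FJ)) ↔ (Fin 1 ⊎ J)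
    1+↔suc {J} FJ = mk↔ₛ′ to from to-from from-to
      where
      module FJ = Finite FJ
      to : Fin (suc FJ.size) → Fin 1 ⊎ J
      to zero    = inj₁ zero
      to (suc i) = inj₂ (FJ.fromFin i)
      from : Fin 1 ⊎ J → Fin (suc FJ.size)
      from (inj₁ zero) = zero
      from (inj₂ j)    = suc (FJ.toFin j)
      to-from : ∀ x → to (from x) ≡ x
      to-from (inj₁ zero) = refl
      to-from (inj₂ j)    = cong inj₂ (FJ.fromFin-toFin j)
      from-to : ∀ x → from (to x) ≡ x
      from-to zero    = refl
      from-to (suc i) = cong suc (Inverse.strictlyInverseˡ FJ.index i)

    det-1⊎ : ∀ {J : Set} (FJ : Finite J) (a : Carrier) (B : J → J → Carrier) →
             det (⊎-finite (Fin-finite 1) FJ) (block (λ _ _ → a) B) ≈ a * det FJ B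
    det-1⊎ FJ a B = begin
      det (⊎-finite (Fin-finite 1) FJ) (block (λ _ _ → a) B)
        ≈⟨ det-↔ (Fin-finite (suc FJ.size)) (⊎-finite (Fin-finite 1) FJ) (1+↔suc FJ) _ ⟨
      det (Fin-finite (suc FJ.size)) _
        ≈⟨ det-column FJ.size _ (λ _ → ≈-refl) ⟩
      a * det (Fin-finite FJ.size) (λ i j → B (FJ.fromFin i) (FJ.fromFin j))
        ≈⟨ *-congˡ (det-↔ (Fin-finite FJ.size) FJ (↔-sym FJ.index) B) ⟩
      a * det FJ B  ∎
      where module FJ = Finite FJ

    det-id⊎ : ∀ n {J : Set} (FJ : Finite J) (B : J → J → Carrier) →
              det (⊎-finite (Fin-finite n) FJ) (block (λ i j → δ (i Fin.≟ j)) B) ≈ det FJ B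
    det-id⊎ zero {J} FJ B = ≈-trans
      (≈-sym (det-↔ FJ (⊎-finite (Fin-finite 0) FJ) J↔0⊎J _)) ≈-refl
      where
      J↔0⊎J : J ↔ (Fin 0 ⊎ J)
      J↔0⊎J = mk↔ₛ′ inj₂ [ (λ ()) , id ]′ (λ { (inj₁ ()) ; (inj₂ j) → refl }) (λ _ → refl)
    det-id⊎ (suc n) FJ B = begin
      det (⊎-finite (Fin-finite (suc n)) FJ) M
        ≈⟨ det-cong (⊎-finite (Fin-finite (suc n)) FJ) eq ⟩
      det (⊎-finite (Fin-finite (suc n)) FJ) (λ x y → N (Inverse.to (I+1↔1+ n) x) (Inverse.to (I+1↔1+ n) y))
        ≈⟨ det-↔ (⊎-finite (Fin-finite (suc n)) FJ) F (I+1↔1+ n) N ⟩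
      det F N
        ≈⟨ det-1⊎ (⊎-finite (Fin-finite n) FJ) 1# _ ⟩
      1# * det (⊎-finite (Fin-finite n) FJ) (block (λ i j → δ (i Fin.≟ j)) B)
        ≈⟨ ≈-trans (*-identityˡ _) (det-id⊎ n FJ B) ⟩
      det FJ B  ∎
      where
      M = block {Fin (suc n)} (λ i j → δ (i Fin.≟ j)) B
      N = block {Fin 1} (λ _ _ → 1#) (block {Fin n} (λ i j → δ (i Fin.≟ j)) B)
      F = ⊎-finite (Fin-finite 1) (⊎-finite (Fin-finite n) FJ)
      eq : ∀ x y → M x y ≈ N (Inverse.to (I+1↔1+ n) x) (Inverse.to (I+1↔1+ n) y)
      eq (inj₁ zero)    (inj₁ zero)    = ≈-refl
      eq (inj₁ zero)    (inj₁ (suc j)) = ≈-refl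
      eq (inj₁ (suc i)) (inj₁ zero)    = ≈-refl
      eq (inj₁ (suc i)) (inj₁ (suc j)) =
        when-⇔ (suc i Fin.≟ suc j) (i Fin.≟ j) Fin.suc-injective (cong suc) (λ _ → ≈-refl)
      eq (inj₁ zero)    (inj₂ j)       = ≈-refl
      eq (inj₁ (suc i)) (inj₂ j)       = ≈-refl
      eq (inj₂ i)       (inj₁ zero)    = ≈-refl
      eq (inj₂ i)       (inj₁ (suc j)) = ≈-refl
      eq (inj₂ i)       (inj₂ j)       = ≈-refl

    det-δ⊎ : {I J : Set} (FI : Finite I) (FJ : Finite J) (B : J → J → Carrier) →
             det (⊎-finite FI FJ) (block (λ i j → δ (Finite._≟_ FI i j)) B) ≈ det FJ B
    det-δ⊎ {I} {J} FI FJ B = begin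
      det (⊎-finite FI FJ) (block (λ i j → δ (Finite._≟_ FI i j)) B)
        ≈⟨ det-↔ F (⊎-finite FI FJ) (↔-sym FI.index ⊎-↔ id↔) _ ⟨
      det F (λ x y → block (λ i j → δ (Finite._≟_ FI i j)) B (Sum.map FI.fromFin id x) (Sum.map FI.fromFin id y))
        ≈⟨ det-cong F eq ⟩
      det F (block (λ i j → δ (i Fin.≟ j)) B)
        ≈⟨ det-id⊎ FI.size FJ B ⟩
      det FJ B  ∎
      where
      module FI = Finite FI
      F = ⊎-finite (Fin-finite FI.size) FJ
      id↔ : J ↔ J
      id↔ = mk↔ₛ′ id id (λ _ → refl) (λ _ → refl)
      to-from = Inverse.strictlyInverseˡ FI.index
      eq : ∀ x y → block (λ i j → δ (Finite._≟_ FI i j)) B (Sum.map FI.fromFin id x) (Sum.map FI.fromFin id y) ≈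
                   block (λ i j → δ (i Fin.≟ j)) B x y
      eq (inj₁ i) (inj₁ j) = when-⇔ (FI.fromFin i FI.≟ FI.fromFin j) (i Fin.≟ j)
        (λ eq → trans (sym (to-from i)) (trans (cong FI.toFin eq) (to-from j))) (cong FI.fromFin) (λ _ → ≈-refl)
      eq (inj₁ i) (inj₂ j) = ≈-refl
      eq (inj₂ i) (inj₁ j) = ≈-refl
      eq (inj₂ i) (inj₂ j) = ≈-refl

  -- `block A B` is the product of `block A 1` and `block 1 B`, and an identity block is removed one
  -- index at a time.
  det-⊎ : {I J : Set} (FI : Finite I) (FJ : Finite J) (A : I → I → Carrier) (B : J → J → Carrier) →
          det (⊎-finite FI FJ) (block A B) ≈ det FI A * det FJ B
  det-⊎ {I} {J} FI FJ A B = begin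
    det F (block A B)
      ≈⟨ det-cong F product ⟩
    det F (λ x y → ∑ F (λ z → block A δJ x z * block δI B z y))
      ≈⟨ det-* F (block A δJ) (block δI B) ⟩
    det F (block A δJ) * det F (block δI B)
      ≈⟨ *-cong (≈-trans (det-cong F swapped) (≈-trans (det-↔ F (⊎-finite FJ FI) swap↔ _) (det-δ⊎ FJ FI A)))
                (det-δ⊎ FI FJ B) ⟩
    det FI A * det FJ B  ∎
    where
    F = ⊎-finite FI FJ
    module FI = Finite FI
    module FJ = Finite FJ
    δI = λ i j → δ (i FI.≟ j)
    δJ = λ i j → δ (i FJ.≟ j)
    swap↔ : (I ⊎ J) ↔ (J ⊎ I)
    swap↔ = mk↔ₛ′ Sum.swap Sum.swap Sum.swap-involutive Sum.swap-involutive
    swapped : ∀ x y → block A δJ x y ≈ block δJ A (Sum.swap x) (Sum.swap y)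
    swapped (inj₁ i) (inj₁ j) = ≈-refl
    swapped (inj₁ i) (inj₂ j) = ≈-refl
    swapped (inj₂ i) (inj₁ j) = ≈-refl
    swapped (inj₂ i) (inj₂ j) = ≈-refl
    split : ∀ x y → ∑ F (λ z → block A δJ x z * block δI B z y) ≈
                    ∑ FI (λ k → block A δJ x (inj₁ k) * block δI B (inj₁ k) y) +
                    ∑ FJ (λ k → block A δJ x (inj₂ k) * block δI B (inj₂ k) y)
    split x y = ∑-⊎ FI FJ _
    product : ∀ x y → block A B x y ≈ ∑ F (λ z → block A δJ x z * block δI B z y)
    product (inj₁ i) (inj₁ j) = ≈-sym (≈-trans (split (inj₁ i) (inj₁ j)) (≈-trans (+-cong
      (≈-trans (∑-at FI j (λ k k≢j → ≈-trans (*-congˡ (when-no (k FI.≟ j) k≢j)) (zeroʳ _)))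
               (≈-trans (*-congˡ (when-yes (j FI.≟ j) refl)) (*-identityʳ _)))
      (∑-0 FJ (λ _ → zeroˡ _))) (+-identityʳ _)))
    product (inj₁ i) (inj₂ j) = ≈-sym (≈-trans (split (inj₁ i) (inj₂ j)) (≈-trans
      (+-cong (∑-0 FI (λ _ → zeroʳ _)) (∑-0 FJ (λ _ → zeroˡ _))) (+-identityˡ _)))
    product (inj₂ i) (inj₁ j) = ≈-sym (≈-trans (split (inj₂ i) (inj₁ j)) (≈-trans
      (+-cong (∑-0 FI (λ _ → zeroˡ _)) (∑-0 FJ (λ _ → zeroʳ _))) (+-identityˡ _)))
    product (inj₂ i) (inj₂ j) = ≈-sym (≈-trans (split (inj₂ i) (inj₂ j)) (≈-trans (+-cong
      (∑-0 FI (λ _ → zeroˡ _))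
      (≈-trans (∑-cong FJ (λ k → δ-* (i FJ.≟ k))) (∑-δ FJ i (i FJ.≟_)))) (+-identityˡ _)))

  det-blocks : ∀ n {J : Set} (FJ : Finite J) (M : Fin n → J → J → Carrier) →
               det (×-finite (Fin-finite n) FJ) (λ (i , x) (j , y) → when (i Fin.≟ j) (M i x y)) ≈
               Π.sum (λ i → det FJ (M i))
  det-blocks zero {J} FJ M = ≈-trans
    (≈-sym (det-↔ (Fin-finite 0) (×-finite (Fin-finite 0) FJ) empty _)) (det-Fin-0 _)
    where
    empty : Fin 0 ↔ (Fin 0 × J)
    empty = mk↔ₛ′ (λ ()) proj₁ (λ { (() , _) }) (λ ())
  det-blocks (suc n) {J} FJ M = begin
    det (×-finite (Fin-finite (suc n)) FJ) D
      ≈⟨ det-↔ F (×-finite (Fin-finite (suc n)) FJ) φ D ⟨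
    det F (λ x y → D (Inverse.to φ x) (Inverse.to φ y))
      ≈⟨ det-cong F eq ⟩
    det F (block (M zero) (λ (i , x) (j , y) → when (i Fin.≟ j) (M (suc i) x y)))
      ≈⟨ det-⊎ FJ (×-finite (Fin-finite n) FJ) _ _ ⟩
    det FJ (M zero) * det (×-finite (Fin-finite n) FJ) (λ (i , x) (j , y) → when (i Fin.≟ j) (M (suc i) x y))
      ≈⟨ *-congˡ (det-blocks n FJ (M ∘ suc)) ⟩
    det FJ (M zero) * Π.sum (λ i → det FJ (M (suc i)))  ∎
    where
    F = ⊎-finite FJ (×-finite (Fin-finite n) FJ)
    D : Fin (suc n) × J → Fin (suc n) × J → Carrier
    D (i , x) (j , y) = when (i Fin.≟ j) (M i x y)
    φ : (J ⊎ Fin n × J) ↔ (Fin (suc n) × J)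
    φ = mk↔ₛ′ to from (λ { (zero , x) → refl ; (suc i , x) → refl }) (λ { (inj₁ x) → refl ; (inj₂ (i , x)) → refl })
      where
      to : J ⊎ Fin n × J → Fin (suc n) × J
      to (inj₁ x)       = zero , x
      to (inj₂ (i , x)) = suc i , x
      from : Fin (suc n) × J → J ⊎ Fin n × J
      from (zero , x)  = inj₁ x
      from (suc i , x) = inj₂ (i , x)
    eq : ∀ x y → D (Inverse.to φ x) (Inverse.to φ y) ≈
                 block (M zero) (λ (i , x) (j , y) → when (i Fin.≟ j) (M (suc i) x y)) x y
    eq (inj₁ x)       (inj₁ y)       = ≈-refl
    eq (inj₁ x)       (inj₂ (j , y)) = ≈-refl
    eq (inj₂ (i , x)) (inj₁ y)       = ≈-refl
    eq (inj₂ (i , x)) (inj₂ (j , y)) =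
      when-⇔ (suc i Fin.≟ suc j) (i Fin.≟ j) Fin.suc-injective (cong suc) (λ _ → ≈-refl)

module _ (R S : CommutativeRing 0ℓ 0ℓ) where
  private
    module R = CommutativeRing R
    module S = CommutativeRing S

  record IsHom (h : R.Carrier → S.Carrier) : Set where
    field
      +-homo : ∀ x y → h (x R.+ y) S.≈ h x S.+ h y
      *-homo : ∀ x y → h (x R.* y) S.≈ h x S.* h y
      -‿homo : ∀ x → h (R.- x) S.≈ S.- h x
      0-homo : h R.0# S.≈ S.0#
      1-homo : h R.1# S.≈ S.1#

module _ {R S : CommutativeRing 0ℓ 0ℓ} {h : CommutativeRing.Carrier R → CommutativeRing.Carrier S}
         (h-hom : IsHom R S h) where
  private
    module R = CommutativeRing R
    module S = CommutativeRing S
    module ER = Exterior R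
    module ES = Exterior S
  open IsHom h-hom

  ∧-homo : ∀ {n} (v : Fin n → R.Carrier) (ω : ER.Λ n) (ω′ : ES.Λ n) → (∀ S → h (ω S) S.≈ ω′ S) →
           ∀ S → h ((v ER.∧ ω) S) S.≈ ((h ∘ v) ES.∧ ω′) S
  ∧-homo v ω ω′ eq []          = 0-homo
  ∧-homo v ω ω′ eq (false ∷ S) = ∧-homo (v ∘ suc) (ω ∘ (false ∷_)) (ω′ ∘ (false ∷_)) (eq ∘ (false ∷_)) S
  ∧-homo v ω ω′ eq (true ∷ S)  = S.trans (+-homo _ _) (S.+-cong
    (S.trans (*-homo _ _) (S.*-congˡ (eq (false ∷ S))))
    (S.trans (-‿homo _) (S.-‿cong
      (∧-homo (v ∘ suc) (ω ∘ (true ∷_)) (ω′ ∘ (true ∷_)) (eq ∘ (true ∷_)) S))))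

  W-homo : ∀ k {n} (A : Fin k → Fin n → R.Carrier) S → h (ER.W k A S) S.≈ ES.W k (λ i j → h (A i j)) S
  W-homo zero    A []          = 1-homo
  W-homo zero    A (false ∷ S) = W-homo zero (λ ()) S
  W-homo zero    A (true ∷ S)  = 0-homo
  W-homo (suc k) A S           = ∧-homo (A zero) _ _ (W-homo k (A ∘ suc)) S

  opaque
    unfolding Determinant.det

    det-homo : {I : Set} (FI : Finite I) (A : I → I → R.Carrier) →
               h (Determinant.det R FI A) S.≈ Determinant.det S FI (λ i j → h (A i j))
    det-homo FI A = W-homo (Finite.size FI) _ _

-- The matrix-tree theorem

-- A function nxt : Fin n → Fin (1 + n) is a parent function on the vertices Fin (1 + n) with root zero,
-- the non-root vertex i being suc i.
data Reach {n} (nxt : Fin n → Fin (suc n)) : Fin n → Set where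
  root : ∀ {i} → nxt i ≡ zero → Reach nxt i
  edge : ∀ {i j} → nxt i ≡ suc j → Reach nxt j → Reach nxt i

Rooted : ∀ {n} → (Fin n → Fin (suc n)) → Set
Rooted nxt = ∀ i → Reach nxt i

module FunctionalGraph (R : CommutativeRing 0ℓ 0ℓ) where
  open CommutativeRing R hiding (zero) renaming (refl to ≈-refl; sym to ≈-sym; trans to ≈-trans)
  open Summation R
  open Determinant R
  open import Relation.Binary.Reasoning.Setoid setoid

  -- The matrix that remains when one outgoing edge is chosen at every non-root vertex in the row
  -- expansion of the reduced Laplacian.
  rootedLaplacian : ∀ {n} → (Fin n → Fin (suc n)) → Fin n → Fin n → Carrier
  rootedLaplacian nxt i j = δ (i Fin.≟ j) - δ (nxt i Fin.≟ suc j)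

  private
    -- If no vertex points to the root, every row sums to zero. Multiplication by the unimodular
    -- `U`, whose first column is all ones, replaces the first column by these row sums.
    det-unrooted : ∀ n (nxt : Fin (suc n) → Fin (suc (suc n))) → (∀ i → nxt i ≢ zero) →
                   det (Fin-finite (suc n)) (rootedLaplacian nxt) ≈ 0#
    det-unrooted n nxt ne = begin
      det F A           ≈⟨ *-identityʳ _ ⟨
      det F A * 1#      ≈⟨ *-congˡ det-U ⟨
      det F A * det F U ≈⟨ det-* F A U ⟨
      det F AU          ≈⟨ det-column n AU (λ i → col (suc i)) ⟩
      AU zero zero * _  ≈⟨ *-congʳ (col zero) ⟩
      0# * _            ≈⟨ zeroˡ _ ⟩
      0#                ∎
      where
      F = Fin-finite (suc n)
      A = rootedLaplacian nxt
      U : Fin (suc n) → Fin (suc n) → Carrier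
      U i zero    = 1#
      U i (suc j) = δ (i Fin.≟ suc j)
      AU = λ i j → ∑ F (λ k → A i k * U k j)
      det-U : det F U ≈ 1#
      det-U = ≈-trans (det-row n U (λ _ → ≈-refl)) (≈-trans (*-identityˡ _)
        (≈-trans (det-cong (Fin-finite n) (λ i j → when-⇔ (suc i Fin.≟ suc j) (i Fin.≟ j) Fin.suc-injective (cong suc) (λ _ → ≈-refl)))
                 (det-1 (Fin-finite n) Fin._≟_)))
      nonzero : ∀ {m} (x : Fin (suc m)) → x ≢ zero → ∃ λ k → x ≡ suc k
      nonzero zero    ne = contradiction refl ne
      nonzero (suc k) ne = k , refl
      col : ∀ i → AU i zero ≈ 0#
      col i = let k , eq = nonzero (nxt i) (ne i) in begin
        ∑ F (λ j → A i j * 1#)                                        ≈⟨ ∑-cong F (λ j → *-identityʳ _) ⟩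
        ∑ F (λ j → A i j)                                             ≈⟨ ∑-+ F ⟩
        ∑ F (λ j → δ (i Fin.≟ j)) + ∑ F (λ j → - δ (nxt i Fin.≟ suc j))  ≈⟨ +-cong (∑-δ F i (i Fin.≟_)) (∑-neg F) ⟩
        1# - ∑ F (λ j → δ (nxt i Fin.≟ suc j))
          ≈⟨ +-congˡ (-‿cong (∑-unique F (λ j → nxt i Fin.≟ suc j) k eq (λ j eq′ → Fin.suc-injective (trans (sym eq′) eq)))) ⟩
        1# - 1#                                                       ≈⟨ -‿inverseʳ 1# ⟩
        0#                                                            ∎

  private
    no-reach : ∀ {n} {nxt : Fin n → Fin (suc n)} → (∀ i → nxt i ≢ zero) → ∀ {i} → ¬ Reach nxt i
    no-reach ne (root eq)  = ne _ eq
    no-reach ne (edge _ r) = no-reach ne r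

  -- Contracting into the root a vertex r pointing to the root; σ moves r to the front.
  module Contract {n} (nxt : Fin (suc n) → Fin (suc (suc n))) (r : Fin (suc n)) (r→root : nxt r ≡ zero) where
    private
      π : Fin (suc n) ↔ Fin (suc n)
      π = Perm.transpose zero r

      σ σ⁻¹ : Fin (suc n) → Fin (suc n)
      σ   = Inverse.to π
      σ⁻¹ = Inverse.from π

      σσ⁻¹ : ∀ i → σ (σ⁻¹ i) ≡ i
      σσ⁻¹ = Inverse.strictlyInverseˡ π

      σ⁻¹σ : ∀ i → σ⁻¹ (σ i) ≡ i
      σ⁻¹σ = Inverse.strictlyInverseʳ π

      lift : Fin (suc (suc n)) → Fin (suc (suc n))
      lift zero    = zero
      lift (suc i) = suc (σ⁻¹ i)

      -- The old root and `suc zero`, where `lift` has put r, both become the new root.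
      merge : Fin (suc (suc n)) → Fin (suc n)
      merge zero    = zero
      merge (suc i) = i

    contract : Fin n → Fin (suc n)
    contract i = merge (lift (nxt (σ (suc i))))

    private
      lift⁻¹ : ∀ x {j} → lift x ≡ suc j → x ≡ suc (σ j)
      lift⁻¹ (suc i) eq = cong suc (trans (sym (σσ⁻¹ i)) (cong σ (Fin.suc-injective eq)))

      forward : ∀ {i} → Reach contract i → Reach nxt (σ (suc i))
      forward {i} (root eq) with lift (nxt (σ (suc i))) in eq₁
      ... | zero     with zero ← nxt (σ (suc i)) in eq₂ = root eq₂
      ... | suc zero = edge (lift⁻¹ _ eq₁) (root (trans (cong nxt σ0) r→root))
        where
        σ0 : σ zero ≡ r
        σ0 = refl
      forward {i} (edge eq q) with lift (nxt (σ (suc i))) in eq₁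
      ... | suc (suc j) with refl ← eq = edge (lift⁻¹ _ eq₁) (forward q)

      backward : ∀ {i k} → k ≡ σ (suc i) → Reach nxt k → Reach contract i
      backward refl (root eq) = root (cong (merge ∘ lift) eq)
      backward {i} refl (edge {j = j} eq q) with σ⁻¹ j in eq₁
      ... | zero   = root (trans (cong (merge ∘ lift) eq) eq₁)
      ... | suc j′ = edge (trans (cong (merge ∘ lift) eq) eq₁)
                          (backward (trans (sym (σσ⁻¹ j)) (cong σ eq₁)) q)

    rooted⁺ : Rooted contract → Rooted nxt
    rooted⁺ h k with σ⁻¹ k in eq
    ... | zero  = root (trans (cong nxt (trans (sym (σσ⁻¹ k)) (cong σ eq))) r→root)
    ... | suc i = subst (Reach nxt) (trans (cong σ (sym eq)) (σσ⁻¹ k)) (forward (h i))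

    rooted⁻ : Rooted nxt → Rooted contract
    rooted⁻ h i = backward refl (h _)

    det-contract : det (Fin-finite (suc n)) (rootedLaplacian nxt) ≈ det (Fin-finite n) (rootedLaplacian contract)
    det-contract = begin
      det F (rootedLaplacian nxt)                                ≈⟨ det-↔ F F π _ ⟨
      det F A                                                    ≈⟨ det-row n A row ⟩
      A zero zero * det (Fin-finite n) (λ i j → A (suc i) (suc j))
        ≈⟨ *-cong corner (det-cong (Fin-finite n) minor) ⟩
      1# * det (Fin-finite n) (rootedLaplacian contract)         ≈⟨ *-identityˡ _ ⟩
      det (Fin-finite n) (rootedLaplacian contract)              ∎
      where
      F = Fin-finite (suc n)
      A = λ i j → rootedLaplacian nxt (σ i) (σ j)
      σ-injective : ∀ {i j} → σ i ≡ σ j → i ≡ j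
      σ-injective eq = trans (sym (σ⁻¹σ _)) (trans (cong σ⁻¹ eq) (σ⁻¹σ _))
      vanish : ∀ j → δ (nxt (σ zero) Fin.≟ suc (σ j)) ≈ 0#
      vanish j = when-no (nxt (σ zero) Fin.≟ suc (σ j)) (λ eq → Fin.0≢1+n (trans (sym r→root) eq))
      row : ∀ j → A zero (suc j) ≈ 0#
      row j = ≈-trans (+-cong (when-no (σ zero Fin.≟ σ (suc j)) (λ eq → Fin.0≢1+n (σ-injective eq)))
                              (-‿cong (vanish (suc j)))) (-‿inverseʳ 0#)
      corner : A zero zero ≈ 1#
      corner = ≈-trans (+-cong (when-yes (σ zero Fin.≟ σ zero) refl) (≈-trans (-‿cong (vanish zero)) -0#≈0#)) (+-identityʳ _)
      minor : ∀ i j → A (suc i) (suc j) ≈ rootedLaplacian contract i j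
      minor i j = +-cong
        (when-⇔ (σ (suc i) Fin.≟ σ (suc j)) (i Fin.≟ j) (Fin.suc-injective ∘ σ-injective) (cong (σ ∘ suc)) (λ _ → ≈-refl))
        (-‿cong (when-⇔ (nxt (σ (suc i)) Fin.≟ suc (σ (suc j))) (contract i Fin.≟ suc j)
          (λ eq → trans (cong (merge ∘ lift) eq) (σ⁻¹σ (suc j)))
          (λ eq → lift⁻¹ (nxt (σ (suc i))) (merge⁻¹ _ eq))
          (λ _ → ≈-refl)))
        where
        merge⁻¹ : ∀ x {j} → merge x ≡ suc j → x ≡ suc (suc j)
        merge⁻¹ (suc x) eq = cong suc eq

  -- Contracting a vertex that points to the root changes neither the determinant nor rootedness.
  -- When no such vertex is left, either all vertices are gone, giving 1, or the parent function is
  -- not rooted and the row sums vanish. The dichotomy also decides rootedness.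
  det-rootedLaplacian : ∀ n (nxt : Fin n → Fin (suc n)) →
    (Rooted nxt × det (Fin-finite n) (rootedLaplacian nxt) ≈ 1#) ⊎
    (¬ Rooted nxt × det (Fin-finite n) (rootedLaplacian nxt) ≈ 0#)
  det-rootedLaplacian zero    nxt = inj₁ ((λ ()) , det-Fin-0 _)
  det-rootedLaplacian (suc n) nxt with Fin.any? (λ i → nxt i Fin.≟ zero)
  ... | no ¬∃ = inj₂ ((λ h → no-reach (λ i eq → ¬∃ (i , eq)) (h zero)) , det-unrooted n nxt (λ i eq → ¬∃ (i , eq)))
  ... | yes (r , eq) = Sum.map (λ (h , d) → rooted⁺ h , ≈-trans det-contract d)
                               (λ (h , d) → h ∘ rooted⁻ , ≈-trans det-contract d)
                               (det-rootedLaplacian n contract)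
    where open Contract nxt r eq

argmax : ∀ {n} (f : Fin (suc n) → ℕ) → ∃ λ i → ∀ j → f j ℕ.≤ f i
argmax {zero}  f = zero , λ { zero → ℕ.≤-refl }
argmax {suc n} f with argmax (f ∘ suc)
... | i , max with ℕ.≤-total (f zero) (f (suc i))
...   | inj₁ f0≤fi = suc i , λ { zero → f0≤fi ; (suc j) → max j }
...   | inj₂ fi≤f0 = zero , λ { zero → ℕ.≤-refl ; (suc j) → ℕ.≤-trans (max j) fi≤f0 }

least : {P : ℕ → Set} → (∀ k → Dec (P k)) → ∀ n → P n → ∃ λ k → P k × (∀ j → P j → k ℕ.≤ j)
least P? zero    p = 0 , p , λ _ _ → z≤n
least P? (suc n) p with P? 0
... | yes p0 = 0 , p0 , λ _ _ → z≤n
... | no ¬p0 with least (P? ∘ suc) n p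
...   | k , pk , min = suc k , pk , λ { zero p0 → contradiction p0 ¬p0 ; (suc j) pj → s≤s (min j pj) }

toℕ-next : ∀ {n} (i : Fin (suc n)) → toℕ i ℕ.< n → toℕ (next i) ≡ suc (toℕ i)
toℕ-next i i<n = trans (Fin.toℕ-fromℕ< _) (ℕ.m<n⇒m%n≡m (s≤s i<n))

next-last : ∀ {n} (i : Fin (suc n)) → toℕ i ≡ n → toℕ (next i) ≡ 0
next-last {n} i eq = trans (Fin.toℕ-fromℕ< _) (trans (cong (λ k → suc k ℕ.% suc n) eq) (ℕ.n%n≡0 (suc n)))

next-surjective : ∀ {n} (i : Fin (suc n)) → ∃ λ j → next j ≡ i
next-surjective {n} zero    = Fin.fromℕ n , Fin.toℕ-injective (next-last (Fin.fromℕ n) (Fin.toℕ-fromℕ n))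
next-surjective {n} (suc i) = Fin.inject₁ i , Fin.toℕ-injective
  (trans (toℕ-next (Fin.inject₁ i) (subst (ℕ._< n) (sym (Fin.toℕ-inject₁ i)) (Fin.toℕ<n i))) (cong suc (Fin.toℕ-inject₁ i)))

-- Closed walks in acyclic graphs

module ClosedWalks (X : Graph) (P : Pred (Graph.E X) 0ℓ) where
  open Graph X

  -- k + 1 edges without backtracking, except possibly at the base point.
  record ClosedWalk (k : ℕ) (f : ℕ → E) : Set where
    field
      within    : ∀ {m} → m ℕ.≤ k → P (f m)
      chained   : ∀ {m} → m ℕ.< k → t (f m) ≡ o (f (suc m))
      no-return : ∀ {m} → m ℕ.< k → f (suc m) ≢ inv (f m)
      closed    : t (f k) ≡ o (f 0)

  private
    -- A walk that starts by undoing its last edge is conjugate to a shorter one: both ends are cut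
    -- off and the base point moves to the other end of that edge.
    tail : ∀ {k f} → ClosedWalk (suc (suc k)) f → f 0 ≡ inv (f (suc (suc k))) → ClosedWalk k (f ∘ suc)
    tail {k} {f} w eq = record
      { within    = λ m≤k → within (s≤s (ℕ.m≤n⇒m≤1+n m≤k))
      ; chained   = λ m<k → chained (s≤s (ℕ.m≤n⇒m≤1+n m<k))
      ; no-return = λ m<k → no-return (s≤s (ℕ.m≤n⇒m≤1+n m<k))
      ; closed    = trans (chained ℕ.≤-refl) (trans (sym (t-inv _)) (trans (cong t (sym eq)) (chained (s≤s z≤n))))
      }
      where open ClosedWalk w

    segment : ∀ {k f} i l → ClosedWalk k f → i ℕ.+ suc l ℕ.≤ k → o (f i) ≡ o (f (i ℕ.+ suc l)) →
              ClosedWalk l (λ m → f (i ℕ.+ m))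
    segment {k} {f} i l w le eq = record
      { within    = λ {m} m≤l → within (ℕ.≤-trans (ℕ.+-monoʳ-≤ i (ℕ.m≤n⇒m≤1+n m≤l)) le)
      ; chained   = λ {m} m<l → trans (chained (below m (ℕ.<⇒≤ m<l))) (cong (o ∘ f) (sym (ℕ.+-suc i m)))
      ; no-return = λ {m} m<l eq → no-return (below m (ℕ.<⇒≤ m<l)) (trans (cong f (sym (ℕ.+-suc i m))) eq)
      ; closed    = trans (chained (below l ℕ.≤-refl)) (trans (cong (o ∘ f) (sym (ℕ.+-suc i l)))
                      (trans (sym eq) (cong (o ∘ f) (sym (ℕ.+-identityʳ i)))))
      }
      where
      open ClosedWalk w
      below : ∀ m → m ℕ.≤ l → i ℕ.+ m ℕ.< k
      below m m≤l = ℕ.<-≤-trans (ℕ.+-monoʳ-< i (s≤s m≤l)) le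

    circuit : ∀ {k f} → ClosedWalk k f → f 0 ≢ inv (f k) →
              (∀ (i j : Fin (suc k)) → toℕ i ℕ.< toℕ j → o (f (toℕ i)) ≢ o (f (toℕ j))) →
              IsCircuit X P {k} (f ∘ toℕ)
    circuit {k} {f} w ne simple = mkCircuit
      (λ i → within (ℕ.≤-pred (Fin.toℕ<n i))) chained′ no-return′ distinct
      where
      open ClosedWalk w
      chained′ : ∀ i → t (f (toℕ i)) ≡ o (f (toℕ (next i)))
      chained′ i with ℕ.m≤n⇒m<n∨m≡n (ℕ.≤-pred (Fin.toℕ<n i))
      ... | inj₁ i<k = trans (chained i<k) (cong (o ∘ f) (sym (toℕ-next i i<k)))
      ... | inj₂ i≡k = trans (cong (t ∘ f) i≡k) (trans closed (cong (o ∘ f) (sym (next-last i i≡k))))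
      no-return′ : ∀ i → f (toℕ (next i)) ≢ inv (f (toℕ i))
      no-return′ i eq with ℕ.m≤n⇒m<n∨m≡n (ℕ.≤-pred (Fin.toℕ<n i))
      ... | inj₁ i<k = no-return i<k (trans (cong f (sym (toℕ-next i i<k))) eq)
      ... | inj₂ i≡k = ne (trans (cong f (sym (next-last i i≡k))) (trans eq (cong (inv ∘ f) i≡k)))
      distinct : ∀ i j → o (f (toℕ i)) ≡ o (f (toℕ j)) → i ≡ j
      distinct i j eq with ℕ.<-cmp (toℕ i) (toℕ j)
      ... | tri< i<j _ _ = contradiction eq (simple i j i<j)
      ... | tri≈ _ i≡j _ = Fin.toℕ-injective i≡j
      ... | tri> _ _ j<i = contradiction (sym eq) (simple j i j<i)

  -- Strong induction on the length. Backtracking at the base point allows both ends to be cut off,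
  -- a repeated vertex gives a shorter closed segment, and otherwise the walk is a circuit. A
  -- segment may backtrack at its own base point, which is why `ClosedWalk` tolerates that.
  no-closedWalk : Acyclic X P → ∀ k f → ¬ ClosedWalk k f
  no-closedWalk acyclic = <-rec (λ k → ∀ f → ¬ ClosedWalk k f) go
    where
    go : ∀ k → (∀ {j} → j ℕ.< k → ∀ f → ¬ ClosedWalk j f) → ∀ f → ¬ ClosedWalk k f
    go k rec f w with f 0 Eᶠ.≟ inv (f k)
    ... | yes eq = returning k rec w eq
      where
      returning : ∀ k → (∀ {j} → j ℕ.< k → ∀ f → ¬ ClosedWalk j f) → ClosedWalk k f → f 0 ≢ inv (f k)
      returning zero          rec w eq = inv-≢ (f 0) (sym eq)
      returning (suc zero)    rec w eq =
        ClosedWalk.no-return w (s≤s z≤n) (trans (sym (inv-inv (f 1))) (cong inv (sym eq)))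
      returning (suc (suc k)) rec w eq = rec (ℕ.m≤n⇒m≤1+n ℕ.≤-refl) _ (tail w eq)
    ... | no ne with Fin.any? (λ (i : Fin (suc k)) → Fin.any? (λ (j : Fin (suc k)) →
                       (toℕ i ℕ.<? toℕ j) ×-dec (o (f (toℕ i)) Vᶠ.≟ o (f (toℕ j)))))
    ...   | no ¬∃ = acyclic k (f ∘ toℕ) (circuit w ne (λ i j i<j eq → ¬∃ (i , j , i<j , eq)))
    ...   | yes (i , j , i<j , eq) = rec l<k _ (segment (toℕ i) l w (ℕ.≤-trans (ℕ.≤-reflexive j≡) j≤k)
                                                  (trans eq (cong (o ∘ f) (sym j≡))))
      where
      l = toℕ j ℕ.∸ suc (toℕ i)
      j≡ : toℕ i ℕ.+ suc l ≡ toℕ j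
      j≡ = trans (ℕ.+-suc (toℕ i) l) (ℕ.m+[n∸m]≡n i<j)
      j≤k = ℕ.≤-pred (Fin.toℕ<n j)
      l<k : l ℕ.< k
      l<k = ℕ.<-≤-trans (ℕ.≤-trans (ℕ.m≤n+m (suc l) (toℕ i)) (ℕ.≤-reflexive j≡)) j≤k

  -- Non-backtracking walks, indexed by their first and last edges.
  data NB : E → E → Set where
    [_] : ∀ {a} → P a → NB a a
    _∷_,_⟩_ : ∀ {a b c} → P a → t a ≡ o b → b ≢ inv a → NB b c → NB a c

  glue : ∀ {a b c} → NB a b → NB b c → NB a c
  glue [ _ ]             w = w
  glue (p ∷ eq , ne ⟩ v) w = p ∷ eq , ne ⟩ glue v w

  reverse : (∀ e → P e → P (inv e)) → ∀ {a b} → NB a b → NB (inv b) (inv a)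
  reverse stable [ p ] = [ stable _ p ]
  reverse stable {a} (_∷_,_⟩_ {b = b} p eq ne v) = glue (reverse stable v)
    (stable _ (first v) ∷ trans (t-inv b) (trans (sym eq) (sym (o-inv a)))
                        , (λ eq′ → ne (sym (trans eq′ (inv-inv b)))) ⟩ [ stable _ p ])
    where
    first : ∀ {a b} → NB a b → P a
    first [ p ]           = p
    first (p ∷ _ , _ ⟩ _) = p

  no-closedNB : Acyclic X P → ∀ {a b} → NB a b → t b ≢ o a
  no-closedNB acyclic w eq = let k , f , f0 , fk , c = walk w in no-closedWalk acyclic k f (record
    { within = proj₁ c ; chained = proj₁ (proj₂ c) ; no-return = proj₂ (proj₂ c)
    ; closed = trans (cong t fk) (trans eq (cong o (sym f0))) })
    where
    walk : ∀ {a b} → NB a b → ∃ λ k → ∃ λ f → f 0 ≡ a × f k ≡ b ×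
           (∀ {m} → m ℕ.≤ k → P (f m)) × (∀ {m} → m ℕ.< k → t (f m) ≡ o (f (suc m))) ×
           (∀ {m} → m ℕ.< k → f (suc m) ≢ inv (f m))
    walk {a} [ p ] = 0 , (λ _ → a) , refl , refl , (λ _ → p) , (λ ()) , (λ ())
    walk {a} (p ∷ eq , ne ⟩ v) = let k , f , f0 , fk , within , chained , no-return = walk v in
      suc k , (λ { zero → a ; (suc m) → f m }) , refl , fk ,
      (λ { {zero} _ → p ; {suc m} (s≤s le) → within le }) ,
      (λ { {zero} _ → trans eq (cong o (sym f0)) ; {suc m} (s≤s lt) → chained lt }) ,
      (λ { {zero} _ eq′ → ne (trans (sym f0) eq′) ; {suc m} (s≤s lt) → no-return lt })

-- Spanning trees as systems of parent edges

module ParentEdges (X : Graph) {n} (V↔ : Graph.V X ↔ Fin (suc n)) where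
  open Graph X

  vertex : Fin (suc n) → V
  vertex = Inverse.from V↔

  number : V → Fin (suc n)
  number = Inverse.to V↔

  vertex-number : ∀ v → vertex (number v) ≡ v
  vertex-number = Inverse.strictlyInverseʳ V↔

  number-vertex : ∀ i → number (vertex i) ≡ i
  number-vertex = Inverse.strictlyInverseˡ V↔

  vertex-injective : ∀ {i j} → vertex i ≡ vertex j → i ≡ j
  vertex-injective eq = trans (sym (number-vertex _)) (trans (cong number eq) (number-vertex _))

  parent : (Fin n → E) → Fin n → Fin (suc n)
  parent φ i = number (t (φ i))

  record IsParent (φ : Fin n → E) : Set where
    field
      origin : ∀ i → o (φ i) ≡ vertex (suc i)
      rooted : Rooted (parent φ)

  -- Rootedness certified by a height that drops along every parent edge, the form in which the
  -- later inductions and extremal arguments use it.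
  Descends : (V → ℕ) → (Fin n → E) → Set
  Descends h φ = ∀ i → h (t (φ i)) ℕ.< h (vertex (suc i))

  private
    depth : ∀ {nxt : Fin n → Fin (suc n)} {i} → Reach nxt i → ℕ
    depth (root _)   = 0
    depth (edge _ r) = suc (depth r)

    depth-unique : ∀ {nxt : Fin n → Fin (suc n)} {i} (p q : Reach nxt i) → depth p ≡ depth q
    depth-unique (root _)    (root _)     = refl
    depth-unique (root eq)   (edge eq′ _) = contradiction (trans (sym eq) eq′) Fin.0≢1+n
    depth-unique (edge eq _) (root eq′)   = contradiction (trans (sym eq′) eq) Fin.0≢1+n
    depth-unique (edge eq p) (edge eq′ q) with refl ← Fin.suc-injective (trans (sym eq) eq′) =
      cong suc (depth-unique p q)

  descends : ∀ {φ} → Rooted (parent φ) → ∃ λ h → Descends h φ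
  descends {φ} r = height ∘ number , λ i → subst (height (parent φ i) ℕ.<_) (cong height (sym (number-vertex (suc i)))) (below i (r i) refl)
    where
    height : Fin (suc n) → ℕ
    height zero    = 0
    height (suc i) = suc (depth (r i))
    below : ∀ i (q : Reach (parent φ) i) → q ≡ r i → height (parent φ i) ℕ.< suc (depth (r i))
    below i (root eq)           _   = subst (λ x → height x ℕ.< suc (depth (r i))) (sym eq) (s≤s z≤n)
    below i (edge {j = j} eq q) q≡r = subst (λ x → height x ℕ.< suc (depth (r i))) (sym eq)
      (s≤s (ℕ.≤-trans (s≤s (ℕ.≤-reflexive (depth-unique (r j) q))) (ℕ.≤-reflexive (cong depth q≡r))))

  descends⇒rooted : ∀ {φ} h → Descends h φ → Rooted (parent φ)
  descends⇒rooted {φ} h desc i = <-rec (λ k → ∀ i → h (vertex (suc i)) ≡ k → Reach (parent φ) i) go _ i refl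
    where
    go : ∀ k → (∀ {j} → j ℕ.< k → ∀ i → h (vertex (suc i)) ≡ j → Reach (parent φ) i) →
         ∀ i → h (vertex (suc i)) ≡ k → Reach (parent φ) i
    go k rec i refl with number (t (φ i)) in eq
    ... | zero  = root eq
    ... | suc j = edge eq (rec (subst (λ v → h v ℕ.< h (vertex (suc i)))
                    (trans (sym (vertex-number _)) (cong vertex eq)) (desc i)) j refl)

  Covered : (Fin n → E) → E → Set
  Covered φ e = ∃ λ i → e ≡ φ i ⊎ e ≡ inv (φ i)

  covered? : ∀ φ e → Dec (Covered φ e)
  covered? φ e = Fin.any? (λ i → (e Eᶠ.≟ φ i) ⊎-dec (e Eᶠ.≟ inv (φ i)))

  covered-inv : ∀ {φ e} → Covered φ e → Covered φ (inv e)
  covered-inv (i , inj₁ eq) = i , inj₂ (cong inv eq)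
  covered-inv (i , inj₂ eq) = i , inj₁ (trans (cong inv eq) (inv-inv _))

  module _ {φ} (origin : ∀ i → o (φ i) ≡ vertex (suc i)) (h : V → ℕ) (desc : Descends h φ) where

    covered-down : ∀ {e} → Covered φ e → h (t e) ℕ.≤ h (o e) → ∃ λ i → e ≡ φ i
    covered-down         (i , inj₁ eq)   le = i , eq
    covered-down {e} (i , inj₂ refl) le = contradiction (desc i) (ℕ.≤⇒≯ (subst₂ (λ v w → h v ℕ.≤ h w)
      (trans (t-inv (φ i)) (origin i)) (o-inv (φ i)) le))

    -- At a highest vertex of a circuit, the outgoing edge and the reversed incoming edge both fail
    -- to go up. So both are the parent edge of that vertex, and the circuit turns back there.
    covered-acyclic : Acyclic X (Covered φ)
    covered-acyclic m c circuit with argmax (h ∘ o ∘ c)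
    ... | i , max with next-surjective i
    ...   | j , refl = no-return j (trans (proj₂ down₁) (trans (cong φ same) (sym (proj₂ down₂))))
      where
      open IsCircuit circuit
      down₁ : ∃ λ k → c i ≡ φ k
      down₁ = covered-down (inside-P i) (subst (λ v → h v ℕ.≤ h (o (c i))) (sym (chained i)) (max (next i)))
      down₂ : ∃ λ k → inv (c j) ≡ φ k
      down₂ = covered-down (covered-inv (inside-P j)) (subst₂ (λ v w → h v ℕ.≤ h w)
        (sym (t-inv (c j))) (sym (trans (o-inv (c j)) (chained j))) (max j))
      same : proj₁ down₁ ≡ proj₁ down₂
      same = Fin.suc-injective (vertex-injective (trans (sym (origin _)) (trans (cong o (sym (proj₂ down₁)))
        (trans (sym (chained j)) (trans (sym (o-inv (c j))) (trans (cong o (proj₂ down₂)) (origin _)))))))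

    covered-connected : ConnectedVia X (Covered φ)
    covered-connected = vertex zero , λ v w → toRoot v ◅◅ back (toRoot w)
      where
      toRoot : ∀ v → Walk X (Covered φ) v (vertex zero)
      toRoot v = <-rec (λ k → ∀ v → h v ≡ k → Walk X (Covered φ) v (vertex zero)) go _ v refl
        where
        go : ∀ k → (∀ {j} → j ℕ.< k → ∀ v → h v ≡ j → Walk X (Covered φ) v (vertex zero)) →
             ∀ v → h v ≡ k → Walk X (Covered φ) v (vertex zero)
        go k rec v refl with number v in eq
        ... | zero  = subst (λ w → Walk X (Covered φ) w (vertex zero)) (trans (cong vertex (sym eq)) (vertex-number v)) ε
        ... | suc i = (φ i , (i , inj₁ refl) , trans (origin i) v≡ , refl) ◅
                      rec (subst (λ w → h (t (φ i)) ℕ.< h w) v≡ (desc i)) (t (φ i)) refl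
          where v≡ = trans (cong vertex (sym eq)) (vertex-number v)
      back : ∀ {v w} → Walk X (Covered φ) v w → Walk X (Covered φ) w v
      back ε                          = ε
      back ((e , p , refl , refl) ◅ w) = back w ◅◅ ((inv e , covered-inv p , o-inv e , t-inv e) ◅ ε)

  -- Induction on the height for φ. If φ i is not ψ i, it is the inverse of some ψ j, so j is the
  -- φ-parent of i. By induction φ j = ψ j, which ends at i; then i lies both above and below j.
  parent-unique : ∀ {φ ψ} → IsParent φ → IsParent ψ → (∀ e → Covered φ e → Covered ψ e) → ∀ i → φ i ≡ ψ i
  parent-unique {φ} {ψ} pφ pψ sub i = <-rec (λ k → ∀ i → h (vertex (suc i)) ≡ k → φ i ≡ ψ i) go _ i refl
    where
    module φ = IsParent pφ
    module ψ = IsParent pψ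
    h = proj₁ (descends φ.rooted)
    desc = proj₂ (descends φ.rooted)
    go : ∀ k → (∀ {j} → j ℕ.< k → ∀ i → h (vertex (suc i)) ≡ j → φ i ≡ ψ i) → ∀ i → h (vertex (suc i)) ≡ k → φ i ≡ ψ i
    go k rec i refl with sub (φ i) (i , inj₁ refl)
    ... | j , inj₁ eq = trans eq (cong ψ (Fin.suc-injective (vertex-injective
                          (trans (sym (ψ.origin j)) (trans (cong o (sym eq)) (φ.origin i))))))
    ... | j , inj₂ eq = contradiction (ℕ.<-trans j<i i<j) (ℕ.<-irrefl refl)
      where
      tφi : t (φ i) ≡ vertex (suc j)
      tφi = trans (cong t eq) (trans (t-inv (ψ j)) (ψ.origin j))
      j<i : h (vertex (suc j)) ℕ.< h (vertex (suc i))
      j<i = subst (λ v → h v ℕ.< h (vertex (suc i))) tφi (desc i)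
      tφj : t (φ j) ≡ vertex (suc i)
      tφj = trans (cong t (rec j<i j refl)) (trans (sym (o-inv (ψ j))) (trans (cong o (sym eq)) (φ.origin i)))
      i<j : h (vertex (suc i)) ℕ.< h (vertex (suc j))
      i<j = subst (λ v → h v ℕ.< h (vertex (suc j))) tφj (desc j)

  module FromTree (P : Pred E 0ℓ) (P? : U.Decidable P) (stable : ∀ e → P e → P (inv e))
                  (connected : ConnectedVia X P) (acyclic : Acyclic X P) where
    private
      -- Walks of exact length to the root. They are decidable, so the distance to the root is a
      -- least length, and each vertex takes as parent edge the first edge of a shortest walk.
      LW : ℕ → V → Set
      LW zero    v = v ≡ vertex zero
      LW (suc k) v = ∃ λ e → P e × o e ≡ v × LW k (t e)

      LW? : ∀ v k → Dec (LW k v)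
      LW? v zero    = v Vᶠ.≟ vertex zero
      LW? v (suc k) = Eᶠ.∃? (λ e → P? e ×-dec (o e Vᶠ.≟ v) ×-dec LW? (t e) k)

      fromWalk : ∀ {v w} → Walk X P v w → w ≡ vertex zero → ∃ λ k → LW k v
      fromWalk ε                           eq = 0 , eq
      fromWalk ((e , p , refl , refl) ◅ w) eq = let k , l = fromWalk w eq in suc k , e , p , refl , l

      shortest : ∀ v → ∃ λ k → LW k v × (∀ j → LW j v → k ℕ.≤ j)
      shortest v = let k , l = fromWalk (proj₂ connected v (vertex zero)) refl in least (LW? v) k l

      dist : V → ℕ
      dist = proj₁ ∘ shortest

      up : ∀ i → ∃ λ e → P e × o e ≡ vertex (suc i) × dist (t e) ℕ.< dist (vertex (suc i))
      up i with shortest (vertex (suc i))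
      ... | zero  , l , _ = contradiction (sym (vertex-injective l)) Fin.0≢1+n
      ... | suc k , (e , p , oe , l) , _ = e , p , oe , s≤s (proj₂ (proj₂ (shortest (t e))) k l)

    φ : Fin n → E
    φ i = proj₁ (up i)

    private
      φ∈P : ∀ i → P (φ i)
      φ∈P i = proj₁ (proj₂ (up i))

      origin : ∀ i → o (φ i) ≡ vertex (suc i)
      origin i = proj₁ (proj₂ (proj₂ (up i)))

      desc : Descends dist φ
      desc i = proj₂ (proj₂ (proj₂ (up i)))

    isParent : IsParent φ
    isParent = record { origin = origin ; rooted = descends⇒rooted dist desc }

    covered⇒P : ∀ e → Covered φ e → P e
    covered⇒P e (i , inj₁ refl) = φ∈P i
    covered⇒P e (i , inj₂ refl) = stable _ (φ∈P i)

    open ClosedWalks X P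

    private
      -- After `e`, follow parent edges down to the root. The hypothesis rules out turning back at
      -- the first step, the only place where this could happen.
      descend : ∀ e → P e → (∀ i → t e ≡ vertex (suc i) → φ i ≢ inv e) → ∃ λ b → NB e b × t b ≡ vertex zero
      descend e p ne = <-rec (λ k → ∀ e → P e → (∀ i → t e ≡ vertex (suc i) → φ i ≢ inv e) → dist (t e) ≡ k →
                                    ∃ λ b → NB e b × t b ≡ vertex zero) go _ e p ne refl
        where
        go : ∀ k → (∀ {j} → j ℕ.< k → ∀ e → P e → (∀ i → t e ≡ vertex (suc i) → φ i ≢ inv e) → dist (t e) ≡ j →
                    ∃ λ b → NB e b × t b ≡ vertex zero) →
             ∀ e → P e → (∀ i → t e ≡ vertex (suc i) → φ i ≢ inv e) → dist (t e) ≡ k →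
             ∃ λ b → NB e b × t b ≡ vertex zero
        go k rec e p ne refl with number (t e) in eq
        ... | zero  = e , [ p ] , trans (sym (vertex-number _)) (cong vertex eq)
        ... | suc i = let b , w , tb = rec lower (φ i) (φ∈P i) ne′ refl
                      in b , p ∷ trans te (sym (origin i)) , ne i te ⟩ w , tb
          where
          te : t e ≡ vertex (suc i)
          te = trans (sym (vertex-number _)) (cong vertex eq)
          lower : dist (t (φ i)) ℕ.< dist (t e)
          lower = subst (λ v → dist (t (φ i)) ℕ.< dist v) (sym te) (desc i)
          -- Each of two mutually inverse parent edges would have to decrease the distance to the
          -- root.
          ne′ : ∀ j → t (φ i) ≡ vertex (suc j) → φ j ≢ inv (φ i)
          ne′ j tφi φj≡ = ℕ.<-irrefl refl (ℕ.<-trans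
            (subst (λ v → dist v ℕ.< dist (vertex (suc i))) tφi (desc i))
            (subst (λ v → dist v ℕ.< dist (vertex (suc j))) (trans (cong t φj≡) (trans (t-inv (φ i)) (origin i))) (desc j)))

    -- Otherwise e followed by the way to the root, and preceded by the way back from the root, is a closed walk.
    P⇒covered : ∀ e → P e → Covered φ e
    P⇒covered e p with covered? φ e
    ... | yes c = c
    ... | no ¬c = let b , w , tb = descend e p (λ i _ eq → ¬c (i , inj₂ (trans (sym (inv-inv e)) (cong inv (sym eq)))))
                      b′ , w′ , tb′ = descend (inv e) (stable e p) (λ i _ eq → ¬c (i , inj₁ (trans (sym (inv-inv e)) (sym eq))))
                      u = subst (NB (inv b′)) (inv-inv e) (reverse stable w′)
                  in contradiction (trans tb (trans (sym tb′) (sym (o-inv b′)))) (no-closedNB acyclic (glue u w))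

Bool-finite : Finite Bool
Bool-finite = record { size = 2 ; index = mk↔ₛ′ to from to-from from-to }
  where
  to : Bool → Fin 2
  to true  = zero
  to false = suc zero
  from : Fin 2 → Bool
  from zero       = true
  from (suc zero) = false
  to-from : ∀ i → to (from i) ≡ i
  to-from zero       = refl
  to-from (suc zero) = refl
  from-to : ∀ b → from (to b) ≡ b
  from-to true  = refl
  from-to false = refl

Vec-ext : {A : Set} {n : ℕ} {u v : Vec A n} → (∀ i → lookup u i ≡ lookup v i) → u ≡ v
Vec-ext {u = u} {v} eq = trans (sym (Vec.tabulate∘lookup u)) (trans (Vec.tabulate-cong eq) (Vec.tabulate∘lookup v))

module _ (X : Graph) {P Q : Pred (Graph.E X) 0ℓ} where

  connectedVia-mono : (∀ e → P e → Q e) → ConnectedVia X P → ConnectedVia X Q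
  connectedVia-mono f (v , walk) = v , λ v w → Star.map (λ (e , p , eq) → e , f e p , eq) (walk v w)

  acyclic-mono : (∀ e → P e → Q e) → Acyclic X Q → Acyclic X P
  acyclic-mono f acyclic n c (mkCircuit a b d e) = acyclic n c (mkCircuit (λ i → f _ (a i)) b d e)

module ParentSets (X : Graph) {n} (V↔ : Graph.V X ↔ Fin (suc n)) where
  open Graph X
  open ParentEdges X V↔

  isParent-cong : ∀ {φ ψ} → φ ≗ ψ → IsParent φ → IsParent ψ
  isParent-cong eq p = record
    { origin = λ i → trans (cong o (sym (eq i))) (origin i)
    ; rooted = λ i → reach-cong (λ j → cong (number ∘ t) (eq j)) (rooted i)
    }
    where
    open IsParent p
    reach-cong : ∀ {f g : Fin n → Fin (suc n)} {i} → f ≗ g → Reach f i → Reach g i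
    reach-cong eq (root r)   = root (trans (sym (eq _)) r)
    reach-cong eq (edge r q) = edge (trans (sym (eq _)) r) (reach-cong eq q)

  edgeSet : Vec E n → Subset Eᶠ.size
  edgeSet d = tabulate (λ k → Dec.does (covered? (lookup d) (Eᶠ.fromFin k)))

  private
    lookup-edgeSet : ∀ d e → lookup (edgeSet d) (Eᶠ.toFin e) ≡ Dec.does (covered? (lookup d) e)
    lookup-edgeSet d e = trans (Vec.lookup∘tabulate _ (Eᶠ.toFin e))
      (cong (Dec.does ∘ covered? (lookup d)) (Eᶠ.fromFin-toFin e))

  edgeSet⇒covered : ∀ d e → Edges X (edgeSet d) e → Covered (lookup d) e
  edgeSet⇒covered d e mem with covered? (lookup d) e | trans (sym (Vec.[]=⇒lookup mem)) (lookup-edgeSet d e)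
  ... | yes c | _ = c

  covered⇒edgeSet : ∀ d e → Covered (lookup d) e → Edges X (edgeSet d) e
  covered⇒edgeSet d e c = Vec.lookup⇒[]= _ (edgeSet d) (trans (lookup-edgeSet d e) (dec-true (covered? (lookup d) e) c))

  edgeSet-isSpanningTree : ∀ d → IsParent (lookup d) → IsSpanningTree X (edgeSet d)
  edgeSet-isSpanningTree d p =
    (λ e mem → covered⇒edgeSet d (inv e) (covered-inv (edgeSet⇒covered d e mem))) ,
    connectedVia-mono X (covered⇒edgeSet d) (covered-connected origin h desc) ,
    acyclic-mono X (edgeSet⇒covered d) (covered-acyclic origin h desc)
    where
    open IsParent p
    h = proj₁ (descends rooted)
    desc = proj₂ (descends rooted)

  edgeSet-injective : ∀ d d′ → IsParent (lookup d) → IsParent (lookup d′) → edgeSet d ≡ edgeSet d′ → d ≡ d′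
  edgeSet-injective d d′ p p′ eq = Vec-ext (parent-unique p p′ (λ e c →
    edgeSet⇒covered d′ e (subst (λ S → Edges X S e) eq (covered⇒edgeSet d e c))))

  -- The parent edges along shortest walks inside `S` and their inverses exhaust `S`, by acyclicity.
  edgeSet-surjective : ∀ S → IsSpanningTree X S → ∃ λ d → IsParent (lookup d) × S ≡ edgeSet d
  edgeSet-surjective S (stable , connected , acyclic) = d , isParent-cong φ≗ isParent , Vec-ext eq
    where
    open FromTree (Edges X S) (λ e → Eᶠ.toFin e ∈? S) stable connected acyclic
    d = tabulate φ
    φ≗ : φ ≗ lookup d
    φ≗ i = sym (Vec.lookup∘tabulate φ i)
    cov-cong : ∀ {φ ψ e} → φ ≗ ψ → Covered φ e → Covered ψ e
    cov-cong eq (i , inj₁ e≡) = i , inj₁ (trans e≡ (eq i))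
    cov-cong eq (i , inj₂ e≡) = i , inj₂ (trans e≡ (cong inv (eq i)))
    eq : ∀ k → lookup S k ≡ lookup (edgeSet d) k
    eq k with covered? (lookup d) (Eᶠ.fromFin k) | Vec.lookup∘tabulate (λ k → Dec.does (covered? (lookup d) (Eᶠ.fromFin k))) k
    ... | yes c | eq′ = trans (trans (cong (lookup S) (sym (Inverse.strictlyInverseˡ Eᶠ.index k)))
                          (Vec.[]=⇒lookup (covered⇒P _ (cov-cong (sym ∘ φ≗) c)))) (sym eq′)
    ... | no ¬c | eq′ with lookup S k in eq″
    ...   | false = sym eq′
    ...   | true  = contradiction (cov-cong φ≗ (P⇒covered (Eᶠ.fromFin k)
                      (subst (_∈ S) (sym (Inverse.strictlyInverseˡ Eᶠ.index k)) (Vec.lookup⇒[]= k S eq″)))) ¬c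

-- Laplacians and the number of spanning trees

module MatrixTree (R : CommutativeRing 0ℓ 0ℓ) where
  open CommutativeRing R hiding (zero) renaming (refl to ≈-refl; sym to ≈-sym; trans to ≈-trans)
  open Summation R
  open Determinant R
  open FunctionalGraph R
  open import Relation.Binary.Reasoning.Setoid setoid

  opaque
    unfolding ∑

    ∑-suc : ∀ n (f : Fin (suc n) → Carrier) → ∑ (Fin-finite (suc n)) f ≈ f zero + ∑ (Fin-finite n) (f ∘ suc)
    ∑-suc n f = ≈-refl

    ∑-const : {A : Set} (FA : Finite A) (x : Carrier) → ∑ FA (λ _ → x) ≈ Finite.size FA · x
    ∑-const FA x = sum-replicate (Finite.size FA)

    ∑-Bool : (f : Bool → Carrier) → ∑ Bool-finite f ≈ f true + f false
    ∑-Bool f = +-congˡ (+-identityʳ _)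

  length-filter : ∀ n {P : Subset n → Set} (P? : ∀ S → Dec (P S)) →
                  ∑ (Vec-finite Bool-finite n) (λ S → δ (P? S)) ≈ List.length (List.filter P? (subsets n)) · 1#
  length-filter zero P? = ≈-trans (∑-[] +-commutativeMonoid Bool-finite _) single
    where
    single : δ (P? []) ≈ List.length (List.filter P? ([] ∷ [])) · 1#
    single with P? []
    ... | yes _ = ≈-sym (+-identityʳ _)
    ... | no _  = ≈-refl
  length-filter (suc n) P? = begin
    ∑ (Vec-finite Bool-finite (suc n)) (λ S → δ (P? S))
      ≈⟨ ≈-trans (∑-∷ +-commutativeMonoid Bool-finite n _) (∑-Bool _) ⟩
    ∑ F (λ S → δ (P? (true ∷ S))) + ∑ F (λ S → δ (P? (false ∷ S)))
      ≈⟨ +-cong (length-filter n (P? ∘ (true ∷_))) (length-filter n (P? ∘ (false ∷_))) ⟩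
    count (P? ∘ (true ∷_)) (subsets n) · 1# + count (P? ∘ (false ∷_)) (subsets n) · 1#
      ≡⟨ cong₂ (λ x y → x · 1# + y · 1#) (count-map true (subsets n)) (count-map false (subsets n)) ⟩
    count P? (List.map (true ∷_) (subsets n)) · 1# + count P? (List.map (false ∷_) (subsets n)) · 1#
      ≈⟨ ×-homo-+ 1# (count P? (List.map (true ∷_) (subsets n))) _ ⟨
    (count P? (List.map (true ∷_) (subsets n)) ℕ.+ count P? (List.map (false ∷_) (subsets n))) · 1#
      ≡⟨ cong (_· 1#) (trans (sym (List.length-++ (List.filter P? (List.map (true ∷_) (subsets n)))))
           (cong List.length (sym (List.filter-++ P? (List.map (true ∷_) (subsets n)) _)))) ⟩
    count P? (subsets (suc n)) · 1#  ∎
    where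
    F = Vec-finite Bool-finite n
    count : ∀ {A : Set} {Q : A → Set} → (∀ a → Dec (Q a)) → List A → ℕ
    count Q? xs = List.length (List.filter Q? xs)
    count-map : ∀ b xs → count (P? ∘ (b ∷_)) xs ≡ count P? (List.map (b ∷_) xs)
    count-map b []       = refl
    count-map b (x ∷ xs) with P? (b ∷ x)
    ... | yes _ = cong suc (count-map b xs)
    ... | no _  = count-map b xs

  Π-δ : ∀ {n} {P : Fin n → Set} (P? : ∀ i → Dec (P i)) → Π.sum (λ i → δ (P? i)) ≈ δ (Fin.all? P?)
  Π-δ {n} P? with Fin.all? P?
  ... | yes h = Π.sum-0 {n} (λ i → when-yes (P? i) (h i))
  ... | no ¬h = let i , ¬p = Fin.¬∀⟶∃¬ n _ P? ¬h in vanish (λ i → δ (P? i)) i (when-no (P? i) ¬p)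
    where
    vanish : ∀ {m} (f : Fin m → Carrier) i → f i ≈ 0# → Π.sum f ≈ 0#
    vanish f zero    eq = ≈-trans (*-congʳ eq) (zeroˡ _)
    vanish f (suc i) eq = ≈-trans (*-congˡ (vanish (f ∘ suc) i eq)) (zeroʳ _)

  -- With weights z^α this is the Laplacian of X twisted by the character ζ ↦ z of the voltage α.
  laplacian : (X : Graph) → (Graph.E X → Carrier) → Graph.V X → Graph.V X → Carrier
  laplacian X wt v w = ∑ E-finite (λ e → when (o e Vᶠ.≟ v) (δ (v Vᶠ.≟ w) - wt e * δ (t e Vᶠ.≟ w)))
    where open Graph X

  module _ (X : Graph) where
    open Graph X

    private
      L = laplacian X (λ _ → 1#)

    laplacian-rowSum : ∀ v → ∑ V-finite (λ w → L v w) ≈ 0#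
    laplacian-rowSum v = ≈-trans (∑-swap V-finite E-finite) (∑-0 E-finite (λ e →
      ≈-trans (∑-when V-finite (o e Vᶠ.≟ v)) (≈-trans (when-cong (o e Vᶠ.≟ v) (λ _ → begin
        ∑ V-finite (λ w → δ (v Vᶠ.≟ w) - 1# * δ (t e Vᶠ.≟ w))
          ≈⟨ ∑-+ V-finite ⟩
        ∑ V-finite (λ w → δ (v Vᶠ.≟ w)) + ∑ V-finite (λ w → - (1# * δ (t e Vᶠ.≟ w)))
          ≈⟨ +-cong (∑-δ V-finite v (v Vᶠ.≟_)) (≈-trans (∑-neg V-finite) (-‿cong
               (≈-trans (∑-cong V-finite (λ w → *-identityˡ _)) (∑-δ V-finite (t e) (t e Vᶠ.≟_))))) ⟩
        1# - 1#
          ≈⟨ -‿inverseʳ 1# ⟩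
        0#  ∎)) (when-0 (o e Vᶠ.≟ v)))))
      where
      when-0 : {P : Set} (d : Dec P) → when d 0# ≈ 0#
      when-0 (yes _) = ≈-refl
      when-0 (no _)  = ≈-refl

    -- The inversion of edges exchanges origins and targets, so the two sums over edges agree.
    laplacian-columnSum : ∀ w → ∑ V-finite (λ v → L v w) ≈ 0#
    laplacian-columnSum w = begin
      ∑ V-finite (λ v → L v w)                                               ≈⟨ ∑-swap V-finite E-finite ⟩
      ∑ E-finite (λ e → ∑ V-finite (λ v → when (o e Vᶠ.≟ v) (δ (v Vᶠ.≟ w) - 1# * δ (t e Vᶠ.≟ w))))
        ≈⟨ ∑-cong E-finite (λ e → ≈-trans (∑-δ V-finite (o e) (o e Vᶠ.≟_)) (+-congˡ (-‿cong (*-identityˡ _)))) ⟩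
      ∑ E-finite (λ e → δ (o e Vᶠ.≟ w) - δ (t e Vᶠ.≟ w))                     ≈⟨ ≈-trans (∑-+ E-finite) (+-congˡ (∑-neg E-finite)) ⟩
      ∑ E-finite (λ e → δ (o e Vᶠ.≟ w)) - ∑ E-finite (λ e → δ (t e Vᶠ.≟ w))
        ≈⟨ +-congˡ (-‿cong (∑-cong E-finite (λ e → reflexive (cong (λ v → δ (v Vᶠ.≟ w)) (sym (o-inv e)))))) ⟩
      ∑ E-finite (λ e → δ (o e Vᶠ.≟ w)) - ∑ E-finite (λ e → δ (o (inv e) Vᶠ.≟ w))
        ≈⟨ +-congˡ (-‿cong (∑-↔ E-finite E-finite (mk↔ₛ′ inv inv inv-inv inv-inv) _)) ⟨
      ∑ E-finite (λ e → δ (o e Vᶠ.≟ w)) - ∑ E-finite (λ e → δ (o e Vᶠ.≟ w))  ≈⟨ -‿inverseʳ _ ⟩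
      0#                                                                     ∎

    module _ {n} (V↔ : V ↔ Fin (suc n)) where
      open ParentEdges X V↔
      open ParentSets X V↔

      rooted? : ∀ (nxt : Fin n → Fin (suc n)) → Dec (Rooted nxt)
      rooted? nxt with det-rootedLaplacian n nxt
      ... | inj₁ (r , _)  = yes r
      ... | inj₂ (¬r , _) = no ¬r

      isParent? : ∀ φ → Dec (IsParent φ)
      isParent? φ = map′ (λ (a , b) → record { origin = a ; rooted = b }) (λ p → IsParent.origin p , IsParent.rooted p)
        (Fin.all? (λ i → o (φ i) Vᶠ.≟ vertex (suc i)) ×-dec rooted? (parent φ))

      private
        tree-count : ∑ (Vec-finite E-finite n) (λ d → δ (isParent? (lookup d))) ≈
                     ∑ (Vec-finite Bool-finite Eᶠ.size) (λ S → δ (isSpanningTree? X S))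
        tree-count = ∑-bij (Vec-finite E-finite n) (Vec-finite Bool-finite Eᶠ.size)
          (λ d → isParent? (lookup d)) (isSpanningTree? X)
          (λ d S → isParent? (lookup d) ×-dec Vec.≡-dec Bool._≟_ S (edgeSet d))
          (λ { {d} (p , refl) → p , edgeSet-isSpanningTree d p , ≈-refl })
          (λ d p → edgeSet d , (p , refl) , λ S (_ , eq) → eq)
          (λ S tree → let d , p , eq = edgeSet-surjective S tree in d , (p , eq) ,
             λ d′ (p′ , eq′) → edgeSet-injective d′ d p′ p (trans (sym eq′) eq))

        term : ∀ d → Π.∑ (Fin-finite n) (λ i → δ (o (lookup d i) Vᶠ.≟ vertex (suc i))) *
                     det (Fin-finite n) (rootedLaplacian (parent (lookup d))) ≈ δ (isParent? (lookup d))
        term d = ≈-trans (*-congʳ (≈-trans (Π.∑-def (Fin-finite n) _) (Π-δ (λ i → o (lookup d i) Vᶠ.≟ vertex (suc i)))))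
                   (≈-trans (δ-* all) (rest (det-rootedLaplacian n nxt)))
          where
          all = Fin.all? (λ i → o (lookup d i) Vᶠ.≟ vertex (suc i))
          nxt = parent (lookup d)
          D = det (Fin-finite n) (rootedLaplacian nxt)
          rest : (Rooted nxt × D ≈ 1#) ⊎ (¬ Rooted nxt × D ≈ 0#) → when all D ≈ δ (isParent? (lookup d))
          rest (inj₁ (r , eq)) = when-⇔ all (isParent? (lookup d)) (λ a → record { origin = a ; rooted = r }) IsParent.origin (λ _ → eq)
          rest (inj₂ (¬r , eq)) = ≈-trans (when-cong all (λ _ → eq)) (≈-trans (zeros all)
                  (≈-sym (when-no (isParent? (lookup d)) (¬r ∘ IsParent.rooted))))
            where
            zeros : {P : Set} (d : Dec P) → when d 0# ≈ 0#
            zeros (yes _) = ≈-refl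
            zeros (no _)  = ≈-refl

      -- Each row is a sum over edges leaving its vertex. A choice of one edge per row contributes 1
      -- if it is a system of parent edges and 0 otherwise, and such systems correspond to spanning
      -- trees.
      det-reducedLaplacian : det (Fin-finite n) (λ i j → L (vertex (suc i)) (vertex (suc j))) ≈ κ X · 1#
      det-reducedLaplacian = begin
        det (Fin-finite n) (λ i j → L (vertex (suc i)) (vertex (suc j)))
          ≈⟨ det-cong (Fin-finite n) (λ i j → ∑-cong E-finite (λ e → entry i j e)) ⟩
        det (Fin-finite n) (λ i j → ∑ E-finite (λ e →
          δ (o e Vᶠ.≟ vertex (suc i)) * (δ (i Fin.≟ j) - δ (number (t e) Fin.≟ suc j))))
          ≈⟨ det-∑ (Fin-finite n) E-finite _ (λ i e j → δ (i Fin.≟ j) - δ (number (t e) Fin.≟ suc j)) ⟩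
        ∑ (Vec-finite E-finite n) (λ d → Π.∑ (Fin-finite n) (λ i → δ (o (lookup d i) Vᶠ.≟ vertex (suc i))) *
          det (Fin-finite n) (rootedLaplacian (parent (lookup d))))
          ≈⟨ ∑-cong (Vec-finite E-finite n) term ⟩
        ∑ (Vec-finite E-finite n) (λ d → δ (isParent? (lookup d)))                ≈⟨ tree-count ⟩
        ∑ (Vec-finite Bool-finite Eᶠ.size) (λ S → δ (isSpanningTree? X S))        ≈⟨ length-filter Eᶠ.size (isSpanningTree? X) ⟩
        κ X · 1#                                                                  ∎
        where
        entry : ∀ i j e → when (o e Vᶠ.≟ vertex (suc i)) (δ (vertex (suc i) Vᶠ.≟ vertex (suc j)) - 1# * δ (t e Vᶠ.≟ vertex (suc j))) ≈
                          δ (o e Vᶠ.≟ vertex (suc i)) * (δ (i Fin.≟ j) - δ (number (t e) Fin.≟ suc j))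
        entry i j e = ≈-trans (when-cong (o e Vᶠ.≟ vertex (suc i)) (λ _ → +-cong
          (when-⇔ (vertex (suc i) Vᶠ.≟ vertex (suc j)) (i Fin.≟ j) (Fin.suc-injective ∘ vertex-injective) (cong (vertex ∘ suc)) (λ _ → ≈-refl))
          (-‿cong (≈-trans (*-identityˡ _) (when-⇔ (t e Vᶠ.≟ vertex (suc j)) (number (t e) Fin.≟ suc j)
            (λ eq → trans (cong number eq) (number-vertex _)) (λ eq → trans (sym (vertex-number _)) (cong vertex eq)) (λ _ → ≈-refl))))))
          (≈-sym (δ-* (o e Vᶠ.≟ vertex (suc i))))

  -- Row and column operations reduce L + t J, J the all-ones matrix, to the minor of L.
  det-shift : ∀ n (L : Fin (suc n) → Fin (suc n) → Carrier) (t : Carrier) →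
              (∀ i → ∑ (Fin-finite (suc n)) (λ j → L i j) ≈ 0#) → (∀ j → ∑ (Fin-finite (suc n)) (λ i → L i j) ≈ 0#) →
              det (Fin-finite (suc n)) (λ i j → L i j + t) ≈
              suc n · 1# * (suc n · t) * det (Fin-finite n) (λ i j → L (suc i) (suc j))
  det-shift n L t rows columns = begin
    det F A                    ≈⟨ *-identityˡ _ ⟨
    1# * det F A               ≈⟨ *-congʳ det-U ⟨
    det F U * det F A          ≈⟨ det-* F U A ⟨
    det F (λ i j → ∑ F (λ k → U i k * A k j))  ≈⟨ det-cong F UA≈QB ⟩
    det F (λ i j → ∑ F (λ k → Q i k * B k j))  ≈⟨ det-* F Q B ⟩
    det F Q * det F B          ≈⟨ *-cong det-Q (≈-sym (*-identityʳ _)) ⟩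
    m * (det F B * 1#)         ≈⟨ *-congˡ (*-congˡ det-U′) ⟨
    m * (det F B * det F U′)   ≈⟨ *-congˡ (det-* F B U′) ⟨
    m * det F C                ≈⟨ *-congˡ (det-column n C C-column) ⟩
    m * (C zero zero * det (Fin-finite n) (λ i j → C (suc i) (suc j)))
      ≈⟨ *-congˡ (*-cong C-corner (det-cong (Fin-finite n) (λ i j → ≈-trans (∑-cong F (λ k → *-comm _ _)) (at-column (suc i) j)))) ⟩
    m * ((suc n · t) * det (Fin-finite n) (λ i j → L (suc i) (suc j)))  ≈⟨ *-assoc _ _ _ ⟨
    m * (suc n · t) * det (Fin-finite n) (λ i j → L (suc i) (suc j))    ∎
    where
    F = Fin-finite (suc n)
    m = suc n · 1#
    -- `U` replaces row 0 of `A` by the sum of all rows, whose entries are (n + 1) t. `Q` extracts n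
    -- + 1 from that row and accounts for the shift by t in the others. `U′` replaces column 0 of
    -- `B` by its row sums, which vanish outside the corner.
    A B C Q U U′ : Fin (suc n) → Fin (suc n) → Carrier
    A i j = L i j + t
    B zero    j = t
    B (suc i) j = L (suc i) j
    U zero    j = 1#
    U (suc i) j = δ (suc i Fin.≟ j)
    U′ i zero    = 1#
    U′ i (suc j) = δ (suc j Fin.≟ i)
    Q zero    zero    = m
    Q zero    (suc j) = 0#
    Q (suc i) zero    = 1#
    Q (suc i) (suc j) = δ (i Fin.≟ j)
    C i j = ∑ F (λ k → B i k * U′ k j)
    δ-suc : ∀ (i j : Fin n) → δ (suc i Fin.≟ suc j) ≈ δ (i Fin.≟ j)
    δ-suc i j = when-⇔ (suc i Fin.≟ suc j) (i Fin.≟ j) Fin.suc-injective (cong suc) (λ _ → ≈-refl)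
    det-I : det (Fin-finite n) (λ i j → δ (i Fin.≟ j)) ≈ 1#
    det-I = det-1 (Fin-finite n) Fin._≟_
    det-U : det F U ≈ 1#
    det-U = ≈-trans (det-column n U (λ _ → ≈-refl)) (≈-trans (*-identityˡ _)
      (≈-trans (det-cong (Fin-finite n) δ-suc) det-I))
    det-U′ : det F U′ ≈ 1#
    det-U′ = ≈-trans (det-row n U′ (λ _ → ≈-refl)) (≈-trans (*-identityˡ _)
      (≈-trans (det-cong (Fin-finite n) (λ i j → ≈-trans (δ-suc j i) (when-⇔ (j Fin.≟ i) (i Fin.≟ j) sym sym (λ _ → ≈-refl)))) det-I))
    det-Q : det F Q ≈ m
    det-Q = ≈-trans (det-row n Q (λ _ → ≈-refl)) (≈-trans (*-congˡ det-I) (*-identityʳ m))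
    UA≈QB : ∀ i j → ∑ F (λ k → U i k * A k j) ≈ ∑ F (λ k → Q i k * B k j)
    UA≈QB zero j = begin
      ∑ F (λ k → 1# * (L k j + t))                    ≈⟨ ≈-trans (∑-cong F (λ k → *-identityˡ _)) (∑-+ F) ⟩
      ∑ F (λ k → L k j) + ∑ F (λ _ → t)               ≈⟨ +-cong (columns j) (∑-const F t) ⟩
      0# + suc n · t                                  ≈⟨ +-identityˡ _ ⟩
      suc n · t                                       ≈⟨ ≈-trans (×-assoc-* (suc n) 1# t) (×-congʳ (suc n) (*-identityˡ t)) ⟨
      m * t                                           ≈⟨ +-identityʳ _ ⟨
      m * t + 0#                                      ≈⟨ +-congˡ (∑-0 (Fin-finite n) (λ _ → zeroˡ _)) ⟨
      m * t + ∑ (Fin-finite n) (λ k → 0# * B (suc k) j)  ≈⟨ ∑-suc n _ ⟨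
      ∑ F (λ k → Q zero k * B k j)                    ∎
    UA≈QB (suc i) j = begin
      ∑ F (λ k → δ (suc i Fin.≟ k) * A k j)           ≈⟨ ∑-cong F (λ k → δ-* (suc i Fin.≟ k)) ⟩
      ∑ F (λ k → when (suc i Fin.≟ k) (A k j))        ≈⟨ ∑-δ F (suc i) (suc i Fin.≟_) ⟩
      L (suc i) j + t                                 ≈⟨ +-comm _ _ ⟩
      t + L (suc i) j
        ≈⟨ +-cong (*-identityˡ t) (≈-trans (∑-cong (Fin-finite n) (λ k → δ-* (i Fin.≟ k))) (∑-δ (Fin-finite n) i (i Fin.≟_))) ⟨
      1# * t + ∑ (Fin-finite n) (λ k → δ (i Fin.≟ k) * L (suc k) j)  ≈⟨ ∑-suc n _ ⟨
      ∑ F (λ k → Q (suc i) k * B k j)                 ∎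
    C-column : ∀ i → C (suc i) zero ≈ 0#
    C-column i = ≈-trans (∑-cong F (λ k → *-identityʳ _)) (rows (suc i))
    C-corner : C zero zero ≈ suc n · t
    C-corner = ≈-trans (∑-cong F (λ k → *-identityʳ _)) (∑-const F t)
    at-column : ∀ i j → ∑ F (λ k → δ (suc j Fin.≟ k) * B i k) ≈ B i (suc j)
    at-column i j = ≈-trans (∑-cong F (λ k → δ-* (suc j Fin.≟ k))) (∑-δ F (suc j) (suc j Fin.≟_))

  -- Unlike a minor, the shifted Laplacian is invariant under graph automorphisms, so that it can be
  -- diagonalised along a cyclic cover.
  matrixTree : (X : Graph) → Graph.V X → (t : Carrier) →
               det (Graph.V-finite X) (λ v w → laplacian X (λ _ → 1#) v w + t) ≈
               Finite.size (Graph.V-finite X) · 1# * (Finite.size (Graph.V-finite X) · t) * (κ X · 1#)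
  matrixTree X v₀ t = sized Vᶠ.size Vᶠ.index refl
    where
    open Graph X using (V; V-finite; module Vᶠ)
    L = laplacian X (λ _ → 1#)
    sized : ∀ m (φ : V ↔ Fin m) → Vᶠ.size ≡ m →
            det V-finite (λ v w → L v w + t) ≈ Vᶠ.size · 1# * (Vᶠ.size · t) * (κ X · 1#)
    sized zero    φ eq = contradiction (Inverse.to φ v₀) (λ ())
    sized (suc n) φ eq = begin
      det V-finite (λ v w → L v w + t)
        ≈⟨ det-↔ F V-finite (↔-sym φ) _ ⟨
      det F (λ i j → L (vertex i) (vertex j) + t)
        ≈⟨ det-shift n (λ i j → L (vertex i) (vertex j)) t
             (λ i → ≈-trans (≈-sym (∑-↔ F V-finite (↔-sym φ) _)) (laplacian-rowSum X (vertex i)))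
             (λ j → ≈-trans (≈-sym (∑-↔ F V-finite (↔-sym φ) _)) (laplacian-columnSum X (vertex j))) ⟩
      suc n · 1# * (suc n · t) * det (Fin-finite n) (λ i j → L (vertex (suc i)) (vertex (suc j)))
        ≈⟨ *-congˡ (det-reducedLaplacian X φ) ⟩
      suc n · 1# * (suc n · t) * (κ X · 1#)
        ≡⟨ cong (λ k → k · 1# * (k · t) * (κ X · 1#)) (sym eq) ⟩
      Vᶠ.size · 1# * (Vᶠ.size · t) * (κ X · 1#)  ∎
      where
      F = Fin-finite (suc n)
      vertex = Inverse.from φ

-- Cyclic covers

-- The vertices above v are vert v i with i modulo N, and α is a voltage assignment: the lift of an
-- edge e from vert (o e) i ends at vert (t e) (i + α e).
record CyclicPresentation {Z X : Graph} (f : Hom Z X) (N : ℕ) .{{_ : ℕ.NonZero N}} (α : Graph.E X → ℕ) : Set where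
  private
    module Z = Graph Z
    module X = Graph X
  field
    vert      : X.V → ℕ → Z.V
    over      : ∀ v i → Hom.onV f (vert v i) ≡ v
    onto      : ∀ w → ∃ λ i → vert (Hom.onV f w) i ≡ w
    periodic  : ∀ v {i j} → i ℕ.% N ≡ j ℕ.% N → vert v i ≡ vert v j
    separated : ∀ v {i j} → vert v i ≡ vert v j → i ℕ.% N ≡ j ℕ.% N
    lift      : ∀ e i → ∃ λ e′ → Hom.onE f e′ ≡ e × Z.o e′ ≡ vert (X.o e) i × Z.t e′ ≡ vert (X.t e) (i ℕ.+ α e)
    unique    : ∀ {e e′} → Z.o e ≡ Z.o e′ → Hom.onE f e ≡ Hom.onE f e′ → e ≡ e′

module CyclicCovers (R : CommutativeRing 0ℓ 0ℓ) where
  open CommutativeRing R hiding (zero) renaming (refl to ≈-refl; sym to ≈-sym; trans to ≈-trans)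
  open Summation R
  open Determinant R
  open MatrixTree R
  open import Algebra.Properties.Semiring.Exp semiring public using (_^_; ^-congˡ; ^-homo-*; ^-assocʳ)
  open import Relation.Binary.Reasoning.Setoid setoid

  -- Non-zero-divisors take the place of invertible elements: N is not invertible in the ring in
  -- question, but it can be cancelled.
  Cancellable : Carrier → Set
  Cancellable c = ∀ {x y} → c * x ≈ c * y → x ≈ y

  cancellable-1 : Cancellable 1#
  cancellable-1 eq = ≈-trans (≈-sym (*-identityˡ _)) (≈-trans eq (*-identityˡ _))

  cancellable-* : ∀ {c d} → Cancellable c → Cancellable d → Cancellable (c * d)
  cancellable-* cc cd eq = cd (cc (≈-trans (≈-sym (*-assoc _ _ _)) (≈-trans eq (*-assoc _ _ _))))

  cancellable-^ : ∀ {c} → Cancellable c → ∀ n → Cancellable (c ^ n)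
  cancellable-^ cc zero    = cancellable-1
  cancellable-^ cc (suc n) = cancellable-* cc (cancellable-^ cc n)

  cancellable-cong : ∀ {c d} → c ≈ d → Cancellable c → Cancellable d
  cancellable-cong eq cc h = cc (≈-trans (*-congʳ eq) (≈-trans h (*-congʳ (≈-sym eq))))

  det-scalar : {I : Set} (FI : Finite I) (_≟_ : ∀ i j → Dec (i ≡ j)) (c : Carrier) →
               det FI (λ i j → when (i ≟ j) c) ≈ c ^ Finite.size FI
  det-scalar FI _≟_ c = ≈-trans (≈-sym (det-↔ (Fin-finite FI.size) FI (↔-sym FI.index) _))
    (≈-trans (det-cong (Fin-finite FI.size) (λ i j → when-⇔ (FI.fromFin i ≟ FI.fromFin j) (i Fin.≟ j)
      (λ eq → trans (sym (to-from i)) (trans (cong FI.toFin eq) (to-from j))) (cong FI.fromFin) (λ _ → ≈-refl)))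
      (go FI.size))
    where
    module FI = Finite FI
    to-from : ∀ i → FI.toFin (FI.fromFin i) ≡ i
    to-from = Inverse.strictlyInverseˡ FI.index
    go : ∀ n → det (Fin-finite n) (λ i j → when (i Fin.≟ j) c) ≈ c ^ n
    go zero    = det-Fin-0 _
    go (suc n) = ≈-trans (det-column n (λ i j → when (i Fin.≟ j) c) (λ _ → ≈-refl)) (*-congˡ (≈-trans
      (det-cong (Fin-finite n) (λ i j → when-⇔ (suc i Fin.≟ suc j) (i Fin.≟ j) Fin.suc-injective (cong suc) (λ _ → ≈-refl)))
      (go n)))

  -- ζ behaves as a primitive N-th root of unity.
  record IsPrincipalRoot (N : ℕ) (ζ : Carrier) : Set where
    field
      power   : ζ ^ N ≈ 1#
      vanish  : ∀ k → ¬ (N ℕ.∣ k) → ∑ (Fin-finite N) (λ i → ζ ^ (toℕ i ℕ.* k)) ≈ 0#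

  module _ (torsionFree : ∀ n → Cancellable (suc n · 1#)) where

    module _ {X Z : Graph} {f : Hom Z X} {n : ℕ} {α : Graph.E X → ℕ} (presentation : CyclicPresentation f (suc n) α)
             {ζ : Carrier} (principal : IsPrincipalRoot (suc n) ζ) (v₀ : Graph.V X) where
      private
        module X = Graph X
        module Z = Graph Z
        open CyclicPresentation presentation
        open IsPrincipalRoot principal
        open Hom f using (onV; onE)

        N = suc n

        toℕ-mod : ∀ k → toℕ (k ℕ.mod N) ≡ k ℕ.% N
        toℕ-mod k = Fin.toℕ-fromℕ< (ℕ.m%n<n k N)

        mod-mod : ∀ k → toℕ (k ℕ.mod N) ℕ.% N ≡ k ℕ.% N
        mod-mod k = trans (cong (ℕ._% N) (toℕ-mod k)) (ℕ.m%n%n≡m%n k N)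

        ζ-multiple : ∀ k → ζ ^ (k ℕ.* N) ≈ 1#
        ζ-multiple k = begin
          ζ ^ (k ℕ.* N)   ≡⟨ cong (ζ ^_) (ℕ.*-comm k N) ⟩
          ζ ^ (N ℕ.* k)   ≈⟨ ^-assocʳ ζ N k ⟨
          (ζ ^ N) ^ k     ≈⟨ ^-congˡ k power ⟩
          1# ^ k          ≈⟨ 1^ k ⟩
          1#              ∎
          where
          1^ : ∀ k → 1# ^ k ≈ 1#
          1^ zero    = ≈-refl
          1^ (suc k) = ≈-trans (*-identityˡ _) (1^ k)

        ζ-mod : ∀ k j → ζ ^ (k ℕ.* j) ≈ ζ ^ ((k ℕ.% N) ℕ.* j)
        ζ-mod k j = begin
          ζ ^ (k ℕ.* j)
            ≡⟨ cong (ζ ^_) (trans (cong (ℕ._* j) (ℕ.m≡m%n+[m/n]*n k N)) (trans (ℕ.*-distribʳ-+ j (k ℕ.% N) _)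
                 (cong ((k ℕ.% N) ℕ.* j ℕ.+_) (trans (ℕ.*-assoc (k ℕ./ N) N j) (trans (cong ((k ℕ./ N) ℕ.*_) (ℕ.*-comm N j))
                   (sym (ℕ.*-assoc (k ℕ./ N) j N))))))) ⟩
          ζ ^ ((k ℕ.% N) ℕ.* j ℕ.+ (k ℕ./ N) ℕ.* j ℕ.* N)   ≈⟨ ^-homo-* ζ ((k ℕ.% N) ℕ.* j) _ ⟩
          ζ ^ ((k ℕ.% N) ℕ.* j) * ζ ^ ((k ℕ./ N) ℕ.* j ℕ.* N) ≈⟨ *-congˡ (ζ-multiple ((k ℕ./ N) ℕ.* j)) ⟩
          ζ ^ ((k ℕ.% N) ℕ.* j) * 1#                       ≈⟨ *-identityʳ _ ⟩
          ζ ^ ((k ℕ.% N) ℕ.* j)                            ∎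

        I : Set
        I = Fin N × X.V

        FI : Finite I
        FI = ×-finite (Fin-finite N) X.V-finite

        φ : I ↔ Z.V
        φ = mk↔ₛ′ (λ (a , v) → vert v (toℕ a)) (λ w → (proj₁ (onto w) ℕ.mod N) , onV w)
              (λ w → trans (periodic (onV w) (mod-mod (proj₁ (onto w)))) (proj₂ (onto w)))
              (λ (a , v) → cong₂ _,_ (Fin.toℕ-injective (trans (toℕ-mod (proj₁ (onto (vert v (toℕ a))))) (index a v))) (over v (toℕ a)))
          where
          index : ∀ a v → proj₁ (onto (vert v (toℕ a))) ℕ.% N ≡ toℕ a
          index a v = trans (separated v (trans (cong (λ u → vert u _) (sym (over v (toℕ a)))) (proj₂ (onto (vert v (toℕ a))))))
                            (ℕ.m<n⇒m%n≡m (Fin.toℕ<n a))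

        -- The Fourier matrix of ℤ/N tensored with the identity on the vertices of `X`; its columns
        -- are the characters supported on a single fibre.
        K : I → I → Carrier
        K (a , v) (j , u) = δ (v X.Vᶠ.≟ u) * ζ ^ (toℕ a ℕ.* toℕ j)

        g : I → Z.V → Carrier
        g j w = K (Inverse.from φ w) j

        g-vert : ∀ v i j u → g (j , u) (vert v i) ≈ δ (v X.Vᶠ.≟ u) * ζ ^ (i ℕ.* toℕ j)
        g-vert v i j u = ≈-trans (reflexive (cong (λ x → g (j , u) x) (periodic v (sym (mod-mod i)))))
          (≈-trans (reflexive (cong (λ x → K x (j , u)) (Inverse.strictlyInverseʳ φ (i ℕ.mod N , v))))
            (*-congˡ (≈-trans (reflexive (cong (λ k → ζ ^ (k ℕ.* toℕ j)) (toℕ-mod i))) (≈-sym (ζ-mod i (toℕ j))))))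

        A : Z.V → Z.V → Carrier
        A w w′ = laplacian Z (λ _ → 1#) w w′ + 1#

        -- The block at the j-th character. The all-ones matrix on `Z` is seen by the trivial
        -- character alone, where it adds N to every entry.
        M : Fin N → X.V → X.V → Carrier
        M j v u = laplacian X (λ e → ζ ^ (toℕ j ℕ.* α e)) v u + when (j Fin.≟ zero) (N · 1#)

        D : I → I → Carrier
        D (i , u) (j , v) = when (i Fin.≟ j) (M i u v)

        laplacian-apply : ∀ (h : Z.V → Carrier) w →
          ∑ Z.V-finite (λ w′ → laplacian Z (λ _ → 1#) w w′ * h w′) ≈ ∑ Z.E-finite (λ e → when (Z.o e Z.Vᶠ.≟ w) (h w - h (Z.t e)))
        laplacian-apply h w = begin
          ∑ Z.V-finite (λ w′ → laplacian Z (λ _ → 1#) w w′ * h w′)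
            ≈⟨ ∑-cong Z.V-finite (λ w′ → ∑-* Z.E-finite) ⟩
          ∑ Z.V-finite (λ w′ → ∑ Z.E-finite (λ e → when (Z.o e Z.Vᶠ.≟ w) (δ (w Z.Vᶠ.≟ w′) - 1# * δ (Z.t e Z.Vᶠ.≟ w′)) * h w′))
            ≈⟨ ∑-swap Z.V-finite Z.E-finite ⟩
          ∑ Z.E-finite (λ e → ∑ Z.V-finite (λ w′ → when (Z.o e Z.Vᶠ.≟ w) (δ (w Z.Vᶠ.≟ w′) - 1# * δ (Z.t e Z.Vᶠ.≟ w′)) * h w′))
            ≈⟨ ∑-cong Z.E-finite (λ e → ≈-trans (∑-cong Z.V-finite (λ w′ → when-* (Z.o e Z.Vᶠ.≟ w)))
                 (≈-trans (∑-when Z.V-finite (Z.o e Z.Vᶠ.≟ w)) (when-cong (Z.o e Z.Vᶠ.≟ w) (λ _ → inner e)))) ⟩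
          ∑ Z.E-finite (λ e → when (Z.o e Z.Vᶠ.≟ w) (h w - h (Z.t e)))  ∎
          where
          inner : ∀ e → ∑ Z.V-finite (λ w′ → (δ (w Z.Vᶠ.≟ w′) - 1# * δ (Z.t e Z.Vᶠ.≟ w′)) * h w′) ≈ h w - h (Z.t e)
          inner e = begin
            ∑ Z.V-finite (λ w′ → (δ (w Z.Vᶠ.≟ w′) - 1# * δ (Z.t e Z.Vᶠ.≟ w′)) * h w′)
              ≈⟨ ∑-cong Z.V-finite (λ w′ → ≈-trans
                   (solve 4 (λ c x y h → (x :- c :* y) :* h := x :* h :- c :* (y :* h)) ≈-refl 1# _ _ (h w′))
                   (+-cong (δ-* (w Z.Vᶠ.≟ w′)) (-‿cong (≈-trans (*-identityˡ _) (δ-* (Z.t e Z.Vᶠ.≟ w′)))))) ⟩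
            ∑ Z.V-finite (λ w′ → when (w Z.Vᶠ.≟ w′) (h w′) - when (Z.t e Z.Vᶠ.≟ w′) (h w′))
              ≈⟨ ∑-+ Z.V-finite ⟩
            _ ≈⟨ +-cong (∑-δ Z.V-finite w (w Z.Vᶠ.≟_)) (≈-trans (∑-neg Z.V-finite) (-‿cong (∑-δ Z.V-finite (Z.t e) (Z.t e Z.Vᶠ.≟_)))) ⟩
            h w - h (Z.t e)  ∎

        out-edges : ∀ v i (h : Z.V → Carrier) →
          ∑ Z.E-finite (λ e → when (Z.o e Z.Vᶠ.≟ vert v i) (h (vert v i) - h (Z.t e))) ≈
          ∑ X.E-finite (λ e → when (X.o e X.Vᶠ.≟ v) (h (vert v i) - h (vert (X.t e) (i ℕ.+ α e))))
        out-edges v i h = ∑-bij Z.E-finite X.E-finite (λ e → Z.o e Z.Vᶠ.≟ vert v i) (λ e → X.o e X.Vᶠ.≟ v)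
          (λ e e′ → (Z.o e Z.Vᶠ.≟ vert v i) ×-dec (onE e X.Eᶠ.≟ e′))
          (λ { {e} (oe , refl) → oe , origin oe ,
               +-congˡ (-‿cong (reflexive (cong h (let e′ , fe′ , oe′ , te′ = lift (onE e) i in
                 trans (cong Z.t (unique (trans oe (sym (trans oe′ (cong (λ u → vert u i) (origin oe))))) (sym fe′))) te′)))) })
          (λ e oe → onE e , (oe , refl) , λ b (_ , eq) → sym eq)
          (λ { e refl → let e′ , fe′ , oe′ , te′ = lift e i in
               e′ , (oe′ , fe′) , λ a (oa , fa) → unique (trans oa (sym oe′)) (trans fa (sym fe′)) })
          where
          origin : ∀ {e} → Z.o e ≡ vert v i → X.o (onE e) ≡ v
          origin {e} oe = trans (sym (Hom.o-hom f e)) (trans (cong onV oe) (over v i))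

        -- The relation AK = KD, entry by entry: moving along a lift of `e` adds its voltage to the
        -- index, which multiplies the j-th character by ζ to the power j α(e). The sum of a
        -- nontrivial character is zero.
        column : ∀ (a j : Fin N) (v u : X.V) →
                 ∑ FI (λ k → A (Inverse.to φ (a , v)) (Inverse.to φ k) * K k (j , u)) ≈ ζ ^ (toℕ a ℕ.* toℕ j) * M j v u
        column a j v u = begin
          ∑ FI (λ k → A w (Inverse.to φ k) * K k (j , u))
            ≈⟨ ∑-cong FI (λ k → *-congˡ (reflexive (cong (λ x → K x (j , u)) (sym (Inverse.strictlyInverseʳ φ k))))) ⟩
          ∑ FI (λ k → A w (Inverse.to φ k) * g (j , u) (Inverse.to φ k))
            ≈⟨ ∑-↔ FI Z.V-finite φ (λ w′ → A w w′ * g (j , u) w′) ⟨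
          ∑ Z.V-finite (λ w′ → (laplacian Z (λ _ → 1#) w w′ + 1#) * g (j , u) w′)
            ≈⟨ ≈-trans (∑-cong Z.V-finite (λ w′ → distribʳ _ _ _)) (∑-+ Z.V-finite) ⟩
          ∑ Z.V-finite (λ w′ → laplacian Z (λ _ → 1#) w w′ * g (j , u) w′) + ∑ Z.V-finite (λ w′ → 1# * g (j , u) w′)
            ≈⟨ +-cong (≈-trans (laplacian-apply (g (j , u)) w) (≈-trans (out-edges v (toℕ a) (g (j , u))) twisted)) constant ⟩
          z * laplacian X (λ e → ζ ^ (toℕ j ℕ.* α e)) v u + z * when (j Fin.≟ zero) (N · 1#)
            ≈⟨ distribˡ _ _ _ ⟨
          z * M j v u  ∎
          where
          w = vert v (toℕ a)
          z = ζ ^ (toℕ a ℕ.* toℕ j)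
          twisted : ∑ X.E-finite (λ e → when (X.o e X.Vᶠ.≟ v) (g (j , u) w - g (j , u) (vert (X.t e) (toℕ a ℕ.+ α e)))) ≈
                    z * laplacian X (λ e → ζ ^ (toℕ j ℕ.* α e)) v u
          twisted = ≈-trans (∑-cong X.E-finite (λ e → ≈-trans (when-cong (X.o e X.Vᶠ.≟ v) (λ _ → term e)) (≈-sym (*-when (X.o e X.Vᶠ.≟ v)))))
                            (≈-sym (*-∑ X.E-finite))
            where
            term : ∀ e → g (j , u) w - g (j , u) (vert (X.t e) (toℕ a ℕ.+ α e)) ≈
                         z * (δ (v X.Vᶠ.≟ u) - ζ ^ (toℕ j ℕ.* α e) * δ (X.t e X.Vᶠ.≟ u))
            term e = ≈-trans (+-cong (g-vert v (toℕ a) j u) (-‿cong (≈-trans (g-vert (X.t e) (toℕ a ℕ.+ α e) j u) (*-congˡ split))))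
              (solve 4 (λ x y z w → x :* z :- y :* (z :* w) := z :* (x :- w :* y)) ≈-refl _ _ _ _)
              where
              split : ζ ^ ((toℕ a ℕ.+ α e) ℕ.* toℕ j) ≈ z * ζ ^ (toℕ j ℕ.* α e)
              split = ≈-trans (reflexive (cong (ζ ^_) (trans (ℕ.*-distribʳ-+ (toℕ j) (toℕ a) (α e))
                        (cong (toℕ a ℕ.* toℕ j ℕ.+_) (ℕ.*-comm (α e) (toℕ j)))))) (^-homo-* ζ (toℕ a ℕ.* toℕ j) _)
          constant : ∑ Z.V-finite (λ w′ → 1# * g (j , u) w′) ≈ z * when (j Fin.≟ zero) (N · 1#)
          constant = begin
            ∑ Z.V-finite (λ w′ → 1# * g (j , u) w′)              ≈⟨ ≈-trans (∑-cong Z.V-finite (λ _ → *-identityˡ _)) (∑-↔ FI Z.V-finite φ _) ⟩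
            ∑ FI (λ k → g (j , u) (Inverse.to φ k))
              ≈⟨ ∑-cong FI (λ k → reflexive (cong (λ x → K x (j , u)) (Inverse.strictlyInverseʳ φ k))) ⟩
            ∑ FI (λ k → K k (j , u))                             ≈⟨ ∑-× (Fin-finite N) X.V-finite _ ⟩
            ∑ (Fin-finite N) (λ a → ∑ X.V-finite (λ v → δ (v X.Vᶠ.≟ u) * ζ ^ (toℕ a ℕ.* toℕ j)))
              ≈⟨ ∑-cong (Fin-finite N) (λ a → ≈-trans (∑-cong X.V-finite (λ v → δ-* (v X.Vᶠ.≟ u)))
                   (∑-unique X.V-finite (λ v → v X.Vᶠ.≟ u) u refl (λ _ eq → eq))) ⟩
            ∑ (Fin-finite N) (λ a → ζ ^ (toℕ a ℕ.* toℕ j))       ≈⟨ cases j ⟩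
            ζ ^ (toℕ a ℕ.* toℕ j) * when (j Fin.≟ zero) (N · 1#)  ∎
            where
            cases : ∀ j → ∑ (Fin-finite N) (λ a → ζ ^ (toℕ a ℕ.* toℕ j)) ≈ ζ ^ (toℕ a ℕ.* toℕ j) * when (j Fin.≟ zero) (N · 1#)
            cases zero    = ≈-trans (≈-trans (∑-cong (Fin-finite N) (λ a → reflexive (cong (ζ ^_) (ℕ.*-zeroʳ (toℕ a))))) (∑-const (Fin-finite N) 1#))
              (≈-sym (≈-trans (*-congʳ (reflexive (cong (ζ ^_) (ℕ.*-zeroʳ (toℕ a))))) (*-identityˡ _)))
            cases (suc j) = ≈-trans (vanish (suc (toℕ j)) (λ N∣j → ℕ.<⇒≱ (s≤s (Fin.toℕ<n j)) (ℕ.∣⇒≤ N∣j))) (≈-sym (zeroʳ _))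

        -- The conjugate Fourier matrix, with N - a as the natural number representing -a.
        K′ : I → I → Carrier
        K′ (i , u) (a , v) = δ (u X.Vᶠ.≟ v) * ζ ^ (toℕ i ℕ.* (N ℕ.∸ toℕ a))

        KK′ : ∀ x y → ∑ FI (λ k → K x k * K′ k y) ≈ when (Finite._≟_ FI x y) (N · 1#)
        KK′ (a , v) (a′ , v′) = begin
          ∑ FI (λ k → K (a , v) k * K′ k (a′ , v′))                                     ≈⟨ ∑-× (Fin-finite N) X.V-finite _ ⟩
          ∑ (Fin-finite N) (λ i → ∑ X.V-finite (λ u → K (a , v) (i , u) * K′ (i , u) (a′ , v′)))
            ≈⟨ ∑-cong (Fin-finite N) (λ i → ≈-trans (∑-cong X.V-finite (λ u → ≈-trans (*-assoc _ _ _) (δ-* (v X.Vᶠ.≟ u))))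
                 (≈-trans (∑-δ X.V-finite v (v X.Vᶠ.≟_)) (term i))) ⟩
          ∑ (Fin-finite N) (λ i → δ (v X.Vᶠ.≟ v′) * ζ ^ (toℕ i ℕ.* (toℕ a ℕ.+ (N ℕ.∸ toℕ a′))))  ≈⟨ *-∑ (Fin-finite N) ⟨
          δ (v X.Vᶠ.≟ v′) * ∑ (Fin-finite N) (λ i → ζ ^ (toℕ i ℕ.* (toℕ a ℕ.+ (N ℕ.∸ toℕ a′))))
            ≈⟨ *-congˡ (inner (a Fin.≟ a′)) ⟩
          δ (v X.Vᶠ.≟ v′) * when (a Fin.≟ a′) (N · 1#)
            ≈⟨ ≈-trans (δ-* (v X.Vᶠ.≟ v′)) (≈-sym (when-× (v X.Vᶠ.≟ v′) (a Fin.≟ a′))) ⟩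
          when ((v X.Vᶠ.≟ v′) ×-dec (a Fin.≟ a′)) (N · 1#)
            ≈⟨ when-⇔ ((v X.Vᶠ.≟ v′) ×-dec (a Fin.≟ a′)) (Finite._≟_ FI (a , v) (a′ , v′)) (λ { (refl , refl) → refl }) (λ { refl → refl , refl }) (λ _ → ≈-refl) ⟩
          when (Finite._≟_ FI (a , v) (a′ , v′)) (N · 1#)  ∎
          where
          term : ∀ i → ζ ^ (toℕ a ℕ.* toℕ i) * (δ (v X.Vᶠ.≟ v′) * ζ ^ (toℕ i ℕ.* (N ℕ.∸ toℕ a′))) ≈
                       δ (v X.Vᶠ.≟ v′) * ζ ^ (toℕ i ℕ.* (toℕ a ℕ.+ (N ℕ.∸ toℕ a′)))
          term i = ≈-trans (solve 3 (λ x y z → x :* (y :* z) := y :* (x :* z)) ≈-refl _ _ _) (*-congˡ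
            (≈-trans (≈-sym (^-homo-* ζ (toℕ a ℕ.* toℕ i) (toℕ i ℕ.* (N ℕ.∸ toℕ a′)))) (reflexive (cong (ζ ^_)
              (trans (cong (ℕ._+ toℕ i ℕ.* (N ℕ.∸ toℕ a′)) (ℕ.*-comm (toℕ a) (toℕ i))) (sym (ℕ.*-distribˡ-+ (toℕ i) (toℕ a) _)))))))
          inner : (d : Dec (a ≡ a′)) → ∑ (Fin-finite N) (λ i → ζ ^ (toℕ i ℕ.* (toℕ a ℕ.+ (N ℕ.∸ toℕ a′)))) ≈ when d (N · 1#)
          inner (yes refl) = ≈-trans (∑-cong (Fin-finite N) (λ i → ≈-trans
            (reflexive (cong (λ k → ζ ^ (toℕ i ℕ.* k)) (ℕ.m+[n∸m]≡n (ℕ.<⇒≤ (Fin.toℕ<n a))))) (ζ-multiple (toℕ i)))) (∑-const (Fin-finite N) 1#)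
          inner (no a≢a′) = vanish _ (λ N∣ → a≢a′ (Fin.toℕ-injective (congruent N∣)))
            where
            -- N divides a + (N - a′), and adding a′ shows a ≡ a′ modulo N.
            congruent : N ℕ.∣ toℕ a ℕ.+ (N ℕ.∸ toℕ a′) → toℕ a ≡ toℕ a′
            congruent N∣ = equal
              where
              sum≡ : (toℕ a ℕ.+ (N ℕ.∸ toℕ a′)) ℕ.+ toℕ a′ ≡ toℕ a ℕ.+ N
              sum≡ = trans (ℕ.+-assoc (toℕ a) _ _) (cong (toℕ a ℕ.+_) (ℕ.m∸n+n≡m (ℕ.<⇒≤ (Fin.toℕ<n a′))))
              equal : toℕ a ≡ toℕ a′
              equal = trans (sym (ℕ.m<n⇒m%n≡m (Fin.toℕ<n a))) (trans (sym (ℕ.[m+n]%n≡m%n (toℕ a) N)) (trans (cong (ℕ._% N) (sym sum≡))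
                (trans (ℕ.%-remove-+ˡ (toℕ a′) N∣) (ℕ.m<n⇒m%n≡m (Fin.toℕ<n a′)))))

        KD : ∀ x y → ∑ FI (λ k → K x k * D k y) ≈ ζ ^ (toℕ (proj₁ x) ℕ.* toℕ (proj₁ y)) * M (proj₁ y) (proj₂ x) (proj₂ y)
        KD (a , v) (j , u) = begin
          ∑ FI (λ k → K (a , v) k * D k (j , u))                                        ≈⟨ ∑-× (Fin-finite N) X.V-finite _ ⟩
          ∑ (Fin-finite N) (λ i → ∑ X.V-finite (λ x → K (a , v) (i , x) * when (i Fin.≟ j) (M i x u)))
            ≈⟨ ∑-cong (Fin-finite N) (λ i → ≈-trans (∑-cong X.V-finite (λ x → ≈-trans (*-assoc _ _ _) (δ-* (v X.Vᶠ.≟ x))))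
                 (≈-trans (∑-δ X.V-finite v (v X.Vᶠ.≟_)) (*-when (i Fin.≟ j)))) ⟩
          ∑ (Fin-finite N) (λ i → when (i Fin.≟ j) (ζ ^ (toℕ a ℕ.* toℕ i) * M i v u))
            ≈⟨ ∑-unique (Fin-finite N) (λ i → i Fin.≟ j) j refl (λ _ eq → eq) ⟩
          ζ ^ (toℕ a ℕ.* toℕ j) * M j v u  ∎

        N-cancellable : Cancellable (N · 1#)
        N-cancellable = torsionFree n

        -- AK = KD gives det A det K = det K det D; multiplying by det K′ turns det K into a power
        -- of N, which is cancelled.
        detA≈detD : det Z.V-finite A ≈ det FI D
        detA≈detD = cancellable-^ N-cancellable (Finite.size FI) (begin
          (N · 1#) ^ Finite.size FI * det Z.V-finite A   ≈⟨ *-congʳ detKK′ ⟨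
          (det FI K * det FI K′) * det Z.V-finite A
            ≈⟨ solve 3 (λ k k′ a → k :* k′ :* a := (a :* k) :* k′) ≈-refl _ _ _ ⟩
          (det Z.V-finite A * det FI K) * det FI K′      ≈⟨ *-congʳ (*-congʳ (≈-sym (det-↔ FI Z.V-finite φ A))) ⟩
          (det FI Aφ * det FI K) * det FI K′             ≈⟨ *-congʳ (det-* FI Aφ K) ⟨
          det FI (λ x y → ∑ FI (λ k → Aφ x k * K k y)) * det FI K′
            ≈⟨ *-congʳ (det-cong FI (λ x y → ≈-trans (column (proj₁ x) (proj₁ y) (proj₂ x) (proj₂ y)) (≈-sym (KD x y)))) ⟩
          det FI (λ x y → ∑ FI (λ k → K x k * D k y)) * det FI K′  ≈⟨ *-congʳ (det-* FI K D) ⟩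
          (det FI K * det FI D) * det FI K′
            ≈⟨ solve 3 (λ k k′ a → k :* a :* k′ := (k :* k′) :* a) ≈-refl _ _ _ ⟩
          (det FI K * det FI K′) * det FI D              ≈⟨ *-congʳ detKK′ ⟩
          (N · 1#) ^ Finite.size FI * det FI D           ∎)
          where
          Aφ = λ x y → A (Inverse.to φ x) (Inverse.to φ y)
          detKK′ : det FI K * det FI K′ ≈ (N · 1#) ^ Finite.size FI
          detKK′ = ≈-trans (≈-sym (det-* FI K K′)) (≈-trans (det-cong FI KK′) (det-scalar FI (Finite._≟_ FI) (N · 1#)))

        size-Z : Z.Vᶠ.size ≡ N ℕ.* X.Vᶠ.size
        size-Z = sym (Perm.↔⇒≡ (Z.Vᶠ.index ↔-∘ (φ ↔-∘ ↔-sym (Finite.index FI))))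

        size-X : ∃ λ m → X.Vᶠ.size ≡ suc m
        size-X = positive X.Vᶠ.size (X.Vᶠ.toFin v₀)
          where
          positive : ∀ k → Fin k → ∃ λ m → k ≡ suc m
          positive (suc m) _ = m , refl

      -- The matrix-tree theorem is used for `Z` with shift 1 and for `X` with shift N, the shift in
      -- the trivial block. The common factor N m², with m the number of vertices of `X`, is
      -- cancelled.
      κ-cover : suc n · 1# * (κ Z · 1#) ≈
                (κ X · 1#) * Π.sum {n} (λ i → det (Graph.V-finite X) (laplacian X (λ e → ζ ^ (suc (toℕ i) ℕ.* α e))))
      κ-cover = cancellable-* N-cancellable (cancellable-* m-cancellable m-cancellable) (begin
        (N · 1# * (m * m)) * (N · 1# * (κ Z · 1#))
          ≈⟨ solve 3 (λ n m k → (n :* (m :* m)) :* (n :* k) := (n :* m) :* (n :* m) :* k) ≈-refl _ _ _ ⟩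
        (N · 1# * m) * (N · 1# * m) * (κ Z · 1#)
          ≈⟨ *-congʳ (*-cong size′ size′) ⟨
        Z.Vᶠ.size · 1# * (Z.Vᶠ.size · 1#) * (κ Z · 1#)   ≈⟨ matrixTree Z (vert v₀ 0) 1# ⟨
        det Z.V-finite A                                 ≈⟨ detA≈detD ⟩
        det FI D                                         ≈⟨ det-blocks N X.V-finite M ⟩
        det X.V-finite (M zero) * Π.sum {n} (λ i → det X.V-finite (M (suc i)))
          ≈⟨ *-cong (≈-trans (det-cong X.V-finite (λ _ _ → ≈-refl)) (matrixTree X v₀ (N · 1#)))
                    (Π.sum-cong-≋ {n} (λ i → det-cong X.V-finite (λ _ _ → +-identityʳ _))) ⟩
        m * (X.Vᶠ.size · (N · 1#)) * (κ X · 1#) * P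
          ≈⟨ *-congʳ (*-congʳ (*-congˡ (≈-trans (×-congʳ X.Vᶠ.size (≈-sym (*-identityˡ _))) (≈-sym (×-assoc-* X.Vᶠ.size 1# _))))) ⟩
        m * (m * (N · 1#)) * (κ X · 1#) * P
          ≈⟨ solve 4 (λ m n k p → m :* (m :* n) :* k :* p := (n :* (m :* m)) :* (k :* p)) ≈-refl _ _ _ _ ⟩
        (N · 1# * (m * m)) * ((κ X · 1#) * P)            ∎)
        where
        m = X.Vᶠ.size · 1#
        P = Π.sum {n} (λ i → det X.V-finite (laplacian X (λ e → ζ ^ (suc (toℕ i) ℕ.* α e))))
        m-cancellable : Cancellable m
        m-cancellable = let k , eq = size-X in cancellable-cong (reflexive (cong (_· 1#) (sym eq))) (torsionFree k)
        size′ : Z.Vᶠ.size · 1# ≈ N · 1# * m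
        size′ = ≈-trans (reflexive (cong (_· 1#) size-Z)) (×1-homo-* N X.Vᶠ.size)

module _ (N : ℕ) .{{_ : ℕ.NonZero N}} where

  %⇒∣ : ∀ i j → i ℕ.% N ≡ j ℕ.% N → + N ℤ.∣ + i ℤ.- + j
  %⇒∣ i j eq = ℤ.divides (+ (i ℕ./ N) ℤ.- + (j ℕ./ N)) (begin
    + i ℤ.- + j                                      ≡⟨ cong₂ (λ x y → x ℤ.- y) (division i) (trans (division j) (cong (λ r → + r ℤ.+ b ℤ.* n) (sym eq))) ⟩
    (r ℤ.+ a ℤ.* n) ℤ.- (r ℤ.+ b ℤ.* n)              ≡⟨ identity r a b n ⟩
    (a ℤ.- b) ℤ.* n                                  ∎)
    where
    open ≡.≡-Reasoning
    r = + (i ℕ.% N)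
    a = + (i ℕ./ N)
    b = + (j ℕ./ N)
    n = + N
    division : ∀ k → + k ≡ + (k ℕ.% N) ℤ.+ + (k ℕ./ N) ℤ.* + N
    division k = trans (cong +_ (ℕ.m≡m%n+[m/n]*n k N)) (trans (ℤ.pos-+ (k ℕ.% N) _) (cong (λ x → + (k ℕ.% N) ℤ.+ x) (ℤ.pos-* (k ℕ./ N) N)))
    identity : ∀ r a b n → (r ℤ.+ a ℤ.* n) ℤ.- (r ℤ.+ b ℤ.* n) ≡ (a ℤ.- b) ℤ.* n
    identity = solve-∀

  ∣⇒% : ∀ i j → + N ℤ.∣ + i ℤ.- + j → i ℕ.% N ≡ j ℕ.% N
  ∣⇒% i j N∣ with ℕ.≤-total j i
  ... | inj₁ j≤i = reduce i j j≤i (subst (+ N ℤ.∣_) (trans (ℤ.m-n≡m⊖n i j) (ℤ.⊖-≥ j≤i)) N∣)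
    where
    reduce : ∀ i j → j ℕ.≤ i → + N ℤ.∣ + (i ℕ.∸ j) → i ℕ.% N ≡ j ℕ.% N
    reduce i j j≤i N∣ = trans (cong (ℕ._% N) (sym (ℕ.m+[n∸m]≡n j≤i))) (ℕ.%-remove-+ʳ j (ℤ.∣⇒∣ᵤ N∣))
  ... | inj₂ i≤j = sym (trans (cong (ℕ._% N) (sym (ℕ.m+[n∸m]≡n i≤j)))
    (ℕ.%-remove-+ʳ i (ℤ.∣⇒∣ᵤ (subst (+ N ℤ.∣_) (trans (neg (+ i) (+ j)) (trans (ℤ.m-n≡m⊖n j i) (ℤ.⊖-≥ i≤j))) (ℤ.∣m⇒∣-m N∣)))))
    where
    neg : ∀ a b → ℤ.- (a ℤ.- b) ≡ b ℤ.- a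
    neg = solve-∀

  %-*-cong : ∀ {i j} k → i ℕ.% N ≡ j ℕ.% N → (i ℕ.* k) ℕ.% N ≡ (j ℕ.* k) ℕ.% N
  %-*-cong {i} {j} k eq = trans (ℕ.%-distribˡ-* i k N)
    (trans (cong (λ r → (r ℕ.* (k ℕ.% N)) ℕ.% N) eq) (sym (ℕ.%-distribˡ-* j k N)))

-- Deck transformations and voltages

module Cover {Z X : Graph} {f : Hom Z X} (cover : IsCover f) where
  private
    module Z = Graph Z
    module X = Graph X
  open Hom f
  open IsCover cover

  edge-unique : ∀ {e e′} → Z.o e ≡ Z.o e′ → onE e ≡ onE e′ → e ≡ e′
  edge-unique {e} {e′} oe fe = cong proj₁ (proj₁ (local-bijection (Z.o e′)) {e , oe} {e′ , refl}
    (Σ-≡,≡→≡ (fe , X.Vᶠ.≡-irrelevant _ _)))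

  edge-lift : ∀ w e → onV w ≡ X.o e → ∃ λ e′ → Z.o e′ ≡ w × onE e′ ≡ e
  edge-lift w e eq = let (e′ , oe′) , h = proj₂ (local-bijection w) (e , sym eq)
                     in e′ , oe′ , cong proj₁ (h refl)

  module _ {W : Graph} (connected : Connected W) (h₁ h₂ : Hom W Z) (over : f ∘ₕ h₁ ≈ₕ f ∘ₕ h₂) where
    private
      module W = Graph W
      module h₁ = Hom h₁
      module h₂ = Hom h₂

      along : ∀ {v w} → Walk W U.U v w → h₁.onV v ≡ h₂.onV v → h₁.onV w ≡ h₂.onV w
      along ε                          eq = eq
      along ((e , _ , refl , refl) ◅ w) eq = along w
        (trans (h₁.t-hom e) (trans (cong Z.t (edge-unique (trans (sym (h₁.o-hom e)) (trans eq (h₂.o-hom e))) (_≈ₕ_.onE≡ over e)))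
          (sym (h₂.t-hom e))))

    -- Agreement at one vertex spreads along walks, since the lift of an edge is determined by its
    -- origin.
    lift-unique : ∀ {w₀} → h₁.onV w₀ ≡ h₂.onV w₀ → h₁ ≈ₕ h₂
    lift-unique {w₀} eq = mk≈ onV≡ (λ e → edge-unique
      (trans (sym (h₁.o-hom e)) (trans (onV≡ (W.o e)) (h₂.o-hom e))) (_≈ₕ_.onE≡ over e))
      where
      onV≡ : ∀ w → h₁.onV w ≡ h₂.onV w
      onV≡ w = along (proj₂ connected w₀ w) eq

module CyclicAction {Z X : Graph} {f : Hom Z X} (galois : IsGalois f) (N : ℕ) .{{nz : ℕ.NonZero N}}
                    (cyclic : AutGroup f ≅ (ℤ/ N)) where
  private
    module Z = Graph Z
    module X = Graph X
    module G = Group (AutGroup f)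
    module C = Group (ℤ/ N)
  open Hom f
  open IsGalois galois
  open Cover isCover
  open GroupMorphisms.IsGroupIsomorphism (proj₂ cyclic) using (injective; surjective; ⟦⟧-cong) renaming (∙-homo to homo)

  private
    log : Aut f → ℤ
    log = proj₁ cyclic

    exp : ℤ → Aut f
    exp z = proj₁ (surjective z)

    log-exp : ∀ z → log (exp z) C.≈ z
    log-exp z = proj₂ (surjective z) {exp z} (G.refl {exp z})

  act : ℕ → Z.V → Z.V
  act i = Hom.onV (Aut.σ (exp (+ i)))

  actE : ℕ → Z.E → Z.E
  actE i = Hom.onE (Aut.σ (exp (+ i)))

  private
    act-≈ : ∀ a i → log a C.≈ + i → ∀ w → Hom.onV (Aut.σ a) w ≡ act i w
    act-≈ a i eq = _≈ₕ_.onV≡ (injective {a} {exp (+ i)} (C.trans {log a} {+ i} {log (exp (+ i))} eq (C.sym {log (exp (+ i))} {+ i} (log-exp (+ i)))))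

  act-over : ∀ i w → onV (act i w) ≡ onV w
  act-over i = _≈ₕ_.onV≡ (Aut.over (exp (+ i)))

  actE-over : ∀ i e → onE (actE i e) ≡ onE e
  actE-over i = _≈ₕ_.onE≡ (Aut.over (exp (+ i)))

  act-o : ∀ i e → Z.o (actE i e) ≡ act i (Z.o e)
  act-o i e = sym (Hom.o-hom (Aut.σ (exp (+ i))) e)

  act-t : ∀ i e → Z.t (actE i e) ≡ act i (Z.t e)
  act-t i e = sym (Hom.t-hom (Aut.σ (exp (+ i))) e)

  act-periodic : ∀ {i j} → i ℕ.% N ≡ j ℕ.% N → ∀ w → act i w ≡ act j w
  act-periodic {i} {j} eq = act-≈ (exp (+ i)) j (C.trans {log (exp (+ i))} {+ i} {+ j} (log-exp (+ i)) (%⇒∣ N i j eq))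

  act-+ : ∀ i j w → act (i ℕ.+ j) w ≡ act i (act j w)
  act-+ i j w = sym (act-≈ (exp (+ i) G.∙ exp (+ j)) (i ℕ.+ j)
    (C.trans {log (exp (+ i) G.∙ exp (+ j))} {log (exp (+ i)) ℤ.+ log (exp (+ j))} {+ (i ℕ.+ j)} (homo (exp (+ i)) (exp (+ j)))
      (C.∙-cong {log (exp (+ i))} {+ i} {log (exp (+ j))} {+ j} (log-exp (+ i)) (log-exp (+ j)))) w)

  act-zero : ∀ w → act 0 w ≡ w
  act-zero w = sym (act-≈ G.ε 0 (GroupMorphisms.IsGroupIsomorphism.ε-homo (proj₂ cyclic)) w)

  -- A deck transformation is determined by one value, so equal values give the same group element,
  -- whose exponents are compared in ℤ/N.
  act-free : ∀ {i j w} → act i w ≡ act j w → i ℕ.% N ≡ j ℕ.% N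
  act-free {i} {j} {w} eq = ∣⇒% N i j (C.trans {+ i} {log (exp (+ i))} {+ j} (C.sym {log (exp (+ i))} {+ i} (log-exp (+ i)))
    (C.trans {log (exp (+ i))} {log (exp (+ j))} {+ j} (⟦⟧-cong {exp (+ i)} {exp (+ j)} same) (log-exp (+ j))))
    where
    σᵢ = Aut.σ (exp (+ i))
    σⱼ = Aut.σ (exp (+ j))
    same : σᵢ ≈ₕ σⱼ
    same = lift-unique connected σᵢ σⱼ
      (mk≈ (λ v → trans (act-over i v) (sym (act-over j v))) (λ e → trans (actE-over i e) (sym (actE-over j e)))) eq

  act-transitive : ∀ {w w′} → onV w ≡ onV w′ → ∃ λ i → act i w ≡ w′
  act-transitive {w} {w′} eq = let a , aw = transitive w w′ eq in
    log a ℤ.%ℕ N , trans (sym (act-≈ a _ (residue (log a)) w)) aw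
    where
    residue : ∀ z → z C.≈ + (z ℤ.%ℕ N)
    residue z = ℤ.divides (z ℤ./ℕ N) (trans (cong (ℤ._- + (z ℤ.%ℕ N)) (ℤ.a≡a%ℕn+[a/ℕn]*n z N)) (identity (+ (z ℤ.%ℕ N)) _))
      where
      identity : ∀ r x → (r ℤ.+ x) ℤ.- r ≡ x
      identity = solve-∀

module _ {Z X : Graph} {f : Hom Z X} (galois : IsGalois f) (N : ℕ) .{{nz : ℕ.NonZero N}}
         (cyclic : AutGroup f ≅ (ℤ/ N)) where
  private
    module Z = Graph Z
    module X = Graph X
    base : X.V → Z.V
    base v = proj₁ (IsCover.surjective (IsGalois.isCover galois) v)

    base-over : ∀ v → Hom.onV f (base v) ≡ v
    base-over v = proj₂ (IsCover.surjective (IsGalois.isCover galois) v)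
  open Hom f
  open Cover (IsGalois.isCover galois)
  open CyclicAction galois N cyclic

  private
    base-edge : ∀ e → ∃ λ e′ → Z.o e′ ≡ base (X.o e) × onE e′ ≡ e
    base-edge e = edge-lift (base (X.o e)) e (base-over (X.o e))

    target : ∀ e → ∃ λ i → act i (base (X.t e)) ≡ Z.t (proj₁ (base-edge e))
    target e = let e′ , oe′ , fe′ = base-edge e in
      act-transitive (trans (base-over (X.t e)) (trans (cong X.t (sym fe′)) (sym (t-hom e′))))

  -- The endpoint of the lift of `e` that starts at the base vertex, measured from the base vertex
  -- over the target. A natural number is kept rather than a residue class, so that one assignment
  -- can describe covers of different degrees.
  voltage : X.E → ℕ
  voltage e = proj₁ (target e)

  presentation : CyclicPresentation f N voltage
  presentation = record
    { vert      = λ v i → act i (base v)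
    ; over      = λ v i → trans (act-over i (base v)) (base-over v)
    ; onto      = λ w → act-transitive (base-over (onV w))
    ; periodic  = λ v eq → act-periodic eq (base v)
    ; separated = λ v → act-free
    ; lift      = λ e i → let e′ , oe′ , fe′ = base-edge e in
        actE i e′ , trans (actE-over i e′) fe′ , trans (act-o i e′) (cong (act i) oe′) ,
        trans (act-t i e′) (trans (cong (act i) (sym (proj₂ (target e)))) (sym (act-+ i (voltage e) _)))
    ; unique    = edge-unique
    }

module _ {Z W X : Graph} {q : Hom W X} {g : Hom Z W} (galois : IsGalois (q ∘ₕ g)) (N : ℕ) .{{nz : ℕ.NonZero N}}
         (cyclic : AutGroup (q ∘ₕ g) ≅ (ℤ/ N))
         (coverg : IsCover g) (galois′ : IsGalois q) (N′ : ℕ) .{{nz′ : ℕ.NonZero N′}} (cyclic′ : AutGroup q ≅ (ℤ/ N′)) where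
  private
    module Z = Graph Z
    module W = Graph W
    module X = Graph X
    module q = Hom q
    module g = Hom g
    module A = CyclicAction galois N cyclic
    module A′ = CyclicAction galois′ N′ cyclic′
    open CyclicPresentation (presentation galois N cyclic)
    open Cover (IsGalois.isCover galois′)
    w₀ : Z.V
    w₀ = proj₁ (IsGalois.connected galois)

    -- The generator of the upper deck group acts on `W` as some exponent c. It need not be 1, as
    -- the isomorphisms with ℤ/N and ℤ/N′ are chosen independently.
    generator : ∃ λ c → A′.act c (g.onV w₀) ≡ g.onV (A.act 1 w₀)
    generator = A′.act-transitive (sym (A.act-over 1 w₀))

    c : ℕ
    c = proj₁ generator

    equivariant₁ : ∀ w → A′.act c (g.onV w) ≡ g.onV (A.act 1 w)
    equivariant₁ = _≈ₕ_.onV≡ (lift-unique (IsGalois.connected galois) (Aut.σ (proj₁ (surj′ (+ c))) ∘ₕ g) (g ∘ₕ Aut.σ (proj₁ (surj (+ 1))))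
      (mk≈ (λ w → trans (A′.act-over c (g.onV w)) (sym (A.act-over 1 w)))
           (λ e → trans (A′.actE-over c (g.onE e)) (sym (A.actE-over 1 e)))) (proj₂ generator))
      where
      surj = GroupMorphisms.IsGroupIsomorphism.surjective (proj₂ cyclic)
      surj′ = GroupMorphisms.IsGroupIsomorphism.surjective (proj₂ cyclic′)

    equivariant : ∀ i w → A′.act (i ℕ.* c) (g.onV w) ≡ g.onV (A.act i w)
    equivariant zero    w = trans (A′.act-zero (g.onV w)) (cong g.onV (sym (A.act-zero w)))
    equivariant (suc i) w = begin
      A′.act (c ℕ.+ i ℕ.* c) (g.onV w)          ≡⟨ A′.act-+ c (i ℕ.* c) (g.onV w) ⟩
      A′.act c (A′.act (i ℕ.* c) (g.onV w))     ≡⟨ cong (A′.act c) (equivariant i w) ⟩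
      A′.act c (g.onV (A.act i w))              ≡⟨ equivariant₁ (A.act i w) ⟩
      g.onV (A.act 1 (A.act i w))               ≡⟨ cong g.onV (A.act-+ 1 i w) ⟨
      g.onV (A.act (suc i) w)                   ∎
      where open ≡.≡-Reasoning

    -- Since `g` is onto, the image of `w₀` under the generator below lifts to `Z`, and transitivity
    -- upstairs reaches this lift by some k-th power. Hence c is invertible modulo N′.
    c-unit : ∃ λ k → (k ℕ.* c) ℕ.% N′ ≡ 1 ℕ.% N′
    c-unit = let w , gw = IsCover.surjective coverg (A′.act 1 (g.onV w₀))
                 k , eq = A.act-transitive {w₀} {w} (trans (sym (A′.act-over 1 (g.onV w₀))) (cong q.onV (sym gw)))
             in k , A′.act-free (trans (equivariant k w₀) (trans (cong g.onV eq) gw))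

    separated′ : ∀ {i j} → (i ℕ.* c) ℕ.% N′ ≡ (j ℕ.* c) ℕ.% N′ → i ℕ.% N′ ≡ j ℕ.% N′
    separated′ {i} {j} eq = trans (sym (back i)) (trans (%-*-cong N′ k eq) (back j))
      where
      k = proj₁ c-unit
      back : ∀ i → (i ℕ.* c ℕ.* k) ℕ.% N′ ≡ i ℕ.% N′
      back i = begin
        (i ℕ.* c ℕ.* k) ℕ.% N′         ≡⟨ cong (ℕ._% N′) (trans (ℕ.*-assoc i c k) (trans (ℕ.*-comm i _) (cong (ℕ._* i) (ℕ.*-comm c k)))) ⟩
        (k ℕ.* c ℕ.* i) ℕ.% N′         ≡⟨ %-*-cong N′ i (proj₂ c-unit) ⟩
        (1 ℕ.* i) ℕ.% N′               ≡⟨ cong (ℕ._% N′) (ℕ.*-identityˡ i) ⟩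
        i ℕ.% N′                       ∎
        where open ≡.≡-Reasoning

  -- The presentation of `Z` pushed forward along `g`. The index i acts on `W` as i c with c a unit,
  -- so it still separates vertices modulo N′. Thus consecutive levels of the tower share one
  -- voltage assignment.
  presentation-below : CyclicPresentation q N′ (voltage galois N cyclic)
  presentation-below = record
    { vert      = λ v i → g.onV (vert v i)
    ; over      = over
    ; onto      = λ u → let w , gw = IsCover.surjective coverg u ; i , eq = onto w in
        i , trans (cong (λ v → g.onV (vert v i)) (sym (cong q.onV gw))) (trans (cong g.onV eq) gw)
    ; periodic  = λ v {i} {j} eq → trans (sym (equivariant i _)) (trans (A′.act-periodic (%-*-cong N′ c eq) _) (equivariant j _))
    ; separated = λ v {i} {j} eq → separated′ (A′.act-free (trans (equivariant i _) (trans eq (sym (equivariant j _)))))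
    ; lift      = λ e i → let e′ , fe′ , oe′ , te′ = lift e i in
        g.onE e′ , fe′ , trans (sym (g.o-hom e′)) (cong g.onV oe′) , trans (sym (g.t-hom e′)) (cong g.onV te′)
    ; unique    = edge-unique
    }

module _ {Y X Z : Graph} (p : Hom Y X) {q : Hom Z X} {N : ℕ} .{{nz : ℕ.NonZero N}} {α : Graph.E X → ℕ}
         (pres : CyclicPresentation q N α) where
  private
    module Y = Graph Y
    module X = Graph X
    module Z = Graph Z
    module P = Graph (pullback p q)
    module p = Hom p
    module q = Hom q
    open CyclicPresentation pres

    V-≡ : {a b : P.V} → proj₁ a ≡ proj₁ b → a ≡ b
    V-≡ eq = Σ-≡,≡→≡ (eq , X.Vᶠ.≡-irrelevant _ _)

    E-≡ : {a b : P.E} → proj₁ a ≡ proj₁ b → a ≡ b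
    E-≡ eq = Σ-≡,≡→≡ (eq , X.Eᶠ.≡-irrelevant _ _)

  presentation-pullback : CyclicPresentation (pullback-proj₁ p q) N (α ∘ p.onE)
  presentation-pullback = record
    { vert      = λ y i → (y , vert (p.onV y) i) , sym (over (p.onV y) i)
    ; over      = λ _ _ → refl
    ; onto      = λ { ((y , z) , eq) → let i , vi = onto z in i , V-≡ (cong (y ,_) (trans (cong (λ v → vert v i) eq) vi)) }
    ; periodic  = λ y eq → V-≡ (cong (y ,_) (periodic (p.onV y) eq))
    ; separated = λ y eq → separated (p.onV y) (cong (proj₂ ∘ proj₁) eq)
    ; lift      = λ e i → let e′ , qe′ , oe′ , te′ = lift (p.onE e) i in
        ((e , e′) , sym qe′) , refl ,
        V-≡ (cong (Y.o e ,_) (trans oe′ (cong (λ v → vert v i) (sym (p.o-hom e))))) ,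
        V-≡ (cong (Y.t e ,_) (trans te′ (cong (λ v → vert v (i ℕ.+ α (p.onE e))) (sym (p.t-hom e)))))
    ; unique    = λ { {(e₁ , e₂) , eq} {(e₁′ , e₂′) , eq′} oe fe → E-≡ (cong₂ _,_ fe
        (unique (cong (proj₂ ∘ proj₁) oe) (trans (sym eq) (trans (cong p.onE fe) eq′)))) }
    }

-- Group determinants of ℓ-groups in characteristic ℓ

prime-power-divisor : ∀ {ℓ} → Prime ℓ → ∀ k m n → m ℕ.* n ≡ ℓ ℕ.^ k → m ≡ 1 ⊎ ℓ ℕ.∣ m
prime-power-divisor isPrime zero m n eq = inj₁ (ℕ.m*n≡1⇒m≡1 m n eq)
prime-power-divisor {ℓ} isPrime (suc k) m n eq
  with euclidsLemma m n isPrime (ℕ.divides (ℓ ℕ.^ k) (trans eq (ℕ.*-comm ℓ _)))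
... | inj₁ ℓ∣m = inj₂ ℓ∣m
... | inj₂ (ℕ.divides s refl) = prime-power-divisor isPrime k m s
  (ℕ.*-cancelʳ-≡ _ _ ℓ {{prime⇒nonZero isPrime}} (trans (ℕ.*-assoc m s ℓ) (trans eq (ℕ.*-comm ℓ _))))

module ℕ-Sum where
  open FiniteSum ℕ.+-0-commutativeMonoid public
  import Algebra.Properties.Semiring.Sum ℕ.+-*-semiring as ℕS

  opaque
    unfolding ∑

    ∑-*ʳ : {A : Set} (FA : Finite A) (f : A → ℕ) (x : ℕ) → ∑ FA f ℕ.* x ≡ ∑ FA (λ a → f a ℕ.* x)
    ∑-*ʳ FA f x = ℕS.*-distribʳ-sum {Finite.size FA} x _

    ∑-count : ∀ n → ∑ (Fin-finite n) (λ _ → 1) ≡ n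
    ∑-count zero    = refl
    ∑-count (suc n) = cong suc (∑-count n)

    ≤-∑ : {A : Set} (FA : Finite A) (f : A → ℕ) (a : A) → f a ℕ.≤ ∑ FA f
    ≤-∑ FA f a = subst (λ b → f b ℕ.≤ ∑ FA f) (Finite.fromFin-toFin FA a) (go (f ∘ Finite.fromFin FA) (Finite.toFin FA a))
      where
      go : ∀ {n} (g : Fin n → ℕ) i → g i ℕ.≤ sum g
      go g zero    = ℕ.m≤m+n _ _
      go g (suc i) = ℕ.≤-trans (go (g ∘ suc) i) (ℕ.m≤n+m _ (g zero))

record FiniteGroup (q : ℕ) : Set where
  infixl 7 _∙_
  field
    _∙_     : Fin q → Fin q → Fin q
    e       : Fin q
    _⁻¹     : Fin q → Fin q
    isGroup : IsGroup _≡_ _∙_ e _⁻¹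

  open IsGroup isGroup public using (assoc; identityˡ; identityʳ; inverseˡ; inverseʳ)

  left : Fin q → Fin q ↔ Fin q
  left g = mk↔ₛ′ (g ∙_) (g ⁻¹ ∙_)
    (λ h → trans (sym (assoc g (g ⁻¹) h)) (trans (cong (_∙ h) (inverseʳ g)) (identityˡ h)))
    (λ h → trans (sym (assoc (g ⁻¹) g h)) (trans (cong (_∙ h) (inverseˡ g)) (identityˡ h)))

  ⁻¹-anti : ∀ g h → (g ∙ h) ⁻¹ ≡ h ⁻¹ ∙ g ⁻¹
  ⁻¹-anti = ⁻¹-anti-homo-∙
    where
    group : Group 0ℓ 0ℓ
    group = record { isGroup = isGroup }
    open import Algebra.Properties.Group group using (⁻¹-anti-homo-∙)

-- In characteristic ℓ an invariant function sums to its sum over the fixed points, since all other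
-- orbits of an ℓ-group have size divisible by ℓ.
module Orbits {ℓ k} (isPrime : Prime ℓ) (G : FiniteGroup (ℓ ℕ.^ k)) {A : Set} (FA : Finite A)
              (act : Fin (ℓ ℕ.^ k) → A → A) (act-e : ∀ a → act (FiniteGroup.e G) a ≡ a)
              (act-∙ : ∀ g h a → act (FiniteGroup._∙_ G g h) a ≡ act g (act h a)) where
  open FiniteGroup G
  private
    module FA = Finite FA
    q = ℓ ℕ.^ k

  Fixed : A → Set
  Fixed a = ∀ g → act g a ≡ a

  fixed? : ∀ a → Dec (Fixed a)
  fixed? a = Fin.all? (λ g → act g a FA.≟ a)

  private
    Orbit : A → A → Set
    Orbit a b = ∃ λ g → act g a ≡ b

    orbit? : ∀ a b → Dec (Orbit a b)
    orbit? a b = Fin.any? (λ g → act g a FA.≟ b)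

    act-inverse : ∀ g {a b} → act g a ≡ b → act (g ⁻¹) b ≡ a
    act-inverse g {a} refl = trans (sym (act-∙ (g ⁻¹) g a)) (trans (cong (λ h → act h a) (inverseˡ g)) (act-e a))

    Index : A → ℕ → Set
    Index a i = ∃ λ g → toℕ (FA.toFin (act g a)) ≡ i

    least-index : ∀ a → ∃ λ i → Index a i × (∀ j → Index a j → i ℕ.≤ j)
    least-index a = least (λ i → Fin.any? (λ g → toℕ (FA.toFin (act g a)) ℕ.≟ i)) _ (e , refl)

    rep : A → A
    rep a = act (proj₁ (proj₁ (proj₂ (least-index a)))) a

    rep-orbit : ∀ a → Orbit a (rep a)
    rep-orbit a = _ , refl

    rep-≤ : ∀ {a b} → Orbit a b → toℕ (FA.toFin (rep a)) ℕ.≤ toℕ (FA.toFin (rep b))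
    rep-≤ {a} (g , refl) = subst (ℕ._≤ toℕ (FA.toFin (rep (act g a)))) (sym (proj₂ (proj₁ (proj₂ (least-index a)))))
      (proj₂ (proj₂ (least-index a)) _ (h ∙ g , cong (toℕ ∘ FA.toFin) (act-∙ h g a)))
      where h = proj₁ (proj₁ (proj₂ (least-index (act g a))))

    rep-≡ : ∀ {a b} → Orbit a b → rep a ≡ rep b
    rep-≡ o@(g , eq) = FA.toFin-injective (Fin.toℕ-injective (ℕ.≤-antisym (rep-≤ o) (rep-≤ (g ⁻¹ , act-inverse g eq))))

    open ℕ-Sum using (∑; when; ∑-cong; ∑-swap; ∑-unique; when-⇔; when-yes; when-no; ∑-*ʳ; ∑-count; ≤-∑; ∑-↔; ∑-0)

    orbit-size stabiliser : A → ℕ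
    orbit-size a = ∑ FA (λ b → when (orbit? a b) 1)
    stabiliser a = ∑ (Fin-finite q) (λ g → when (act g a FA.≟ a) 1)

    -- Counting the pairs (b, g) with g a = b: for each b in the orbit the admissible g form a coset
    -- of the stabiliser.
    orbit-stabiliser : ∀ a → orbit-size a ℕ.* stabiliser a ≡ q
    orbit-stabiliser a = begin
      orbit-size a ℕ.* stabiliser a                            ≡⟨ ∑-*ʳ FA _ _ ⟩
      ∑ FA (λ b → when (orbit? a b) 1 ℕ.* stabiliser a)        ≡⟨ ∑-cong FA (λ b → fibre b (orbit? a b)) ⟩
      ∑ FA (λ b → ∑ (Fin-finite q) (λ g → when (act g a FA.≟ b) 1))  ≡⟨ ∑-swap FA (Fin-finite q) ⟩
      ∑ (Fin-finite q) (λ g → ∑ FA (λ b → when (act g a FA.≟ b) 1))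
        ≡⟨ ∑-cong (Fin-finite q) (λ g → ∑-unique FA (λ b → act g a FA.≟ b) (act g a) refl (λ _ → sym)) ⟩
      ∑ (Fin-finite q) (λ _ → 1)                               ≡⟨ ∑-count q ⟩
      q                                                        ∎
      where
      open ≡.≡-Reasoning
      fibre : ∀ b (d : Dec (Orbit a b)) → when d 1 ℕ.* stabiliser a ≡ ∑ (Fin-finite q) (λ g → when (act g a FA.≟ b) 1)
      fibre b (no ¬o) = sym (∑-0 (Fin-finite q) (λ g → when-no (act g a FA.≟ b) (λ eq → ¬o (g , eq))))
      fibre b (yes (h , refl)) = trans (ℕ.*-identityˡ _) (sym (trans
        (∑-↔ (Fin-finite q) (Fin-finite q) (left h) _)
        (∑-cong (Fin-finite q) (λ g → when-⇔ (act (h ∙ g) a FA.≟ act h a) (act g a FA.≟ a)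
          (λ eq → trans (sym (act-inverse h (sym (act-∙ h g a)))) (trans (cong (act (h ⁻¹)) eq) (act-inverse h refl)))
          (λ eq → trans (act-∙ h g a) (cong (act h) eq)) (λ _ → refl)))))

    orbit-size-1 : ∀ a → orbit-size a ≡ 1 → Fixed a
    orbit-size-1 a eq g with act g a FA.≟ a
    ... | yes p = p
    ... | no ne = contradiction two (λ le → ℕ.<-irrefl (sym eq) le)
      where
      open ≡.≡-Reasoning
      others = λ b → when (orbit? a b ×-dec ¬? (b FA.≟ a)) 1
      split : ∀ b → when (orbit? a b) 1 ≡ when (b FA.≟ a) 1 ℕ.+ others b
      split b with b FA.≟ a
      ... | yes refl = trans (when-yes (orbit? a b) (e , act-e a)) (cong suc (sym (when-no (orbit? a b ×-dec no _) (λ { (_ , f) → f refl }))))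
      ... | no b≢a   = when-⇔ (orbit? a b) (orbit? a b ×-dec yes b≢a) (λ o → o , b≢a) proj₁ (λ _ → refl)
      size : orbit-size a ≡ suc (∑ FA others)
      size = trans (∑-cong FA split) (trans (ℕ-Sum.∑-+ FA) (cong (ℕ._+ ∑ FA others) (∑-unique FA (FA._≟ a) a refl (λ _ eq → eq))))
      two : 2 ℕ.≤ orbit-size a
      two = subst (2 ℕ.≤_) (sym size) (s≤s (ℕ.≤-trans
        (ℕ.≤-reflexive (sym (when-yes (orbit? a (act g a) ×-dec ¬? (act g a FA.≟ a)) ((g , refl) , ne))))
        (≤-∑ FA others (act g a))))

    orbit-size-fixed : ∀ a → Fixed a → orbit-size a ≡ 1
    orbit-size-fixed a fix = ∑-unique FA (orbit? a) a (e , act-e a) (λ b (g , eq) → trans (sym eq) (fix g))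

  module _ (R : CommutativeRing 0ℓ 0ℓ) where
    private
      module R = CommutativeRing R
      module S = Summation R
      open S using (_·_)
      open import Relation.Binary.Reasoning.Setoid R.setoid

      opaque
        unfolding ∑

        ∑-·1 : (f : A → ℕ) → ∑ FA f · R.1# R.≈ S.∑ FA (λ a → f a · R.1#)
        ∑-·1 f = go (f ∘ FA.fromFin)
          where
          go : ∀ {n} (g : Fin n → ℕ) → ℕ-Sum.sum g · R.1# R.≈ S.sum (λ i → g i · R.1#)
          go {zero}  g = R.refl
          go {suc n} g = R.trans (S.×-homo-+ R.1# (g zero) _) (R.+-congˡ (go (g ∘ suc)))

    ∑-fixed : ℓ · R.1# R.≈ R.0# → (w : A → R.Carrier) → (∀ g a → w (act g a) R.≈ w a) →
              S.∑ FA w R.≈ S.∑ FA (λ a → S.when (fixed? a) (w a))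
    ∑-fixed char w inv = begin
      S.∑ FA w
        ≈⟨ S.∑-cong FA (λ a → R.sym (S.∑-δ FA (rep a) (rep a FA.≟_))) ⟩
      S.∑ FA (λ a → S.∑ FA (λ r → S.when (rep a FA.≟ r) (w a)))   ≈⟨ S.∑-swap FA FA ⟩
      S.∑ FA (λ r → S.∑ FA (λ a → S.when (rep a FA.≟ r) (w a)))   ≈⟨ S.∑-cong FA class ⟩
      S.∑ FA (λ r → S.when (fixed? r) (w r))                      ∎
      where
      class : ∀ r → S.∑ FA (λ a → S.when (rep a FA.≟ r) (w a)) R.≈ S.when (fixed? r) (w r)
      class r with rep r FA.≟ r
      ... | no ne = R.trans
        (S.∑-0 FA (λ a → S.when-no (rep a FA.≟ r) (λ { refl → ne (sym (rep-≡ (rep-orbit a))) })))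
        (R.sym (S.when-no (fixed? r) (λ fix → ne (fix _))))
      ... | yes eq = begin
        S.∑ FA (λ a → S.when (rep a FA.≟ r) (w a))
          ≈⟨ S.∑-cong FA (λ a → S.when-⇔ (rep a FA.≟ r) (orbit? r a)
               (λ eq′ → let g , ga = rep-orbit a in g ⁻¹ , act-inverse g (trans ga eq′))
               (λ o → trans (sym (rep-≡ o)) eq)
               (λ eq′ → let g , ga = rep-orbit a in R.trans (R.sym (inv g a)) (R.reflexive (cong w (trans ga eq′))))) ⟩
        S.∑ FA (λ a → S.when (orbit? r a) (w r))
          ≈⟨ S.∑-cong FA (λ a → R.trans (R.sym (S.δ-* (orbit? r a))) (R.*-congʳ (indicator (orbit? r a)))) ⟩
        S.∑ FA (λ a → when (orbit? r a) 1 · R.1# R.* w r)         ≈⟨ S.∑-* FA ⟨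
        S.∑ FA (λ a → when (orbit? r a) 1 · R.1#) R.* w r         ≈⟨ R.*-congʳ (∑-·1 _) ⟨
        orbit-size r · R.1# R.* w r                               ≈⟨ size (fixed? r) ⟩
        S.when (fixed? r) (w r)                                   ∎
        where
        indicator : {P : Set} (d : Dec P) → S.δ d R.≈ when d 1 · R.1#
        indicator (yes _) = R.sym (R.+-identityʳ _)
        indicator (no _)  = R.refl
        size : (d : Dec (Fixed r)) → orbit-size r · R.1# R.* w r R.≈ S.when d (w r)
        size (yes fix) = R.trans (R.*-congʳ (R.trans (R.reflexive (cong (_· R.1#) (orbit-size-fixed r fix))) (R.+-identityʳ _))) (R.*-identityˡ _)
        size (no ¬fix) with prime-power-divisor isPrime k (orbit-size r) (stabiliser r) (orbit-stabiliser r)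
        ... | inj₁ one = contradiction (orbit-size-1 r one) ¬fix
        ... | inj₂ (ℕ.divides c eq) = R.trans (R.*-congʳ (begin
          orbit-size r · R.1#           ≡⟨ cong (_· R.1#) eq ⟩
          (c ℕ.* ℓ) · R.1#              ≈⟨ S.×1-homo-* c ℓ ⟩
          c · R.1# R.* (ℓ · R.1#)       ≈⟨ R.*-congˡ char ⟩
          c · R.1# R.* R.0#             ≈⟨ R.zeroʳ _ ⟩
          R.0#                          ∎)) (R.zeroˡ _)

module Translation {ℓ k} (isPrime : Prime ℓ) (G : FiniteGroup (ℓ ℕ.^ k)) (R : CommutativeRing 0ℓ 0ℓ)
                   (char : CommutativeRing._≈_ R (IntegerCoefficients._·_ R ℓ (CommutativeRing.1# R)) (CommutativeRing.0# R)) where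
  open CommutativeRing R hiding (zero) renaming (refl to ≈-refl; sym to ≈-sym; trans to ≈-trans)
  open Summation R
  open Determinant R
  open FiniteGroup G renaming (assoc to ∙-assoc; identityˡ to ∙-identityˡ; identityʳ to ∙-identityʳ;
                               inverseˡ to ∙-inverseˡ; inverseʳ to ∙-inverseʳ)
  open import Algebra.Properties.CommutativeSemiring.Exp commutativeSemiring using (_^_; ^-distrib-*; ^-congˡ)
  open import Algebra.Properties.Ring ring using (-‿distribˡ-*; +-inverseˡ-unique)
  open import Relation.Binary.Reasoning.Setoid setoid

  q : ℕ
  q = ℓ ℕ.^ k

  translate : {D : Set} → Fin q → Vec D q → Vec D q
  translate h Φ = tabulate (λ g → lookup Φ (h ⁻¹ ∙ g))

  -- The vectors are functions on the group, and the fixed points of left translation are the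
  -- constant functions.
  ∑-translation-invariant : {D : Set} (FD : Finite D) (w : Vec D q → Carrier) → (∀ h Φ → w (translate h Φ) ≈ w Φ) →
                            ∑ (Vec-finite FD q) w ≈ ∑ FD (λ d → w (Vec.replicate q d))
  ∑-translation-invariant {D} FD w inv = begin
    ∑ (Vec-finite FD q) w                                   ≈⟨ ∑-fixed R char w inv ⟩
    ∑ (Vec-finite FD q) (λ Φ → when (fixed? Φ) (w Φ))
      ≈⟨ ∑-bij (Vec-finite FD q) FD fixed? (λ _ → yes tt) (λ Φ d → Finite._≟_ (Vec-finite FD q) Φ (Vec.replicate q d))
           (λ { {Φ} {d} refl → (λ h → Vec-ext (λ g → trans (Vec.lookup∘tabulate _ g) (trans (Vec.lookup-replicate (h ⁻¹ ∙ g) d) (sym (Vec.lookup-replicate g d))))) , tt , ≈-refl })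
           (λ Φ fix → lookup Φ e , Vec-ext (constant Φ fix) , λ d eq → sym (trans (cong (λ v → lookup v e) eq) (Vec.lookup-replicate e d)))
           (λ d _ → Vec.replicate q d , refl , λ _ eq → eq) ⟩
    ∑ FD (λ d → w (Vec.replicate q d))                      ∎
    where
    e⁻¹ : e ⁻¹ ≡ e
    e⁻¹ = trans (sym (∙-identityʳ (e ⁻¹))) (∙-inverseˡ e)
    open Orbits {ℓ} {k} isPrime G (Vec-finite FD q) translate
      (λ Φ → Vec-ext (λ g → trans (Vec.lookup∘tabulate _ g) (cong (lookup Φ) (trans (cong (_∙ g) e⁻¹) (∙-identityˡ g)))))
      (λ g h Φ → Vec-ext (λ x → trans (Vec.lookup∘tabulate _ x) (sym (trans (Vec.lookup∘tabulate _ x) (trans (Vec.lookup∘tabulate _ (g ⁻¹ ∙ x))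
        (cong (lookup Φ) (trans (sym (∙-assoc (h ⁻¹) (g ⁻¹) x)) (cong (_∙ x) (sym (⁻¹-anti g h))))))))))
    constant : ∀ Φ → Fixed Φ → ∀ g → lookup Φ g ≡ lookup (Vec.replicate q (lookup Φ e)) g
    constant Φ fix g = trans (sym (cong (λ v → lookup v g) (fix g))) (trans (Vec.lookup∘tabulate _ g)
      (trans (cong (lookup Φ) (∙-inverseˡ g)) (sym (Vec.lookup-replicate g (lookup Φ e)))))

  Π-∑ : ∀ {D : Set} (FD : Finite D) n (f : D → Carrier) →
        (∑ FD f) ^ n ≈ ∑ (Vec-finite FD n) (λ v → Π.sum (λ i → f (lookup v i)))
  Π-∑ FD zero    f = ≈-sym (∑-[] +-commutativeMonoid FD _)
  Π-∑ FD (suc n) f = begin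
    ∑ FD f * (∑ FD f) ^ n                                                   ≈⟨ *-congˡ (Π-∑ FD n f) ⟩
    ∑ FD f * ∑ (Vec-finite FD n) (λ v → Π.sum (λ i → f (lookup v i)))       ≈⟨ ∑-* FD ⟩
    ∑ FD (λ a → f a * ∑ (Vec-finite FD n) (λ v → Π.sum (λ i → f (lookup v i))))
      ≈⟨ ∑-cong FD (λ a → *-∑ (Vec-finite FD n)) ⟩
    ∑ FD (λ a → ∑ (Vec-finite FD n) (λ v → f a * Π.sum (λ i → f (lookup v i))))  ≈⟨ ∑-∷ +-commutativeMonoid FD n _ ⟨
    ∑ (Vec-finite FD (suc n)) (λ v → Π.sum (λ i → f (lookup v i)))          ∎

  -- The q-th power expands over all functions from the group to `D`. Each product is unchanged by
  -- translating its function, so only the constant functions contribute.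
  frobenius-∑ : {D : Set} (FD : Finite D) (f : D → Carrier) → (∑ FD f) ^ q ≈ ∑ FD (λ d → f d ^ q)
  frobenius-∑ FD f = begin
    (∑ FD f) ^ q                                                      ≈⟨ Π-∑ FD q f ⟩
    ∑ (Vec-finite FD q) (λ v → Π.sum (λ i → f (lookup v i)))
      ≈⟨ ∑-translation-invariant FD _ (λ h Φ → ≈-trans
           (Π.sum-cong-≋ {q} (λ g → reflexive (cong f (Vec.lookup∘tabulate _ g))))
           (≈-sym (Π.sum-permute (λ g → f (lookup Φ g)) (left (h ⁻¹))))) ⟩
    ∑ FD (λ d → Π.sum (λ i → f (lookup (Vec.replicate q d) i)))
      ≈⟨ ∑-cong FD (λ d → ≈-trans (Π.sum-cong-≋ {q} (λ i → reflexive (cong f (Vec.lookup-replicate i d)))) (Π.sum-replicate q)) ⟩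
    ∑ FD (λ d → f d ^ q)                                              ∎

  0^q : 0# ^ q ≈ 0#
  0^q = nonempty q e
    where
    nonempty : ∀ n → Fin n → 0# ^ n ≈ 0#
    nonempty (suc n) _ = zeroˡ _

  1^ : ∀ n → 1# ^ n ≈ 1#
  1^ zero    = ≈-refl
  1^ (suc n) = ≈-trans (*-identityˡ _) (1^ n)

  frobenius : IsHom R R (_^ q)
  frobenius = record
    { +-homo = +-homo
    ; *-homo = λ x y → ^-distrib-* x y q
    ; -‿homo = λ x → +-inverseˡ-unique _ _ (≈-trans (≈-sym (+-homo (- x) x)) (≈-trans (^-congˡ q (-‿inverseˡ x)) 0^q))
    ; 0-homo = 0^q
    ; 1-homo = 1^ q
    }
    where
    +-homo : ∀ x y → (x + y) ^ q ≈ x ^ q + y ^ q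
    +-homo x y = begin
      (x + y) ^ q                                      ≈⟨ ^-congˡ q (MatrixTree.∑-Bool R f) ⟨
      (∑ Bool-finite f) ^ q                            ≈⟨ frobenius-∑ Bool-finite f ⟩
      ∑ Bool-finite (λ b → f b ^ q)                    ≈⟨ MatrixTree.∑-Bool R (λ b → f b ^ q) ⟩
      x ^ q + y ^ q                                    ∎
      where
      f : Bool → Carrier
      f true  = x
      f false = y

  δ^q : {P : Set} (d : Dec P) → δ d ^ q ≈ δ d
  δ^q (yes _) = 1^ q
  δ^q (no _)  = 0^q

  det-δ^q : {I : Set} (FI : Finite I) {P : I → I → Set} (d : ∀ i j → Dec (P i j)) →
            det FI (λ i j → δ (d i j)) ^ q ≈ det FI (λ i j → δ (d i j))
  det-δ^q FI d = ≈-trans (det-homo frobenius FI _) (det-cong FI (λ i j → δ^q (d i j)))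

  private
    -- The sign of right translation by c, as an element of `R`.
    ψ : Fin q → Carrier
    ψ c = det (Fin-finite q) (λ g h → δ ((g ∙ c) Fin.≟ h))

    ψ-∙ : ∀ c d → ψ (c ∙ d) ≈ ψ c * ψ d
    ψ-∙ c d = ≈-trans
      (det-cong (Fin-finite q) (λ g h → reflexive (cong (λ x → δ (x Fin.≟ h)) (sym (∙-assoc g c d)))))
      (det-rows (Fin-finite q) Fin._≟_ (_∙ c) (λ g h → δ ((g ∙ d) Fin.≟ h)))

    ψ-e : ψ e ≈ 1#
    ψ-e = ≈-trans (det-cong (Fin-finite q) (λ g h → reflexive (cong (λ x → δ (x Fin.≟ h)) (∙-identityʳ g))))
                  (det-1 (Fin-finite q) Fin._≟_)

    -- Since ψ is multiplicative, ψ c ^ q = 1 (compare the products of ψ over G and over c G),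
    -- while Frobenius fixes ψ c.
    ψ-trivial : ∀ c → ψ c ≈ 1#
    ψ-trivial c = begin
      ψ c                          ≈⟨ det-δ^q (Fin-finite q) (λ g h → (g ∙ c) Fin.≟ h) ⟨
      ψ c ^ q                      ≈⟨ *-identityʳ _ ⟨
      ψ c ^ q * 1#                 ≈⟨ *-congˡ unit ⟨
      ψ c ^ q * (P * P⁻¹)          ≈⟨ *-assoc _ _ _ ⟨
      ψ c ^ q * P * P⁻¹            ≈⟨ *-congʳ shift ⟩
      P * P⁻¹                      ≈⟨ unit ⟩
      1#                           ∎
      where
      P = Π.sum ψ
      P⁻¹ = Π.sum (λ g → ψ (g ⁻¹))
      unit : P * P⁻¹ ≈ 1#
      unit = ≈-trans (≈-sym (Π.∑-distrib-+ ψ (λ g → ψ (g ⁻¹)))) (Π.sum-0 {q} (λ g → ≈-trans (≈-sym (ψ-∙ g (g ⁻¹)))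
        (≈-trans (reflexive (cong ψ (∙-inverseʳ g))) ψ-e)))
      shift : ψ c ^ q * P ≈ P
      shift = ≈-trans (*-congʳ (≈-sym (Π.sum-replicate q))) (≈-trans (≈-sym (Π.∑-distrib-+ {q} (λ _ → ψ c) ψ))
        (≈-trans (Π.sum-cong-≋ {q} (λ g → ≈-sym (ψ-∙ c g))) (≈-sym (Π.sum-permute ψ (left c)))))

  module _ {V : Set} (FV : Finite V) (B : V → V × Fin q → Carrier) where
    private
      module FV = Finite FV
      m = FV.size

      I A : Set
      I = Fin q × V
      A = V × Fin q

      FI : Finite I
      FI = ×-finite (Fin-finite q) FV

      FA : Finite A
      FA = ×-finite FV (Fin-finite q)

      module FI = Finite FI

      M : I → I → Carrier
      M (g , v) (h , u) = B v (u , g ⁻¹ ∙ h)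

      target : I → A → I
      target (g , v) (u , c) = g ∙ c , u

      M-expand : ∀ x y → M x y ≈ ∑ FA (λ a → B (proj₂ x) a * δ (target x a FI.≟ y))
      M-expand (g , v) (h , u) = ≈-sym (≈-trans (∑-cong FA (λ a → *-δ (target (g , v) a FI.≟ (h , u))))
        (∑-unique FA (λ a → target (g , v) a FI.≟ (h , u)) (u , g ⁻¹ ∙ h)
          (cong (_, u) (Inverse.strictlyInverseˡ (left g) h))
          (λ { (u′ , c) refl → cong (u′ ,_) (sym (Inverse.strictlyInverseʳ (left g) c)) })))

      E : (I → A) → I → I → Carrier
      E Φ x y = δ (target x (Φ x) FI.≟ y)

      weight : (I → A) → Carrier
      weight Φ = Π.∑ FI (λ x → B (proj₂ x) (Φ x)) * det FI (E Φ)

      weight-cong : ∀ {Φ Ψ} → (∀ x → Φ x ≡ Ψ x) → weight Φ ≈ weight Ψ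
      weight-cong eq = *-cong (Π.∑-cong FI (λ x → reflexive (cong (B (proj₂ x)) (eq x))))
        (det-cong FI (λ x y → reflexive (cong (λ a → δ (target x a FI.≟ y)) (eq x))))

      left′ : Fin q → I ↔ I
      left′ h = mk↔ₛ′ (λ (g , v) → h ∙ g , v) (λ (g , v) → h ⁻¹ ∙ g , v)
        (λ (g , v) → cong (_, v) (Inverse.strictlyInverseˡ (left h) g)) (λ (g , v) → cong (_, v) (Inverse.strictlyInverseʳ (left h) g))

      -- Translating a choice function permutes the rows and columns of its 0-1 matrix
      -- simultaneously, because left multiplication commutes with the right multiplication in
      -- `target`.
      weight-translate : ∀ h Φ → weight (λ (g , v) → Φ (h ∙ g , v)) ≈ weight Φ
      weight-translate h Φ = *-cong (≈-sym (Π.∑-↔ FI FI (left′ h) (λ x → B (proj₂ x) (Φ x))))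
        (≈-trans (det-cong FI (λ x y → when-⇔ (target x (Φ (to x)) FI.≟ y) (target (to x) (Φ (to x)) FI.≟ to y)
            (λ eq → trans (sym (to-target x (Φ (to x)))) (cong to eq))
            (λ eq → trans (sym (from-to _)) (trans (cong from (trans (to-target x (Φ (to x))) eq)) (from-to y)))
            (λ _ → ≈-refl)))
          (det-↔ FI FI (left′ h) (E Φ)))
        where
        to = Inverse.to (left′ h)
        from = Inverse.from (left′ h)
        from-to : ∀ x → from (to x) ≡ x
        from-to = Inverse.strictlyInverseʳ (left′ h)
        to-target : ∀ x a → to (target x a) ≡ target (to x) a
        to-target (g , v) (u , c) = cong (_, u) (sym (∙-assoc h g c))

      curry↔ : Vec (Vec A m) q ↔ Vec A (q ℕ.* m)
      curry↔ = mk↔ₛ′ (λ Φ → tabulate (uncurried Φ)) (λ d → tabulate (λ g → tabulate (λ j → lookup d (Fin.combine g j))))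
        (λ d → Vec-ext (λ i → let g = proj₁ (Fin.remQuot {q} m i) ; j = proj₂ (Fin.remQuot {q} m i) in
          trans (Vec.lookup∘tabulate _ i) (trans (cong (λ v → lookup v j) (Vec.lookup∘tabulate (λ g → tabulate (λ j → lookup d (Fin.combine g j))) g))
          (trans (Vec.lookup∘tabulate (λ j → lookup d (Fin.combine g j)) j) (cong (lookup d) (Fin.combine-remQuot {q} m i))))))
        (λ Φ → Vec-ext (λ g → Vec-ext (λ j → trans
          (cong (λ v → lookup v j) (Vec.lookup∘tabulate (λ g → tabulate (λ j → lookup (tabulate (uncurried Φ)) (Fin.combine g j))) g))
          (trans (Vec.lookup∘tabulate (λ j → lookup (tabulate (uncurried Φ)) (Fin.combine g j)) j) (lookup-curry Φ g j)))))
        where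
        uncurried : Vec (Vec A m) q → Fin (q ℕ.* m) → A
        uncurried Φ i = lookup (lookup Φ (proj₁ (Fin.remQuot {q} m i))) (proj₂ (Fin.remQuot {q} m i))
        lookup-curry : ∀ Φ g j → lookup (tabulate (uncurried Φ)) (Fin.combine g j) ≡ lookup (lookup Φ g) j
        lookup-curry Φ g j = trans (Vec.lookup∘tabulate (uncurried Φ) (Fin.combine g j))
          (cong₂ (λ g′ j′ → lookup (lookup Φ g′) j′) (cong proj₁ (Fin.remQuot-combine g j)) (cong proj₂ (Fin.remQuot-combine g j)))

      choice : Vec (Vec A m) q → I → A
      choice Φ (g , v) = lookup (lookup Φ g) (FV.toFin v)

      endpoint : (V → A) → V → V
      endpoint a v = proj₁ (a v)

      -- For a choice independent of g, the matrix factors into right translations within the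
      -- fibres, which have trivial sign, and q equal blocks. The q-th power of a 0-1 determinant is
      -- the determinant itself.
      det-lift : (a : V → A) → det FI (E (a ∘ proj₂)) ≈ det FV (λ v u → δ (endpoint a v FV.≟ u))
      det-lift a = begin
        det FI (E (a ∘ proj₂))
          ≈⟨ det-rows FI FI._≟_ ρ (λ x y → δ ((proj₁ x , endpoint a (proj₂ x)) FI.≟ y)) ⟩
        det FI (λ x y → δ (ρ x FI.≟ y)) * det FI (λ x y → δ ((proj₁ x , endpoint a (proj₂ x)) FI.≟ y))
          ≈⟨ *-cong det-ρ det-endpoint ⟩
        1# * det FV (λ v u → δ (endpoint a v FV.≟ u))  ≈⟨ *-identityˡ _ ⟩
        det FV (λ v u → δ (endpoint a v FV.≟ u))       ∎
        where
        ρ : I → I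
        ρ (g , v) = g ∙ proj₂ (a v) , v
        det-endpoint : det FI (λ x y → δ ((proj₁ x , endpoint a (proj₂ x)) FI.≟ y)) ≈ det FV (λ v u → δ (endpoint a v FV.≟ u))
        det-endpoint = begin
          det FI (λ x y → δ ((proj₁ x , endpoint a (proj₂ x)) FI.≟ y))
            ≈⟨ det-cong FI (λ (g , v) (h , u) → ≈-trans (when-⇔ ((g , endpoint a v) FI.≟ (h , u)) ((g Fin.≟ h) ×-dec (endpoint a v FV.≟ u))
                 (λ { refl → refl , refl }) (λ { (refl , refl) → refl }) (λ _ → ≈-refl)) (when-× (g Fin.≟ h) (endpoint a v FV.≟ u))) ⟩
          det FI (λ (g , v) (h , u) → when (g Fin.≟ h) (δ (endpoint a v FV.≟ u)))
            ≈⟨ det-blocks q FV (λ _ v u → δ (endpoint a v FV.≟ u)) ⟩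
          Π.sum {q} (λ _ → det FV (λ v u → δ (endpoint a v FV.≟ u)))  ≈⟨ Π.sum-replicate q ⟩
          det FV (λ v u → δ (endpoint a v FV.≟ u)) ^ q                ≈⟨ det-δ^q FV (λ v u → endpoint a v FV.≟ u) ⟩
          det FV (λ v u → δ (endpoint a v FV.≟ u))                    ∎
        swap↔ : (Fin m × Fin q) ↔ I
        swap↔ = mk↔ₛ′ (λ (i , g) → g , FV.fromFin i) (λ (g , v) → FV.toFin v , g)
          (λ (g , v) → cong (g ,_) (FV.fromFin-toFin v)) (λ (i , g) → cong (_, g) (Inverse.strictlyInverseˡ FV.index i))
        det-ρ : det FI (λ x y → δ (ρ x FI.≟ y)) ≈ 1#
        det-ρ = begin
          det FI (λ x y → δ (ρ x FI.≟ y))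
            ≈⟨ det-↔ F FI swap↔ _ ⟨
          det F (λ (i , g) (j , h) → δ ((g ∙ proj₂ (a (FV.fromFin i)) , FV.fromFin i) FI.≟ (h , FV.fromFin j)))
            ≈⟨ det-cong F (λ (i , g) (j , h) → ≈-trans (when-⇔ ((g ∙ c i , FV.fromFin i) FI.≟ (h , FV.fromFin j)) ((i Fin.≟ j) ×-dec ((g ∙ c i) Fin.≟ h))
                 (λ eq → fromFin-injective (cong proj₂ eq) , cong proj₁ eq) (λ { (refl , refl) → refl }) (λ _ → ≈-refl))
                 (when-× (i Fin.≟ j) ((g ∙ c i) Fin.≟ h))) ⟩
          det F (λ (i , g) (j , h) → when (i Fin.≟ j) (δ ((g ∙ c i) Fin.≟ h)))
            ≈⟨ det-blocks m (Fin-finite q) (λ i g h → δ ((g ∙ c i) Fin.≟ h)) ⟩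
          Π.sum {m} (λ i → ψ (c i))                    ≈⟨ Π.sum-0 {m} (λ i → ψ-trivial (c i)) ⟩
          1#                                           ∎
          where
          F = ×-finite (Fin-finite m) (Fin-finite q)
          c : Fin m → Fin q
          c i = proj₂ (a (FV.fromFin i))
          fromFin-injective : ∀ {i j} → FV.fromFin i ≡ FV.fromFin j → i ≡ j
          fromFin-injective eq = trans (sym (Inverse.strictlyInverseˡ FV.index _)) (trans (cong FV.toFin eq) (Inverse.strictlyInverseˡ FV.index _))

    -- Choice functions on G × V are regarded as functions from G to the choices on V. The terms
    -- constant on G reassemble, by multilinearity, into the determinant with entries the sums of
    -- q-th powers; Frobenius then moves the power outside.
    det-invariant : det FI M ≈ det FV (λ v u → ∑ (Fin-finite q) (λ c → B v (u , c))) ^ q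
    det-invariant = begin
      det FI M
        ≈⟨ det-cong FI M-expand ⟩
      det FI (λ x y → ∑ FA (λ a → B (proj₂ x) a * δ (target x a FI.≟ y)))
        ≈⟨ det-∑ FI FA (λ x → B (proj₂ x)) (λ x a y → δ (target x a FI.≟ y)) ⟩
      ∑ (Vec-finite FA (q ℕ.* m)) (λ d → weight (λ x → lookup d (FI.toFin x)))
        ≈⟨ ∑-↔ (Vec-finite (Vec-finite FA m) q) (Vec-finite FA (q ℕ.* m)) curry↔ _ ⟩
      ∑ (Vec-finite (Vec-finite FA m) q) (λ Φ → weight (λ x → lookup (Inverse.to curry↔ Φ) (FI.toFin x)))
        ≈⟨ ∑-cong (Vec-finite (Vec-finite FA m) q) (λ Φ → weight-cong (λ (g , v) → trans (Vec.lookup∘tabulate _ (Fin.combine g (FV.toFin v)))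
             (cong₂ (λ g′ j′ → lookup (lookup Φ g′) j′) (cong proj₁ (Fin.remQuot-combine g (FV.toFin v))) (cong proj₂ (Fin.remQuot-combine g (FV.toFin v)))))) ⟩
      ∑ (Vec-finite (Vec-finite FA m) q) (λ Φ → weight (choice Φ))
        ≈⟨ ∑-translation-invariant (Vec-finite FA m) _ (λ h Φ → ≈-trans
             (weight-cong (λ (g , v) → cong (λ d → lookup d (FV.toFin v)) (Vec.lookup∘tabulate _ g))) (weight-translate (h ⁻¹) (choice Φ))) ⟩
      ∑ (Vec-finite FA m) (λ d → weight (choice (Vec.replicate q d)))
        ≈⟨ ∑-cong (Vec-finite FA m) constant ⟩
      ∑ (Vec-finite FA m) (λ d → Π.∑ FV (λ v → B v (lookup d (FV.toFin v)) ^ q) *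
                                 det FV (λ v u → δ (proj₁ (lookup d (FV.toFin v)) FV.≟ u)))
        ≈⟨ det-∑ FV FA (λ v a → B v a ^ q) (λ v a u → δ (proj₁ a FV.≟ u)) ⟨
      det FV (λ v u → ∑ FA (λ a → B v a ^ q * δ (proj₁ a FV.≟ u)))
        ≈⟨ det-cong FV entry ⟩
      det FV (λ v u → ∑ (Fin-finite q) (λ c → B v (u , c)) ^ q)
        ≈⟨ det-homo frobenius FV _ ⟨
      det FV (λ v u → ∑ (Fin-finite q) (λ c → B v (u , c))) ^ q  ∎
      where
      constant : ∀ d → weight (choice (Vec.replicate q d)) ≈
                       Π.∑ FV (λ v → B v (lookup d (FV.toFin v)) ^ q) * det FV (λ v u → δ (proj₁ (lookup d (FV.toFin v)) FV.≟ u))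
      constant d = ≈-trans (weight-cong (λ (g , v) → cong (λ v′ → lookup v′ (FV.toFin v)) (Vec.lookup-replicate g d)))
        (*-cong (≈-trans (Π.∑-× (Fin-finite q) FV _) (≈-trans (Π.∑-swap (Fin-finite q) FV)
                  (Π.∑-cong FV (λ v → ≈-trans (Π.∑-def (Fin-finite q) _) (Π.sum-replicate q)))))
                (det-lift (λ v → lookup d (FV.toFin v))))
      entry : ∀ v u → ∑ FA (λ a → B v a ^ q * δ (proj₁ a FV.≟ u)) ≈ ∑ (Fin-finite q) (λ c → B v (u , c)) ^ q
      entry v u = ≈-trans (∑-× FV (Fin-finite q) _) (≈-trans
        (∑-cong FV (λ u′ → ≈-trans (∑-cong (Fin-finite q) (λ c → *-δ (u′ FV.≟ u))) (∑-when (Fin-finite q) (u′ FV.≟ u))))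
        (≈-trans (∑-unique FV (λ u′ → u′ FV.≟ u) u refl (λ _ eq → eq)) (≈-sym (frobenius-∑ (Fin-finite q) _))))

-- Laplacians of Galois covers

finiteGroup : (G : Group 0ℓ 0ℓ) {q : ℕ} → HasOrder G q → FiniteGroup q
finiteGroup G {q} order = record
  { _∙_ = λ g h → to (from g G.∙ from h) ; e = to G.ε ; _⁻¹ = λ g → to (from g G.⁻¹)
  ; isGroup = record
    { isMonoid = record
      { isSemigroup = record
        { isMagma = record { isEquivalence = ≡.isEquivalence ; ∙-cong = cong₂ _ }
        ; assoc = λ g h k → to-cong (G.trans (G.∙-congʳ (from-to _)) (G.trans (G.assoc _ _ _) (G.∙-congˡ (G.sym (from-to _)))))
        }
      ; identity = (λ g → trans (to-cong (G.trans (G.∙-congʳ (from-to _)) (G.identityˡ _))) (to-from g)) ,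
                   (λ g → trans (to-cong (G.trans (G.∙-congˡ (from-to _)) (G.identityʳ _))) (to-from g))
      }
    ; inverse = (λ g → to-cong (G.trans (G.∙-congʳ (from-to _)) (G.inverseˡ _))) ,
                (λ g → to-cong (G.trans (G.∙-congˡ (from-to _)) (G.inverseʳ _)))
    ; ⁻¹-cong = cong (λ g → to (from g G.⁻¹))
    }
  }
  where
  module G = Group G
  open Inverse order using (to; from; to-cong)
  to-from : ∀ g → to (from g) ≡ g
  to-from = Inverse.strictlyInverseˡ order
  from-to : ∀ x → from (to x) G.≈ x
  from-to = Inverse.strictlyInverseʳ order

module GaloisCover {Y X : Graph} {p : Hom Y X} (galois : IsGalois p) {q : ℕ} (order : HasOrder (AutGroup p) q) where
  private
    module Y = Graph Y
    module X = Graph X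
    module p = Hom p
    module G = Group (AutGroup p)
    open IsGalois galois
    open Cover isCover
    open Inverse order using (to; from; to-cong)

    base : X.V → Y.V
    base v = proj₁ (IsCover.surjective isCover v)

    base-over : ∀ v → p.onV (base v) ≡ v
    base-over v = proj₂ (IsCover.surjective isCover v)

    from-to : ∀ x → from (to x) G.≈ x
    from-to = Inverse.strictlyInverseʳ order

  σV : Fin q → Y.V → Y.V
  σV g = Hom.onV (Aut.σ (from g))

  σE : Fin q → Y.E → Y.E
  σE g = Hom.onE (Aut.σ (from g))

  open FiniteGroup (finiteGroup (AutGroup p) order)

  private
    σV-∙ : ∀ g h y → σV (g ∙ h) y ≡ σV g (σV h y)
    σV-∙ g h = _≈ₕ_.onV≡ (from-to (from g G.∙ from h))

    σV-over : ∀ g y → p.onV (σV g y) ≡ p.onV y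
    σV-over g = _≈ₕ_.onV≡ (Aut.over (from g))

    σV-free : ∀ {g h y} → σV g y ≡ σV h y → g ≡ h
    σV-free {g} {h} eq = trans (sym (Inverse.strictlyInverseˡ order g)) (trans (to-cong same) (Inverse.strictlyInverseˡ order h))
      where
      same : from g G.≈ from h
      same = lift-unique connected (Aut.σ (from g)) (Aut.σ (from h))
        (mk≈ (λ v → trans (σV-over g v) (sym (σV-over h v)))
             (λ e → trans (_≈ₕ_.onE≡ (Aut.over (from g)) e) (sym (_≈ₕ_.onE≡ (Aut.over (from h)) e)))) eq

    σV-transitive : ∀ {y y′} → p.onV y ≡ p.onV y′ → ∃ λ g → σV g y ≡ y′
    σV-transitive {y} {y′} eq = let a , ay = transitive y y′ eq in to a , trans (_≈ₕ_.onV≡ (from-to a) y) ay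

    σV↔ : ∀ g → Y.V ↔ Y.V
    σV↔ g = mk↔ₛ′ (σV g) (Hom.onV (Aut.σ⁻¹ (from g))) (_≈ₕ_.onV≡ (Aut.σ∘σ⁻¹ (from g))) (_≈ₕ_.onV≡ (Aut.σ⁻¹∘σ (from g)))

    σE↔ : ∀ g → Y.E ↔ Y.E
    σE↔ g = mk↔ₛ′ (σE g) (Hom.onE (Aut.σ⁻¹ (from g))) (_≈ₕ_.onE≡ (Aut.σ∘σ⁻¹ (from g))) (_≈ₕ_.onE≡ (Aut.σ⁻¹∘σ (from g)))

  vertices↔ : (Fin q × X.V) ↔ Y.V
  vertices↔ = mk↔ₛ′ (λ (g , v) → σV g (base v)) (λ y → proj₁ (group y) , p.onV y)
    (λ y → proj₂ (group y))
    (λ (g , v) → let over = trans (σV-over g (base v)) (base-over v) in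
      cong₂ _,_ (σV-free (trans (cong (λ u → σV (proj₁ (group (σV g (base v)))) (base u)) (sym over)) (proj₂ (group (σV g (base v)))))) over)
    where
    group : ∀ y → ∃ λ g → σV g (base (p.onV y)) ≡ y
    group y = σV-transitive (base-over (p.onV y))

  -- The deck group acts freely and transitively on a fibre, which therefore has as many elements as
  -- the group.
  degree : ∀ {d} → X.V → HasDegree p d → d ≡ q
  degree {d} v deg = Perm.↔⇒≡ (fibre↔ ↔-∘ ↔-sym (deg v))
    where
    fibre↔ : Fibre p v ↔ Fin q
    fibre↔ = mk↔ₛ′
      (λ (y , eq) → proj₁ (σV-transitive (trans (base-over v) (sym eq))))
      (λ g → σV g (base v) , trans (σV-over g (base v)) (base-over v))
      (λ g → σV-free (proj₂ (σV-transitive (trans (base-over v) (sym (trans (σV-over g (base v)) (base-over v)))))))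
      (λ (y , eq) → Σ-≡,≡→≡ (proj₂ (σV-transitive (trans (base-over v) (sym eq))) , X.Vᶠ.≡-irrelevant _ _))

  module _ (R : CommutativeRing 0ℓ 0ℓ) (wt : Graph.E X → CommutativeRing.Carrier R) where
    open CommutativeRing R hiding (zero) renaming (refl to ≈-refl; sym to ≈-sym; trans to ≈-trans)
    open Summation R
    open Determinant R
    open MatrixTree R using (laplacian)
    open import Algebra.Properties.Semiring.Exp semiring using (_^_; ^-congˡ)
    open import Relation.Binary.Reasoning.Setoid setoid

    private
      L : Y.V → Y.V → Carrier
      L = laplacian Y (wt ∘ p.onE)

      B : X.V → X.V × Fin q → Carrier
      B v (u , c) = L (base v) (σV c (base u))

      injective : {A C : Set} (φ : A ↔ C) {a b : A} → Inverse.to φ a ≡ Inverse.to φ b → a ≡ b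
      injective φ eq = trans (sym (Inverse.strictlyInverseʳ φ _)) (trans (cong (Inverse.from φ) eq) (Inverse.strictlyInverseʳ φ _))

      L-invariant : ∀ g y y′ → L (σV g y) (σV g y′) ≈ L y y′
      L-invariant g y y′ = ≈-trans (∑-↔ Y.E-finite Y.E-finite (σE↔ g) _) (∑-cong Y.E-finite (λ e →
        when-⇔ (Y.o (σE g e) Y.Vᶠ.≟ σV g y) (Y.o e Y.Vᶠ.≟ y)
          (λ eq → injective (σV↔ g) (trans (Hom.o-hom (Aut.σ (from g)) e) eq))
          (λ eq → trans (sym (Hom.o-hom (Aut.σ (from g)) e)) (cong (σV g) eq))
          (λ _ → +-cong (when-⇔ (σV g y Y.Vᶠ.≟ σV g y′) (y Y.Vᶠ.≟ y′) (injective (σV↔ g)) (cong (σV g)) (λ _ → ≈-refl))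
            (-‿cong (*-cong (reflexive (cong wt (_≈ₕ_.onE≡ (Aut.over (from g)) e)))
              (when-⇔ (Y.t (σE g e) Y.Vᶠ.≟ σV g y′) (Y.t e Y.Vᶠ.≟ y′)
                (λ eq → injective (σV↔ g) (trans (Hom.t-hom (Aut.σ (from g)) e) eq))
                (λ eq → trans (sym (Hom.t-hom (Aut.σ (from g)) e)) (cong (σV g) eq)) (λ _ → ≈-refl)))))))

      ∑-fibre : ∀ y u → ∑ (Fin-finite q) (λ c → δ (y Y.Vᶠ.≟ σV c (base u))) ≈ δ (p.onV y X.Vᶠ.≟ u)
      ∑-fibre y u with p.onV y X.Vᶠ.≟ u
      ... | yes refl = let c , eq = σV-transitive (base-over (p.onV y)) in
        ∑-unique (Fin-finite q) (λ c → y Y.Vᶠ.≟ σV c (base u)) c (sym eq) (λ c′ eq′ → σV-free (trans (sym eq′) (sym eq)))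
      ... | no ne = ∑-0 (Fin-finite q) (λ c → when-no (y Y.Vᶠ.≟ σV c (base u))
        (λ eq → ne (trans (cong p.onV eq) (trans (σV-over c (base u)) (base-over u)))))

      -- Summing over the fibre of u collects every edge that leaves the base vertex by the image of
      -- its target, and the edges at the base vertex correspond to those at v.
      ∑-B : ∀ v u → ∑ (Fin-finite q) (λ c → B v (u , c)) ≈ laplacian X wt v u
      ∑-B v u = begin
        ∑ (Fin-finite q) (λ c → B v (u , c))
          ≈⟨ ∑-swap (Fin-finite q) Y.E-finite ⟩
        ∑ Y.E-finite (λ e → ∑ (Fin-finite q) (λ c → when (Y.o e Y.Vᶠ.≟ base v) (δ (base v Y.Vᶠ.≟ σV c (base u)) - wt (p.onE e) * δ (Y.t e Y.Vᶠ.≟ σV c (base u)))))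
          ≈⟨ ∑-cong Y.E-finite (λ e → ≈-trans (∑-when (Fin-finite q) (Y.o e Y.Vᶠ.≟ base v))
               (when-cong (Y.o e Y.Vᶠ.≟ base v) (λ _ → ≈-trans (∑-+ (Fin-finite q)) (+-cong (∑-fibre (base v) u)
                 (≈-trans (∑-neg (Fin-finite q)) (-‿cong (≈-trans (≈-sym (*-∑ (Fin-finite q))) (*-congˡ (∑-fibre (Y.t e) u))))))))) ⟩
        ∑ Y.E-finite (λ e → when (Y.o e Y.Vᶠ.≟ base v) (δ (p.onV (base v) X.Vᶠ.≟ u) - wt (p.onE e) * δ (p.onV (Y.t e) X.Vᶠ.≟ u)))
          ≈⟨ ∑-bij Y.E-finite X.E-finite (λ e → Y.o e Y.Vᶠ.≟ base v) (λ e → X.o e X.Vᶠ.≟ v)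
               (λ e e′ → (Y.o e Y.Vᶠ.≟ base v) ×-dec (p.onE e X.Eᶠ.≟ e′))
               (λ { {e} (oe , refl) → oe , origin oe , +-cong (reflexive (cong (λ x → δ (x X.Vᶠ.≟ u)) (base-over v)))
                    (-‿cong (*-congˡ (reflexive (cong (λ x → δ (x X.Vᶠ.≟ u)) (p.t-hom e))))) })
               (λ e oe → p.onE e , (oe , refl) , λ _ (_ , eq) → sym eq)
               (λ { e refl → let e′ , oe′ , pe′ = edge-lift (base v) e (base-over v) in
                    e′ , (oe′ , pe′) , λ a (oa , pa) → edge-unique (trans oa (sym oe′)) (trans pa (sym pe′)) }) ⟩
        ∑ X.E-finite (λ e → when (X.o e X.Vᶠ.≟ v) (δ (v X.Vᶠ.≟ u) - wt e * δ (X.t e X.Vᶠ.≟ u)))  ∎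
        where
        origin : ∀ {e} → Y.o e ≡ base v → X.o (p.onE e) ≡ v
        origin {e} oe = trans (sym (p.o-hom e)) (trans (cong p.onV oe) (base-over v))

    det-galois : ∀ {ℓ k} → Prime ℓ → q ≡ ℓ ℕ.^ k → ℓ · 1# ≈ 0# →
                 det Y.V-finite L ≈ det X.V-finite (laplacian X wt) ^ q
    det-galois {ℓ} {k} isPrime eq char = begin
      det Y.V-finite L
        ≈⟨ det-↔ (×-finite (Fin-finite q) X.V-finite) Y.V-finite vertices↔ L ⟨
      det (×-finite (Fin-finite q) X.V-finite) (λ (g , v) (h , u) → L (σV g (base v)) (σV h (base u)))
        -- Invariance under σ_g makes the entry depend on g and h only through g⁻¹ h, which is the
        -- form of a group matrix.
        ≈⟨ det-cong (×-finite (Fin-finite q) X.V-finite) (λ (g , v) (h , u) → ≈-trans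
             (reflexive (cong (L (σV g (base v))) (trans (cong (λ x → σV x (base u)) (sym (Inverse.strictlyInverseˡ (left g) h))) (σV-∙ g (g ⁻¹ ∙ h) (base u)))))
             (L-invariant g (base v) _)) ⟩
      det (×-finite (Fin-finite q) X.V-finite) (λ (g , v) (h , u) → B v (u , g ⁻¹ ∙ h))
        ≈⟨ invariant {k = k} isPrime (finiteGroup (AutGroup p) order) eq char ⟩
      det X.V-finite (λ v u → ∑ (Fin-finite q) (λ c → B v (u , c))) ^ q
        ≈⟨ ^-congˡ q (det-cong X.V-finite ∑-B) ⟩
      det X.V-finite (laplacian X wt) ^ q  ∎
      where
      invariant : ∀ {ℓ k q} → Prime ℓ → (G : FiniteGroup q) → q ≡ ℓ ℕ.^ k → ℓ · 1# ≈ 0# →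
                  {V : Set} {FV : Finite V} {B : V → V × Fin q → Carrier} →
                  det (×-finite (Fin-finite q) FV) (λ (g , v) (h , u) → B v (u , FiniteGroup._∙_ G (FiniteGroup._⁻¹ G g) h)) ≈
                  det FV (λ v u → ∑ (Fin-finite q) (λ c → B v (u , c))) ^ q
      invariant {k = k} isPrime G refl char {FV = FV} {B} = Translation.det-invariant {k = k} isPrime G R char FV B

-- The ring ℤ[ζ]

module _ (R : CommutativeRing 0ℓ 0ℓ) (c : CommutativeRing.Carrier R) where
  open CommutativeRing R hiding (zero) renaming (refl to ≈-refl; sym to ≈-sym; trans to ≈-trans)
  open IntegerCoefficients R

  infix 4 _≈/_
  -- The cofactor is kept as data: the valuation argument later uses it as an element of the ring.
  _≈/_ : Carrier → Carrier → Set
  x ≈/ y = ∃ λ d → x ≈ y + c * d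

  private
    lift : ∀ {x y} → x ≈ y → x ≈/ y
    lift {x} {y} eq = 0# , ≈-trans eq (solve 2 (λ y c → y := y :+ c :* con (+ 0)) ≈-refl y c)

  _/⟨_⟩ : CommutativeRing 0ℓ 0ℓ
  _/⟨_⟩ = record
    { Carrier = Carrier ; _≈_ = _≈/_ ; _+_ = _+_ ; _*_ = _*_ ; -_ = -_ ; 0# = 0# ; 1# = 1#
    ; isCommutativeRing = record
      { isRing = record
        { +-isAbelianGroup = record
          { isGroup = record
            { isMonoid = record
              { isSemigroup = record
                { isMagma = record
                  { isEquivalence = record
                    { refl  = lift ≈-refl
                    ; sym   = λ { {x} {y} (d , eq) → - d , ≈-sym (≈-trans (+-congʳ eq)
                        (solve 3 (λ y c d → y :+ c :* d :+ c :* (:- d) := y) ≈-refl y c d)) }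
                    ; trans = λ { {x} {y} {z} (d , eq) (d′ , eq′) → d′ + d , ≈-trans eq (≈-trans (+-congʳ eq′)
                        (solve 4 (λ z c d d′ → z :+ c :* d′ :+ c :* d := z :+ c :* (d′ :+ d)) ≈-refl z c d d′)) }
                    }
                  ; ∙-cong = λ { {x} {y} {u} {v} (d , eq) (d′ , eq′) → d + d′ , ≈-trans (+-cong eq eq′)
                      (solve 5 (λ y v c d d′ → y :+ c :* d :+ (v :+ c :* d′) := y :+ v :+ c :* (d :+ d′)) ≈-refl y v c d d′) }
                  }
                ; assoc = λ x y z → lift (+-assoc x y z)
                }
              ; identity = (λ x → lift (+-identityˡ x)) , (λ x → lift (+-identityʳ x))
              }
            ; inverse = (λ x → lift (-‿inverseˡ x)) , (λ x → lift (-‿inverseʳ x))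
            ; ⁻¹-cong = λ { {x} {y} (d , eq) → - d , ≈-trans (-‿cong eq)
                (solve 3 (λ y c d → :- (y :+ c :* d) := :- y :+ c :* (:- d)) ≈-refl y c d) }
            }
          ; comm = λ x y → lift (+-comm x y)
          }
        ; *-cong = λ { {x} {y} {u} {v} (d , eq) (d′ , eq′) → y * d′ + d * v + c * (d * d′) , ≈-trans (*-cong eq eq′)
            (solve 5 (λ y v c d d′ → (y :+ c :* d) :* (v :+ c :* d′) := y :* v :+ c :* (y :* d′ :+ d :* v :+ c :* (d :* d′))) ≈-refl y v c d d′) }
        ; *-assoc = λ x y z → lift (*-assoc x y z)
        ; *-identity = (λ x → lift (*-identityˡ x)) , (λ x → lift (*-identityʳ x))
        ; distrib = (λ x y z → lift (distribˡ x y z)) , (λ x y z → lift (distribʳ x y z))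
        }
      ; *-comm = λ x y → lift (*-comm x y)
      }
    }

  quotient-≈ : ∀ {x y} → x ≈ y → x ≈/ y
  quotient-≈ = lift

  quotient-zero : c ≈/ 0#
  quotient-zero = 1# , ≈-sym (≈-trans (+-identityˡ _) (*-identityʳ c))

-- Polynomials acting on integer sequences

data Polynomial : Set where
  X           : Polynomial
  constant    : ℤ → Polynomial
  _⊕_ _⊗_     : Polynomial → Polynomial → Polynomial
  ⊖_          : Polynomial → Polynomial

-- Evaluation at X = 1. It is defined on expressions; it respects equality in ℤ[X], and in ℤ[ζ] only
-- modulo ℓ, where it is the residue map at the prime above ℓ.
augment : Polynomial → ℤ
augment X            = + 1
augment (constant c) = c
augment (p ⊕ q)      = augment p ℤ.+ augment q
augment (p ⊗ q)      = augment p ℤ.* augment q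
augment (⊖ p)        = ℤ.- augment p

-- Polynomials act on sequences, X by the shift.
act : Polynomial → (ℕ → ℤ) → ℕ → ℤ
act X            f k = f (suc k)
act (constant c) f k = c ℤ.* f k
act (p ⊕ q)      f k = act p f k ℤ.+ act q f k
act (p ⊗ q)      f   = act p (act q f)
act (⊖ p)        f k = ℤ.- act p f k

act-cong : ∀ p {f g} → f ≗ g → act p f ≗ act p g
act-cong X            eq k = eq (suc k)
act-cong (constant c) eq k = cong (c ℤ.*_) (eq k)
act-cong (p ⊕ q)      eq k = cong₂ ℤ._+_ (act-cong p eq k) (act-cong q eq k)
act-cong (p ⊗ q)      eq   = act-cong p (act-cong q eq)
act-cong (⊖ p)        eq k = cong ℤ.-_ (act-cong p eq k)

act-linear : ∀ p a b f g k → act p (λ i → a ℤ.* f i ℤ.+ b ℤ.* g i) k ≡ a ℤ.* act p f k ℤ.+ b ℤ.* act p g k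
act-linear X            a b f g k = refl
act-linear (constant c) a b f g k = identity c a b (f k) (g k)
  where
  identity : ∀ c a b x y → c ℤ.* (a ℤ.* x ℤ.+ b ℤ.* y) ≡ a ℤ.* (c ℤ.* x) ℤ.+ b ℤ.* (c ℤ.* y)
  identity = solve-∀
act-linear (p ⊕ q)      a b f g k = trans (cong₂ ℤ._+_ (act-linear p a b f g k) (act-linear q a b f g k))
  (identity a b (act p f k) (act p g k) (act q f k) (act q g k))
  where
  identity : ∀ a b x y z w → (a ℤ.* x ℤ.+ b ℤ.* y) ℤ.+ (a ℤ.* z ℤ.+ b ℤ.* w) ≡ a ℤ.* (x ℤ.+ z) ℤ.+ b ℤ.* (y ℤ.+ w)
  identity = solve-∀
act-linear (p ⊗ q)      a b f g k = trans (act-cong p (act-linear q a b f g) k) (act-linear p a b (act q f) (act q g) k)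
act-linear (⊖ p)        a b f g k = trans (cong ℤ.-_ (act-linear p a b f g k)) (identity a b (act p f k) (act p g k))
  where
  identity : ∀ a b x y → ℤ.- (a ℤ.* x ℤ.+ b ℤ.* y) ≡ a ℤ.* (ℤ.- x) ℤ.+ b ℤ.* (ℤ.- y)
  identity = solve-∀

act-+ : ∀ p f g k → act p (λ i → f i ℤ.+ g i) k ≡ act p f k ℤ.+ act p g k
act-+ p f g k = trans (act-cong p (λ i → identity (f i) (g i)) k)
  (trans (act-linear p (+ 1) (+ 1) f g k) (sym (identity (act p f k) (act p g k))))
  where
  identity : ∀ x y → x ℤ.+ y ≡ + 1 ℤ.* x ℤ.+ + 1 ℤ.* y
  identity = solve-∀

act-* : ∀ p c f k → act p (λ i → c ℤ.* f i) k ≡ c ℤ.* act p f k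
act-* p c f k = trans (act-cong p (λ i → identity c (f i)) k)
  (trans (act-linear p c (+ 0) f f k) (sym (identity c (act p f k))))
  where
  identity : ∀ c x → c ℤ.* x ≡ c ℤ.* x ℤ.+ + 0 ℤ.* x
  identity = solve-∀

act-neg : ∀ p f k → act p (λ i → ℤ.- f i) k ≡ ℤ.- act p f k
act-neg p f k = trans (act-cong p (λ i → identity (f i)) k) (trans (act-* p (ℤ.- (+ 1)) f k) (sym (identity (act p f k))))
  where
  identity : ∀ x → ℤ.- x ≡ ℤ.- (+ 1) ℤ.* x
  identity = solve-∀

act-shift : ∀ p f k → act p (f ∘ suc) k ≡ act p f (suc k)
act-shift X            f k = refl
act-shift (constant c) f k = refl
act-shift (p ⊕ q)      f k = cong₂ ℤ._+_ (act-shift p f k) (act-shift q f k)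
act-shift (p ⊗ q)      f k = trans (act-cong p (act-shift q f) k) (act-shift p (act q f) k)
act-shift (⊖ p)        f k = cong ℤ.-_ (act-shift p f k)

act-comm : ∀ p q f k → act p (act q f) k ≡ act q (act p f) k
act-comm X            q f k = sym (act-shift q f k)
act-comm (constant c) q f k = sym (act-* q c f k)
act-comm (p ⊕ p′)     q f k = trans (cong₂ ℤ._+_ (act-comm p q f k) (act-comm p′ q f k)) (sym (act-+ q (act p f) (act p′ f) k))
act-comm (p ⊗ p′)     q f k = trans (act-cong p (act-comm p′ q f) k) (act-comm p q (act p′ f) k)
act-comm (⊖ p)        q f k = trans (cong ℤ.-_ (act-comm p q f k)) (sym (act-neg q (act p f) k))

-- The image of ℤ[X] in the endomorphisms of a space of sequences.
module ShiftRing (Good : (ℕ → ℤ) → Set) (good-act : ∀ p {f} → Good f → Good (act p f)) where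

  infix 4 _≋_
  record _≋_ (p q : Polynomial) : Set where
    constructor mk≋
    field
      apply : ∀ f → Good f → ∀ k → act p f k ≡ act q f k

  open _≋_ public

  shiftRing : CommutativeRing 0ℓ 0ℓ
  shiftRing = record
    { Carrier = Polynomial ; _≈_ = _≋_ ; _+_ = _⊕_ ; _*_ = _⊗_ ; -_ = ⊖_ ; 0# = constant (+ 0) ; 1# = constant (+ 1)
    ; isCommutativeRing = record
      { isRing = record
        { +-isAbelianGroup = record
          { isGroup = record
            { isMonoid = record
              { isSemigroup = record
                { isMagma = record
                  { isEquivalence = record
                    { refl  = mk≋ λ f _ k → refl
                    ; sym   = λ eq → mk≋ λ f g k → sym (apply eq f g k)
                    ; trans = λ eq eq′ → mk≋ λ f g k → trans (apply eq f g k) (apply eq′ f g k)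
                    }
                  ; ∙-cong = λ eq eq′ → mk≋ λ f g k → cong₂ ℤ._+_ (apply eq f g k) (apply eq′ f g k)
                  }
                ; assoc = λ p q r → mk≋ λ f _ k → ℤ.+-assoc (act p f k) (act q f k) (act r f k)
                }
              ; identity = (λ p → mk≋ λ f _ k → trans (cong (ℤ._+ act p f k) (ℤ.*-zeroˡ (f k))) (ℤ.+-identityˡ _)) ,
                           (λ p → mk≋ λ f _ k → trans (cong (λ z → act p f k ℤ.+ z) (ℤ.*-zeroˡ (f k))) (ℤ.+-identityʳ _))
              }
            ; inverse = (λ p → mk≋ λ f _ k → trans (ℤ.+-inverseˡ (act p f k)) (sym (ℤ.*-zeroˡ (f k)))) ,
                        (λ p → mk≋ λ f _ k → trans (ℤ.+-inverseʳ (act p f k)) (sym (ℤ.*-zeroˡ (f k))))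
            ; ⁻¹-cong = λ eq → mk≋ λ f g k → cong ℤ.-_ (apply eq f g k)
            }
          ; comm = λ p q → mk≋ λ f _ k → ℤ.+-comm (act p f k) (act q f k)
          }
        ; *-cong = λ {p} {p′} {q} {q′} eq eq′ → mk≋ λ f g k → trans (act-cong p (apply eq′ f g) k) (apply eq (act q′ f) (good-act q′ g) k)
        ; *-assoc = λ p q r → mk≋ λ f _ k → refl
        ; *-identity = (λ p → mk≋ λ f _ k → ℤ.*-identityˡ (act p f k)) ,
                       (λ p → mk≋ λ f _ k → act-cong p (λ i → ℤ.*-identityˡ (f i)) k)
        ; distrib = (λ p q r → mk≋ λ f _ k → act-+ p (act q f) (act r f) k) , (λ p q r → mk≋ λ f _ k → refl)
        }
      ; *-comm = λ p q → mk≋ λ f _ k → act-comm p q f k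
      }
    }

  open CommutativeRing shiftRing using (1#; _*_; setoid)
  open Summation shiftRing using (_·_; sum)
  open import Algebra.Properties.Semiring.Exp (CommutativeRing.semiring shiftRing) using (_^_)

  act-multiple : ∀ n f k → act (n · 1#) f k ≡ + n ℤ.* f k
  act-multiple zero    f k = refl
  act-multiple (suc n) f k = trans (cong (λ x → + 1 ℤ.* f k ℤ.+ x) (act-multiple n f k)) (trans (sym (ℤ.*-distribʳ-+ (f k) (+ 1) (+ n))) refl)

  -- Integers are cancelled in the values of the sequences.
  torsionFree : ∀ n {p q} → (suc n · 1#) * p ≋ (suc n · 1#) * q → p ≋ q
  torsionFree n {p} {q} eq = mk≋ λ f g k → ℤ.*-cancelˡ-≡ (+ suc n) (act p f k) (act q f k)
    (trans (sym (act-multiple (suc n) (act p f) k)) (trans (apply eq f g k) (act-multiple (suc n) (act q f) k)))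

  act-^ : ∀ n f k → act (X ^ n) f k ≡ f (n ℕ.+ k)
  act-^ zero    f k = ℤ.*-identityˡ (f k)
  act-^ (suc n) f k = trans (act-^ n f (suc k)) (cong f (ℕ.+-suc n k))

  augment-multiple : ∀ n → augment (n · 1#) ≡ + n
  augment-multiple zero    = refl
  augment-multiple (suc n) = cong (λ z → + 1 ℤ.+ z) (augment-multiple n)

  augment-^ : ∀ p n → augment (p ^ n) ≡ augment p ℤ.^ n
  augment-^ p zero    = refl
  augment-^ p (suc n) = cong (augment p ℤ.*_) (augment-^ p n)

  1^ : ∀ n → (+ 1) ℤ.^ n ≡ + 1
  1^ zero    = refl
  1^ (suc n) = trans (ℤ.*-identityˡ _) (1^ n)

-- All sequences together are a faithful module, so this is the polynomial ring itself.
module ℤ[X] = ShiftRing (λ _ → ⊤) (λ _ _ → tt)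

-- Constant sequences are eigenvectors of the shift with eigenvalue 1, which makes the augmentation
-- visible to the action.
act-const : ∀ p c k → act p (λ _ → c) k ≡ augment p ℤ.* c
act-const X            c k = sym (ℤ.*-identityˡ c)
act-const (constant d) c k = refl
act-const (p ⊕ q)      c k = trans (cong₂ ℤ._+_ (act-const p c k) (act-const q c k)) (sym (ℤ.*-distribʳ-+ c (augment p) (augment q)))
act-const (p ⊗ q)      c k = trans (act-cong p (act-const q c) k) (trans (act-const p (augment q ℤ.* c) k) (sym (ℤ.*-assoc (augment p) (augment q) c)))
act-const (⊖ p)        c k = trans (cong ℤ.-_ (act-const p c k)) (ℤ.neg-distribˡ-* (augment p) c)

act-1 : ∀ p k → act p (λ _ → + 1) k ≡ augment p
act-1 p k = trans (act-const p (+ 1) k) (ℤ.*-identityʳ _)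

augment-≋ : ∀ {p q} → p ℤ[X].≋ q → augment p ≡ augment q
augment-≋ {p} {q} eq = trans (sym (act-1 p 0)) (trans (ℤ[X].apply eq (λ _ → + 1) tt 0) (act-1 q 0))

-- p ↦ p(Xⁱ)
power : ℕ → Polynomial → Polynomial
power i X            = X ^ i
  where open import Algebra.Properties.Semiring.Exp (CommutativeRing.semiring ℤ[X].shiftRing) using (_^_)
power i (constant c) = constant c
power i (p ⊕ q)      = power i p ⊕ power i q
power i (p ⊗ q)      = power i p ⊗ power i q
power i (⊖ p)        = ⊖ power i p

augment-power : ∀ i p → augment (power i p) ≡ augment p
augment-power i X            = trans (ℤ[X].augment-^ X i) (ℤ[X].1^ i)
augment-power i (constant c) = refl
augment-power i (p ⊕ q)      = cong₂ ℤ._+_ (augment-power i p) (augment-power i q)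
augment-power i (p ⊗ q)      = cong₂ ℤ._*_ (augment-power i p) (augment-power i q)
augment-power i (⊖ p)        = cong ℤ.-_ (augment-power i p)

-- On an arithmetic progression of step i, the polynomial p(Xⁱ) acts as p does on the subsequence.
act-power : ∀ i p f k m → act (power i p) f (k ℕ.+ m ℕ.* i) ≡ act p (λ j → f (k ℕ.+ j ℕ.* i)) m
act-power i X            f k m = trans (ℤ[X].act-^ i f _) (cong f (begin
  i ℕ.+ (k ℕ.+ m ℕ.* i)    ≡⟨ ℕ.+-assoc i k _ ⟨
  (i ℕ.+ k) ℕ.+ m ℕ.* i    ≡⟨ cong (ℕ._+ m ℕ.* i) (ℕ.+-comm i k) ⟩
  (k ℕ.+ i) ℕ.+ m ℕ.* i    ≡⟨ ℕ.+-assoc k i _ ⟩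
  k ℕ.+ suc m ℕ.* i        ∎))
  where open ≡.≡-Reasoning
act-power i (constant c) f k m = refl
act-power i (p ⊕ q)      f k m = cong₂ ℤ._+_ (act-power i p f k m) (act-power i q f k m)
act-power i (p ⊗ q)      f k m = trans (act-power i p (act (power i q) f) k m) (act-cong p (act-power i q f k) m)
act-power i (⊖ p)        f k m = cong ℤ.-_ (act-power i p f k m)

module _ {Good : (ℕ → ℤ) → Set} {good-act : ∀ p {f} → Good f → Good (act p f)} where
  private module S = ShiftRing Good good-act

  -- An equation in ℤ[X] may be tested on any sequence, in particular on the subsequences of step i
  -- of a sequence in `Good`.
  power-≋ : ∀ i {p q} → p ℤ[X].≋ q → power i p S.≋ power i q
  power-≋ i {p} {q} eq = S.mk≋ λ f _ k → trans (cong (act (power i p) f) (sym (ℕ.+-identityʳ k))) (trans (act-power i p f k 0)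
    (trans (ℤ[X].apply eq _ tt 0) (trans (sym (act-power i q f k 0)) (cong (act (power i q) f) (ℕ.+-identityʳ k)))))

  power-hom : ∀ i → IsHom ℤ[X].shiftRing S.shiftRing (power i)
  power-hom i = record
    { +-homo = λ p q → refl≋ ; *-homo = λ p q → refl≋ ; -‿homo = λ p → refl≋ ; 0-homo = refl≋ ; 1-homo = refl≋ }
    where open CommutativeRing S.shiftRing using () renaming (refl to refl≋)

-- Binomial coefficients and cyclotomic polynomials modulo ℓ

prime∤! : ∀ {ℓ} → Prime ℓ → ∀ {m} → m ℕ.< ℓ → ¬ (ℓ ℕ.∣ m !)
prime∤! isPrime {zero}  m<ℓ ℓ∣ = prime⇒≢1 isPrime (ℕ.∣1⇒≡1 ℓ∣)
  where
  prime⇒≢1 : ∀ {ℓ} → Prime ℓ → ℓ ≢ 1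
  prime⇒≢1 isPrime refl = ¬prime[1] isPrime
prime∤! isPrime {suc m} m<ℓ ℓ∣ with euclidsLemma (suc m) (m !) isPrime ℓ∣
... | inj₁ ℓ∣m  = ℕ.<⇒≱ m<ℓ (ℕ.∣⇒≤ ℓ∣m)
... | inj₂ ℓ∣m! = prime∤! isPrime (ℕ.<-trans (ℕ.n<1+n m) m<ℓ) ℓ∣m!

prime∣C : ∀ {ℓ} → Prime ℓ → ∀ {k} → 0 ℕ.< k → k ℕ.< ℓ → ℓ ℕ.∣ ℓ choose k
prime∣C {ℓ} isPrime {k} 0<k k<ℓ = by-euclid (euclidsLemma (ℓ choose k) (k ! ℕ.* (ℓ ℕ.∸ k) !) isPrime (subst (ℓ ℕ.∣_) (sym product) (ℓ∣ℓ! ℓ (ℕ.<-trans 0<k k<ℓ))))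
  where
  instance
    nonZero : ℕ.NonZero (k ! ℕ.* (ℓ ℕ.∸ k) !)
    nonZero = ℕ.m*n≢0 (k !) ((ℓ ℕ.∸ k) !) {{k ℕ.!≢0}} {{(ℓ ℕ.∸ k) ℕ.!≢0}}
  product : (ℓ choose k) ℕ.* (k ! ℕ.* (ℓ ℕ.∸ k) !) ≡ ℓ !
  product = trans (cong (ℕ._* (k ! ℕ.* (ℓ ℕ.∸ k) !)) (nCk≡n!/k![n-k]! (ℕ.<⇒≤ k<ℓ))) (ℕ.m/n*n≡m (k![n∸k]!∣n! (ℕ.<⇒≤ k<ℓ)))
  ℓ∣ℓ! : ∀ n → 0 ℕ.< n → n ℕ.∣ n !
  ℓ∣ℓ! (suc n) _ = ℕ.m∣m*n (n !)
  by-euclid : ℓ ℕ.∣ ℓ choose k ⊎ ℓ ℕ.∣ k ! ℕ.* (ℓ ℕ.∸ k) ! → ℓ ℕ.∣ ℓ choose k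
  by-euclid (inj₁ ℓ∣C) = ℓ∣C
  by-euclid (inj₂ ℓ∣) with euclidsLemma (k !) ((ℓ ℕ.∸ k) !) isPrime ℓ∣
  ... | inj₁ ℓ∣k! = contradiction ℓ∣k! (prime∤! isPrime k<ℓ)
  ... | inj₂ ℓ∣!  = contradiction ℓ∣! (prime∤! isPrime (ℕ.∸-monoʳ-< 0<k (ℕ.<⇒≤ k<ℓ)))

module GeometricSums (R : CommutativeRing 0ℓ 0ℓ) where
  open CommutativeRing R hiding (zero) renaming (refl to ≈-refl; sym to ≈-sym; trans to ≈-trans)
  open Summation R
  open import Algebra.Properties.CommutativeSemiring.Exp commutativeSemiring public
  open import Relation.Binary.Reasoning.Setoid setoid

  geometric : Carrier → ℕ → Carrier
  geometric z n = sum {n} (λ i → z ^ toℕ i)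

  1^n : ∀ n → 1# ^ n ≈ 1#
  1^n zero    = ≈-refl
  1^n (suc n) = ≈-trans (*-identityˡ _) (1^n n)

  geometric-sum : ∀ z n → (1# - z) * geometric z n ≈ 1# - z ^ n
  geometric-sum z zero    = ≈-trans (zeroʳ _) (≈-sym (-‿inverseʳ 1#))
  geometric-sum z (suc n) = begin
    (1# - z) * (1# + sum {n} (λ i → z * z ^ toℕ i))   ≈⟨ *-congˡ (+-congˡ (≈-sym (*-distribˡ-sum {n} z (λ i → z ^ toℕ i)))) ⟩
    (1# - z) * (1# + z * geometric z n)               ≈⟨ expand ⟩
    (1# - z) * 1# + z * ((1# - z) * geometric z n)    ≈⟨ +-cong (*-identityʳ _) (*-congˡ (geometric-sum z n)) ⟩
    (1# - z) + z * (1# - z ^ n)                       ≈⟨ +-congˡ (≈-trans (solve 3 (λ z o w → z :* (o :- w) := z :* o :- z :* w) ≈-refl z 1# (z ^ n)) (+-congʳ (*-identityʳ z))) ⟩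
    (1# - z) + (z - z * z ^ n)                        ≈⟨ solve 3 (λ o z w → (o :- z) :+ (z :- w) := o :- w) ≈-refl 1# z (z * z ^ n) ⟩
    1# - z ^ suc n                                    ∎
    where
    expand : (1# - z) * (1# + z * geometric z n) ≈ (1# - z) * 1# + z * ((1# - z) * geometric z n)
    expand = solve 3 (λ o z g → (o :- z) :* (o :+ z :* g) := (o :- z) :* o :+ z :* ((o :- z) :* g)) ≈-refl 1# z (geometric z n)

  module _ {ℓ′ : ℕ} (isPrime : Prime (suc ℓ′)) (char : suc ℓ′ · 1# ≈ 0#) where
    private
      ℓ = suc ℓ′

      -- By Pascal's rule, two neighbouring binomial coefficients of ℓ - 1 add up to one of ℓ, which
      -- vanishes in characteristic ℓ; so they alternate in sign, starting from 1.
      coefficient : ∀ k → k ℕ.≤ ℓ′ → (ℓ′ choose k) · 1# * (- 1#) ^ k ≈ 1#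
      coefficient zero    _   = ≈-trans (*-identityʳ _) (+-identityʳ _)
      coefficient (suc k) k<ℓ′ = begin
        c * (- 1# * u)        ≈⟨ solve 3 (λ c o u → c :* ((:- o) :* u) := (:- c) :* (o :* u)) ≈-refl c 1# u ⟩
        - c * (1# * u)        ≈⟨ *-cong (≈-sym pascal) (*-identityˡ u) ⟩
        (ℓ′ choose k) · 1# * u     ≈⟨ coefficient k (ℕ.<⇒≤ k<ℓ′) ⟩
        1#                    ∎
        where
        c = (ℓ′ choose suc k) · 1#
        u = (- 1#) ^ k
        pascal : (ℓ′ choose k) · 1# ≈ - c
        pascal = begin
          (ℓ′ choose k) · 1#                              ≈⟨ solve 2 (λ x c → x := (x :+ c) :- c) ≈-refl _ c ⟩
          ((ℓ′ choose k) · 1# + c) - c                    ≈⟨ +-congʳ (≈-sym (×-homo-+ 1# (ℓ′ choose k) (ℓ′ choose suc k))) ⟩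
          (ℓ′ choose k ℕ.+ ℓ′ choose suc k) · 1# - c           ≡⟨ cong (λ n → n · 1# - c) (nCk+nC[k+1]≡[n+1]C[k+1] ℓ′ k) ⟩
          (ℓ choose suc k) · 1# - c                       ≈⟨ +-congʳ (multiple (prime∣C isPrime (s≤s z≤n) (s≤s k<ℓ′))) ⟩
          0# - c                                     ≈⟨ +-identityˡ _ ⟩
          - c                                        ∎
          where
          multiple : ∀ {n} → ℓ ℕ.∣ n → n · 1# ≈ 0#
          multiple (ℕ.divides d refl) = ≈-trans (×1-homo-* d ℓ) (≈-trans (*-congˡ char) (zeroʳ _))

    [1-y]^[ℓ-1] : ∀ y → (1# - y) ^ ℓ′ ≈ geometric y ℓ
    [1-y]^[ℓ-1] y = begin
      (1# - y) ^ ℓ′        ≈⟨ ^-congˡ ℓ′ (+-comm _ _) ⟩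
      (- y + 1#) ^ ℓ′      ≈⟨ theorem ℓ′ (- y) 1# ⟩
      binomialExpansion (- y) 1# ℓ′  ≈⟨ sum-cong-≋ {ℓ} term ⟩
      geometric y ℓ        ∎
      where
      open import Algebra.Properties.CommutativeSemiring.Binomial commutativeSemiring using (theorem; binomialExpansion)
      term : ∀ (k : Fin ℓ) → (ℓ′ choose toℕ k) · ((- y) ^ toℕ k * 1# ^ (ℓ′ ℕ.∸ toℕ k)) ≈ y ^ toℕ k
      term k = begin
        (ℓ′ choose toℕ k) · ((- y) ^ toℕ k * 1# ^ (ℓ′ ℕ.∸ toℕ k))
          ≈⟨ ×-congʳ (ℓ′ choose toℕ k) (≈-trans (*-congˡ (1^n (ℓ′ ℕ.∸ toℕ k))) (≈-trans (*-identityʳ _) (≈-trans (^-congˡ (toℕ k) negate) (^-distrib-* (- 1#) y (toℕ k))))) ⟩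
        (ℓ′ choose toℕ k) · ((- 1#) ^ toℕ k * y ^ toℕ k)           ≈⟨ ×-congʳ (ℓ′ choose toℕ k) (*-identityˡ _) ⟨
        (ℓ′ choose toℕ k) · (1# * ((- 1#) ^ toℕ k * y ^ toℕ k))    ≈⟨ ×-assoc-* (ℓ′ choose toℕ k) 1# _ ⟨
        (ℓ′ choose toℕ k) · 1# * ((- 1#) ^ toℕ k * y ^ toℕ k)      ≈⟨ *-assoc _ _ _ ⟨
        (ℓ′ choose toℕ k) · 1# * (- 1#) ^ toℕ k * y ^ toℕ k        ≈⟨ *-congʳ (coefficient (toℕ k) (ℕ.≤-pred (Fin.toℕ<n k))) ⟩
        1# * y ^ toℕ k                                         ≈⟨ *-identityˡ _ ⟩
        y ^ toℕ k                                              ∎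
        where
        negate : - y ≈ - 1# * y
        negate = ≈-trans (-‿cong (≈-sym (*-identityˡ y))) (solve 2 (λ o y → :- (o :* y) := (:- o) :* y) ≈-refl 1# y)

    [1-y]^ℓ : ∀ m y → (1# - y) ^ (ℓ ℕ.^ m) ≈ 1# - y ^ (ℓ ℕ.^ m)
    [1-y]^ℓ zero    y = ≈-trans (*-identityʳ _) (+-congˡ (-‿cong (≈-sym (*-identityʳ y))))
    [1-y]^ℓ (suc m) y = begin
      (1# - y) ^ (ℓ ℕ.* ℓ ℕ.^ m)          ≡⟨ cong ((1# - y) ^_) (ℕ.*-comm ℓ (ℓ ℕ.^ m)) ⟩
      (1# - y) ^ (ℓ ℕ.^ m ℕ.* ℓ)          ≈⟨ ^-assocʳ (1# - y) (ℓ ℕ.^ m) ℓ ⟨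
      ((1# - y) ^ (ℓ ℕ.^ m)) ^ ℓ          ≈⟨ ^-congˡ ℓ ([1-y]^ℓ m y) ⟩
      (1# - y ^ (ℓ ℕ.^ m)) ^ ℓ            ≈⟨ *-congˡ ([1-y]^[ℓ-1] _) ⟩
      (1# - y ^ (ℓ ℕ.^ m)) * geometric (y ^ (ℓ ℕ.^ m)) ℓ  ≈⟨ geometric-sum _ ℓ ⟩
      1# - (y ^ (ℓ ℕ.^ m)) ^ ℓ            ≈⟨ +-congˡ (-‿cong (^-assocʳ y (ℓ ℕ.^ m) ℓ)) ⟩
      1# - y ^ (ℓ ℕ.^ m ℕ.* ℓ)            ≡⟨ cong (λ n → 1# - y ^ n) (ℕ.*-comm (ℓ ℕ.^ m) ℓ) ⟩
      1# - y ^ (ℓ ℕ.* ℓ ℕ.^ m)            ∎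

    -- The reduction modulo ℓ of the ℓᵐ⁺¹-th cyclotomic polynomial.
    cyclotomic-mod-ℓ : ∀ m y → (1# - y) ^ (ℓ ℕ.^ m ℕ.* ℓ′) ≈ geometric (y ^ (ℓ ℕ.^ m)) ℓ
    cyclotomic-mod-ℓ m y = ≈-trans (≈-sym (^-assocʳ (1# - y) (ℓ ℕ.^ m) ℓ′))
      (≈-trans (^-congˡ ℓ′ ([1-y]^ℓ m y)) ([1-y]^[ℓ-1] _))

-- ζ is a root of the ℓᵐ⁺¹-th cyclotomic polynomial in a torsion-free ring.
module RootsOfUnity (R : CommutativeRing 0ℓ 0ℓ) {ℓ′ : ℕ} (isPrime : Prime (suc ℓ′)) (m : ℕ) where
  open CommutativeRing R hiding (zero) renaming (refl to ≈-refl; sym to ≈-sym; trans to ≈-trans)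
  open Summation R
  open GeometricSums R
  open CyclicCovers R using (Cancellable; cancellable-*; IsPrincipalRoot)
  open import Relation.Binary.Reasoning.Setoid setoid

  private
    ℓ = suc ℓ′
    M = ℓ ℕ.^ m
    N = M ℕ.* ℓ

  module _ (torsionFree : ∀ n → Cancellable (suc n · 1#)) (ζ : Carrier) (cyclotomic : geometric (ζ ^ M) ℓ ≈ 0#) where

    cancellable-factor : ∀ {c d} → Cancellable (c * d) → Cancellable d
    cancellable-factor cd eq = cd (≈-trans (*-assoc _ _ _) (≈-trans (*-congˡ eq) (≈-sym (*-assoc _ _ _))))

    cancellable-≈ : ∀ {c d} → c ≈ d → Cancellable d → Cancellable c
    cancellable-≈ eq cd h = cd (≈-trans (*-congʳ (≈-sym eq)) (≈-trans h (*-congʳ eq)))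

    ζ^N : ζ ^ N ≈ 1#
    ζ^N = begin
      ζ ^ N                              ≈⟨ ^-assocʳ ζ M ℓ ⟨
      (ζ ^ M) ^ ℓ                        ≈⟨ solve 2 (λ o w → w := o :- (o :- w)) ≈-refl 1# _ ⟩
      1# - (1# - (ζ ^ M) ^ ℓ)            ≈⟨ +-congˡ (-‿cong (≈-trans (≈-sym (geometric-sum (ζ ^ M) ℓ)) (≈-trans (*-congˡ cyclotomic) (zeroʳ _)))) ⟩
      1# - 0#                            ≈⟨ ≈-trans (+-congˡ -0#≈0#) (+-identityʳ _) ⟩
      1#                                 ∎

    ζ^N* : ∀ k → ζ ^ (k ℕ.* N) ≈ 1#
    ζ^N* k = ≈-trans (reflexive (cong (ζ ^_) (ℕ.*-comm k N))) (≈-trans (≈-sym (^-assocʳ ζ N k)) (≈-trans (^-congˡ k ζ^N) (1^n k)))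

    -- 1 - ω divides ℓ.
    cancellable-ω : Cancellable (1# - ζ ^ M)
    cancellable-ω = cancellable-factor (cancellable-≈ (≈-sym ℓ≈) (torsionFree ℓ′))
      where
      ω = ζ ^ M
      -- As the full geometric sum vanishes, ℓ is the sum of all 1 - ωʲ, each a multiple of 1 - ω.
      ℓ≈ : ℓ · 1# ≈ sum {ℓ} (λ j → geometric ω (toℕ j)) * (1# - ω)
      ℓ≈ = begin
        ℓ · 1#                                               ≈⟨ sum-replicate ℓ ⟨
        sum {ℓ} (λ _ → 1#)                                   ≈⟨ sum-cong-≋ {ℓ} (λ j → solve 2 (λ o w → o := (o :- w) :+ w) ≈-refl 1# (ω ^ toℕ j)) ⟩
        sum {ℓ} (λ j → (1# - ω ^ toℕ j) + ω ^ toℕ j)         ≈⟨ ∑-distrib-+ {ℓ} (λ j → 1# - ω ^ toℕ j) (λ j → ω ^ toℕ j) ⟩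
        sum {ℓ} (λ j → 1# - ω ^ toℕ j) + geometric ω ℓ       ≈⟨ ≈-trans (+-congˡ cyclotomic) (+-identityʳ _) ⟩
        sum {ℓ} (λ j → 1# - ω ^ toℕ j)                       ≈⟨ sum-cong-≋ {ℓ} (λ j → ≈-trans (≈-sym (geometric-sum ω (toℕ j))) (*-comm _ _)) ⟩
        sum {ℓ} (λ j → geometric ω (toℕ j) * (1# - ω))       ≈⟨ *-distribʳ-sum {ℓ} (1# - ω) (λ j → geometric ω (toℕ j)) ⟨
        sum {ℓ} (λ j → geometric ω (toℕ j)) * (1# - ω)       ∎

    private
      -- Bézout: if N ∤ k then some multiple of k is M or -M modulo N.
      bezout : ∀ k → ¬ (N ℕ.∣ k) → (∃ λ t → ∃ λ y → M ℕ.+ y ℕ.* N ≡ k ℕ.* t) ⊎ (∃ λ t → ∃ λ y → M ℕ.+ k ℕ.* t ≡ y ℕ.* N)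
      bezout k N∤k with ℕ.gcd[m,n]∣n k N
      ... | ℕ.divides s eq = Sum.map plus minus (cases (ℕ.Bézout.identity (ℕ.gcd-GCD k N)))
        where
        g = ℕ.gcd k N
        M-multiple : ∃ λ s′ → M ≡ s′ ℕ.* g
        M-multiple with prime-power-divisor isPrime (suc m) s g (trans (sym eq) (ℕ.*-comm M ℓ))
        ... | inj₁ refl = contradiction (subst (ℕ._∣ k) (sym (trans eq (ℕ.*-identityˡ g))) (ℕ.gcd[m,n]∣m k N)) N∤k
        ... | inj₂ (ℕ.divides s′ refl) = s′ , ℕ.*-cancelʳ-≡ M (s′ ℕ.* g) ℓ (trans eq (trans (ℕ.*-assoc s′ ℓ g)
                (trans (cong (s′ ℕ.*_) (ℕ.*-comm ℓ g)) (sym (ℕ.*-assoc s′ g ℓ)))))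
        s′ = proj₁ M-multiple
        M≡ = proj₂ M-multiple
        cases : ℕ.Bézout.Identity g k N → (∃ λ x → ∃ λ y → g ℕ.+ y ℕ.* N ≡ x ℕ.* k) ⊎ (∃ λ x → ∃ λ y → g ℕ.+ x ℕ.* k ≡ y ℕ.* N)
        cases (ℕ.Bézout.+- x y eq) = inj₁ (x , y , eq)
        cases (ℕ.Bézout.-+ x y eq) = inj₂ (x , y , eq)
        scale : ∀ {a b c} → g ℕ.+ a ≡ b → c ≡ s′ ℕ.* a → M ℕ.+ c ≡ s′ ℕ.* b
        scale {a} refl refl = trans (cong (ℕ._+ s′ ℕ.* a) M≡) (sym (ℕ.*-distribˡ-+ s′ g a))
        shuffle : ∀ x → k ℕ.* (s′ ℕ.* x) ≡ s′ ℕ.* (x ℕ.* k)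
        shuffle x = trans (ℕ.*-comm k _) (ℕ.*-assoc s′ x k)
        plus : (∃ λ x → ∃ λ y → g ℕ.+ y ℕ.* N ≡ x ℕ.* k) → ∃ λ t → ∃ λ y → M ℕ.+ y ℕ.* N ≡ k ℕ.* t
        plus (x , y , eq) = s′ ℕ.* x , s′ ℕ.* y , trans (scale eq (ℕ.*-assoc s′ y N)) (sym (shuffle x))
        minus : (∃ λ x → ∃ λ y → g ℕ.+ x ℕ.* k ≡ y ℕ.* N) → ∃ λ t → ∃ λ y → M ℕ.+ k ℕ.* t ≡ y ℕ.* N
        minus (x , y , eq) = s′ ℕ.* x , s′ ℕ.* y , trans (scale eq (shuffle x)) (sym (ℕ.*-assoc s′ y N))

      divisor : ∀ k t → geometric (ζ ^ k) t * (1# - ζ ^ k) ≈ 1# - ζ ^ (k ℕ.* t)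
      divisor k t = ≈-trans (*-comm _ _) (≈-trans (geometric-sum (ζ ^ k) t) (+-congˡ (-‿cong (^-assocʳ ζ k t))))

    -- By Bézout, 1 - ζᵏ divides 1 - ω with ω = ζᴹ, and a factor of a non-zero-divisor is a
    -- non-zero-divisor.
    cancellable-1-ζ : ∀ k → ¬ (N ℕ.∣ k) → Cancellable (1# - ζ ^ k)
    cancellable-1-ζ k N∤k with bezout k N∤k
    ... | inj₁ (t , y , eq) = cancellable-factor (cancellable-≈ (≈-trans (divisor k t) (+-congˡ (-‿cong (begin
      ζ ^ (k ℕ.* t)              ≡⟨ cong (ζ ^_) (sym eq) ⟩
      ζ ^ (M ℕ.+ y ℕ.* N)        ≈⟨ ≈-trans (^-homo-* ζ M _) (≈-trans (*-congˡ (ζ^N* y)) (*-identityʳ _)) ⟩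
      ζ ^ M                      ∎)))) cancellable-ω)
    ... | inj₂ (t , y , eq) = cancellable-factor (cancellable-≈ (divisor k t) (cancellable-factor (cancellable-≈ (begin
      -- Here k t is congruent to -M modulo N, so ζ to the power k t is inverse to ζᴹ; the factor
      -- -ζᴹ converts 1 - ω⁻¹ into 1 - ω.
      - ζ ^ M * (1# - ζ ^ (k ℕ.* t))              ≈⟨ solve 3 (λ w o u → (:- w) :* (o :- u) := w :* u :- w :* o) ≈-refl _ 1# _ ⟩
      ζ ^ M * ζ ^ (k ℕ.* t) - ζ ^ M * 1#
        ≈⟨ +-cong (≈-trans (≈-sym (^-homo-* ζ M _)) (≈-trans (reflexive (cong (ζ ^_) eq)) (ζ^N* y))) (-‿cong (*-identityʳ _)) ⟩
      1# - ζ ^ M                                  ∎) cancellable-ω)))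

    geometric-vanish : ∀ k n → ¬ (N ℕ.∣ k) → ζ ^ (k ℕ.* n) ≈ 1# → geometric (ζ ^ k) n ≈ 0#
    geometric-vanish k n N∤k eq = cancellable-1-ζ k N∤k (begin
      (1# - ζ ^ k) * geometric (ζ ^ k) n   ≈⟨ geometric-sum (ζ ^ k) n ⟩
      1# - (ζ ^ k) ^ n                     ≈⟨ +-congˡ (-‿cong (≈-trans (^-assocʳ ζ k n) eq)) ⟩
      1# - 1#                              ≈⟨ -‿inverseʳ 1# ⟩
      0#                                   ≈⟨ zeroʳ _ ⟨
      (1# - ζ ^ k) * 0#                    ∎)

    private
      ∑-geometric : ∀ n z → ∑ (Fin-finite n) (λ i → z ^ toℕ i) ≈ geometric z n
      ∑-geometric n z = ∑-def (Fin-finite n) _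

    principalRoot : IsPrincipalRoot N ζ
    principalRoot = record
      { power  = ζ^N
      ; vanish = λ k N∤k → ≈-trans (∑-cong (Fin-finite N) (λ i → ≈-trans (reflexive (cong (ζ ^_) (ℕ.*-comm (toℕ i) k))) (≈-sym (^-assocʳ ζ k (toℕ i)))))
          (≈-trans (∑-geometric N (ζ ^ k)) (geometric-vanish k N N∤k (ζ^N* k)))
      }

    principalRoot-below : IsPrincipalRoot M (ζ ^ ℓ)
    principalRoot-below = record
      { power  = ≈-trans (^-assocʳ ζ ℓ M) (≈-trans (reflexive (cong (ζ ^_) (ℕ.*-comm ℓ M))) ζ^N)
      ; vanish = λ k M∤k → ≈-trans (∑-cong (Fin-finite M) (λ i → ≈-trans (^-assocʳ ζ ℓ (toℕ i ℕ.* k))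
          (≈-trans (reflexive (cong (ζ ^_) (trans (cong (ℓ ℕ.*_) (ℕ.*-comm (toℕ i) k)) (sym (ℕ.*-assoc ℓ k (toℕ i)))))) (≈-sym (^-assocʳ ζ (ℓ ℕ.* k) (toℕ i))))))
          (≈-trans (∑-geometric M (ζ ^ (ℓ ℕ.* k))) (geometric-vanish (ℓ ℕ.* k) M
            (λ N∣ → M∤k (ℕ.*-cancelˡ-∣ ℓ (subst (ℕ._∣ ℓ ℕ.* k) (ℕ.*-comm M ℓ) N∣)))
            (≈-trans (reflexive (cong (ζ ^_) (trans (cong (ℕ._* M) (ℕ.*-comm ℓ k)) (trans (ℕ.*-assoc k ℓ M) (cong (k ℕ.*_) (ℕ.*-comm ℓ M)))))) (ζ^N* k))))
      }

    -- N does not divide i M when ℓ does not divide i, so the factor 1 - ζ to the power i M can be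
    -- cancelled from the telescoped geometric sum.
    conjugate-cyclotomic : ∀ i → ¬ (ℓ ℕ.∣ i) → geometric ((ζ ^ i) ^ M) ℓ ≈ 0#
    conjugate-cyclotomic i ℓ∤i = ≈-trans (sum-cong-≋ {ℓ} (λ j → ^-congˡ (toℕ j) (^-assocʳ ζ i M)))
      (geometric-vanish (i ℕ.* M) ℓ (λ N∣ → ℓ∤i (ℕ.*-cancelˡ-∣ M {{ℕ.m^n≢0 ℓ m}} (subst (N ℕ.∣_) (ℕ.*-comm i M) N∣)))
        (≈-trans (reflexive (cong (ζ ^_) (ℕ.*-assoc i M ℓ))) (ζ^N* i)))

module HomProperties {R S : CommutativeRing 0ℓ 0ℓ} {h : CommutativeRing.Carrier R → CommutativeRing.Carrier S} (h-hom : IsHom R S h) where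
  private
    module R = CommutativeRing R
    module S = CommutativeRing S
    module ΣR = Summation R
    module ΣS = Summation S
    open import Algebra.Properties.Semiring.Exp R.semiring using () renaming (_^_ to _^ᴿ_)
    open import Algebra.Properties.Semiring.Exp S.semiring using () renaming (_^_ to _^ˢ_)
  open IsHom h-hom

  ^-homo : ∀ x n → h (x ^ᴿ n) S.≈ h x ^ˢ n
  ^-homo x zero    = 1-homo
  ^-homo x (suc n) = S.trans (*-homo _ _) (S.*-congˡ (^-homo x n))

  multiple-homo : ∀ n → h (n ΣR.· R.1#) S.≈ n ΣS.· S.1#
  multiple-homo zero    = 0-homo
  multiple-homo (suc n) = S.trans (+-homo _ _) (S.+-cong 1-homo (multiple-homo n))

  sum-homo : ∀ n (f : Fin n → R.Carrier) → h (ΣR.sum f) S.≈ ΣS.sum (λ i → h (f i))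
  sum-homo zero    f = 0-homo
  sum-homo (suc n) f = S.trans (+-homo _ _) (S.+-congˡ (sum-homo n (f ∘ suc)))

  when-homo : {P : Set} (d : Dec P) (x : R.Carrier) → h (ΣR.when d x) S.≈ ΣS.when d (h x)
  when-homo (yes _) x = S.refl
  when-homo (no _)  x = 0-homo

  opaque
    unfolding ΣR.∑ ΣS.∑

    ∑-homo : {A : Set} (FA : Finite A) (f : A → R.Carrier) → h (ΣR.∑ FA f) S.≈ ΣS.∑ FA (λ a → h (f a))
    ∑-homo FA f = sum-homo (Finite.size FA) _

  laplacian-homo : ∀ Γ wt v w → h (MatrixTree.laplacian R Γ wt v w) S.≈ MatrixTree.laplacian S Γ (h ∘ wt) v w
  laplacian-homo Γ wt v w = S.trans (∑-homo E-finite _) (ΣS.∑-cong E-finite (λ e → S.trans (when-homo (o e Vᶠ.≟ v) _)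
    (ΣS.when-cong (o e Vᶠ.≟ v) (λ _ → S.trans (+-homo _ _) (S.+-cong
      (S.trans (when-homo (v Vᶠ.≟ w) _) (ΣS.when-cong (v Vᶠ.≟ w) (λ _ → 1-homo)))
      (S.trans (-‿homo _) (S.-‿cong (S.trans (*-homo _ _) (S.*-congˡ
        (S.trans (when-homo (t e Vᶠ.≟ w) _) (ΣS.when-cong (t e Vᶠ.≟ w) (λ _ → 1-homo)))))))))))) 
    where open Graph Γ

quotient-hom : (R : CommutativeRing 0ℓ 0ℓ) (c : CommutativeRing.Carrier R) → IsHom R (R /⟨ c ⟩) id
quotient-hom R c = record
  { +-homo = λ _ _ → quotient-≈ R c ≈-refl ; *-homo = λ _ _ → quotient-≈ R c ≈-refl ; -‿homo = λ _ → quotient-≈ R c ≈-refl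
  ; 0-homo = quotient-≈ R c ≈-refl ; 1-homo = quotient-≈ R c ≈-refl }
  where open CommutativeRing R using () renaming (refl to ≈-refl)

-- The ring ℤ[ζ], ζ of order ℓᵐ⁺¹: the sequences on which it acts are those killed by the cyclotomic polynomial.
module Cyclotomic {ℓ′ : ℕ} (isPrime : Prime (suc ℓ′)) (m : ℕ) where
  ℓ M : ℕ
  ℓ = suc ℓ′
  M = ℓ ℕ.^ m

  instance
    M-nonZero : ℕ.NonZero M
    M-nonZero = ℕ.m^n≢0 ℓ m

  private
    module Σℤ = Summation ℤ.+-*-commutativeRing

  -- The ℓᵐ⁺¹-th cyclotomic polynomial is the sum of the Xʲᴹ with j < ℓ, and this sum is its action
  -- on f.
  Good : (ℕ → ℤ) → Set
  Good f = ∀ k → Σℤ.sum {ℓ} (λ j → f (k ℕ.+ toℕ j ℕ.* M)) ≡ + 0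

  good-act : ∀ p {f} → Good f → Good (act p f)
  good-act X            g k = g (suc k)
  good-act (constant c) {f} g k = trans (sym (Σℤ.*-distribˡ-sum {ℓ} c (λ j → f (k ℕ.+ toℕ j ℕ.* M)))) (trans (cong (c ℤ.*_) (g k)) (ℤ.*-zeroʳ c))
  good-act (p ⊕ q) {f}  g k = trans (Σℤ.∑-distrib-+ {ℓ} (λ j → act p f (k ℕ.+ toℕ j ℕ.* M)) (λ j → act q f (k ℕ.+ toℕ j ℕ.* M))) (cong₂ ℤ._+_ (good-act p g k) (good-act q g k))
  good-act (p ⊗ q)      g   = good-act p (good-act q g)
  good-act (⊖ p) {f}    g k = trans
    (Σℤ.sum-cong-≋ {ℓ} {λ j → ℤ.- act p f (k ℕ.+ toℕ j ℕ.* M)} (λ j → sym (ℤ.-1*i≡-i (act p f (k ℕ.+ toℕ j ℕ.* M)))))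
    (trans (sym (Σℤ.*-distribˡ-sum {ℓ} (ℤ.- (+ 1)) (λ j → act p f (k ℕ.+ toℕ j ℕ.* M)))) (cong (ℤ.- (+ 1) ℤ.*_) (good-act p g k)))

  open ShiftRing Good good-act public

  open CommutativeRing shiftRing public hiding (zero) renaming (refl to ≈-refl; sym to ≈-sym; trans to ≈-trans)
  open Summation shiftRing public
  open GeometricSums shiftRing public

  ζ : Carrier
  ζ = X

  cyclotomic : geometric (ζ ^ M) ℓ ≈ 0#
  cyclotomic = ≈-trans (sum-cong-≋ {ℓ} {λ j → (ζ ^ M) ^ toℕ j} {λ j → ζ ^ (M ℕ.* toℕ j)} (λ j → ^-assocʳ ζ M (toℕ j))) (mk≋ λ f g k →
    trans (act-sum ℓ (λ j → ζ ^ (M ℕ.* toℕ j)) f k)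
      (trans (Σℤ.sum-cong-≋ {ℓ} (λ j → trans (act-^ (M ℕ.* toℕ j) f k) (cong f (trans (ℕ.+-comm _ k) (cong (k ℕ.+_) (ℕ.*-comm M (toℕ j)))))))
        (g k)))
    where
    act-sum : ∀ n (p : Fin n → Carrier) f k → act (sum p) f k ≡ Σℤ.sum (λ j → act (p j) f k)
    act-sum zero    p f k = refl
    act-sum (suc n) p f k = cong (λ z → act (p zero) f k ℤ.+ z) (act-sum n (p ∘ suc) f k)

  private
    -- A sequence of the right kind that is congruent to the constant 1 modulo ℓ.
    excess : ℕ → ℤ
    excess a with a ℕ.% ℓ ℕ.≟ 0
    ... | yes _ = ℤ.- (+ 1)
    ... | no _  = + 0

    -- The value is 1 - ℓ at multiples of ℓ and 1 elsewhere, so that any ℓ consecutive values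
    -- cancel. The product `+ 1 ℤ.* + 1` gives it the shape of `act-linear`.
    wave : ℕ → ℤ
    wave a = + 1 ℤ.* + 1 ℤ.+ + ℓ ℤ.* excess a

    excess-cong : ∀ {a b} → a ℕ.% ℓ ≡ b ℕ.% ℓ → excess a ≡ excess b
    excess-cong {a} {b} eq with a ℕ.% ℓ ℕ.≟ 0 | b ℕ.% ℓ ℕ.≟ 0
    ... | yes _ | yes _ = refl
    ... | no _  | no _  = refl
    ... | yes p | no ¬p = contradiction (trans (sym eq) p) ¬p
    ... | no ¬p | yes p = contradiction (trans eq p) ¬p

    window : ∀ n a → Σℤ.sum {n} (λ j → wave (suc a ℕ.+ toℕ j)) ℤ.+ wave a ≡ Σℤ.sum {n} (λ j → wave (a ℕ.+ toℕ j)) ℤ.+ wave (a ℕ.+ n)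
    window zero    a = cong (λ b → + 0 ℤ.+ wave b) (sym (ℕ.+-identityʳ a))
    window (suc n) a = begin
      (wave (suc a ℕ.+ 0) ℤ.+ Σℤ.sum {n} (λ j → wave (suc a ℕ.+ suc (toℕ j)))) ℤ.+ wave a
        ≡⟨ cong (ℤ._+ wave a) (trans (ℤ.+-comm (wave (suc a ℕ.+ 0)) (Σℤ.sum {n} (λ j → wave (suc a ℕ.+ suc (toℕ j))))) (cong₂ ℤ._+_ (Σℤ.sum-cong-≋ {n} (λ j → cong wave (ℕ.+-suc (suc a) (toℕ j)))) (cong wave (ℕ.+-identityʳ (suc a))))) ⟩
      (Σℤ.sum {n} (λ j → wave (suc (suc a) ℕ.+ toℕ j)) ℤ.+ wave (suc a)) ℤ.+ wave a
        ≡⟨ cong (ℤ._+ wave a) (window n (suc a)) ⟩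
      (Σℤ.sum {n} (λ j → wave (suc a ℕ.+ toℕ j)) ℤ.+ wave (suc a ℕ.+ n)) ℤ.+ wave a
        ≡⟨ rearrange (Σℤ.sum {n} (λ j → wave (suc a ℕ.+ toℕ j))) (wave (suc a ℕ.+ n)) (wave a) ⟩
      (wave a ℤ.+ Σℤ.sum {n} (λ j → wave (suc a ℕ.+ toℕ j))) ℤ.+ wave (suc a ℕ.+ n)
        ≡⟨ cong₂ ℤ._+_ (cong₂ ℤ._+_ (cong wave (sym (ℕ.+-identityʳ a))) (Σℤ.sum-cong-≋ {n} (λ j → cong wave (sym (ℕ.+-suc a (toℕ j)))))) (cong wave (sym (ℕ.+-suc a n))) ⟩
      (wave (a ℕ.+ 0) ℤ.+ Σℤ.sum {n} (λ j → wave (a ℕ.+ suc (toℕ j)))) ℤ.+ wave (a ℕ.+ suc n) ∎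
      where
      open ≡.≡-Reasoning
      rearrange : ∀ x y z → (x ℤ.+ y) ℤ.+ z ≡ (z ℤ.+ x) ℤ.+ y
      rearrange = solve-∀

    -- The window at 0 is computed directly. Moving it by one step replaces a value by the one ℓ
    -- places further on, which is equal to it.
    window-zero : ∀ a → Σℤ.sum {ℓ} (λ j → wave (a ℕ.+ toℕ j)) ≡ + 0
    window-zero zero    = trans (cong₂ ℤ._+_ {wave 0} {+ 1 ℤ.* + 1 ℤ.+ + ℓ ℤ.* (ℤ.- (+ 1))} refl (rest ℓ′ 1 ℕ.≤-refl)) (total (+ ℓ′))
      where
      rest : ∀ n a → a ℕ.+ n ℕ.≤ suc ℓ′ → {{_ : ℕ.NonZero a}} → Σℤ.sum {n} (λ j → wave (a ℕ.+ toℕ j)) ≡ + n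
      rest zero    a le = refl
      rest (suc n) a le = cong₂ ℤ._+_ (one (a ℕ.+ 0) (subst (ℕ._≤ suc ℓ′) (trans (ℕ.+-suc a n) (cong (λ b → suc b ℕ.+ n) (sym (ℕ.+-identityʳ a)))) le) (subst ℕ.NonZero (sym (ℕ.+-identityʳ a)) it))
        (trans (Σℤ.sum-cong-≋ {n} (λ j → cong wave (ℕ.+-suc a (toℕ j)))) (rest n (suc a) (subst (ℕ._≤ suc ℓ′) (ℕ.+-suc a n) le)))
        where
        one : ∀ b → suc b ℕ.+ n ℕ.≤ suc ℓ′ → ℕ.NonZero b → wave b ≡ + 1
        one b lt nz with b ℕ.% ℓ ℕ.≟ 0
        ... | no _   = trans (cong (λ z → + 1 ℤ.* + 1 ℤ.+ z) (ℤ.*-zeroʳ (+ ℓ))) refl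
        ... | yes eq = contradiction (trans (sym (ℕ.m<n⇒m%n≡m (ℕ.≤-trans (ℕ.m≤m+n (suc b) n) lt))) eq) (ℕ.≢-nonZero⁻¹ b {{nz}})
      total : ∀ x → (+ 1 ℤ.* + 1 ℤ.+ (+ 1 ℤ.+ x) ℤ.* (ℤ.- (+ 1))) ℤ.+ x ≡ + 0
      total = solve-∀
    window-zero (suc a) = ∙-cancelʳ (wave a) _ _ (trans (window ℓ a) (cong₂ ℤ._+_ (window-zero a)
      (cong (λ x → + 1 ℤ.* + 1 ℤ.+ + ℓ ℤ.* x) (excess-cong {a ℕ.+ ℓ} {a} (ℕ.[m+n]%n≡m%n a ℓ)))))
      where open import Algebra.Properties.AbelianGroup ℤ.+-0-abelianGroup using (∙-cancelʳ)

    -- Constant on blocks of length M, so that steps of M run through consecutive values of `wave`.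
    test : ℕ → ℤ
    test k = wave (k ℕ./ M)

    test-good : Good test
    test-good k = trans (Σℤ.sum-cong-≋ {ℓ} (λ j → cong wave (trans (ℕ.+-distrib-/-∣ʳ k (ℕ.n∣m*n (toℕ j)))
      (cong (k ℕ./ M ℕ.+_) (ℕ.m*n/n≡m (toℕ j) M))))) (window-zero (k ℕ./ M))

  -- `test` is an admissible sequence congruent to the constant 1 modulo ℓ, and on that constant a
  -- polynomial acts as its augmentation.
  augment-mod-ℓ : ∀ {p q} → p ≈ q → + ℓ ℤ.∣ augment p ℤ.- augment q
  augment-mod-ℓ {p} {q} eq = ℤ.divides (y ℤ.- x) (begin
    augment p ℤ.- augment q                                            ≡⟨ shift (augment p) (augment q) x (+ ℓ) ⟩
    ((+ 1 ℤ.* augment p ℤ.+ + ℓ ℤ.* x) ℤ.- augment q) ℤ.- + ℓ ℤ.* x       ≡⟨ cong (λ z → (z ℤ.- augment q) ℤ.- + ℓ ℤ.* x) same ⟩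
    ((+ 1 ℤ.* augment q ℤ.+ + ℓ ℤ.* y) ℤ.- augment q) ℤ.- + ℓ ℤ.* x       ≡⟨ collect (augment q) x y (+ ℓ) ⟩
    (y ℤ.- x) ℤ.* + ℓ                                                  ∎)
    where
    open ≡.≡-Reasoning
    x = act p (λ k → excess (k ℕ./ M)) 0
    y = act q (λ k → excess (k ℕ./ M)) 0
    value : ∀ r → act r test 0 ≡ + 1 ℤ.* augment r ℤ.+ + ℓ ℤ.* act r (λ k → excess (k ℕ./ M)) 0
    value r = trans (act-linear r (+ 1) (+ ℓ) (λ _ → + 1) (λ k → excess (k ℕ./ M)) 0) (cong (λ z → + 1 ℤ.* z ℤ.+ + ℓ ℤ.* act r (λ k → excess (k ℕ./ M)) 0) (act-1 r 0))
    same : + 1 ℤ.* augment p ℤ.+ + ℓ ℤ.* x ≡ + 1 ℤ.* augment q ℤ.+ + ℓ ℤ.* y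
    same = trans (sym (value p)) (trans (apply eq test test-good 0) (value q))
    shift : ∀ a b x l → a ℤ.- b ≡ ((+ 1 ℤ.* a ℤ.+ l ℤ.* x) ℤ.- b) ℤ.- l ℤ.* x
    shift = solve-∀
    collect : ∀ b x y l → ((+ 1 ℤ.* b ℤ.+ l ℤ.* y) ℤ.- b) ℤ.- l ℤ.* x ≡ (y ℤ.- x) ℤ.* l
    collect = solve-∀

  -- Prime to the prime above ℓ.
  Unit : Carrier → Set
  Unit p = ¬ (ℓ ℕ.∣ ℤ.∣ augment p ∣)

  unit-* : ∀ {p q} → Unit p → Unit q → Unit (p * q)
  unit-* {p} {q} up uq ℓ∣ with euclidsLemma ℤ.∣ augment p ∣ ℤ.∣ augment q ∣ isPrime (subst (ℓ ℕ.∣_) (ℤ.abs-* (augment p) (augment q)) ℓ∣)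
  ... | inj₁ ℓ∣p = up ℓ∣p
  ... | inj₂ ℓ∣q = uq ℓ∣q

  unit-1 : Unit 1#
  unit-1 ℓ∣1 = ¬prime[1] (subst Prime (ℕ.∣1⇒≡1 ℓ∣1) isPrime)

  unit-^ : ∀ {p} → Unit p → ∀ n → Unit (p ^ n)
  unit-^     up zero    = unit-1
  unit-^ {p} up (suc n) = unit-* {p} {p ^ n} up (unit-^ {p} up n)

  unit-Π : ∀ {n} {f : Fin n → Carrier} → (∀ i → Unit (f i)) → Unit (Π.sum f)
  unit-Π {zero}      u = unit-1
  unit-Π {suc n} {f} u = unit-* {f zero} {Π.sum (f ∘ suc)} (u zero) (unit-Π (u ∘ suc))

  unit-+ : ∀ {p q} → Unit p → augment q ≡ + 0 → Unit (p + q)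
  unit-+ {p} {q} up eq ℓ∣ = up (subst (λ z → ℓ ℕ.∣ ℤ.∣ z ∣) (trans (cong (λ z → augment p ℤ.+ z) eq) (ℤ.+-identityʳ (augment p))) ℓ∣)

  -- If b exceeded a, cancelling ℓᵃ would leave a multiple of ℓ on the right, so ℓ would divide the
  -- augmentation of A u, although it divides neither factor. This takes the place of a valuation on
  -- ℤ[ζ].
  valuation-≤ : ∀ a b {A B u v} → ¬ (ℓ ℕ.∣ A) → Unit u → ((ℓ ℕ.^ a ℕ.* A) · 1#) * u ≈ ((ℓ ℕ.^ b ℕ.* B) · 1#) * v → b ℕ.≤ a
  valuation-≤ a b {A} {B} {u} {v} ℓ∤A uu eq with ℕ.≤-<-connex b a
  ... | inj₁ b≤a = b≤a
  ... | inj₂ a<b = contradiction divides-Au (λ ℓ∣ → [ ℓ∤A , uu ]′ (euclidsLemma A ℤ.∣ augment u ∣ isPrime ℓ∣))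
    where
    open import Relation.Binary.Reasoning.Setoid setoid
    c = b ℕ.∸ suc a
    b≡ : a ℕ.+ suc c ≡ b
    b≡ = trans (ℕ.+-suc a c) (ℕ.m+[n∸m]≡n a<b)
    reduced : (A · 1#) * u ≈ ((ℓ ℕ.* (ℓ ℕ.^ c ℕ.* B)) · 1#) * v
    reduced = subst (λ n → ∀ {x y} → (n · 1#) * x ≈ (n · 1#) * y → x ≈ y) (ℕ.suc-pred (ℓ ℕ.^ a) {{ℕ.m^n≢0 ℓ a}}) (torsionFree (ℕ.pred (ℓ ℕ.^ a))) (begin
      ((ℓ ℕ.^ a) · 1#) * ((A · 1#) * u)         ≈⟨ *-assoc _ _ _ ⟨
      ((ℓ ℕ.^ a) · 1#) * (A · 1#) * u           ≈⟨ *-congʳ (×1-homo-* (ℓ ℕ.^ a) A) ⟨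
      ((ℓ ℕ.^ a ℕ.* A) · 1#) * u                ≈⟨ eq ⟩
      ((ℓ ℕ.^ b ℕ.* B) · 1#) * v
        ≡⟨ cong (λ n → (n · 1#) * v) (trans (cong (λ b → ℓ ℕ.^ b ℕ.* B) (sym b≡)) (trans (cong (ℕ._* B) (ℕ.^-distribˡ-+-* ℓ a (suc c)))
             (trans (ℕ.*-assoc (ℓ ℕ.^ a) _ B) (cong (ℓ ℕ.^ a ℕ.*_) (ℕ.*-assoc ℓ (ℓ ℕ.^ c) B))))) ⟩
      ((ℓ ℕ.^ a ℕ.* (ℓ ℕ.* (ℓ ℕ.^ c ℕ.* B))) · 1#) * v   ≈⟨ *-congʳ (×1-homo-* (ℓ ℕ.^ a) _) ⟩
      ((ℓ ℕ.^ a) · 1#) * ((ℓ ℕ.* (ℓ ℕ.^ c ℕ.* B)) · 1#) * v  ≈⟨ *-assoc _ _ _ ⟩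
      ((ℓ ℕ.^ a) · 1#) * (((ℓ ℕ.* (ℓ ℕ.^ c ℕ.* B)) · 1#) * v)  ∎)
    D = ℓ ℕ.^ c ℕ.* B
    divides-Au : ℓ ℕ.∣ A ℕ.* ℤ.∣ augment u ∣
    divides-Au = subst (ℓ ℕ.∣_) (ℤ.abs-* (+ A) (augment u)) (ℤ.∣⇒∣ᵤ (subst (+ ℓ ℤ.∣_) (sum≡ (+ A ℤ.* augment u) (+ (ℓ ℕ.* D) ℤ.* augment v))
      (ℤ.∣m∣n⇒∣m+n
        (subst (+ ℓ ℤ.∣_) (cong₂ (λ x y → x ℤ.* augment u ℤ.- y ℤ.* augment v) (augment-multiple A) (augment-multiple (ℓ ℕ.* D))) (augment-mod-ℓ reduced))
        (ℤ.divides (+ D ℤ.* augment v) (trans (cong (ℤ._* augment v) (ℤ.pos-* ℓ D)) (commute (+ ℓ) (+ D) (augment v)))))))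
      where
      sum≡ : ∀ x y → (x ℤ.- y) ℤ.+ y ≡ x
      sum≡ = solve-∀
      commute : ∀ l d v → (l ℤ.* d) ℤ.* v ≡ (d ℤ.* v) ℤ.* l
      commute = solve-∀

-- Valuations of spanning-tree numbers

module RingIdentities (R : CommutativeRing 0ℓ 0ℓ) where
  open CommutativeRing R hiding (zero) renaming (refl to ≈-refl; sym to ≈-sym; trans to ≈-trans)
  open IntegerCoefficients R
  open import Algebra.Properties.CommutativeSemiring.Exp commutativeSemiring
  open import Relation.Binary.Reasoning.Setoid setoid

  pull-scalar : ∀ t p g l e → t * (p * g + l * e) ≈ p * (t * g) + e * (l * t)
  pull-scalar = solve 5 (λ t p g l e → t :* (p :* g :+ l :* e) := p :* (t :* g) :+ e :* (l :* t)) ≈-refl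

  factor-left : ∀ p g e q → p * g + e * (p * q) ≈ p * (g + e * q)
  factor-left = solve 4 (λ p g e q → p :* g :+ e :* (p :* q) := p :* (g :+ e :* q)) ≈-refl

  factor-scalar : ∀ l t g e → l * t * g + l * e ≈ l * (t * g + e)
  factor-scalar = solve 4 (λ l t g e → l :* t :* g :+ l :* e := l :* (t :* g :+ e)) ≈-refl

  add-multiples : ∀ x y t u v → x + t * u + (y + t * v) ≈ x + y + t * (u + v)
  add-multiples = solve 5 (λ x y t u v → x :+ t :* u :+ (y :+ t :* v) := (x :+ y) :+ t :* (u :+ v)) ≈-refl

  mul-multiples : ∀ x y t u v b → x * (y + t * v) + t * u * b ≈ x * y + t * (x * v + u * b)
  mul-multiples = solve 6 (λ x y t u v b → x :* (y :+ t :* v) :+ t :* u :* b := x :* y :+ t :* (x :* v :+ u :* b)) ≈-refl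

  neg-multiple : ∀ x t u → - (x + t * u) ≈ - x + t * - u
  neg-multiple = solve 3 (λ x t u → :- (x :+ t :* u) := :- x :+ t :* (:- u)) ≈-refl

  step-order : ∀ l c t u g e → l * c + t * (u * g + l * e) ≈ t * u * g + l * (c + t * e)
  step-order = solve 6 (λ l c t u g e → l :* c :+ t :* (u :* g :+ l :* e) := t :* u :* g :+ l :* (c :+ t :* e)) ≈-refl

  swap-^ : ∀ a m n → (a ^ m) ^ n ≈ (a ^ n) ^ m
  swap-^ a m n = ≈-trans (^-assocʳ a m n) (≈-trans (reflexive (cong (a ^_) (ℕ.*-comm m n))) (≈-sym (^-assocʳ a n m)))

  -- Eliminates the uniformizer: `P` is the product of the 1 - ζⁱ, and its n-th power is an integer
  -- times Δ. The variables K, D, Δ, E, L stand for κ₂, the product of the Q i, that of the θ i,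
  -- that of the unit cofactors, and ℓ.
  power-relation : ∀ K D Δ P E L b n → Δ * D ≈ P ^ b * E → P ^ n ≈ L ^ n * Δ →
                   (K * D) ^ n * Δ ^ n ≈ K ^ n * (L ^ n) ^ b * (Δ ^ b * E ^ n)
  power-relation K D Δ P E L b n ΔD P^n = begin
    (K * D) ^ n * Δ ^ n                             ≈⟨ ^-distrib-* (K * D) Δ n ⟨
    (K * D * Δ) ^ n                                 ≈⟨ ^-congˡ n (≈-trans (*-assoc K D Δ) (*-congˡ (≈-trans (*-comm D Δ) ΔD))) ⟩
    (K * (P ^ b * E)) ^ n                           ≈⟨ ≈-trans (^-distrib-* K (P ^ b * E) n) (*-congˡ (^-distrib-* (P ^ b) E n)) ⟩
    K ^ n * ((P ^ b) ^ n * E ^ n)                   ≈⟨ *-congˡ (*-congʳ (≈-trans (swap-^ P b n) (≈-trans (^-congˡ b P^n) (^-distrib-* (L ^ n) Δ b)))) ⟩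
    K ^ n * ((L ^ n) ^ b * Δ ^ b * E ^ n)           ≈⟨ ≈-trans (*-congˡ (*-assoc _ _ _)) (≈-sym (*-assoc _ _ _)) ⟩
    K ^ n * (L ^ n) ^ b * (Δ ^ b * E ^ n)           ∎

module Valuation {ℓ′ : ℕ} (isPrime : Prime (suc ℓ′)) (m : ℕ) where
  open Cyclotomic isPrime m
  open Determinant shiftRing using (det; det-cong)
  open MatrixTree shiftRing using (laplacian)
  open CyclicCovers shiftRing using (κ-cover; IsPrincipalRoot; Cancellable)
  open RootsOfUnity shiftRing isPrime m using (principalRoot; principalRoot-below; conjugate-cyclotomic)
  open RingIdentities shiftRing using (pull-scalar; factor-left; factor-scalar; swap-^; power-relation)
  open import Relation.Binary.Reasoning.Setoid setoid

  private
    module P where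
      open CommutativeRing ℤ[X].shiftRing public
      open Summation ℤ[X].shiftRing public
      open GeometricSums ℤ[X].shiftRing public
      open RingIdentities ℤ[X].shiftRing public using (add-multiples; mul-multiples; neg-multiple; step-order)

    Pℓ : CommutativeRing 0ℓ 0ℓ
    Pℓ = ℤ[X].shiftRing /⟨ ℓ P.· P.1# ⟩

  φ : ℕ
  φ = M ℕ.* ℓ′

  infix 4 _≈ℓ_
  _≈ℓ_ : Carrier → Carrier → Set
  _≈ℓ_ = _≈/_ shiftRing (ℓ · 1#)

  π : ℕ → Carrier
  π i = 1# - ζ ^ i

  private
    prime-pred : ∀ n → Prime (suc n) → ∃ λ k → n ≡ suc k
    prime-pred zero    pr = contradiction pr ¬prime[1]
    prime-pred (suc k) pr = k , refl

  0<φ : 0 ℕ.< φ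
  0<φ = let k , eq = prime-pred ℓ′ isPrime in subst (λ n → 0 ℕ.< M ℕ.* n) (sym eq)
    (ℕ.<-≤-trans (ℕ.>-nonZero⁻¹ M) (ℕ.m≤m*n M (suc k)))

  module Eval (i : ℕ) where
    hom : IsHom ℤ[X].shiftRing shiftRing (power i)
    hom = power-hom {Good} {good-act} i
    open HomProperties hom public
    open IsHom hom public

    X-power : power i X ≈ ζ ^ i
    X-power = reflexive (same i)
      where
      same : ∀ n → X P.^ n ≡ X ^ n
      same zero    = refl
      same (suc n) = cong (X ⊗_) (same n)

    π-power : ∀ n → power i ((P.1# P.- X) P.^ n) ≈ π i ^ n
    π-power n = ≈-trans (^-homo (P.1# P.- X) n) (^-congˡ n (+-congˡ (-‿cong X-power)))

  private
    quotient : IsHom ℤ[X].shiftRing Pℓ id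
    quotient = quotient-hom ℤ[X].shiftRing (ℓ P.· P.1#)

    opaque
      -- The congruence modulo ℓ is unpacked to an equation in ℤ[X], so that a single cofactor d
      -- serves every conjugate of ζ.
      uniformizer : ∃ λ d → (P.1# P.- X) P.^ φ P.≈ P.geometric (X P.^ M) ℓ P.+ (ℓ P.· P.1#) P.* d
      uniformizer = Q.trans (^-homo (P.1# P.- X) φ) (Q.trans (G.cyclotomic-mod-ℓ isPrime char m X)
        (Q.sym (Q.trans (sum-homo ℓ (λ j → (X P.^ M) P.^ toℕ j)) (ΣQ.sum-cong-≋ {ℓ} (λ j → Q.trans (^-homo (X P.^ M) (toℕ j)) (G.^-congˡ (toℕ j) (^-homo X M)))))))
        where
        module Q = CommutativeRing Pℓ
        module G = GeometricSums Pℓ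
        module ΣQ = Summation Pℓ
        open HomProperties quotient
        char : ℓ ΣQ.· Q.1# Q.≈ Q.0#
        char = Q.trans (Q.sym (multiple-homo ℓ)) (quotient-zero ℤ[X].shiftRing (ℓ P.· P.1#))

    augment-π^ : ∀ n → 0 ℕ.< n → augment ((P.1# P.- X) P.^ n) ≡ + 0
    augment-π^ (suc n) _ = refl

    -- At X = 1 the equation reads 0 = ℓ + ℓ d(1). Hence all conjugates of d are prime to ℓ.
    augment-uniformizer : augment (proj₁ uniformizer) ≡ ℤ.- (+ 1)
    augment-uniformizer = ℤ.*-cancelˡ-≡ (+ ℓ) a (ℤ.- (+ 1)) (solved (+ ℓ) a (trans (sym (augment-π^ φ 0<φ)) (trans (augment-≋ (proj₂ uniformizer))
        (cong₂ (λ x y → x ℤ.+ y ℤ.* a) (augment-geometric ℓ) (ℤ[X].augment-multiple ℓ)))))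
      where
      a = augment (proj₁ uniformizer)
      augment-sum : ∀ n (f : Fin n → Polynomial) → (∀ i → augment (f i) ≡ + 1) → augment (P.sum f) ≡ + n
      augment-sum zero    f eq = refl
      augment-sum (suc n) f eq = cong₂ ℤ._+_ (eq zero) (augment-sum n (f ∘ suc) (eq ∘ suc))
      augment-1^ : ∀ {p} n → augment p ≡ + 1 → augment (p P.^ n) ≡ + 1
      augment-1^ {p} n eq = trans (ℤ[X].augment-^ p n) (trans (cong (ℤ._^ n) eq) (ℤ[X].1^ n))
      augment-geometric : ∀ n → augment (P.geometric (X P.^ M) n) ≡ + n
      augment-geometric n = augment-sum n (λ j → (X P.^ M) P.^ toℕ j) (λ j → augment-1^ {X P.^ M} (toℕ j) (augment-1^ {X} M refl))
      solved : ∀ l a → + 0 ≡ l ℤ.+ l ℤ.* a → l ℤ.* a ≡ l ℤ.* (ℤ.- (+ 1))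
      solved l a eq = trans (step₁ l a) (trans (cong (λ z → z ℤ.- l) (sym eq)) (step₂ l))
        where
        step₁ : ∀ l a → l ℤ.* a ≡ (l ℤ.+ l ℤ.* a) ℤ.- l
        step₁ = solve-∀
        step₂ : ∀ l → + 0 ℤ.- l ≡ l ℤ.* (ℤ.- (+ 1))
        step₂ = solve-∀

  θ : ℕ → Carrier
  θ i = power i (proj₁ uniformizer)

  unit-θ : ∀ i → Unit (θ i)
  unit-θ i ℓ∣ = unit-1 (subst (λ z → ℓ ℕ.∣ ℤ.∣ z ∣) (trans (augment-power i (proj₁ uniformizer)) augment-uniformizer) ℓ∣)

  -- Total ramification of ℓ: at Xⁱ the cyclotomic term of `uniformizer` vanishes.
  π^φ : ∀ i → ¬ (ℓ ℕ.∣ i) → π i ^ φ ≈ (ℓ · 1#) * θ i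
  π^φ i ℓ∤i = begin
    π i ^ φ                                                              ≈⟨ π-power φ ⟨
    power i ((P.1# P.- X) P.^ φ)                                         ≈⟨ power-≋ {Good} {good-act} i (proj₂ uniformizer) ⟩
    power i (P.geometric (X P.^ M) ℓ) + power i (ℓ P.· P.1#) * θ i
      ≈⟨ +-cong (≈-trans (sum-homo ℓ (λ j → (X P.^ M) P.^ toℕ j)) (sum-cong-≋ {ℓ} (λ j → ≈-trans (^-homo (X P.^ M) (toℕ j))
           (^-congˡ (toℕ j) (≈-trans (^-homo X M) (^-congˡ M X-power)))))) (*-congʳ (multiple-homo ℓ)) ⟩
    geometric ((ζ ^ i) ^ M) ℓ + (ℓ · 1#) * θ i                           ≈⟨ +-congʳ (conjugate-cyclotomic torsionFree ζ cyclotomic i ℓ∤i) ⟩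
    0# + (ℓ · 1#) * θ i                                                  ≈⟨ +-identityˡ _ ⟩
    (ℓ · 1#) * θ i                                                       ∎
    where open Eval i

  augment-π : ∀ i n → 0 ℕ.< n → augment (π i ^ n) ≡ + 0
  augment-π i (suc n) _ = trans (cong (ℤ._* augment (π i ^ n)) (trans (cong (λ z → + 1 ℤ.+ ℤ.- z) (trans (augment-^ ζ i) (1^ i))) refl)) (ℤ.*-zeroˡ (augment (π i ^ n)))

  -- The exponents in [0, ℓᵐ⁺¹) prime to ℓ.
  exponent : Fin M → Fin ℓ′ → ℕ
  exponent j r = ℓ ℕ.* toℕ j ℕ.+ suc (toℕ r)

  ℓ∤exponent : ∀ j r → ¬ (ℓ ℕ.∣ exponent j r)
  ℓ∤exponent j r ℓ∣ = ℕ.<⇒≱ (s≤s (Fin.toℕ<n r)) (ℕ.∣⇒≤ (ℕ.∣m+n∣m⇒∣n ℓ∣ (ℕ.m∣m*n (toℕ j))))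

  -- For f i the i-th conjugate of an element, this is its norm, kept as a product in ℤ[ζ].
  ΠJ : (ℕ → Carrier) → Carrier
  ΠJ f = Π.sum {M} (λ j → Π.sum {ℓ′} (λ r → f (exponent j r)))

  ΠJ-cong : ∀ {f g} → (∀ i → ¬ (ℓ ℕ.∣ i) → f i ≈ g i) → ΠJ f ≈ ΠJ g
  ΠJ-cong eq = Π.sum-cong-≋ {M} (λ j → Π.sum-cong-≋ {ℓ′} (λ r → eq (exponent j r) (ℓ∤exponent j r)))

  ΠJ-* : ∀ f g → ΠJ (λ i → f i * g i) ≈ ΠJ f * ΠJ g
  ΠJ-* f g = ≈-trans (Π.sum-cong-≋ {M} (λ j → Π.∑-distrib-+ {ℓ′} (λ r → f (exponent j r)) (λ r → g (exponent j r))))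
    (Π.∑-distrib-+ {M} (λ j → Π.sum {ℓ′} (λ r → f (exponent j r))) (λ j → Π.sum {ℓ′} (λ r → g (exponent j r))))

  ΠJ-const : ∀ c → ΠJ (λ _ → c) ≈ c ^ φ
  ΠJ-const c = ≈-trans (Π.sum-cong-≋ {M} (λ _ → Π.sum-replicate ℓ′)) (≈-trans (Π.sum-replicate M)
    (≈-trans (^-assocʳ c ℓ′ M) (reflexive (cong (c ^_) (ℕ.*-comm ℓ′ M)))))

  ΠJ-^ : ∀ f n → ΠJ (λ i → f i ^ n) ≈ ΠJ f ^ n
  ΠJ-^ f zero    = ≈-trans (ΠJ-const 1#) (1^n φ)
  ΠJ-^ f (suc n) = ≈-trans (ΠJ-* f (λ i → f i ^ n)) (*-congˡ (ΠJ-^ f n))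

  unit-ΠJ : ∀ {f} → (∀ i → Unit (f i)) → Unit (ΠJ f)
  unit-ΠJ {f} u = unit-Π {M} (λ j → unit-Π {ℓ′} (λ r → u (exponent j r)))

  multiple-^ : ∀ a n → (a · 1#) ^ n ≈ (a ℕ.^ n) · 1#
  multiple-^ a zero    = ≈-sym (+-identityʳ 1#)
  multiple-^ a (suc n) = ≈-trans (*-congˡ (multiple-^ a n)) (≈-sym (×1-homo-* a (a ℕ.^ n)))

  private
    odd-part : ∀ {n k} → IsOrd ℓ n k → ∃ λ x → n ≡ ℓ ℕ.^ k ℕ.* x × ¬ (ℓ ℕ.∣ x)
    odd-part {n} {k} (ℕ.divides x eq , ¬∣) = x , trans eq (ℕ.*-comm x _) , λ { (ℕ.divides y refl) → ¬∣ (ℕ.divides y (trans eq (ℕ.*-assoc y ℓ (ℓ ℕ.^ k)))) }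

    ∤-^ : ∀ {x} → ¬ (ℓ ℕ.∣ x) → ∀ n → ¬ (ℓ ℕ.∣ x ℕ.^ n)
    ∤-^         ℓ∤x zero    ℓ∣ = ¬prime[1] (subst Prime (ℕ.∣1⇒≡1 ℓ∣) isPrime)
    ∤-^ {x} ℓ∤x (suc n) ℓ∣ = [ ℓ∤x , ∤-^ ℓ∤x n ]′ (euclidsLemma x (x ℕ.^ n) isPrime ℓ∣)

    ^-distrib : ∀ n x y → (x ℕ.* y) ℕ.^ n ≡ x ℕ.^ n ℕ.* y ℕ.^ n
    ^-distrib zero    x y = refl
    ^-distrib (suc n) x y = trans (cong (x ℕ.* y ℕ.*_) (^-distrib n x y)) (ℕ.[m*n]*[o*p]≡[m*o]*[n*p] x y (x ℕ.^ n) (y ℕ.^ n))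

    power-split : ∀ a x n → (ℓ ℕ.^ a ℕ.* x) ℕ.^ n ≡ ℓ ℕ.^ (a ℕ.* n) ℕ.* x ℕ.^ n
    power-split a x n = trans (^-distrib n (ℓ ℕ.^ a) x) (cong (ℕ._* x ℕ.^ n) (ℕ.^-*-assoc ℓ a n))

  module _ {κ₁ κ₂ k₁ k₂ : ℕ} {Q : ℕ → Carrier} (main : (ℓ · 1#) * (κ₁ · 1#) ≈ (κ₂ · 1#) * ΠJ Q)
           (ord₁ : IsOrd ℓ κ₁ k₁) (ord₂ : IsOrd ℓ κ₂ k₂) where
    private
      x = proj₁ (odd-part {κ₁} {k₁} ord₁)
      y = proj₁ (odd-part {κ₂} {k₂} ord₂)
      κ₁≡ = proj₁ (proj₂ (odd-part {κ₁} {k₁} ord₁))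
      κ₂≡ = proj₁ (proj₂ (odd-part {κ₂} {k₂} ord₂))
      ℓ∤x = proj₂ (proj₂ (odd-part {κ₁} {k₁} ord₁))
      ℓ∤y = proj₂ (proj₂ (odd-part {κ₂} {k₂} ord₂))

      main′ : ((ℓ ℕ.^ suc k₁ ℕ.* x) · 1#) ≈ (κ₂ · 1#) * ΠJ Q
      main′ = ≈-trans (reflexive (cong (_· 1#) (trans (ℕ.*-assoc ℓ (ℓ ℕ.^ k₁) x) (cong (ℓ ℕ.*_) (sym κ₁≡))))) (≈-trans (×1-homo-* ℓ κ₁) main)

    -- θ i Q i = π iᵇ c i with c i a unit; both sides of the product over i are raised to the power φ,
    -- since π iᶲ = ℓ θ i.
    order-exact : ∀ b → b ℕ.< φ → (γ : ℕ → Carrier) → (∀ i → Unit (γ i)) →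
                  (∀ i → ¬ (ℓ ℕ.∣ i) → Q i ≈ℓ π i ^ b * γ i) → suc k₁ ≡ k₂ ℕ.+ b
    order-exact b b<φ γ unit-γ Q≈ = ℕ.≤-antisym
      (ℕ.*-cancelʳ-≤ (suc k₁) (k₂ ℕ.+ b) φ {{ℕ.>-nonZero 0<φ}} (valuation-≤ ((k₂ ℕ.+ b) ℕ.* φ) (suc k₁ ℕ.* φ) {y ℕ.^ φ} {x ℕ.^ φ} {Δ ^ b * Πc ^ φ} {Δ ^ φ}
        (∤-^ ℓ∤y φ) (unit-* {Δ ^ b} {Πc ^ φ} (unit-^ {Δ} unit-Δ b) (unit-^ {Πc} unit-Πc φ)) (≈-sym equation)))
      (ℕ.*-cancelʳ-≤ (k₂ ℕ.+ b) (suc k₁) φ {{ℕ.>-nonZero 0<φ}} (valuation-≤ (suc k₁ ℕ.* φ) ((k₂ ℕ.+ b) ℕ.* φ) {x ℕ.^ φ} {y ℕ.^ φ} {Δ ^ φ} {Δ ^ b * Πc ^ φ}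
        (∤-^ ℓ∤x φ) (unit-^ {Δ} unit-Δ φ) equation))
      where
      -- Positive because b < φ. The error term, a multiple of ℓ, becomes after multiplication by θ
      -- i a multiple of π iᶲ; beyond the common π iᵇ it keeps a factor 1 - ζⁱ and does not affect
      -- the augmentation of the cofactor.
      n = φ ℕ.∸ b
      -- No congruence is given when ℓ divides i. The default 0 keeps `c i` prime to ℓ for all i,
      -- and such i do not occur in `ΠJ`.
      η : ∀ i → Dec (ℓ ℕ.∣ i) → Carrier
      η i (yes _)  = 0#
      η i (no ℓ∤i) = proj₁ (Q≈ i ℓ∤i)
      c : ℕ → Carrier
      c i = θ i * γ i + η i (ℓ ℕ.∣? i) * π i ^ n
      unit-c : ∀ i → Unit (c i)
      unit-c i = unit-+ {θ i * γ i} {η i (ℓ ℕ.∣? i) * π i ^ n} (unit-* {θ i} {γ i} (unit-θ i) (unit-γ i))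
        (trans (cong (λ z → augment (η i (ℓ ℕ.∣? i)) ℤ.* z) (augment-π i n (ℕ.m<n⇒0<n∸m b<φ))) (ℤ.*-zeroʳ (augment (η i (ℓ ℕ.∣? i)))))
      factored : ∀ i → ¬ (ℓ ℕ.∣ i) → θ i * Q i ≈ π i ^ b * c i
      factored i ℓ∤i with ℓ ℕ.∣? i
      ... | yes ℓ∣i = contradiction ℓ∣i ℓ∤i
      ... | no ℓ∤i′ = begin
        θ i * Q i                                                  ≈⟨ *-congˡ (proj₂ (Q≈ i ℓ∤i′)) ⟩
        θ i * (π i ^ b * γ i + (ℓ · 1#) * e)
          ≈⟨ pull-scalar (θ i) (π i ^ b) (γ i) (ℓ · 1#) e ⟩
        π i ^ b * (θ i * γ i) + e * ((ℓ · 1#) * θ i)               ≈⟨ +-congˡ (*-congˡ (π^φ i ℓ∤i)) ⟨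
        π i ^ b * (θ i * γ i) + e * π i ^ φ
          ≈⟨ +-congˡ (*-congˡ (≈-trans (reflexive (cong (π i ^_) (sym (ℕ.m+[n∸m]≡n (ℕ.<⇒≤ b<φ))))) (^-homo-* (π i) b n))) ⟩
        π i ^ b * (θ i * γ i) + e * (π i ^ b * π i ^ n)
          ≈⟨ factor-left (π i ^ b) (θ i * γ i) e (π i ^ n) ⟩
        π i ^ b * (θ i * γ i + e * π i ^ n)                        ∎
        where e = proj₁ (Q≈ i ℓ∤i′)
      Δ Πc D Ππ : Carrier
      Δ = ΠJ θ
      Πc = ΠJ c
      D = ΠJ Q
      Ππ = ΠJ π
      unit-Δ : Unit Δ
      unit-Δ = unit-ΠJ {θ} unit-θ
      unit-Πc : Unit Πc
      unit-Πc = unit-ΠJ {c} unit-c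
      L = ℓ · 1#
      K = κ₂ · 1#
      ΔD : Δ * D ≈ Ππ ^ b * Πc
      ΔD = ≈-trans (≈-sym (ΠJ-* θ Q)) (≈-trans (ΠJ-cong {λ i → θ i * Q i} {λ i → π i ^ b * c i} factored)
        (≈-trans (ΠJ-* (λ i → π i ^ b) c) (*-congʳ (ΠJ-^ π b))))
      Ππ^φ : Ππ ^ φ ≈ L ^ φ * Δ
      Ππ^φ = ≈-trans (≈-sym (ΠJ-^ π φ)) (≈-trans (ΠJ-cong {λ i → π i ^ φ} {λ i → L * θ i} π^φ) (≈-trans (ΠJ-* (λ _ → L) θ) (*-congʳ (ΠJ-const L))))
      left : ((ℓ ℕ.^ (suc k₁ ℕ.* φ) ℕ.* x ℕ.^ φ) · 1#) ≈ (K * D) ^ φ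
      left = ≈-trans (reflexive (cong (_· 1#) (sym (power-split (suc k₁) x φ)))) (≈-trans (≈-sym (multiple-^ (ℓ ℕ.^ suc k₁ ℕ.* x) φ)) (^-congˡ φ main′))
      right : ((ℓ ℕ.^ ((k₂ ℕ.+ b) ℕ.* φ) ℕ.* y ℕ.^ φ) · 1#) ≈ K ^ φ * (L ^ φ) ^ b
      right = ≈-trans (reflexive (cong (_· 1#) (sym (power-split (k₂ ℕ.+ b) y φ)))) (≈-trans (≈-sym (multiple-^ (ℓ ℕ.^ (k₂ ℕ.+ b) ℕ.* y) φ))
        (≈-trans (^-congˡ φ (≈-trans (reflexive (cong (_· 1#) split)) (≈-trans (×1-homo-* κ₂ (ℓ ℕ.^ b)) (*-congˡ (≈-sym (multiple-^ ℓ b))))))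
        (≈-trans (^-distrib-* K (L ^ b) φ) (*-congˡ (swap-^ L b φ)))))
        where
        split : ℓ ℕ.^ (k₂ ℕ.+ b) ℕ.* y ≡ κ₂ ℕ.* ℓ ℕ.^ b
        split = trans (cong (ℕ._* y) (ℕ.^-distribˡ-+-* ℓ k₂ b)) (trans (ℕ.*-assoc (ℓ ℕ.^ k₂) _ y) (trans (cong (ℓ ℕ.^ k₂ ℕ.*_) (ℕ.*-comm (ℓ ℕ.^ b) y))
          (trans (sym (ℕ.*-assoc (ℓ ℕ.^ k₂) y _)) (cong (ℕ._* ℓ ℕ.^ b) (sym κ₂≡)))))
      equation : ((ℓ ℕ.^ (suc k₁ ℕ.* φ) ℕ.* x ℕ.^ φ) · 1#) * Δ ^ φ ≈ ((ℓ ℕ.^ ((k₂ ℕ.+ b) ℕ.* φ) ℕ.* y ℕ.^ φ) · 1#) * (Δ ^ b * Πc ^ φ)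
      equation = begin
        ((ℓ ℕ.^ (suc k₁ ℕ.* φ) ℕ.* x ℕ.^ φ) · 1#) * Δ ^ φ   ≈⟨ *-congʳ left ⟩
        (K * D) ^ φ * Δ ^ φ                             ≈⟨ power-relation K D Δ Ππ Πc L b φ ΔD Ππ^φ ⟩
        K ^ φ * (L ^ φ) ^ b * (Δ ^ b * Πc ^ φ)          ≈⟨ *-congʳ right ⟨
        ((ℓ ℕ.^ ((k₂ ℕ.+ b) ℕ.* φ) ℕ.* y ℕ.^ φ) · 1#) * (Δ ^ b * Πc ^ φ)  ∎

    -- Since π iᶲ = ℓ θ i, every Q i is divisible by ℓ, so the product over the φ exponents
    -- contributes at least ℓᶲ. Nothing is known about the remaining cofactors, whence only an
    -- inequality.
    order-bound : (γ : ℕ → Carrier) → (∀ i → ¬ (ℓ ℕ.∣ i) → Q i ≈ℓ π i ^ φ * γ i) → k₂ ℕ.+ φ ℕ.≤ suc k₁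
    order-bound γ Q≈ = valuation-≤ (suc k₁) (k₂ ℕ.+ φ) {x} {y} {1#} {ΠJ c} ℓ∤x unit-1 (begin
      ((ℓ ℕ.^ suc k₁ ℕ.* x) · 1#) * 1#                        ≈⟨ ≈-trans (*-identityʳ _) main′ ⟩
      K * ΠJ Q                                                ≈⟨ *-congˡ (ΠJ-cong {Q} {λ i → L * c i} divisible) ⟩
      K * ΠJ (λ i → L * c i)                                  ≈⟨ *-congˡ (≈-trans (ΠJ-* (λ _ → L) c) (*-congʳ (≈-trans (ΠJ-const L) (multiple-^ ℓ φ)))) ⟩
      K * (((ℓ ℕ.^ φ) · 1#) * ΠJ c)                           ≈⟨ ≈-trans (≈-sym (*-assoc _ _ _)) (*-congʳ (≈-sym (×1-homo-* κ₂ (ℓ ℕ.^ φ)))) ⟩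
      ((κ₂ ℕ.* ℓ ℕ.^ φ) · 1#) * ΠJ c                          ≡⟨ cong (λ n → (n · 1#) * ΠJ c) split ⟨
      ((ℓ ℕ.^ (k₂ ℕ.+ φ) ℕ.* y) · 1#) * ΠJ c                  ∎)
      where
      L = ℓ · 1#
      K = κ₂ · 1#
      split : ℓ ℕ.^ (k₂ ℕ.+ φ) ℕ.* y ≡ κ₂ ℕ.* ℓ ℕ.^ φ
      split = trans (cong (ℕ._* y) (ℕ.^-distribˡ-+-* ℓ k₂ φ)) (trans (ℕ.*-assoc (ℓ ℕ.^ k₂) _ y) (trans (cong (ℓ ℕ.^ k₂ ℕ.*_) (ℕ.*-comm (ℓ ℕ.^ φ) y))
        (trans (sym (ℕ.*-assoc (ℓ ℕ.^ k₂) y _)) (cong (ℕ._* ℓ ℕ.^ φ) (sym κ₂≡)))))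
      η : ∀ i → Dec (ℓ ℕ.∣ i) → Carrier
      η i (yes _)  = 0#
      η i (no ℓ∤i) = proj₁ (Q≈ i ℓ∤i)
      c : ℕ → Carrier
      c i = θ i * γ i + η i (ℓ ℕ.∣? i)
      divisible : ∀ i → ¬ (ℓ ℕ.∣ i) → Q i ≈ L * c i
      divisible i ℓ∤i with ℓ ℕ.∣? i
      ... | yes ℓ∣i = contradiction ℓ∣i ℓ∤i
      ... | no ℓ∤i′ = ≈-trans (proj₂ (Q≈ i ℓ∤i′)) (≈-trans (+-congʳ (*-congʳ (π^φ i ℓ∤i)))
        (factor-scalar L (θ i) (γ i) (proj₁ (Q≈ i ℓ∤i′))))

  module TwistedLaplacian (Γ : Graph) (α : Graph.E Γ → ℕ) where
    private module Γ = Graph Γ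

    Q : ℕ → Carrier
    Q i = det Γ.V-finite (laplacian Γ (λ e → ζ ^ (i ℕ.* α e)))

    laplacian-cong : ∀ {wt wt′ : Γ.E → Carrier} → (∀ e → wt e ≈ wt′ e) → ∀ v w → laplacian Γ wt v w ≈ laplacian Γ wt′ v w
    laplacian-cong eq v w = ∑-cong Γ.E-finite (λ e → when-cong (Γ.o e Γ.Vᶠ.≟ v) (λ _ → +-congˡ (-‿cong (*-congʳ (eq e)))))

    -- One polynomial with all the Q i as specialisations, so that one order of vanishing is valid
    -- for all conjugates.
    q : Polynomial
    q = Determinant.det ℤ[X].shiftRing Γ.V-finite (MatrixTree.laplacian ℤ[X].shiftRing Γ (λ e → X P.^ α e))

    power-q : ∀ i → power i q ≈ Q i
    power-q i = ≈-trans (det-homo hom Γ.V-finite _) (det-cong Γ.V-finite (λ v w → ≈-trans (laplacian-homo Γ _ v w)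
      (laplacian-cong (λ e → ≈-trans (^-homo X (α e)) (≈-trans (^-congˡ (α e) X-power) (^-assocʳ ζ i (α e)))) v w)))
      where open Eval i

    private
      -- The trivial character is accounted for by κ, and the determinant Q 0 would vanish. The
      -- value 1 at 0 turns a product over 0 < i < N into one over all residues.
      Q′ : ℕ → Carrier
      Q′ zero    = 1#
      Q′ (suc i) = Q (suc i)

      Q′-nonzero : ∀ i j → Q′ (i ℕ.+ suc j) ≈ Q (i ℕ.+ suc j)
      Q′-nonzero i j = reflexive (trans (cong Q′ (ℕ.+-suc i j)) (cong Q (sym (ℕ.+-suc i j))))

      cover-product : ∀ {Z} {f : Hom Z Γ} (N : ℕ) .{{nz : ℕ.NonZero N}} → CyclicPresentation f N α → ∀ {ξ} → IsPrincipalRoot N ξ → Γ.V →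
                      ∀ h → ξ ≈ ζ ^ h → (∀ i → Q′ (h ℕ.* suc i) ≈ Q (h ℕ.* suc i)) →
                      (N · 1#) * (κ Z · 1#) ≈ (κ Γ · 1#) * Π.sum {N} (λ i → Q′ (h ℕ.* toℕ i))
      cover-product (suc n) presentation {ξ} principal v₀ h ξ≈ Q′≈ = ≈-trans (κ-cover torsionFree presentation principal v₀)
        (*-congˡ (≈-trans (≈-sym (*-identityˡ _)) (*-cong (reflexive (cong Q′ (sym (ℕ.*-zeroʳ h))))
          (Π.sum-cong-≋ {n} (λ i → ≈-trans (det-cong Γ.V-finite (laplacian-cong (λ e → ≈-trans (^-congˡ (suc (toℕ i) ℕ.* α e) ξ≈)
            (≈-trans (^-assocʳ ζ h _) (reflexive (cong (ζ ^_) (sym (ℕ.*-assoc h (suc (toℕ i)) (α e)))))))))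
            (≈-sym (Q′≈ (toℕ i))))))))

    -- Quotient of the formulas for the covers of degrees ℓᵐ⁺¹ and ℓᵐ.
    κ-ratio : ∀ {Z₁ Z₂} {f₁ : Hom Z₁ Γ} {f₂ : Hom Z₂ Γ} → .{{nz : ℕ.NonZero (M ℕ.* ℓ)}} → CyclicPresentation f₁ (M ℕ.* ℓ) α → CyclicPresentation f₂ M α → Γ.V →
              (ℓ · 1#) * (κ Z₁ · 1#) ≈ (κ Z₂ · 1#) * ΠJ Q
    κ-ratio {Z₁} {Z₂} pres₁ pres₂ v₀ = M-cancellable (begin
      (M · 1#) * ((ℓ · 1#) * (κ Z₁ · 1#))                ≈⟨ ≈-trans (≈-sym (*-assoc _ _ _)) (*-congʳ (≈-sym (×1-homo-* M ℓ))) ⟩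
      ((M ℕ.* ℓ) · 1#) * (κ Z₁ · 1#)
        ≈⟨ cover-product (M ℕ.* ℓ) pres₁ (principalRoot torsionFree ζ cyclotomic) v₀ 1 (≈-sym (*-identityʳ ζ)) (λ i → ≈-refl) ⟩
      (κ Γ · 1#) * Π.sum {M ℕ.* ℓ} (λ i → Q′ (1 ℕ.* toℕ i))     ≈⟨ *-congˡ split ⟩
      (κ Γ · 1#) * (Π.sum {M} (λ j → Q′ (ℓ ℕ.* toℕ j)) * ΠJ Q)  ≈⟨ *-assoc _ _ _ ⟨
      (κ Γ · 1#) * Π.sum {M} (λ j → Q′ (ℓ ℕ.* toℕ j)) * ΠJ Q
        ≈⟨ *-congʳ (cover-product M pres₂ (principalRoot-below torsionFree ζ cyclotomic) v₀ ℓ ≈-refl (λ i → ≈-refl)) ⟨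
      (M · 1#) * (κ Z₂ · 1#) * ΠJ Q                      ≈⟨ *-assoc _ _ _ ⟩
      (M · 1#) * ((κ Z₂ · 1#) * ΠJ Q)                    ∎)
      where
      M-cancellable : Cancellable (M · 1#)
      M-cancellable = subst (λ n → Cancellable (n · 1#)) (ℕ.suc-pred M) (torsionFree (ℕ.pred M))
      -- Write i = ℓ j + r: the terms with r = 0 form the product for the lower cover, and those
      -- with r > 0 have the exponents prime to ℓ.
      split : Π.sum {M ℕ.* ℓ} (λ i → Q′ (1 ℕ.* toℕ i)) ≈ Π.sum {M} (λ j → Q′ (ℓ ℕ.* toℕ j)) * ΠJ Q
      split = ≈-trans (Π.sum-combine M ℓ (λ i → Q′ (1 ℕ.* toℕ i))) (≈-trans (Π.sum-cong-≋ {M} (λ j → *-cong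
          (reflexive (cong Q′ (trans (index j zero) (ℕ.+-identityʳ _))))
          (Π.sum-cong-≋ {ℓ′} (λ r → ≈-trans (reflexive (cong Q′ (index j (suc r)))) (Q′-nonzero (ℓ ℕ.* toℕ j) (toℕ r))))))
        (Π.∑-distrib-+ {M} (λ j → Q′ (ℓ ℕ.* toℕ j)) (λ j → Π.sum {ℓ′} (λ r → Q (exponent j r)))))
        where
        index : ∀ (j : Fin M) (r : Fin ℓ) → 1 ℕ.* toℕ (Fin.combine j r) ≡ ℓ ℕ.* toℕ j ℕ.+ toℕ r
        index j r = trans (ℕ.*-identityˡ _) (Fin.toℕ-combine j r)

    private
      -- The quotient of p - p(1) by 1 - X, computed by a Leibniz rule.
      difference : Polynomial → Polynomial
      difference X            = ⊖ P.1#
      difference (constant c) = P.0#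
      difference (a ⊕ b)      = difference a ⊕ difference b
      difference (a ⊗ b)      = (constant (augment a) ⊗ difference b) ⊕ (difference a ⊗ b)
      difference (⊖ a)        = ⊖ difference a

      difference-spec : ∀ p → p P.≈ constant (augment p) P.+ (P.1# P.- X) P.* difference p
      difference-spec X            = ℤ[X].mk≋ λ f _ k → identity (f k) (f (suc k))
        where
        identity : ∀ x y → y ≡ + 1 ℤ.* x ℤ.+ (+ 1 ℤ.* (ℤ.- (+ 1 ℤ.* x)) ℤ.+ ℤ.- (ℤ.- (+ 1 ℤ.* y)))
        identity = solve-∀
      difference-spec (constant c) = ℤ[X].mk≋ λ f _ k → identity c (f k) (f (suc k))
        where
        identity : ∀ c x y → c ℤ.* x ≡ c ℤ.* x ℤ.+ (+ 1 ℤ.* (+ 0 ℤ.* x) ℤ.+ ℤ.- (+ 0 ℤ.* y))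
        identity = solve-∀
      difference-spec (a ⊕ b)      = P.trans (P.+-cong (difference-spec a) (difference-spec b)) (P.trans
        (P.add-multiples (constant (augment a)) (constant (augment b)) (P.1# P.- X) (difference a) (difference b))
        (P.+-congʳ (ℤ[X].mk≋ λ f _ k → sym (ℤ.*-distribʳ-+ (f k) (augment a) (augment b)))))
      difference-spec (a ⊗ b)      = P.trans (P.*-congʳ (difference-spec a)) (P.trans (P.distribʳ b _ _) (P.trans
        (P.+-congʳ (P.*-congˡ (difference-spec b))) (P.trans
        (P.mul-multiples (constant (augment a)) (constant (augment b)) (P.1# P.- X) (difference a) (difference b) b)
        (P.+-congʳ (ℤ[X].mk≋ λ f _ k → sym (ℤ.*-assoc (augment a) (augment b) (f k)))))))
      difference-spec (⊖ a)        = P.trans (P.-‿cong (difference-spec a)) (P.trans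
        (P.neg-multiple (constant (augment a)) (P.1# P.- X) (difference a))
        (P.+-congʳ (ℤ[X].mk≋ λ f _ k → ℤ.neg-distribˡ-* (augment a) (f k))))

      _≈ᴾ_ : Polynomial → Polynomial → Set
      _≈ᴾ_ = _≈/_ ℤ[X].shiftRing (ℓ P.· P.1#)

      -- If ℓ divides p(1), then p is congruent to (1 - X) times `difference p` modulo ℓ, and the
      -- division is repeated. It is cut off at n because p may vanish modulo ℓ, and then it would
      -- never stop.
      order : ∀ n p → ∃ λ a → ∃ λ γ → p ≈ᴾ ((P.1# P.- X) P.^ a P.* γ) × ((a ℕ.< n × Unit γ) ⊎ a ≡ n)
      order zero    p = 0 , p , quotient-≈ ℤ[X].shiftRing _ (P.sym (P.*-identityˡ p)) , inj₂ refl
      order (suc n) p with ℓ ℕ.∣? ℤ.∣ augment p ∣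
      ... | no ℓ∤p  = 0 , p , quotient-≈ ℤ[X].shiftRing _ (P.sym (P.*-identityˡ p)) , inj₁ (s≤s z≤n , ℓ∤p)
      ... | yes ℓ∣p with ℤ.∣ᵤ⇒∣ {+ ℓ} {augment p} ℓ∣p | order n (difference p)
      ...   | ℤ.divides c eq | a , γ , (η , p′≈) , cases =
        suc a , γ , (constant c P.+ (P.1# P.- X) P.* η , P.trans (difference-spec p) (P.trans
          (P.+-cong head (P.*-congˡ p′≈))
          (P.step-order (ℓ P.· P.1#) (constant c) (P.1# P.- X) ((P.1# P.- X) P.^ a) γ η))) ,
        Sum.map (λ (lt , u) → s≤s lt , u) (cong suc) cases
        where
        head : constant (augment p) P.≈ (ℓ P.· P.1#) P.* constant c
        head = ℤ[X].mk≋ λ f _ k → trans (cong (ℤ._* f k) (trans eq (ℤ.*-comm c (+ ℓ)))) (trans (ℤ.*-assoc (+ ℓ) c (f k)) (sym (ℤ[X].act-multiple ℓ (act (constant c) f) k)))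

    opaque
      Q-order : ∃ λ a → ∃ λ (γ : ℕ → Carrier) → (∀ i → Q i ≈ℓ π i ^ a * γ i) × ((a ℕ.< φ × (∀ i → Unit (γ i))) ⊎ a ≡ φ)
      Q-order = let a , γ , (η , q≈) , cases = order φ q in
        a , (λ i → power i γ) , (λ i → let open Eval i in power i η ,
          ≈-trans (≈-sym (power-q i)) (≈-trans (power-≋ {Good} {good-act} i q≈) (+-cong (*-congʳ (π-power a)) (*-congʳ (multiple-homo ℓ))))) ,
        Sum.map₁ (λ (lt , u) → lt , λ i ℓ∣ → u (subst (λ z → ℓ ℕ.∣ ℤ.∣ z ∣) (augment-power i γ) ℓ∣)) cases

  module _ {Y Γ : Graph} {p : Hom Y Γ} (galois : IsGalois p) {k : ℕ} (hasOrder : HasOrder (AutGroup p) (ℓ ℕ.^ k)) (α : Graph.E Γ → ℕ) where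
    private
      module QY = TwistedLaplacian Y (α ∘ Hom.onE p)
      module QΓ = TwistedLaplacian Γ α
      Rℓ = shiftRing /⟨ ℓ · 1# ⟩
      module Q = CommutativeRing Rℓ
      module ΣQ = Summation Rℓ
      open IsHom (quotient-hom shiftRing (ℓ · 1#))
      open HomProperties (quotient-hom shiftRing (ℓ · 1#))
      open import Algebra.Properties.Semiring.Exp Q.semiring using () renaming (_^_ to _^ᵠ_; ^-congˡ to ^ᵠ-congˡ)

    -- Both determinants are reduced modulo ℓ, where `det-galois` applies with the weights ζ to the
    -- power i α; the factorisation of Q i is then raised to the power ℓᵏ.
    Q-galois : ∀ {a} {γ : ℕ → Carrier} i → QΓ.Q i ≈ℓ π i ^ a * γ i → QY.Q i ≈ℓ π i ^ (a ℕ.* ℓ ℕ.^ k) * γ i ^ (ℓ ℕ.^ k)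
    Q-galois {a} {γ} i Q≈ = Q.trans (det-homo h Y.V-finite _) (Q.trans (Determinant.det-cong Rℓ Y.V-finite (laplacian-homo Y _))
      (Q.trans (GaloisCover.det-galois galois hasOrder Rℓ (λ e → ζ ^ (i ℕ.* α e)) {k = k} isPrime refl char)
      (Q.trans (^ᵠ-congˡ (ℓ ℕ.^ k) (Q.trans (Q.sym (Q.trans (det-homo h Γ.V-finite _) (Determinant.det-cong Rℓ Γ.V-finite (laplacian-homo Γ _)))) Q≈))
      (Q.trans (Q.sym (^-homo (π i ^ a * γ i) (ℓ ℕ.^ k)))
        (quotient-≈ shiftRing (ℓ · 1#) (≈-trans (^-distrib-* (π i ^ a) (γ i) (ℓ ℕ.^ k)) (*-congʳ (^-assocʳ (π i) a (ℓ ℕ.^ k)))))))))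
      where
      module Y = Graph Y
      module Γ = Graph Γ
      h = quotient-hom shiftRing (ℓ · 1#)
      char : ℓ ΣQ.· Q.1# Q.≈ Q.0#
      char = Q.trans (Q.sym (multiple-homo ℓ)) (quotient-zero shiftRing (ℓ · 1#))

    module _ {X₁ X₂ Y₁ Y₂ : Graph} {fX₁ : Hom X₁ Γ} {fX₂ : Hom X₂ Γ} {fY₁ : Hom Y₁ Y} {fY₂ : Hom Y₂ Y} .{{nz : ℕ.NonZero (M ℕ.* ℓ)}}
             (presX₁ : CyclicPresentation fX₁ (M ℕ.* ℓ) α) (presX₂ : CyclicPresentation fX₂ M α)
             (presY₁ : CyclicPresentation fY₁ (M ℕ.* ℓ) (α ∘ Hom.onE p)) (presY₂ : CyclicPresentation fY₂ M (α ∘ Hom.onE p))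
             (v₀ : Graph.V Γ) (y₀ : Graph.V Y)
             {x₁ x₂ y₁ y₂ : ℕ} (ordX₁ : IsOrd ℓ (κ X₁) x₁) (ordX₂ : IsOrd ℓ (κ X₂) x₂)
             (ordY₁ : IsOrd ℓ (κ Y₁) y₁) (ordY₂ : IsOrd ℓ (κ Y₂) y₂) where
      private
        d = ℓ ℕ.^ k

        instance
          d-nonZero : ℕ.NonZero d
          d-nonZero = ℕ.m^n≢0 ℓ k

        mainX = QΓ.κ-ratio presX₁ presX₂ v₀
        mainY = QY.κ-ratio presY₁ presY₂ y₀

      -- The alternatives are the two outcomes of the search for a cut off at φ. When a reaches φ
      -- for Γ, the order for Y, multiplied by d ≥ 1, reaches φ as well.
      compare-orders :
        (∃ λ a → a ℕ.< φ × suc x₁ ≡ x₂ ℕ.+ a × (d ℕ.* a ℕ.< φ → suc y₁ ≡ y₂ ℕ.+ d ℕ.* a)) ⊎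
        (x₂ ℕ.+ φ ℕ.≤ suc x₁ × y₂ ℕ.+ φ ℕ.≤ suc y₁)
      compare-orders = cases QΓ.Q-order
        where
        -- As φ d = φ + φ (d - 1), one factor π iᶲ is isolated and the rest joins the cofactor.
        split : ∀ γ i → π i ^ (φ ℕ.* d) * γ i ^ d ≈ π i ^ φ * (π i ^ (φ ℕ.* ℕ.pred d) * γ i ^ d)
        split γ i = ≈-trans (*-congʳ (≈-trans (reflexive (cong (π i ^_) (trans (cong (φ ℕ.*_) (sym (ℕ.suc-pred d))) (ℕ.*-suc φ (ℕ.pred d)))))
          (^-homo-* (π i) φ (φ ℕ.* ℕ.pred d)))) (*-assoc (π i ^ φ) (π i ^ (φ ℕ.* ℕ.pred d)) (γ i ^ d))
        cases : (∃ λ a → ∃ λ (γ : ℕ → Carrier) → (∀ i → QΓ.Q i ≈ℓ π i ^ a * γ i) × ((a ℕ.< φ × (∀ i → Unit (γ i))) ⊎ a ≡ φ)) →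
                (∃ λ a → a ℕ.< φ × suc x₁ ≡ x₂ ℕ.+ a × (d ℕ.* a ℕ.< φ → suc y₁ ≡ y₂ ℕ.+ d ℕ.* a)) ⊎
                (x₂ ℕ.+ φ ℕ.≤ suc x₁ × y₂ ℕ.+ φ ℕ.≤ suc y₁)
        cases (a , γ , Q≈ , inj₁ (a<φ , unit)) = inj₁ (a , a<φ ,
          order-exact {κ X₁} {κ X₂} {x₁} {x₂} {QΓ.Q} mainX ordX₁ ordX₂ a a<φ γ unit (λ i _ → Q≈ i) ,
          λ da<φ → trans (order-exact {κ Y₁} {κ Y₂} {y₁} {y₂} {QY.Q} mainY ordY₁ ordY₂ (a ℕ.* d) (subst (ℕ._< φ) (ℕ.*-comm d a) da<φ)
                     (λ i → γ i ^ d) (λ i → unit-^ {γ i} (unit i) d) (λ i _ → Q-galois {a} {γ} i (Q≈ i)))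
                   (cong (y₂ ℕ.+_) (ℕ.*-comm a d)))
        cases (a , γ , Q≈ , inj₂ refl) = inj₂ (
          order-bound {κ X₁} {κ X₂} {x₁} {x₂} {QΓ.Q} mainX ordX₁ ordX₂ γ (λ i _ → Q≈ i) ,
          order-bound {κ Y₁} {κ Y₂} {y₁} {y₂} {QY.Q} mainY ordY₁ ordY₂ (λ i → π i ^ (φ ℕ.* ℕ.pred d) * γ i ^ d)
            (λ i _ → let η , eq = Q-galois {φ} {γ} i (Q≈ i) in η , ≈-trans eq (+-congʳ (split γ i))))

-- Iwasawa invariants

presentation-cast : ∀ {Z X : Graph} {f : Hom Z X} {N N′ : ℕ} .{{nz : ℕ.NonZero N}} .{{nz′ : ℕ.NonZero N′}} {α : Graph.E X → ℕ} →
                    N ≡ N′ → CyclicPresentation f N α → CyclicPresentation f N′ α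
presentation-cast refl pres = pres

n<ℓ^n : ∀ ℓ′ → 0 ℕ.< ℓ′ → ∀ n → n ℕ.< suc ℓ′ ℕ.^ n
n<ℓ^n ℓ′ 0<ℓ′ zero    = s≤s z≤n
n<ℓ^n ℓ′ 0<ℓ′ (suc n) = ℕ.≤-trans (ℕ.+-mono-≤ (ℕ.≤-trans (s≤s z≤n) (n<ℓ^n ℓ′ 0<ℓ′ n)) (n<ℓ^n ℓ′ 0<ℓ′ n))
  (ℕ.+-monoʳ-≤ (suc ℓ′ ℕ.^ n) (ℕ.m≤n*m (suc ℓ′ ℕ.^ n) ℓ′ {{ℕ.>-nonZero 0<ℓ′}}))

consecutive : ∀ ℓ′ m μ lam ν {k₁ k₂} → let ℓ = suc ℓ′ in
              + k₁ ≡ + μ ℤ.* + (ℓ ℕ.^ suc m) ℤ.+ + lam ℤ.* + suc m ℤ.+ ν →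
              + k₂ ≡ + μ ℤ.* + (ℓ ℕ.^ m) ℤ.+ + lam ℤ.* + m ℤ.+ ν →
              k₁ ≡ k₂ ℕ.+ (μ ℕ.* (ℓ ℕ.^ m ℕ.* ℓ′) ℕ.+ lam)
consecutive ℓ′ m μ lam ν {k₁} {k₂} eq₁ eq₂ = ℤ.+-injective (begin
  + k₁                                                              ≡⟨ eq₁ ⟩
  + μ ℤ.* + (M ℕ.+ ℓ′ ℕ.* M) ℤ.+ + lam ℤ.* (+ 1 ℤ.+ + m) ℤ.+ ν
    ≡⟨ cong (λ x → + μ ℤ.* x ℤ.+ + lam ℤ.* (+ 1 ℤ.+ + m) ℤ.+ ν) (trans (ℤ.pos-+ M (ℓ′ ℕ.* M)) (cong (λ x → + M ℤ.+ x) (ℤ.pos-* ℓ′ M))) ⟩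
  + μ ℤ.* (+ M ℤ.+ + ℓ′ ℤ.* + M) ℤ.+ + lam ℤ.* (+ 1 ℤ.+ + m) ℤ.+ ν  ≡⟨ identity (+ μ) (+ M) (+ ℓ′) (+ lam) (+ m) ν ⟩
  (+ μ ℤ.* + M ℤ.+ + lam ℤ.* + m ℤ.+ ν) ℤ.+ (+ μ ℤ.* (+ M ℤ.* + ℓ′) ℤ.+ + lam)
    ≡⟨ cong₂ ℤ._+_ (sym eq₂) (sym (trans (ℤ.pos-+ (μ ℕ.* (M ℕ.* ℓ′)) lam) (cong (ℤ._+ + lam) (trans (ℤ.pos-* μ _) (cong (+ μ ℤ.*_) (ℤ.pos-* M ℓ′)))))) ⟩
  + k₂ ℤ.+ + (μ ℕ.* (M ℕ.* ℓ′) ℕ.+ lam)                             ≡⟨ ℤ.pos-+ k₂ _ ⟨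
  + (k₂ ℕ.+ (μ ℕ.* (M ℕ.* ℓ′) ℕ.+ lam))                             ∎)
  where
  open ≡.≡-Reasoning
  M = suc ℓ′ ℕ.^ m
  identity : ∀ μ M l a m ν → μ ℤ.* (M ℤ.+ l ℤ.* M) ℤ.+ a ℤ.* (+ 1 ℤ.+ m) ℤ.+ ν ≡ (μ ℤ.* M ℤ.+ a ℤ.* m ℤ.+ ν) ℤ.+ (μ ℤ.* (M ℤ.* l) ℤ.+ a)
  identity = solve-∀

-- `lamX` and `lamY` are to be λ + 1. Since they are below φ, the growth μ φ + (λ + 1) is itself
-- below φ exactly when μ = 0, so the two alternatives for a separate μ = 0 from μ > 0.
module _ (φ μX lamX μY lamY d : ℕ) {x₁ x₂ y₁ y₂ : ℕ} (lamX<φ : lamX ℕ.< φ) (lamY<φ : lamY ℕ.< φ) (dlamX<φ : d ℕ.* lamX ℕ.< φ)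
         (growthX : suc x₁ ≡ x₂ ℕ.+ (μX ℕ.* φ ℕ.+ lamX)) (growthY : suc y₁ ≡ y₂ ℕ.+ (μY ℕ.* φ ℕ.+ lamY)) where
  private
    small : ∀ μ lam → μ ℕ.* φ ℕ.+ lam ℕ.< φ → μ ≡ 0
    small zero    lam lt = refl
    small (suc μ) lam lt = contradiction (ℕ.≤-trans (ℕ.m≤m+n φ (μ ℕ.* φ)) (ℕ.m≤m+n _ lam)) (ℕ.<⇒≱ lt)

    large : ∀ {μ lam} → lam ℕ.< φ → φ ℕ.≤ μ ℕ.* φ ℕ.+ lam → μ ≢ 0
    large lt le refl = ℕ.<⇒≱ lt le

  invariants : (∃ λ a → a ℕ.< φ × suc x₁ ≡ x₂ ℕ.+ a × (d ℕ.* a ℕ.< φ → suc y₁ ≡ y₂ ℕ.+ d ℕ.* a)) ⊎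
               (x₂ ℕ.+ φ ℕ.≤ suc x₁ × y₂ ℕ.+ φ ℕ.≤ suc y₁) →
               (μX ≡ 0 ⇔ μY ≡ 0) × (μX ≡ 0 → lamY ≡ d ℕ.* lamX)
  invariants (inj₁ (a , a<φ , eqX , eqY)) = mk⇔ (λ _ → μY≡0) (λ _ → μX≡0) , λ _ → trans (sym (trans da≡ (cong (λ μ → μ ℕ.* φ ℕ.+ lamY) μY≡0))) (cong (d ℕ.*_) a≡lamX)
    where
    a≡ : a ≡ μX ℕ.* φ ℕ.+ lamX
    a≡ = ℕ.+-cancelˡ-≡ x₂ _ _ (trans (sym eqX) growthX)
    μX≡0 : μX ≡ 0
    μX≡0 = small μX lamX (subst (ℕ._< φ) a≡ a<φ)
    a≡lamX : a ≡ lamX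
    a≡lamX = trans a≡ (cong (λ μ → μ ℕ.* φ ℕ.+ lamX) μX≡0)
    da<φ : d ℕ.* a ℕ.< φ
    da<φ = subst (λ a → d ℕ.* a ℕ.< φ) (sym a≡lamX) dlamX<φ
    da≡ : d ℕ.* a ≡ μY ℕ.* φ ℕ.+ lamY
    da≡ = ℕ.+-cancelˡ-≡ y₂ _ _ (trans (sym (eqY da<φ)) growthY)
    μY≡0 : μY ≡ 0
    μY≡0 = small μY lamY (subst (ℕ._< φ) da≡ da<φ)
  invariants (inj₂ (leX , leY)) = mk⇔ (λ eq → contradiction eq μX≢0) (λ eq → contradiction eq μY≢0) , λ eq → contradiction eq μX≢0
    where
    μX≢0 : μX ≢ 0
    μX≢0 = large lamX<φ (ℕ.+-cancelˡ-≤ x₂ _ _ (ℕ.≤-trans leX (ℕ.≤-reflexive growthX)))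
    μY≢0 : μY ≢ 0
    μY≢0 = large lamY<φ (ℕ.+-cancelˡ-≤ y₂ _ _ (ℕ.≤-trans leY (ℕ.≤-reflexive growthY)))

-- One sufficiently large m is enough: only the levels m and m + 1 are compared.
module TwoLevels {ℓ′ : ℕ} (isPrime : Prime (suc ℓ′)) (T : Tower) (tower : IsℤℓTower (suc ℓ′) T)
                 {Y : Graph} (p : Hom Y (Tower.base T)) (galoisY : IsGalois p) (k : ℕ) (order : HasOrder (AutGroup p) (suc ℓ′ ℕ.^ k))
                 (m′ : ℕ) where
  open Tower T
  open IsℤℓTower tower
  private
    ℓ = suc ℓ′
    -- The Galois data of the tower begin at level 1, and only from there on are the levels of the
    -- pulled back tower given as pullbacks.
    m = suc m′

  open Valuation isPrime m public using (φ)

  private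
    M = ℓ ℕ.^ m
    d = ℓ ℕ.^ k

    instance
      N-nonZero : ℕ.NonZero (ℓ ℕ.^ suc m)
      N-nonZero = ℕ.m^n≢0 ℓ (suc m)
      M-nonZero : ℕ.NonZero M
      M-nonZero = ℕ.m^n≢0 ℓ m
      Mℓ-nonZero : ℕ.NonZero (M ℕ.* ℓ)
      Mℓ-nonZero = ℕ.m*n≢0 M ℓ

    galois₁ : IsGalois (toBase m ∘ₕ map m)
    galois₁ = galois (suc m) (s≤s z≤n)

    cyclic₁ : AutGroup (toBase m ∘ₕ map m) ≅ (ℤ/ (ℓ ℕ.^ suc m))
    cyclic₁ = cyclic (suc m) (s≤s z≤n)

    α : Graph.E base → ℕ
    α = voltage galois₁ (ℓ ℕ.^ suc m) {{N-nonZero}} cyclic₁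

    presentation₁ : CyclicPresentation (toBase m ∘ₕ map m) (M ℕ.* ℓ) {{Mℓ-nonZero}} α
    presentation₁ = presentation-cast {{N-nonZero}} {{Mℓ-nonZero}} (ℕ.*-comm ℓ M) (presentation galois₁ (ℓ ℕ.^ suc m) {{N-nonZero}} cyclic₁)

    presentation₂ : CyclicPresentation (toBase m) M {{M-nonZero}} α
    presentation₂ = presentation-below {q = toBase m} {g = map m} galois₁ (ℓ ℕ.^ suc m) {{N-nonZero}} cyclic₁ (covers m) (galois m (s≤s z≤n)) M {{M-nonZero}} (cyclic m (s≤s z≤n))

  compare : ∀ {x₁ x₂ y₁ y₂} → IsOrd ℓ (κ (level (suc m))) x₁ → IsOrd ℓ (κ (level m)) x₂ →
            IsOrd ℓ (κ (Tower.level (pullbackTower T p) (suc m))) y₁ → IsOrd ℓ (κ (Tower.level (pullbackTower T p) m)) y₂ →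
            (∃ λ a → a ℕ.< φ × suc x₁ ≡ x₂ ℕ.+ a × (d ℕ.* a ℕ.< φ → suc y₁ ≡ y₂ ℕ.+ d ℕ.* a)) ⊎
            (x₂ ℕ.+ φ ℕ.≤ suc x₁ × y₂ ℕ.+ φ ℕ.≤ suc y₁)
  compare {x₁} {x₂} {y₁} {y₂} = Valuation.compare-orders isPrime m galoisY {k} order α
    {level (suc m)} {level m} {Tower.level (pullbackTower T p) (suc m)} {Tower.level (pullbackTower T p) m} {{Mℓ-nonZero}} presentation₁ presentation₂
    (presentation-pullback p {{Mℓ-nonZero}} presentation₁) (presentation-pullback p {{M-nonZero}} presentation₂)
    (proj₁ (connected 0)) (proj₁ (IsGalois.connected galoisY)) {x₁} {x₂} {y₁} {y₂}

  -- φ is at least ℓᵐ, so every bound that φ must exceed can be met by enlarging m.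
  m<φ : m ℕ.< φ
  m<φ = ℕ.<-≤-trans (n<ℓ^n ℓ′ 0<ℓ′ m) (ℕ.m≤m*n M ℓ′ {{ℕ.>-nonZero 0<ℓ′}})
    where
    positive : ∀ n → Prime (suc n) → 0 ℕ.< n
    positive zero    pr = contradiction pr ¬prime[1]
    positive (suc n) pr = s≤s z≤n
    0<ℓ′ : 0 ℕ.< ℓ′
    0<ℓ′ = positive ℓ′ isPrime

  -- The extra 1 on each side is the factor ℓ on the left of `κ-ratio`; it is the origin of the 1 in
  -- λ + 1.
  growth : ∀ μ lam ν {k₁ k₂} →
           + k₁ ≡ + μ ℤ.* + (ℓ ℕ.^ suc m) ℤ.+ + lam ℤ.* + suc m ℤ.+ ν →
           + k₂ ≡ + μ ℤ.* + M ℤ.+ + lam ℤ.* + m ℤ.+ ν → suc k₁ ≡ k₂ ℕ.+ (μ ℕ.* φ ℕ.+ (lam ℕ.+ 1))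
  growth μ lam ν {k₁} {k₂} eq₁ eq₂ = begin
    suc k₁                                     ≡⟨ cong suc (consecutive ℓ′ m μ lam ν eq₁ eq₂) ⟩
    suc (k₂ ℕ.+ (μ ℕ.* φ ℕ.+ lam))             ≡⟨ ℕ.+-suc k₂ _ ⟨
    k₂ ℕ.+ suc (μ ℕ.* φ ℕ.+ lam)               ≡⟨ cong (k₂ ℕ.+_) (trans (sym (ℕ.+-comm (μ ℕ.* φ ℕ.+ lam) 1)) (ℕ.+-assoc (μ ℕ.* φ) lam 1)) ⟩
    k₂ ℕ.+ (μ ℕ.* φ ℕ.+ (lam ℕ.+ 1))           ∎
    where open ≡.≡-Reasoning

  kida : ∀ {μX λX μY λY} (invX : IwasawaInvariants ℓ T μX λX) (invY : IwasawaInvariants ℓ (pullbackTower T p) μY λY) →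
         IwasawaInvariants.bound invX ℕ.≤ m → IwasawaInvariants.bound invY ℕ.≤ m →
         λX ℕ.+ 1 ℕ.< φ → λY ℕ.+ 1 ℕ.< φ → d ℕ.* (λX ℕ.+ 1) ℕ.< φ →
         (μX ≡ 0 ⇔ μY ≡ 0) × (μX ≡ 0 → λY ℕ.+ 1 ≡ d ℕ.* (λX ℕ.+ 1))
  kida {μX} {λX} {μY} {λY} invX invY boundX boundY λX<φ λY<φ dλX<φ =
    combine (formula invX (suc m) (ℕ.m≤n⇒m≤1+n boundX)) (formula invX m boundX)
            (formula invY (suc m) (ℕ.m≤n⇒m≤1+n boundY)) (formula invY m boundY)
    where
    open IwasawaInvariants
    Formula : Tower → ℕ → ℕ → ℤ → ℕ → Set
    Formula T μ lam ν n = ∃ λ k → IsOrd ℓ (κ (Tower.level T n)) k × + k ≡ + μ ℤ.* + (ℓ ℕ.^ n) ℤ.+ + lam ℤ.* + n ℤ.+ ν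
    combine : Formula T μX λX (ν invX) (suc m) → Formula T μX λX (ν invX) m →
              Formula (pullbackTower T p) μY λY (ν invY) (suc m) → Formula (pullbackTower T p) μY λY (ν invY) m →
              (μX ≡ 0 ⇔ μY ≡ 0) × (μX ≡ 0 → λY ℕ.+ 1 ≡ d ℕ.* (λX ℕ.+ 1))
    combine (x₁ , ordX₁ , eqX₁) (x₂ , ordX₂ , eqX₂) (y₁ , ordY₁ , eqY₁) (y₂ , ordY₂ , eqY₂) =
      invariants φ μX (λX ℕ.+ 1) μY (λY ℕ.+ 1) d {x₁} {x₂} {y₁} {y₂} λX<φ λY<φ dλX<φ
        (growth μX λX (ν invX) eqX₁ eqX₂) (growth μY λY (ν invY) eqY₁ eqY₂)
        (compare {x₁} {x₂} {y₁} {y₂} ordX₁ ordX₂ ordY₁ ordY₂)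

open import Data.Nat using (_+_; _*_)
open import Data.Integer using (0ℤ)

theoremA : (ℓ : ℕ) → Prime ℓ →
    (T : Tower) → IsℤℓTower ℓ T →
    χ (Tower.base T) ≢ 0ℤ →
    (Y : Graph) (p : Hom Y (Tower.base T)) →
    IsGalois p → IsFiniteℓGroup ℓ (AutGroup p) →
    (∀ n → Connected (Tower.level (pullbackTower T p) n)) →
    (d : ℕ) → HasDegree p d →
    (μX λX μY λY : ℕ) →
    IwasawaInvariants ℓ T μX λX →
    IwasawaInvariants ℓ (pullbackTower T p) μY λY →
    (μX ≡ 0 ⇔ μY ≡ 0) ×
    (μX ≡ 0 → λY + 1 ≡ d * (λX + 1))
theoremA zero     isPrime = contradiction isPrime ¬prime[0]
theoremA (suc ℓ′) isPrime T tower _ Y p galois (k , order) _ d degree μX λX μY λY invX invY =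
  subst (λ d → (μX ≡ 0 ⇔ μY ≡ 0) × (μX ≡ 0 → λY + 1 ≡ d * (λX + 1)))
    (sym (GaloisCover.degree galois order (proj₁ (IsℤℓTower.connected tower 0)) degree))
    (kida invX invY (ℕ.m≤n⇒m≤1+n (ℕ.≤-trans (ℕ.m≤m+n bX bY) (ℕ.m≤m+n _ _))) (ℕ.m≤n⇒m≤1+n (ℕ.≤-trans (ℕ.m≤n+m bY bX) (ℕ.m≤m+n _ _)))
      (below (ℕ.≤-trans (ℕ.m≤m+n (λX + 1) (λY + 1)) (ℕ.m≤n+m _ dX)))
      (below (ℕ.≤-trans (ℕ.m≤n+m (λY + 1) (λX + 1)) (ℕ.m≤n+m _ dX)))
      (below (ℕ.m≤m+n dX _)))
  where
  bX = IwasawaInvariants.bound invX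
  bY = IwasawaInvariants.bound invY
  dX = suc ℓ′ ℕ.^ k * (λX + 1)
  -- Dominates the two bounds from which the formulas hold, and the three numbers λX + 1, λY + 1 and
  -- d (λX + 1) that have to be smaller than φ.
  m′ = (bX + bY) + (dX + ((λX + 1) + (λY + 1)))
  open TwoLevels isPrime T tower p galois k order m′
  below : ∀ {a} → a ℕ.≤ dX + ((λX + 1) + (λY + 1)) → a ℕ.< φ
  below a≤ = ℕ.<-trans (s≤s (ℕ.≤-trans a≤ (ℕ.m≤n+m _ (bX + bY)))) m<φ
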